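{- Let $T_j(x)$ denote the $j$-th Chebyshev polynomial of the first kind, let $i=\sqrt{ -1}$, and let $\zeta_{h,d}:=\cos\left(\frac{(2h-1)\pi}{4d}\right)$ for all integers $h$ and $d\neq 0$. Then for all integers $m,n\geq 1$, the following four numbers are equal: (1) the number of symmetric recurrents on the sandpile grid graph $\mathrm{S}\Gamma_{(2m-1)\times(2n-1)}$; (2) the number of domino tilings of the $2$-weighted checkerboard of size $2m\times 2n$, counted according to weight; (3) $(-1)^{mn}\,2^m\prod_{h=1}^m T_{2n}(i\,\zeta_{h,m})$; (4) $\prod_{h=1}^{m}\prod_{k=1}^{n}\left(4\,\zeta_{h,m}^2+4\,\zeta_{k,n}^2\right)$.
   Context: Chebyshev polynomials of the first kind: $T_0(x)=1$, $T_1(x)=x$, $T_j(x)=2x\,T_{j-1}(x)-T_{j-2}(x)$ for $j\ge 2$. Grid graph: for integers $p,q\ge1$, $\Gamma_{p\times q}$ is the undirected graph with vertex set $[p]\times[q]$ and edges $\{(a,b),(a',b')\}$ with $|a-a'|+|b-b'|=1$. The sandpile grid graph $\mathrm{S}\Gamma_{p\times q}$ is obtained from $\Gamma_{p\times q}$ by adding a new vertex $s$ (the sink) and, for each grid vertex $v$, an edge between $v$ and $s$ of weight $4-\deg_{\Gamma_{p\times q}}(v)$ (no edge if this is $0$), so that every non-sink vertex has total degree $4$. Recurrents: a configuration on $\mathrm{S}\Gamma_{p\times q}$ is a function $c\colon[p]\times[q]\to\mathbb{N}=\{0,1,2,\dots\}$. A vertex $v$ is unstable in $c$ if $c_v\ge4$;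 firing an unstable $v$ subtracts $4$ from $c_v$ and adds $1$ to $c_w$ for each neighbor $w$ of $v$ in $\Gamma_{p\times q}$. Repeatedly firing unstable vertices always leads, after finitely many steps, to a stable configuration (one with no unstable vertices) $c^\circ$ that depends only on $c$. A configuration $c$ is recurrent if it is stable and for every configuration $a$ there is a configuration $b$ with $(a+b)^\circ=c$. A symmetric recurrent on $\mathrm{S}\Gamma_{p\times q}$ is a recurrent configuration $c$ such that $c_{(a,b)}=c_{(a,q-b+1)}=c_{(p-a+1,b)}$ for all $(a,b)\in[p]\times[q]$. $2$-weighted checkerboard: the $2$-weighted $2m\times2n$ grid graph is $\Gamma_{2m\times2n}$ where each horizontal edge $\{(2m-2h,2n-1),(2m-2h,2n)\}$ with $0\le h<m$ and each vertical edge $\{(2m-1,2n-2k),(2m,2n-2k)\}$ with $0\le k<n$ has weight $2$, and all other edges have weight $1$. Domino tilings of the $2$-weighted $2m\times2n$ checkerboard are the perfect matchings of this graph, the weight of a matching is the product of the weights of its edges, and counting according to weight means taking the sum of the weights of all perfect matchings. -}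

module Defs where

open import Algebra.Bundles.Raw using (RawRing)
open import Data.Nat.Base as ℕ using (ℕ; zero; suc; _!; z≤n; s≤s)
import Data.Nat.Properties as ℕ
open import Data.Nat.Properties using (_!≢0)
open import Data.Integer.Base as ℤ using (ℤ; +_)
open import Data.Product.Base using (Σ-syntax; ∃-syntax; _×_; _,_; proj₁; proj₂)
open import Level using (0ℓ)
open import Relation.Binary.PropositionalEquality
open import Relation.Nullary.Decidable.Core using (yes; no)
open import Relation.Nullary.Negation.Core using (¬_)

module Reals where
  open import Data.Sum.Base using (inj₁; inj₂)
  import Data.Integer.Properties as ℤ
  import Data.Rational.Unnormalised.Base as ℚᵘ
  import Data.Rational.Unnormalised.Properties as ℚᵘ
  open import Data.Rational.Base
  open import Data.Rational.Properties
  open import Data.Rational.Solver using (module +-*-Solver)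
  open import Algebra.Definitions.RawSemiring +-*-rawSemiring using (_^_)
  open +-*-Solver using (solve; _:+_; _:*_; _:-_; :-_; _:=_; con)

  Cauchy : (ℕ → ℚ) → Set
  Cauchy x = ∀ {ε} → 0ℚ < ε → ∃[ N ] ∀ {i j} → N ℕ.≤ i → N ℕ.≤ j → ∣ x i - x j ∣ < ε

  module Estimates where
    Null : (ℕ → ℕ → ℚ) → Set
    Null f = ∀ {ε} → 0ℚ < ε → ∃[ N ] ∀ {i j} → N ℕ.≤ i → N ℕ.≤ j → ∣ f i j ∣ < ε

    0<half : ∀ {ε} → 0ℚ < ε → 0ℚ < ½ * ε
    0<half 0<ε = *-monoʳ-<-pos ½ 0<ε

    halves : ∀ ε → ½ * ε + ½ * ε ≡ ε
    halves = solve 1 (λ e → con ½ :* e :+ con ½ :* e := e) refl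

    Null-sum : ∀ {f g} (h : ℕ → ℕ → ℚ) →
               (∀ i j → ∣ h i j ∣ ≤ ∣ f i j ∣ + ∣ g i j ∣) → Null f → Null g → Null h
    Null-sum h bd nf ng {ε} 0<ε with nf (0<half 0<ε) | ng (0<half 0<ε)
    ... | N , p | M , q = N ℕ.⊔ M , λ {i} {j} i≥ j≥ →
      ≤-<-trans (bd i j) (subst (_ <_) (halves ε)
        (+-mono-< (p (ℕ.m⊔n≤o⇒m≤o N M i≥) (ℕ.m⊔n≤o⇒m≤o N M j≥))
                  (q (ℕ.m⊔n≤o⇒n≤o N M i≥) (ℕ.m⊔n≤o⇒n≤o N M j≥))))

    Null-scale : ∀ {f} (h : ℕ → ℕ → ℚ) (K : ℚ) .{{_ : Positive K}} (N₀ : ℕ) →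
                 (∀ {i j} → N₀ ℕ.≤ i → N₀ ℕ.≤ j → ∣ h i j ∣ ≤ K * ∣ f i j ∣) → Null f → Null h
    Null-scale h K N₀ bd nf {ε} 0<ε = N₀ ℕ.⊔ N , λ {i} {j} i≥ j≥ →
        ≤-<-trans (bd (ℕ.m⊔n≤o⇒m≤o N₀ N i≥) (ℕ.m⊔n≤o⇒m≤o N₀ N j≥))
          (subst (_ <_) (trans (sym (*-assoc K K⁻¹ ε)) (trans (cong (_* ε) (*-inverseʳ K)) (*-identityˡ ε)))
            (*-monoʳ-<-pos K (p (ℕ.m⊔n≤o⇒n≤o N₀ N i≥) (ℕ.m⊔n≤o⇒n≤o N₀ N j≥))))
      where
      instance
        K≢0 : NonZero K
        K≢0 = pos⇒nonZero K
      K⁻¹ = 1/ K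
      instance
        K⁻¹>0 : Positive K⁻¹
        K⁻¹>0 = 1/pos⇒pos K
      0<δ : 0ℚ < K⁻¹ * ε
      0<δ = subst (_< K⁻¹ * ε) (*-zeroʳ K⁻¹) (*-monoʳ-<-pos K⁻¹ 0<ε)
      N = proj₁ (nf 0<δ)
      p = proj₂ (nf 0<δ)

    ι : ℕ → ℚ
    ι n = + n / 1

    ι-* : ∀ m n → ι (m ℕ.* n) ≡ ι m * ι n
    ι-* m n = toℚᵘ-injective (begin
      toℚᵘ (ι (m ℕ.* n))                    ≈⟨ toℚᵘ-fromℚᵘ (ℚᵘ.mkℚᵘ (+ (m ℕ.* n)) 0) ⟩
      ℚᵘ.mkℚᵘ (+ (m ℕ.* n)) 0               ≈⟨ ℚᵘ.≃-reflexive (cong (λ z → ℚᵘ.mkℚᵘ z 0) (ℤ.pos-* m n)) ⟩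
      ℚᵘ.mkℚᵘ (+ m) 0 ℚᵘ.* ℚᵘ.mkℚᵘ (+ n) 0  ≈⟨ ℚᵘ.*-cong (toℚᵘ-fromℚᵘ (ℚᵘ.mkℚᵘ (+ m) 0)) (toℚᵘ-fromℚᵘ (ℚᵘ.mkℚᵘ (+ n) 0)) ⟨
      toℚᵘ (ι m) ℚᵘ.* toℚᵘ (ι n)            ≈⟨ toℚᵘ-homo-* (ι m) (ι n) ⟨
      toℚᵘ (ι m * ι n)                      ∎)
      where open ℚᵘ.≃-Reasoning

    ι-+ : ∀ m n → ι (m ℕ.+ n) ≡ ι m + ι n
    ι-+ m n = toℚᵘ-injective (begin
      toℚᵘ (ι (m ℕ.+ n))                    ≈⟨ toℚᵘ-fromℚᵘ (ℚᵘ.mkℚᵘ (+ (m ℕ.+ n)) 0) ⟩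
      ℚᵘ.mkℚᵘ (+ (m ℕ.+ n)) 0               ≈⟨ ℚᵘ.≃-reflexive (cong (λ z → ℚᵘ.mkℚᵘ z 0)
                                                (trans (ℤ.pos-+ m n) (sym (cong₂ ℤ._+_ (ℤ.*-identityʳ (+ m)) (ℤ.*-identityʳ (+ n)))))) ⟩
      ℚᵘ.mkℚᵘ (+ m) 0 ℚᵘ.+ ℚᵘ.mkℚᵘ (+ n) 0  ≈⟨ ℚᵘ.+-cong (toℚᵘ-fromℚᵘ (ℚᵘ.mkℚᵘ (+ m) 0)) (toℚᵘ-fromℚᵘ (ℚᵘ.mkℚᵘ (+ n) 0)) ⟨
      toℚᵘ (ι m) ℚᵘ.+ toℚᵘ (ι n)            ≈⟨ toℚᵘ-homo-+ (ι m) (ι n) ⟨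
      toℚᵘ (ι m + ι n)                      ∎)
      where open ℚᵘ.≃-Reasoning

    ι-mono-≤ : ∀ {m n} → m ℕ.≤ n → ι m ≤ ι n
    ι-mono-≤ {m} {n} m≤n = toℚᵘ-cancel-≤ (begin
      toℚᵘ (ι m)       ≃⟨ toℚᵘ-fromℚᵘ (ℚᵘ.mkℚᵘ (+ m) 0) ⟩
      ℚᵘ.mkℚᵘ (+ m) 0  ≤⟨ ℚᵘ.*≤* (ℤ.*-monoʳ-≤-nonNeg (+ 1) (ℤ.+≤+ m≤n)) ⟩
      ℚᵘ.mkℚᵘ (+ n) 0  ≃⟨ toℚᵘ-fromℚᵘ (ℚᵘ.mkℚᵘ (+ n) 0) ⟨
      toℚᵘ (ι n)       ∎)
      where open ℚᵘ.≤-Reasoning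

    ι-inv : ∀ n .{{_ : ℕ.NonZero n}} → ι n * (+ 1 / n) ≡ 1ℚ
    ι-inv n@(suc n-1) = toℚᵘ-injective (begin
      toℚᵘ (ι n * (+ 1 / n))                  ≈⟨ toℚᵘ-homo-* (ι n) (+ 1 / n) ⟩
      toℚᵘ (ι n) ℚᵘ.* toℚᵘ (+ 1 / n)          ≈⟨ ℚᵘ.*-cong (toℚᵘ-fromℚᵘ (ℚᵘ.mkℚᵘ (+ n) 0)) (toℚᵘ-fromℚᵘ (ℚᵘ.mkℚᵘ (+ 1) n-1)) ⟩
      ℚᵘ.mkℚᵘ (+ n) 0 ℚᵘ.* ℚᵘ.mkℚᵘ (+ 1) n-1  ≈⟨ ℚᵘ.*-inverseʳ (ℚᵘ.mkℚᵘ (+ n) 0) ⟩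
      ℚᵘ.1ℚᵘ                                  ∎)
      where open ℚᵘ.≃-Reasoning

    ι-nonNeg : ∀ n → NonNegative (ι n)
    ι-nonNeg n = normalize-nonNeg n 1

    inv-nonNeg : ∀ n .{{_ : ℕ.NonZero n}} → NonNegative (+ 1 / n)
    inv-nonNeg n = normalize-nonNeg 1 n

    archimedean : ∀ q → ∃[ n ] q ≤ ι n
    archimedean q@(mkℚ z d _) = n , toℚᵘ-cancel-≤ (begin
      ℚᵘ.mkℚᵘ z d      ≤⟨ ℚᵘ.*≤* (ℤ.≤-trans (ℤ.≤-reflexive (ℤ.*-identityʳ z)) (z≤∣z∣*d z)) ⟩
      ℚᵘ.mkℚᵘ (+ n) 0  ≃⟨ toℚᵘ-fromℚᵘ (ℚᵘ.mkℚᵘ (+ n) 0) ⟨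
      toℚᵘ (ι n)       ∎)
      where
      open ℚᵘ.≤-Reasoning
      n = ℤ.∣ z ∣
      z≤∣z∣*d : ∀ z → z ℤ.≤ + ℤ.∣ z ∣ ℤ.* + suc d
      z≤∣z∣*d (+ m) = subst ((+ m) ℤ.≤_) (ℤ.pos-* m (suc d)) (ℤ.+≤+ (ℕ.m≤m*n m (suc d)))
      z≤∣z∣*d (ℤ.-[1+ m ]) = subst (ℤ.-[1+ m ] ℤ.≤_) (ℤ.pos-* (suc m) (suc d)) ℤ.-≤+

    *-mono-≤-nonNeg : ∀ {p q r s} → 0ℚ ≤ q → 0ℚ ≤ r → p ≤ q → r ≤ s → p * r ≤ q * s
    *-mono-≤-nonNeg {p} {q} {r} {s} 0≤q 0≤r p≤q r≤s = ≤-trans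
      (*-monoʳ-≤-nonNeg r {{nonNegative 0≤r}} p≤q) (*-monoˡ-≤-nonNeg q {{nonNegative 0≤q}} r≤s)

    *-mono-∣∣ : ∀ {p q P Q} → ∣ p ∣ ≤ P → ∣ q ∣ ≤ Q → ∣ p * q ∣ ≤ P * Q
    *-mono-∣∣ {p} {q} p≤ q≤ = subst (_≤ _) (sym (∣p*q∣≡∣p∣*∣q∣ p q))
      (*-mono-≤-nonNeg (≤-trans (0≤∣p∣ p) p≤) (0≤∣p∣ q) p≤ q≤)

    bounded : ∀ {x} → Cauchy x → ∃[ b ] ∃[ N ] (∀ {i} → N ℕ.≤ i → ∣ x i ∣ ≤ ι (suc b))
    bounded {x} cx with cx {1ℚ} (*<* (ℤ.+<+ (s≤s z≤n)))
    ... | N , p with archimedean ∣ x N ∣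
    ...   | b , xN≤b = b , N , λ {i} N≤i → begin
      ∣ x i ∣                    ≡⟨ cong ∣_∣ (solve 2 (λ u v → u := (u :- v) :+ v) refl (x i) (x N)) ⟩
      ∣ (x i - x N) + x N ∣      ≤⟨ ∣p+q∣≤∣p∣+∣q∣ (x i - x N) (x N) ⟩
      ∣ x i - x N ∣ + ∣ x N ∣    ≤⟨ +-mono-≤ (<⇒≤ (p N≤i ℕ.≤-refl)) xN≤b ⟩
      1ℚ + ι b                   ≡⟨ ι-+ 1 b ⟨
      ι (suc b)                  ∎
      where open ≤-Reasoning

    ι-pos : ∀ n → Positive (ι (suc n))
    ι-pos n = normalize-pos (suc n) 1

    rearrange-+ : ∀ a b c d → (a + c) - (b + d) ≡ (a - b) + (c - d)
    rearrange-+ = solve 4 (λ a b c d → (a :+ c) :- (b :+ d) := (a :- b) :+ (c :- d)) refl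

    rearrange-neg : ∀ a b → - a - - b ≡ - (a - b)
    rearrange-neg = solve 2 (λ a b → (:- a) :- (:- b) := :- (a :- b)) refl

    rearrange-* : ∀ a b c d → a * c - b * d ≡ a * (c - d) + d * (a - b)
    rearrange-* = solve 4 (λ a b c d → a :* c :- b :* d := a :* (c :- d) :+ d :* (a :- b)) refl

    ∣-∣-comm : ∀ p q → ∣ p - q ∣ ≡ ∣ q - p ∣
    ∣-∣-comm p q = trans (sym (∣-p∣≡∣p∣ (p - q)))
      (cong ∣_∣ (solve 2 (λ a b → :- (a :- b) := b :- a) refl p q))

    split : ∀ a b c → a - c ≡ (a - b) + (b - c)
    split = solve 3 (λ a b c → a :- c := (a :- b) :+ (b :- c)) refl

    ∣sum∣≤ : ∀ {p} q r → p ≡ q + r → ∣ p ∣ ≤ ∣ q ∣ + ∣ r ∣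
    ∣sum∣≤ q r refl = ∣p+q∣≤∣p∣+∣q∣ q r

    +-cauchy : ∀ {x y} → Cauchy x → Cauchy y → Cauchy (λ i → x i + y i)
    +-cauchy {x} {y} cx cy = Null-sum (λ i j → (x i + y i) - (x j + y j))
      (λ i j → ∣sum∣≤ (x i - x j) (y i - y j) (rearrange-+ (x i) (x j) (y i) (y j))) cx cy

    neg-cauchy : ∀ {x} → Cauchy x → Cauchy (λ i → - x i)
    neg-cauchy {x} cx {ε} 0<ε with cx 0<ε
    ... | N , p = N , λ {i} {j} i≥ j≥ → subst (_< ε) (lemma i j) (p i≥ j≥)
      where
      lemma : ∀ i j → ∣ x i - x j ∣ ≡ ∣ - x i - - x j ∣
      lemma i j = sym (trans (cong ∣_∣ (rearrange-neg (x i) (x j))) (∣-p∣≡∣p∣ (x i - x j)))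

    *-cauchy : ∀ {x y} → Cauchy x → Cauchy y → Cauchy (λ i → x i * y i)
    *-cauchy {x} {y} cx cy = Null-sum {f} {g} (λ i j → x i * y i - x j * y j)
      (λ i j → ∣sum∣≤ (f i j) (g i j) (rearrange-* (x i) (x j) (y i) (y j))) null-f null-g
      where
      f g : ℕ → ℕ → ℚ
      f i j = x i * (y i - y j)
      g i j = y j * (x i - x j)
      null-f : Null f
      null-f = let a , A , x≤ = bounded cx in
        Null-scale {λ i j → y i - y j} f (ι (suc a)) {{ι-pos a}} A
          (λ {i} {j} i≥ _ → *-mono-∣∣ {x i} {y i - y j} {ι (suc a)} {∣ y i - y j ∣} (x≤ i≥) ≤-refl) cy
      null-g : Null g
      null-g = let b , B , y≤ = bounded cy in
        Null-scale {λ i j → x i - x j} g (ι (suc b)) {{ι-pos b}} B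
          (λ {i} {j} _ j≥ → *-mono-∣∣ {y j} {x i - x j} {ι (suc b)} {∣ x i - x j ∣} (y≤ j≥) ≤-refl) cx

  open Estimates

  coeff : ℕ → ℚ
  coeff k = _/_ (+ 1) ((2 ℕ.* k) !) {{(2 ℕ.* k) !≢0}}

  cosTerm : ℚ → ℕ → ℚ
  cosTerm x k = (- 1ℚ) ^ k * (x ^ (2 ℕ.* k) * coeff k)

  -- cosSum n x = ∑_{k<n} (-1)ᵏ x²ᵏ / (2k)!
  cosSum : ℕ → ℚ → ℚ
  cosSum zero    x = 0ℚ
  cosSum (suc n) x = cosSum n x + cosTerm x n

  module CosineSeries where
    n<2^n : ∀ n → n ℕ.< 2 ℕ.^ n
    n<2^n zero = s≤s z≤n
    n<2^n (suc n) = begin-strict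
      suc n                     <⟨ s≤s (n<2^n n) ⟩
      1 ℕ.+ 2 ℕ.^ n             ≤⟨ ℕ.+-monoˡ-≤ (2 ℕ.^ n) (ℕ.m^n>0 2 n) ⟩
      2 ℕ.^ n ℕ.+ 2 ℕ.^ n       ≡⟨ cong (2 ℕ.^ n ℕ.+_) (ℕ.+-identityʳ (2 ℕ.^ n)) ⟨
      2 ℕ.^ suc n               ∎
      where open ℕ.≤-Reasoning

    ^≤! : ∀ E .{{_ : ℕ.NonZero E}} k → E ℕ.^ k ℕ.≤ E ℕ.^ E ℕ.* k !
    ^≤! E zero = subst (1 ℕ.≤_) (sym (ℕ.*-identityʳ (E ℕ.^ E))) (ℕ.m^n>0 E E)
    ^≤! E (suc k) with ℕ.≤-total (suc k) E
    ... | inj₁ k<E = ℕ.≤-trans (ℕ.^-monoʳ-≤ E k<E)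
                       (ℕ.m≤m*n (E ℕ.^ E) (suc k !) {{suc k !≢0}})
    ... | inj₂ E≤k = begin
      E ℕ.* E ℕ.^ k                    ≤⟨ ℕ.*-mono-≤ E≤k (^≤! E k) ⟩
      suc k ℕ.* (E ℕ.^ E ℕ.* k !)      ≡⟨ ℕ.*-assoc (suc k) (E ℕ.^ E) (k !) ⟨
      suc k ℕ.* E ℕ.^ E ℕ.* k !        ≡⟨ cong (ℕ._* k !) (ℕ.*-comm (suc k) (E ℕ.^ E)) ⟩
      E ℕ.^ E ℕ.* suc k ℕ.* k !        ≡⟨ ℕ.*-assoc (E ℕ.^ E) (suc k) (k !) ⟩
      E ℕ.^ E ℕ.* (suc k ℕ.* k !)      ∎
      where open ℕ.≤-Reasoning

    ^-distribʳ : ∀ a b k → (a ℕ.* b) ℕ.^ k ≡ a ℕ.^ k ℕ.* b ℕ.^ k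
    ^-distribʳ a b zero = refl
    ^-distribʳ a b (suc k) = trans (cong (a ℕ.* b ℕ.*_) (^-distribʳ a b k)) (interchange a b (a ℕ.^ k) (b ℕ.^ k))
      where
      open import Data.Nat.Solver using () renaming (module +-*-Solver to S)
      interchange : ∀ a b c d → a ℕ.* b ℕ.* (c ℕ.* d) ≡ a ℕ.* c ℕ.* (b ℕ.* d)
      interchange = S.solve 4 (λ a b c d → a S.:* b S.:* (c S.:* d) S.:= a S.:* c S.:* (b S.:* d)) refl

    module Bound (b-1 : ℕ) where
      b = suc b-1
      M = (4 ℕ.* b) ℕ.^ (4 ℕ.* b)

      nat-bound : ∀ j → suc j ℕ.* b ℕ.^ j ℕ.* 2 ℕ.^ j ℕ.≤ M ℕ.* j !
      nat-bound j = begin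
        suc j ℕ.* b ℕ.^ j ℕ.* 2 ℕ.^ j            ≤⟨ ℕ.*-monoˡ-≤ (2 ℕ.^ j) (ℕ.*-monoˡ-≤ (b ℕ.^ j) (n<2^n j)) ⟩
        2 ℕ.^ j ℕ.* b ℕ.^ j ℕ.* 2 ℕ.^ j          ≡⟨ cong (ℕ._* 2 ℕ.^ j) (^-distribʳ 2 b j) ⟨
        (2 ℕ.* b) ℕ.^ j ℕ.* 2 ℕ.^ j              ≡⟨ ^-distribʳ (2 ℕ.* b) 2 j ⟨
        (2 ℕ.* b ℕ.* 2) ℕ.^ j                    ≡⟨ cong (ℕ._^ j) (trans (ℕ.*-comm (2 ℕ.* b) 2) (sym (ℕ.*-assoc 2 2 b))) ⟩
        (4 ℕ.* b) ℕ.^ j                          ≤⟨ ^≤! (4 ℕ.* b) j ⟩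
        M ℕ.* j !                                ∎
        where open ℕ.≤-Reasoning

      r : ℕ → ℚ
      r k = ½ ^ k

      r-nonNeg : ∀ k → NonNegative (r k)
      r-nonNeg zero = _
      r-nonNeg (suc k) = nonNeg*nonNeg⇒nonNeg ½ (r k) {{r-nonNeg k}}

      ι2^*r : ∀ k → ι (2 ℕ.^ k) * r k ≡ 1ℚ
      ι2^*r zero = refl
      ι2^*r (suc k) = begin
        ι (2 ℕ.* 2 ℕ.^ k) * (½ * r k)         ≡⟨ cong (_* (½ * r k)) (ι-* 2 (2 ℕ.^ k)) ⟩
        ι 2 * ι (2 ℕ.^ k) * (½ * r k)         ≡⟨ solve 2 (λ u v → con (ι 2) :* u :* (con ½ :* v) := u :* v) refl (ι (2 ℕ.^ k)) (r k) ⟩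
        ι (2 ℕ.^ k) * r k                     ≡⟨ ι2^*r k ⟩
        1ℚ                                    ∎
        where open ≡-Reasoning

      key : ∀ k c → c ℕ.≤ suc (2 ℕ.* k) ℕ.* b ℕ.^ (2 ℕ.* k) → ι c * coeff k ≤ ι M * r k
      key k c c≤ = begin
        ι c * coeff k                                          ≡⟨ cong (_* coeff k) (*-identityʳ (ι c)) ⟨
        ι c * 1ℚ * coeff k                                     ≡⟨ cong (λ z → ι c * z * coeff k) (ι2^*r k) ⟨
        ι c * (ι (2 ℕ.^ k) * r k) * coeff k                    ≡⟨ solve 4 (λ u v w z → u :* (v :* w) :* z := u :* v :* (w :* z)) refl (ι c) (ι (2 ℕ.^ k)) (r k) (coeff k) ⟩
        ι c * ι (2 ℕ.^ k) * (r k * coeff k)                    ≡⟨ cong (_* (r k * coeff k)) (ι-* c (2 ℕ.^ k)) ⟨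
        ι (c ℕ.* 2 ℕ.^ k) * (r k * coeff k)                    ≤⟨ *-monoʳ-≤-nonNeg (r k * coeff k) {{rc}} (ι-mono-≤ nat) ⟩
        ι (M ℕ.* (2 ℕ.* k) !) * (r k * coeff k)                ≡⟨ cong (_* (r k * coeff k)) (ι-* M ((2 ℕ.* k) !)) ⟩
        ι M * ι ((2 ℕ.* k) !) * (r k * coeff k)                ≡⟨ solve 4 (λ u v w z → u :* v :* (w :* z) := u :* w :* (v :* z)) refl (ι M) (ι ((2 ℕ.* k) !)) (r k) (coeff k) ⟩
        ι M * r k * (ι ((2 ℕ.* k) !) * coeff k)                ≡⟨ cong (ι M * r k *_) (ι-inv ((2 ℕ.* k) !) {{(2 ℕ.* k) !≢0}}) ⟩
        ι M * r k * 1ℚ                                         ≡⟨ *-identityʳ (ι M * r k) ⟩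
        ι M * r k                                              ∎
        where
        open ≤-Reasoning
        rc : NonNegative (r k * coeff k)
        rc = nonNeg*nonNeg⇒nonNeg (r k) {{r-nonNeg k}} (coeff k) {{inv-nonNeg ((2 ℕ.* k) !) {{(2 ℕ.* k) !≢0}}}}
        nat : c ℕ.* 2 ℕ.^ k ℕ.≤ M ℕ.* (2 ℕ.* k) !
        nat = ℕ.≤-trans (ℕ.*-mono-≤ c≤ (ℕ.^-monoʳ-≤ 2 (ℕ.m≤m+n k (k ℕ.+ 0)))) (nat-bound (2 ℕ.* k))

      ∣sign∣ : ∀ k → ∣ (- 1ℚ) ^ k ∣ ≡ 1ℚ
      ∣sign∣ zero = refl
      ∣sign∣ (suc k) = trans (∣p*q∣≡∣p∣*∣q∣ (- 1ℚ) ((- 1ℚ) ^ k)) (cong (1ℚ *_) (∣sign∣ k))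

      module _ (x z : ℚ) (x≤ : ∣ x ∣ ≤ ι b) (z≤ : ∣ z ∣ ≤ ι b) where
        δ = ∣ x - z ∣

        pow-bound : ∀ {x} → ∣ x ∣ ≤ ι b → ∀ j → ∣ x ^ j ∣ ≤ ι (b ℕ.^ j)
        pow-bound x≤ zero = ≤-refl
        pow-bound {x} x≤ (suc j) = subst (_ ≤_) (sym (ι-* b (b ℕ.^ j))) (*-mono-∣∣ {x} x≤ (pow-bound x≤ j))

        pow-lip : ∀ j → ∣ x ^ j - z ^ j ∣ ≤ ι (j ℕ.* b ℕ.^ j) * δ
        pow-lip zero = ≤-reflexive (sym (*-zeroˡ δ))
        pow-lip (suc j) = begin
          ∣ x * x ^ j - z * z ^ j ∣                        ≡⟨ cong ∣_∣ (solve 4 (λ x X z Z → x :* X :- z :* Z := x :* (X :- Z) :+ Z :* (x :- z)) refl x (x ^ j) z (z ^ j)) ⟩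
          ∣ x * (x ^ j - z ^ j) + z ^ j * (x - z) ∣        ≤⟨ ∣p+q∣≤∣p∣+∣q∣ (x * (x ^ j - z ^ j)) (z ^ j * (x - z)) ⟩
          ∣ x * (x ^ j - z ^ j) ∣ + ∣ z ^ j * (x - z) ∣    ≤⟨ +-mono-≤ (*-mono-∣∣ {x} x≤ (pow-lip j)) (*-mono-∣∣ {z ^ j} (pow-bound z≤ j) ≤-refl) ⟩
          ι b * (ι (j ℕ.* b ℕ.^ j) * δ) + ι (b ℕ.^ j) * δ  ≡⟨ solve 4 (λ u v w d → u :* (v :* d) :+ w :* d := (u :* v :+ w) :* d) refl (ι b) (ι (j ℕ.* b ℕ.^ j)) (ι (b ℕ.^ j)) δ ⟩
          (ι b * ι (j ℕ.* b ℕ.^ j) + ι (b ℕ.^ j)) * δ      ≡⟨ cong (λ t → (t + ι (b ℕ.^ j)) * δ) (ι-* b (j ℕ.* b ℕ.^ j)) ⟨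
          (ι (b ℕ.* (j ℕ.* b ℕ.^ j)) + ι (b ℕ.^ j)) * δ    ≡⟨ cong (_* δ) (ι-+ (b ℕ.* (j ℕ.* b ℕ.^ j)) (b ℕ.^ j)) ⟨
          ι (b ℕ.* (j ℕ.* b ℕ.^ j) ℕ.+ b ℕ.^ j) * δ        ≤⟨ *-monoʳ-≤-nonNeg δ {{∣-∣-nonNeg (x - z)}} (ι-mono-≤ nat) ⟩
          ι (suc j ℕ.* b ℕ.^ suc j) * δ                    ∎
          where
          open ≤-Reasoning
          nat : b ℕ.* (j ℕ.* b ℕ.^ j) ℕ.+ b ℕ.^ j ℕ.≤ suc j ℕ.* b ℕ.^ suc j
          nat = ℕ.≤-trans (ℕ.+-mono-≤ (ℕ.≤-reflexive (trans (sym (ℕ.*-assoc b j (b ℕ.^ j)))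
                  (trans (cong (ℕ._* b ℕ.^ j) (ℕ.*-comm b j)) (ℕ.*-assoc j b (b ℕ.^ j))))) (ℕ.m≤n*m (b ℕ.^ j) b))
                  (ℕ.≤-reflexive (ℕ.+-comm (j ℕ.* b ℕ.^ suc j) (b ℕ.^ suc j)))

        c≥0 : ∀ k → 0ℚ ≤ coeff k
        c≥0 k = nonNegative⁻¹ (coeff k) {{inv-nonNeg ((2 ℕ.* k) !) {{(2 ℕ.* k) !≢0}}}}

        term-bound : ∀ k → ∣ cosTerm x k ∣ ≤ ι M * r k
        term-bound k = begin
          ∣ (- 1ℚ) ^ k * (x ^ (2 ℕ.* k) * coeff k) ∣  ≤⟨ *-mono-∣∣ {(- 1ℚ) ^ k} (≤-reflexive (∣sign∣ k))
                                                           (*-mono-∣∣ {x ^ (2 ℕ.* k)} (pow-bound x≤ (2 ℕ.* k)) (≤-reflexive (0≤p⇒∣p∣≡p (c≥0 k)))) ⟩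
          1ℚ * (ι (b ℕ.^ (2 ℕ.* k)) * coeff k)        ≡⟨ *-identityˡ _ ⟩
          ι (b ℕ.^ (2 ℕ.* k)) * coeff k               ≤⟨ key k (b ℕ.^ (2 ℕ.* k)) (ℕ.m≤n*m (b ℕ.^ (2 ℕ.* k)) (suc (2 ℕ.* k))) ⟩
          ι M * r k                                   ∎
          where open ≤-Reasoning

        term-lip : ∀ k → ∣ cosTerm x k - cosTerm z k ∣ ≤ ι M * r k * δ
        term-lip k = begin
          ∣ cosTerm x k - cosTerm z k ∣                       ≡⟨ cong ∣_∣ (solve 4 (λ s X Z c → s :* (X :* c) :- s :* (Z :* c) := s :* ((X :- Z) :* c)) refl
                                                                   ((- 1ℚ) ^ k) (x ^ (2 ℕ.* k)) (z ^ (2 ℕ.* k)) (coeff k)) ⟩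
          ∣ (- 1ℚ) ^ k * ((x ^ (2 ℕ.* k) - z ^ (2 ℕ.* k)) * coeff k) ∣
            ≤⟨ *-mono-∣∣ {(- 1ℚ) ^ k} (≤-reflexive (∣sign∣ k))
                 (*-mono-∣∣ {x ^ (2 ℕ.* k) - z ^ (2 ℕ.* k)} (pow-lip (2 ℕ.* k)) (≤-reflexive (0≤p⇒∣p∣≡p (c≥0 k)))) ⟩
          1ℚ * (ι (2 ℕ.* k ℕ.* b ℕ.^ (2 ℕ.* k)) * δ * coeff k) ≡⟨ solve 3 (λ u d c → con 1ℚ :* (u :* d :* c) := u :* c :* d) refl (ι (2 ℕ.* k ℕ.* b ℕ.^ (2 ℕ.* k))) δ (coeff k) ⟩
          ι (2 ℕ.* k ℕ.* b ℕ.^ (2 ℕ.* k)) * coeff k * δ        ≤⟨ *-monoʳ-≤-nonNeg δ {{∣-∣-nonNeg (x - z)}}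
                                                                   (key k (2 ℕ.* k ℕ.* b ℕ.^ (2 ℕ.* k)) (ℕ.*-monoˡ-≤ (b ℕ.^ (2 ℕ.* k)) (ℕ.n≤1+n (2 ℕ.* k)))) ⟩
          ι M * r k * δ                                       ∎
          where open ≤-Reasoning

        H : ℕ → ℚ
        H n = (ι M + ι M) * (1ℚ - r n)

        H-step : ∀ n → H n + ι M * r n ≡ H (suc n)
        H-step n = solve 2 (λ m s → (m :+ m) :* (con 1ℚ :- s) :+ m :* s := (m :+ m) :* (con 1ℚ :- con ½ :* s)) refl (ι M) (r n)

        H≤ : ∀ n → H n ≤ ι M + ι M
        H≤ n = begin
          (ι M + ι M) * (1ℚ - r n)   ≤⟨ *-monoˡ-≤-nonNeg (ι M + ι M) {{M+M}} (+-monoʳ-≤ 1ℚ (neg-antimono-≤ (nonNegative⁻¹ (r n) {{r-nonNeg n}}))) ⟩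
          (ι M + ι M) * 1ℚ           ≡⟨ *-identityʳ (ι M + ι M) ⟩
          ι M + ι M                  ∎
          where
          open ≤-Reasoning
          M+M = nonNeg+nonNeg⇒nonNeg (ι M) {{ι-nonNeg M}} (ι M) {{ι-nonNeg M}}

        sum-lip′ : ∀ n → ∣ cosSum n x - cosSum n z ∣ ≤ H n * δ
        sum-lip′ zero = ≤-reflexive (sym (trans (cong (_* δ) (*-zeroʳ (ι M + ι M))) (*-zeroˡ δ)))
        sum-lip′ (suc n) = begin
          ∣ (cosSum n x + cosTerm x n) - (cosSum n z + cosTerm z n) ∣
            ≡⟨ cong ∣_∣ (solve 4 (λ a b c d → (a :+ b) :- (c :+ d) := (a :- c) :+ (b :- d)) refl (cosSum n x) (cosTerm x n) (cosSum n z) (cosTerm z n)) ⟩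
          ∣ (cosSum n x - cosSum n z) + (cosTerm x n - cosTerm z n) ∣
            ≤⟨ ∣p+q∣≤∣p∣+∣q∣ (cosSum n x - cosSum n z) (cosTerm x n - cosTerm z n) ⟩
          ∣ cosSum n x - cosSum n z ∣ + ∣ cosTerm x n - cosTerm z n ∣
            ≤⟨ +-mono-≤ (sum-lip′ n) (term-lip n) ⟩
          H n * δ + ι M * r n * δ    ≡⟨ *-distribʳ-+ δ (H n) (ι M * r n) ⟨
          (H n + ι M * r n) * δ      ≡⟨ cong (_* δ) (H-step n) ⟩
          H (suc n) * δ              ∎
          where open ≤-Reasoning

        sum-lip : ∀ n → ∣ cosSum n x - cosSum n z ∣ ≤ (ι M + ι M) * δ
        sum-lip n = ≤-trans (sum-lip′ n) (*-monoʳ-≤-nonNeg δ {{∣-∣-nonNeg (x - z)}} (H≤ n))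

        tail′ : ∀ N d → ∣ cosSum (d ℕ.+ N) x - cosSum N x ∣ ≤ H (d ℕ.+ N) - H N
        tail′ N zero = ≤-reflexive (trans (cong ∣_∣ (+-inverseʳ (cosSum N x))) (sym (+-inverseʳ (H N))))
        tail′ N (suc d) = begin
          ∣ (S + t) - S₀ ∣            ≡⟨ cong ∣_∣ (solve 3 (λ s t u → (s :+ t) :- u := (s :- u) :+ t) refl S t S₀) ⟩
          ∣ (S - S₀) + t ∣            ≤⟨ ∣p+q∣≤∣p∣+∣q∣ (S - S₀) t ⟩
          ∣ S - S₀ ∣ + ∣ t ∣          ≤⟨ +-mono-≤ (tail′ N d) (term-bound (d ℕ.+ N)) ⟩
          (H (d ℕ.+ N) - H N) + ι M * r (d ℕ.+ N)  ≡⟨ solve 3 (λ s t u → (s :- t) :+ u := (s :+ u) :- t) refl (H (d ℕ.+ N)) (H N) (ι M * r (d ℕ.+ N)) ⟩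
          (H (d ℕ.+ N) + ι M * r (d ℕ.+ N)) - H N  ≡⟨ cong (_- H N) (H-step (d ℕ.+ N)) ⟩
          H (suc d ℕ.+ N) - H N       ∎
          where
          open ≤-Reasoning
          S = cosSum (d ℕ.+ N) x
          S₀ = cosSum N x
          t = cosTerm x (d ℕ.+ N)

        tail : ∀ {N i} → N ℕ.≤ i → ∣ cosSum i x - cosSum N x ∣ ≤ (ι M + ι M) * r N
        tail {N} {i} N≤i = begin
          ∣ cosSum i x - cosSum N x ∣  ≤⟨ subst (λ i → ∣ cosSum i x - cosSum N x ∣ ≤ H i - H N) (ℕ.m∸n+n≡m N≤i) (tail′ N (i ℕ.∸ N)) ⟩
          H i - H N                    ≤⟨ +-monoˡ-≤ (- H N) (H≤ i) ⟩
          (ι M + ι M) - H N            ≡⟨ solve 2 (λ m s → m :- m :* (con 1ℚ :- s) := m :* s) refl (ι M + ι M) (r N) ⟩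
          (ι M + ι M) * r N            ∎
          where open ≤-Reasoning

      tail-sym : ∀ y → ∣ y ∣ ≤ ι b → ∀ i j → ∣ cosSum i y - cosSum j y ∣ ≤ (ι M + ι M) * ∣ r i + r j ∣
      tail-sym y y≤ i j = go (ℕ.≤-total i j)
        where
        open ≤-Reasoning
        K = ι M + ι M
        K≥0 = nonNeg+nonNeg⇒nonNeg (ι M) {{ι-nonNeg M}} (ι M) {{ι-nonNeg M}}
        ri≤ : r i ≤ r i + r j
        ri≤ = subst (_≤ r i + r j) (+-identityʳ (r i)) (+-monoʳ-≤ (r i) (nonNegative⁻¹ (r j) {{r-nonNeg j}}))
        rj≤ : r j ≤ r i + r j
        rj≤ = subst (_≤ r i + r j) (+-identityˡ (r j)) (+-monoˡ-≤ (r j) (nonNegative⁻¹ (r i) {{r-nonNeg i}}))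
        s≡ : ∣ r i + r j ∣ ≡ r i + r j
        s≡ = 0≤p⇒∣p∣≡p (≤-trans (nonNegative⁻¹ (r i) {{r-nonNeg i}}) ri≤)
        go : _ → ∣ cosSum i y - cosSum j y ∣ ≤ K * ∣ r i + r j ∣
        go (inj₁ i≤j) = begin
          ∣ cosSum i y - cosSum j y ∣  ≡⟨ ∣-∣-comm (cosSum i y) (cosSum j y) ⟩
          ∣ cosSum j y - cosSum i y ∣  ≤⟨ tail y y y≤ y≤ i≤j ⟩
          K * r i                      ≤⟨ *-monoˡ-≤-nonNeg K {{K≥0}} ri≤ ⟩
          K * (r i + r j)              ≡⟨ cong (K *_) s≡ ⟨
          K * ∣ r i + r j ∣            ∎
        go (inj₂ j≤i) = begin
          ∣ cosSum i y - cosSum j y ∣  ≤⟨ tail y y y≤ y≤ j≤i ⟩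
          K * r j                      ≤⟨ *-monoˡ-≤-nonNeg K {{K≥0}} rj≤ ⟩
          K * (r i + r j)              ≡⟨ cong (K *_) s≡ ⟨
          K * ∣ r i + r j ∣            ∎

      r-anti : ∀ N d → r (d ℕ.+ N) ≤ r N
      r-anti N zero = ≤-refl
      r-anti N (suc d) = begin
        ½ * r (d ℕ.+ N)    ≤⟨ *-monoʳ-≤-nonNeg (r (d ℕ.+ N)) {{r-nonNeg (d ℕ.+ N)}} ½≤1 ⟩
        1ℚ * r (d ℕ.+ N)   ≡⟨ *-identityˡ (r (d ℕ.+ N)) ⟩
        r (d ℕ.+ N)        ≤⟨ r-anti N d ⟩
        r N                ∎
        where
        open ≤-Reasoning
        ½≤1 : ½ ≤ 1ℚ
        ½≤1 = *≤* (ℤ.+≤+ (s≤s z≤n))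

      r-pos : ∀ k → Positive (r k)
      r-pos zero = _
      r-pos (suc k) = pos*pos⇒pos ½ (r k) {{r-pos k}}

      r→0 : ∀ {ε} → 0ℚ < ε → ∃[ N ] r N < ε
      r→0 {ε} 0<ε = N , (begin-strict
        r N                                ≡⟨ *-identityʳ (r N) ⟨
        r N * 1ℚ                           ≡⟨ cong (r N *_) (*-inverseˡ ε) ⟨
        r N * (ε⁻¹ * ε)                    ≡⟨ *-assoc (r N) ε⁻¹ ε ⟨
        r N * ε⁻¹ * ε                      ≤⟨ *-monoʳ-≤-nonNeg ε {{pos⇒nonNeg ε}} (*-monoˡ-≤-nonNeg (r N) {{r-nonNeg N}} bd) ⟩
        r N * ι N * ε                      <⟨ *-monoˡ-<-pos ε (*-monoʳ-<-pos (r N) {{r-pos N}} (ι-mono-< N)) ⟩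
        r N * ι (2 ℕ.^ N) * ε              ≡⟨ cong (_* ε) (*-comm (r N) (ι (2 ℕ.^ N))) ⟩
        ι (2 ℕ.^ N) * r N * ε              ≡⟨ cong (_* ε) (ι2^*r N) ⟩
        1ℚ * ε                             ≡⟨ *-identityˡ ε ⟩
        ε                                  ∎)
        where
        open ≤-Reasoning
        instance
          ε>0 : Positive ε
          ε>0 = positive 0<ε
          ε≢0 : NonZero ε
          ε≢0 = pos⇒nonZero ε
        ε⁻¹ = 1/ ε
        N = proj₁ (archimedean ε⁻¹)
        bd = proj₂ (archimedean ε⁻¹)
        ι-mono-< : ∀ n → ι n < ι (2 ℕ.^ n)
        ι-mono-< n = <-≤-trans
          (subst₂ _<_ (+-identityˡ (ι n)) (sym (ι-+ 1 n)) (+-monoˡ-< (ι n) {0ℚ} {1ℚ} (*<* (ℤ.+<+ (s≤s z≤n)))))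
          (ι-mono-≤ (n<2^n n))

      r< : ∀ {N ε} → r N < ε → ∀ {i} → N ℕ.≤ i → ∣ r i ∣ < ε
      r< {N} {ε} rN<ε {i} N≤i = begin-strict
        ∣ r i ∣             ≡⟨ 0≤p⇒∣p∣≡p (nonNegative⁻¹ (r i) {{r-nonNeg i}}) ⟩
        r i                 ≡⟨ cong r (ℕ.m∸n+n≡m N≤i) ⟨
        r (i ℕ.∸ N ℕ.+ N)   ≤⟨ r-anti N (i ℕ.∸ N) ⟩
        r N                 <⟨ rN<ε ⟩
        ε                   ∎
        where open ≤-Reasoning

      null-r₁ : Null (λ i j → r i)
      null-r₁ 0<ε = proj₁ (r→0 0<ε) , λ i≥ j≥ → r< (proj₂ (r→0 0<ε)) i≥

      null-r₂ : Null (λ i j → r j)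
      null-r₂ 0<ε = proj₁ (r→0 0<ε) , λ i≥ j≥ → r< (proj₂ (r→0 0<ε)) j≥

      null-s : Null (λ i j → r i + r j)
      null-s = Null-sum {λ i j → r i} {λ i j → r j} (λ i j → r i + r j) (λ i j → ∣sum∣≤ (r i) (r j) refl) null-r₁ null-r₂

      K>0 : Positive (ι M + ι M)
      K>0 = pos+pos⇒pos (ι M) {{M>0}} (ι M) {{M>0}}
        where
        M>0 : Positive (ι M)
        M>0 = normalize-pos M 1 {{_}} {{ℕ.m^n≢0 (4 ℕ.* b) (4 ℕ.* b)}}

    cosSum-cauchy : ∀ {x} → Cauchy x → Cauchy (λ i → cosSum i (x i))
    cosSum-cauchy {x} cx = Null-sum {f} {g} h h≤ null-f null-g
      where
      bd = bounded {x} cx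
      b-1 = proj₁ bd
      A   = proj₁ (proj₂ bd)
      x≤ : ∀ {i} → A ℕ.≤ i → ∣ x i ∣ ≤ ι (suc b-1)
      x≤ = proj₂ (proj₂ bd)
      open Bound b-1
      K = ι M + ι M
      f g h : ℕ → ℕ → ℚ
      f i j = cosSum i (x i) - cosSum i (x j)
      g i j = cosSum i (x j) - cosSum j (x j)
      h i j = cosSum i (x i) - cosSum j (x j)
      h≤ : ∀ i j → ∣ h i j ∣ ≤ ∣ f i j ∣ + ∣ g i j ∣
      h≤ i j = ∣sum∣≤ (f i j) (g i j) (split (cosSum i (x i)) (cosSum i (x j)) (cosSum j (x j)))
      null-f : Null f
      null-f = Null-scale {λ i j → x i - x j} f K {{K>0}} A (λ {i} {j} i≥ j≥ → sum-lip (x i) (x j) (x≤ i≥) (x≤ j≥) i) cx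
      null-g : Null g
      null-g = Null-scale {λ i j → r i + r j} g K {{K>0}} A (λ {i} {j} _ j≥ → tail-sym (x j) (x≤ j≥) i j) null-s

    -- cosSum (2 + n) is strictly decreasing on [0 , 2], by comparison with
    -- an alternating series.

    alt : (ℕ → ℚ) → ℕ → ℚ
    alt v zero    = 0ℚ
    alt v (suc m) = v 0 - alt (λ k → v (suc k)) m

    alt-snoc : ∀ v m → alt v (suc m) ≡ alt v m + (- 1ℚ) ^ m * v m
    alt-snoc v zero = solve 1 (λ u → u :- con 0ℚ := con 0ℚ :+ con 1ℚ :* u) refl (v 0)
    alt-snoc v (suc m) = trans (cong (λ t → v 0 - t) (alt-snoc (λ k → v (suc k)) m))
      (solve 4 (λ u w t z → u :- (w :+ t :* z) := (u :- w) :+ (:- con 1ℚ :* t) :* z) refl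
        (v 0) (alt (λ k → v (suc k)) m) ((- 1ℚ) ^ m) (v (suc m)))

    0≤q-p : ∀ {p q} → p ≤ q → 0ℚ ≤ q - p
    0≤q-p {p} {q} p≤q = subst (_≤ q - p) (+-inverseʳ p) (+-monoˡ-≤ (- p) p≤q)

    p-q≤p : ∀ {p q} → 0ℚ ≤ q → p - q ≤ p
    p-q≤p {p} {q} 0≤q = subst (p - q ≤_) (+-identityʳ p) (+-monoʳ-≤ p (neg-antimono-≤ 0≤q))

    alt-bounds : ∀ v → (∀ k → 0ℚ ≤ v k) → (∀ k → v (suc k) ≤ v k) → ∀ m → 0ℚ ≤ alt v m × alt v m ≤ v 0
    alt-bounds v v≥0 dec zero = ≤-refl , v≥0 0
    alt-bounds v v≥0 dec (suc m) =
      let lo , hi = alt-bounds (λ k → v (suc k)) (λ k → v≥0 (suc k)) (λ k → dec (suc k)) m in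
      0≤q-p (≤-trans hi (dec 0)) , p-q≤p lo

    0≤* : ∀ {p q} → 0ℚ ≤ p → 0ℚ ≤ q → 0ℚ ≤ p * q
    0≤* {p} {q} 0≤p 0≤q = subst (_≤ p * q) (*-zeroʳ p) (*-monoˡ-≤-nonNeg p {{nonNegative 0≤p}} 0≤q)

    0≤+ : ∀ {p q} → 0ℚ ≤ p → 0ℚ ≤ q → 0ℚ ≤ p + q
    0≤+ {p} {q} 0≤p 0≤q = subst (_≤ p + q) (+-identityʳ 0ℚ) (+-mono-≤ 0≤p 0≤q)

    coeff-nonNeg : ∀ k → 0ℚ ≤ coeff k
    coeff-nonNeg k = nonNegative⁻¹ (coeff k) {{inv-nonNeg ((2 ℕ.* k) !) {{(2 ℕ.* k) !≢0}}}}

    coeff-step : ∀ j → ι 12 * coeff (suc (suc j)) ≤ coeff (suc j)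
    coeff-step j = begin
      ι 12 * coeff (suc k)                              ≡⟨ *-identityʳ (ι 12 * coeff (suc k)) ⟨
      ι 12 * coeff (suc k) * 1ℚ                         ≡⟨ cong (ι 12 * coeff (suc k) *_) (ι-inv (F k) {{(2 ℕ.* k) !≢0}}) ⟨
      ι 12 * coeff (suc k) * (ι (F k) * coeff k)        ≡⟨ rearr (ι 12) (coeff (suc k)) (ι (F k)) (coeff k) ⟩
      ι 12 * ι (F k) * (coeff (suc k) * coeff k)        ≡⟨ cong (_* (coeff (suc k) * coeff k)) (ι-* 12 (F k)) ⟨
      ι (12 ℕ.* F k) * (coeff (suc k) * coeff k)        ≤⟨ *-monoʳ-≤-nonNeg (coeff (suc k) * coeff k)
                                                             {{nonNegative (0≤* (coeff-nonNeg (suc k)) (coeff-nonNeg k))}} (ι-mono-≤ nat) ⟩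
      ι (F (suc k)) * (coeff (suc k) * coeff k)         ≡⟨ *-assoc (ι (F (suc k))) (coeff (suc k)) (coeff k) ⟨
      ι (F (suc k)) * coeff (suc k) * coeff k           ≡⟨ cong (_* coeff k) (ι-inv (F (suc k)) {{(2 ℕ.* suc k) !≢0}}) ⟩
      1ℚ * coeff k                                      ≡⟨ *-identityˡ (coeff k) ⟩
      coeff k                                           ∎
      where
      open ≤-Reasoning
      k = suc j
      F : ℕ → ℕ
      F k = (2 ℕ.* k) !
      rearr : ∀ a b c d → a * b * (c * d) ≡ a * c * (b * d)
      rearr = solve 4 (λ a b c d → a :* b :* (c :* d) := a :* c :* (b :* d)) refl
      2≤2k : 2 ℕ.≤ 2 ℕ.* k
      2≤2k = ℕ.*-monoʳ-≤ 2 (s≤s (z≤n {j}))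
      nat : 12 ℕ.* F k ℕ.≤ F (suc k)
      nat = subst (λ e → 12 ℕ.* F k ℕ.≤ e !) (sym (ℕ.*-suc 2 k))
        (ℕ.≤-trans (ℕ.*-monoˡ-≤ (F k) (ℕ.*-mono-≤ {4} {2 ℕ.+ 2 ℕ.* k} {3} {1 ℕ.+ 2 ℕ.* k} (s≤s (s≤s 2≤2k)) (s≤s 2≤2k)))
          (ℕ.≤-reflexive (ℕ.*-assoc (2 ℕ.+ 2 ℕ.* k) (1 ℕ.+ 2 ℕ.* k) (F k))))

    ^-double : ∀ x k → x ^ (2 ℕ.* k) ≡ (x * x) ^ k
    ^-double x zero = refl
    ^-double x (suc k) = trans (cong (x ^_) (ℕ.*-suc 2 k))
      (trans (sym (*-assoc x x (x ^ (2 ℕ.* k)))) (cong (x * x *_) (^-double x k)))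

    module Decreasing (a b : ℚ) (0≤a : 0ℚ ≤ a) (a≤b : a ≤ b) (b≤2 : b ≤ ι 2) where
      A B : ℚ
      A = a * a
      B = b * b
      0≤b = ≤-trans 0≤a a≤b
      0≤A : 0ℚ ≤ A
      0≤A = 0≤* 0≤a 0≤a
      0≤B : 0ℚ ≤ B
      0≤B = 0≤* 0≤b 0≤b
      A≤B : A ≤ B
      A≤B = *-mono-≤-nonNeg 0≤b 0≤a a≤b a≤b
      B≤4 : B ≤ ι 4
      B≤4 = *-mono-≤-nonNeg (≤-trans 0≤b b≤2) 0≤b b≤2 b≤2
      Q u : ℕ → ℚ
      Q k = B ^ k - A ^ k
      u k = Q k * coeff k

      0≤pow : ∀ k → 0ℚ ≤ A ^ k
      0≤pow zero = *≤* (ℤ.+≤+ z≤n)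
      0≤pow (suc k) = 0≤* 0≤A (0≤pow k)

      pow-mono : ∀ k → A ^ k ≤ B ^ k
      pow-mono zero = ≤-refl
      pow-mono (suc k) = *-mono-≤-nonNeg 0≤B (0≤pow k) A≤B (pow-mono k)

      0≤Q : ∀ k → 0ℚ ≤ Q k
      0≤Q k = 0≤q-p (pow-mono k)

      0≤u : ∀ k → 0ℚ ≤ u k
      0≤u k = 0≤* (0≤Q k) (coeff-nonNeg k)

      Q-step : ∀ j → Q (suc (suc j)) ≤ (A + B) * Q (suc j)
      Q-step j = subst (_≤ (A + B) * Q (suc j)) (sym (eq A B (A ^ j) (B ^ j))) (p-q≤p (0≤* (0≤* 0≤A 0≤B) (0≤Q j)))
        where
        eq : ∀ A B X Y → B * (B * Y) - A * (A * X) ≡ (A + B) * (B * Y - A * X) - A * B * (Y - X)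
        eq = solve 4 (λ A B X Y → B :* (B :* Y) :- A :* (A :* X) := (A :+ B) :* (B :* Y :- A :* X) :- A :* B :* (Y :- X)) refl

      A+B≤12 : A + B ≤ ι 12
      A+B≤12 = ≤-trans (+-mono-≤ (≤-trans A≤B B≤4) B≤4) (*≤* (ℤ.+≤+ (ℕ.m≤m+n 8 4)))

      u-dec : ∀ j → u (suc (suc j)) ≤ u (suc j)
      u-dec j = begin
        Q (suc (suc j)) * coeff (suc (suc j))      ≤⟨ *-monoʳ-≤-nonNeg (coeff (suc (suc j))) {{nonNegative (coeff-nonNeg (suc (suc j)))}}
                                                        (≤-trans (Q-step j) (*-monoʳ-≤-nonNeg (Q (suc j)) {{nonNegative (0≤Q (suc j))}} A+B≤12)) ⟩
        ι 12 * Q (suc j) * coeff (suc (suc j))     ≡⟨ rearr (ι 12) (Q (suc j)) (coeff (suc (suc j))) ⟩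
        Q (suc j) * (ι 12 * coeff (suc (suc j)))   ≤⟨ *-monoˡ-≤-nonNeg (Q (suc j)) {{nonNegative (0≤Q (suc j))}} (coeff-step j) ⟩
        Q (suc j) * coeff (suc j)                  ∎
        where
        open ≤-Reasoning
        rearr : ∀ a b c → a * b * c ≡ b * (a * c)
        rearr = solve 3 (λ a b c → a :* b :* c := b :* (a :* c)) refl

      diff : ∀ n → cosSum n b - cosSum n a ≡ alt u n
      diff zero = refl
      diff (suc n) = begin
        (cosSum n b + s * (b ^ (2 ℕ.* n) * c)) - (cosSum n a + s * (a ^ (2 ℕ.* n) * c))
          ≡⟨ cong₂ (λ y x → (cosSum n b + s * (y * c)) - (cosSum n a + s * (x * c))) (^-double b n) (^-double a n) ⟩
        (cosSum n b + s * (B ^ n * c)) - (cosSum n a + s * (A ^ n * c))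
          ≡⟨ rearr (cosSum n b) (cosSum n a) s (B ^ n) (A ^ n) c ⟩
        (cosSum n b - cosSum n a) + s * (Q n * c)
          ≡⟨ cong (_+ s * u n) (diff n) ⟩
        alt u n + s * u n
          ≡⟨ alt-snoc u n ⟨
        alt u (suc n) ∎
        where
        open ≡-Reasoning
        s = (- 1ℚ) ^ n
        c = coeff n
        rearr : ∀ p q s x y c → (p + s * (x * c)) - (q + s * (y * c)) ≡ (p - q) + s * ((x - y) * c)
        rearr = solve 6 (λ p q s x y c → (p :+ s :* (x :* c)) :- (q :+ s :* (y :* c)) := (p :- q) :+ s :* ((x :- y) :* c)) refl

      u2 : ℕ → ℚ
      u2 k = u (suc (suc k))

      drop≡ : ∀ n → cosSum (2 ℕ.+ n) a - cosSum (2 ℕ.+ n) b ≡ u 1 - alt u2 n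
      drop≡ n = begin
        cosSum (2 ℕ.+ n) a - cosSum (2 ℕ.+ n) b         ≡⟨ flip (cosSum (2 ℕ.+ n) a) (cosSum (2 ℕ.+ n) b) ⟩
        - (cosSum (2 ℕ.+ n) b - cosSum (2 ℕ.+ n) a)     ≡⟨ cong (λ t → - t) (diff (2 ℕ.+ n)) ⟩
        - (u 0 - (u 1 - alt u2 n))                      ≡⟨ simp (u 1) (alt u2 n) ⟩
        u 1 - alt u2 n                                  ∎
        where
        open ≡-Reasoning
        flip : ∀ p q → p - q ≡ - (q - p)
        flip = solve 2 (λ p q → p :- q := :- (q :- p)) refl
        simp : ∀ p q → - ((1ℚ - 1ℚ) * coeff 0 - (p - q)) ≡ p - q
        simp = solve 2 (λ p q → :- ((con 1ℚ :- con 1ℚ) :* con (coeff 0) :- (p :- q)) := p :- q) refl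

      u1≡ : u 1 ≡ ½ * (B - A)
      u1≡ = solve 2 (λ A B → (B :* con 1ℚ :- A :* con 1ℚ) :* con (coeff 1) := con ½ :* (B :- A)) refl A B

      upper : ∀ n → cosSum (2 ℕ.+ n) a - cosSum (2 ℕ.+ n) b ≤ ½ * (B - A)
      upper n = subst₂ _≤_ (sym (drop≡ n)) u1≡ (p-q≤p (proj₁ (alt-bounds u2 (λ k → 0≤u (suc (suc k))) (λ k → u-dec (suc k)) n)))

      lower : ∀ n → (+ 1 / 24) * ((B - A) * (ι 12 - (A + B))) ≤ cosSum (2 ℕ.+ n) a - cosSum (2 ℕ.+ n) b
      lower n = subst₂ _≤_ (eq A B) (sym (drop≡ n))
        (+-monoʳ-≤ (u 1) (neg-antimono-≤ (proj₂ (alt-bounds u2 (λ k → 0≤u (suc (suc k))) (λ k → u-dec (suc k)) n))))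
        where
        eq : ∀ A B → (B * 1ℚ - A * 1ℚ) * coeff 1 - (B * (B * 1ℚ) - A * (A * 1ℚ)) * coeff 2 ≡ (+ 1 / 24) * ((B - A) * (ι 12 - (A + B)))
        eq = solve 2 (λ A B → (B :* con 1ℚ :- A :* con 1ℚ) :* con (coeff 1) :- (B :* (B :* con 1ℚ) :- A :* (A :* con 1ℚ)) :* con (coeff 2)
                            := con (+ 1 / 24) :* ((B :- A) :* (con (ι 12) :- (A :+ B)))) refl

      sixth : ∀ n → 1ℚ ≤ a + b → (+ 1 / 6) * (b - a) ≤ cosSum (2 ℕ.+ n) a - cosSum (2 ℕ.+ n) b
      sixth n 1≤a+b = begin
        (+ 1 / 6) * (b - a)                               ≡⟨ e₁ (b - a) ⟩
        (+ 1 / 24) * ((b - a) * 1ℚ * ι 4)                 ≤⟨ *-monoˡ-≤-nonNeg (+ 1 / 24)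
                                                               (*-mono-≤-nonNeg (0≤* 0≤d (≤-trans 0≤1 1≤a+b)) (*≤* (ℤ.+≤+ z≤n))
                                                                 (*-monoˡ-≤-nonNeg (b - a) {{nonNegative 0≤d}} 1≤a+b) 4≤) ⟩
        (+ 1 / 24) * ((b - a) * (a + b) * (ι 12 - (A + B))) ≡⟨ cong (λ t → (+ 1 / 24) * (t * (ι 12 - (A + B)))) (e₂ a b) ⟩
        (+ 1 / 24) * ((B - A) * (ι 12 - (A + B)))         ≤⟨ lower n ⟩
        cosSum (2 ℕ.+ n) a - cosSum (2 ℕ.+ n) b           ∎
        where
        open ≤-Reasoning
        0≤1 : 0ℚ ≤ 1ℚ
        0≤1 = *≤* (ℤ.+≤+ z≤n)
        0≤d = 0≤q-p a≤b
        4≤ : ι 4 ≤ ι 12 - (A + B)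
        4≤ = +-monoʳ-≤ (ι 12) (neg-antimono-≤ {A + B} {ι 8} (+-mono-≤ (≤-trans A≤B B≤4) B≤4))
        e₁ : ∀ d → (+ 1 / 6) * d ≡ (+ 1 / 24) * (d * 1ℚ * ι 4)
        e₁ = solve 1 (λ d → con (+ 1 / 6) :* d := con (+ 1 / 24) :* (d :* con 1ℚ :* con (ι 4))) refl
        e₂ : ∀ a b → (b - a) * (a + b) ≡ b * b - a * a
        e₂ = solve 2 (λ a b → (b :- a) :* (a :+ b) := b :* b :- a :* a) refl

  open CosineSeries

  infix 4 _≈ʳ_ _<ʳ_

  -- Real numbers are Cauchy sequences of rationals, with equality _≈ʳ_.
  record ℝ : Set where
    constructor mkℝ
    field
      seq    : ℕ → ℚ
      cauchy : Cauchy seq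
  open ℝ public

  _≈ʳ_ : ℝ → ℝ → Set
  x ≈ʳ y = ∀ {ε} → 0ℚ < ε → ∃[ N ] ∀ {i} → N ℕ.≤ i → ∣ seq x i - seq y i ∣ < ε

  _<ʳ_ : ℝ → ℝ → Set
  x <ʳ y = ∃[ ε ] (0ℚ < ε × ∃[ N ] ∀ {i} → N ℕ.≤ i → ε < seq y i - seq x i)

  fromℚ : ℚ → ℝ
  fromℚ q = mkℝ (λ _ → q) (λ {ε} 0<ε → 0 , λ _ _ → subst (_< ε) (sym (cong ∣_∣ (+-inverseʳ q))) 0<ε)

  ℝ-rawRing : RawRing 0ℓ 0ℓ
  ℝ-rawRing = record
    { Carrier = ℝ
    ; _≈_     = _≈ʳ_
    ; _+_     = λ x y → mkℝ (λ i → seq x i + seq y i) (+-cauchy {seq x} {seq y} (cauchy x) (cauchy y))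
    ; _*_     = λ x y → mkℝ (λ i → seq x i * seq y i) (*-cauchy {seq x} {seq y} (cauchy x) (cauchy y))
    ; -_      = λ x → mkℝ (λ i → - seq x i) (neg-cauchy {seq x} (cauchy x))
    ; 0#      = fromℚ 0ℚ
    ; 1#      = fromℚ 1ℚ
    }

  -- If x is the limit of rationals xₙ, the diagonal sequence ∑_{k<n} (-1)ᵏ xₙ²ᵏ/(2k)!
  -- converges to cos x, because the power series converges uniformly on bounded sets.
  cos : ℝ → ℝ
  cos x = mkℝ (λ n → cosSum n (seq x n)) (cosSum-cauchy {seq x} (cauchy x))

  -- Bisection of [1 , 2]: the first component is the left end of the k-th interval.
  bisect : (ℚ → ℚ) → ℕ → ℚ × ℚ
  bisect f zero = 1ℚ , + 2 / 1
  bisect f (suc k) with bisect f k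
  ... | l , h with f (½ * (l + h)) ≤? 0ℚ
  ...   | yes _ = l , ½ * (l + h)
  ...   | no  _ = ½ * (l + h) , h

  -- The n-th approximation to the zero of cos in [1 , 2]: n bisection steps applied
  -- to the n-th partial sum of the cosine series.
  rootApprox : ℕ → ℚ
  rootApprox n = proj₁ (bisect (cosSum n) n)

  module Bisection where
    record Bracket (f : ℚ → ℚ) (k : ℕ) (l h : ℚ) : Set where
      field
        1≤l   : 1ℚ ≤ l
        h≤2   : h ≤ ι 2
        width : h - l ≡ ½ ^ k
        0≤fl  : 0ℚ ≤ f l
        fh≤0  : f h ≤ 0ℚ

    ½^-nonNeg : ∀ k → 0ℚ ≤ ½ ^ k
    ½^-nonNeg zero = *≤* (ℤ.+≤+ z≤n)
    ½^-nonNeg (suc k) = 0≤* {½} (*≤* (ℤ.+≤+ z≤n)) (½^-nonNeg k)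

    q-p≥0 : ∀ {p q} → 0ℚ ≤ q - p → p ≤ q
    q-p≥0 {p} {q} 0≤ = subst₂ _≤_ (+-identityˡ p) (solve 2 (λ p q → (q :- p) :+ p := q) refl p q) (+-monoˡ-≤ p 0≤)

    mid-l : ∀ l h → ½ * (l + h) - l ≡ ½ * (h - l)
    mid-l = solve 2 (λ l h → con ½ :* (l :+ h) :- l := con ½ :* (h :- l)) refl

    mid-h : ∀ l h → h - ½ * (l + h) ≡ ½ * (h - l)
    mid-h = solve 2 (λ l h → h :- con ½ :* (l :+ h) := con ½ :* (h :- l)) refl

    bracket : ∀ f → 0ℚ ≤ f 1ℚ → f (ι 2) ≤ 0ℚ → ∀ k → Bracket f k (proj₁ (bisect f k)) (proj₂ (bisect f k))
    bracket f f1 f2 zero = record { 1≤l = ≤-refl ; h≤2 = ≤-refl ; width = refl ; 0≤fl = f1 ; fh≤0 = f2 }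
    bracket f f1 f2 (suc k) with bisect f k | bracket f f1 f2 k
    ... | l , h | br with f (½ * (l + h)) ≤? 0ℚ
    ...   | yes fm≤0 = record
      { 1≤l = 1≤l
      ; h≤2 = ≤-trans (q-p≥0 (subst (0ℚ ≤_) (sym (trans (mid-h l h) (cong (½ *_) width))) (½^-nonNeg (suc k)))) h≤2
      ; width = trans (mid-l l h) (cong (½ *_) width) ; 0≤fl = 0≤fl ; fh≤0 = fm≤0 }
      where open Bracket br
    ...   | no fm≰0 = record
      { 1≤l = ≤-trans 1≤l (q-p≥0 (subst (0ℚ ≤_) (sym (trans (mid-l l h) (cong (½ *_) width))) (½^-nonNeg (suc k))))
      ; h≤2 = h≤2
      ; width = trans (mid-h l h) (cong (½ *_) width) ; 0≤fl = <⇒≤ (≰⇒> fm≰0) ; fh≤0 = fh≤0 }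
      where open Bracket br

    cosSum-0 : ∀ n → cosSum (suc n) 0ℚ ≡ 1ℚ
    cosSum-0 zero = refl
    cosSum-0 (suc n) = trans (cong₂ _+_ (cosSum-0 n)
      (trans (cong ((- 1ℚ) ^ suc n *_) (trans (cong (_* coeff (suc n)) (*-zeroˡ (0ℚ ^ (n ℕ.+ (suc n ℕ.+ 0))))) (*-zeroˡ (coeff (suc n)))))
        (*-zeroʳ ((- 1ℚ) ^ suc n)))) (+-identityʳ 1ℚ)

    0≤1 : 0ℚ ≤ 1ℚ
    0≤1 = *≤* (ℤ.+≤+ z≤n)

    cosSum-1 : ∀ n → 0ℚ ≤ cosSum (2 ℕ.+ n) 1ℚ
    cosSum-1 n = ≤-trans {0ℚ} {½} (*≤* (ℤ.+≤+ z≤n)) (q-p≥0 (subst (0ℚ ≤_) (eq c) (0≤q-p up)))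
      where
      c = cosSum (2 ℕ.+ n) 1ℚ
      up : 1ℚ - c ≤ ½
      up = subst (λ t → t - c ≤ ½) (cosSum-0 (suc n)) (Decreasing.upper 0ℚ 1ℚ ≤-refl 0≤1 (*≤* (ℤ.+≤+ (s≤s z≤n))) n)
      eq : ∀ c → ½ - (1ℚ - c) ≡ c - ½
      eq = solve 1 (λ c → con ½ :- (con 1ℚ :- c) := c :- con ½) refl

    cosSum-2 : ∀ n → cosSum (2 ℕ.+ n) (ι 2) ≤ 0ℚ
    cosSum-2 n = ≤-trans {_} { - (+ 1 / 3)} (q-p≥0 {c} { - (+ 1 / 3)} (subst (0ℚ ≤_) (eq c) (0≤q-p lo))) (*≤* ℤ.-≤+)
      where
      c = cosSum (2 ℕ.+ n) (ι 2)
      lo : + 4 / 3 ≤ 1ℚ - c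
      lo = subst (λ t → + 4 / 3 ≤ t - c) (cosSum-0 (suc n)) (Decreasing.lower 0ℚ (ι 2) ≤-refl (*≤* (ℤ.+≤+ z≤n)) ≤-refl n)
      eq : ∀ c → 1ℚ - c - + 4 / 3 ≡ (- (+ 1 / 3)) - c
      eq = solve 1 (λ c → con 1ℚ :- c :- con (+ 4 / 3) := con (- (+ 1 / 3)) :- c) refl

    module Root (b-1 : ℕ) (2≤b : ι 2 ≤ ι (suc b-1)) where
      open Bound b-1 
      K = ι M + ι M

      s : ℕ → ℚ
      s = rootApprox

      br : ∀ n → Bracket (cosSum (2 ℕ.+ n)) (2 ℕ.+ n) (s (2 ℕ.+ n)) (proj₂ (bisect (cosSum (2 ℕ.+ n)) (2 ℕ.+ n)))
      br n = bracket (cosSum (2 ℕ.+ n)) (cosSum-1 n) (cosSum-2 n) (2 ℕ.+ n)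

      1≤s : ∀ {i} → 2 ℕ.≤ i → 1ℚ ≤ s i
      1≤s {suc (suc n)} (s≤s (s≤s z≤n)) = Bracket.1≤l (br n)

      s≤2 : ∀ {i} → 2 ℕ.≤ i → s i ≤ ι 2
      s≤2 {suc (suc n)} (s≤s (s≤s z≤n)) = ≤-trans (q-p≥0 (subst (0ℚ ≤_) (sym width) (½^-nonNeg (2 ℕ.+ n)))) h≤2
        where open Bracket (br n)

      0≤cos-s : ∀ {i} → 2 ℕ.≤ i → 0ℚ ≤ cosSum i (s i)
      0≤cos-s {suc (suc n)} (s≤s (s≤s z≤n)) = Bracket.0≤fl (br n)

      ∣∣≤b : ∀ {p} → 1ℚ ≤ p → p ≤ ι 2 → ∣ p ∣ ≤ ι b
      ∣∣≤b {p} 1≤p p≤2 = subst (_≤ ι b) (sym (0≤p⇒∣p∣≡p (≤-trans 0≤1 1≤p))) (≤-trans p≤2 2≤b)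

      ∣s∣≤ : ∀ {i} → 2 ℕ.≤ i → ∣ s i ∣ ≤ ι b
      ∣s∣≤ i≥ = ∣∣≤b (1≤s i≥) (s≤2 i≥)

      cos-s≤ : ∀ {i} → 2 ℕ.≤ i → ∣ cosSum i (s i) ∣ ≤ K * r i
      cos-s≤ {suc (suc n)} 2≤i@(s≤s (s≤s z≤n)) = begin
        ∣ cosSum i l ∣                    ≡⟨ 0≤p⇒∣p∣≡p 0≤fl ⟩
        cosSum i l                        ≡⟨ +-identityʳ (cosSum i l) ⟨
        cosSum i l - 0ℚ                   ≤⟨ +-monoʳ-≤ (cosSum i l) (neg-antimono-≤ fh≤0) ⟩
        cosSum i l - cosSum i h           ≡⟨ 0≤p⇒∣p∣≡p (0≤q-p (≤-trans fh≤0 0≤fl)) ⟨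
        ∣ cosSum i l - cosSum i h ∣       ≤⟨ sum-lip l h (∣s∣≤ 2≤i) (∣∣≤b (≤-trans 1≤l l≤h) h≤2) i ⟩
        K * ∣ l - h ∣                     ≡⟨ cong (K *_) (∣-∣-comm l h) ⟩
        K * ∣ h - l ∣                     ≡⟨ cong (λ t → K * ∣ t ∣) width ⟩
        K * ∣ r i ∣                       ≡⟨ cong (K *_) (0≤p⇒∣p∣≡p (½^-nonNeg i)) ⟩
        K * r i                           ∎
        where
        open ≤-Reasoning
        open Bracket (br n)
        i = 2 ℕ.+ n
        l = s i
        h = proj₂ (bisect (cosSum i) i)
        l≤h : l ≤ h
        l≤h = q-p≥0 (subst (0ℚ ≤_) (sym width) (½^-nonNeg i))

      sixth : ∀ {i} → 2 ℕ.≤ i → ∀ {p q} → 0ℚ ≤ p → p ≤ q → q ≤ ι 2 → 1ℚ ≤ q →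
              (+ 1 / 6) * (q - p) ≤ cosSum i p - cosSum i q
      sixth {suc (suc n)} (s≤s (s≤s z≤n)) {p} {q} 0≤p p≤q q≤2 1≤q =
        Decreasing.sixth p q 0≤p p≤q q≤2 n (≤-trans 1≤q (subst (_≤ p + q) (+-identityˡ q) (+-monoˡ-≤ q 0≤p)))

      inv-lip : ∀ {i} → 2 ℕ.≤ i → ∀ {p q} → 1ℚ ≤ p → p ≤ ι 2 → 1ℚ ≤ q → q ≤ ι 2 →
                ∣ p - q ∣ ≤ ι 6 * ∣ cosSum i p - cosSum i q ∣
      inv-lip {i} i≥ {p} {q} 1≤p p≤2 1≤q q≤2 = go (≤-total p q)
        where
        open ≤-Reasoning
        half : ∀ {p q} → 1ℚ ≤ p → p ≤ q → q ≤ ι 2 → ∣ p - q ∣ ≤ ι 6 * ∣ cosSum i p - cosSum i q ∣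
        half {p} {q} 1≤p p≤q q≤2 = begin
          ∣ p - q ∣                              ≡⟨ ∣-∣-comm p q ⟩
          ∣ q - p ∣                              ≡⟨ 0≤p⇒∣p∣≡p (0≤q-p p≤q) ⟩
          q - p                                  ≡⟨ solve 1 (λ d → con (ι 6) :* (con (+ 1 / 6) :* d) := d) refl (q - p) ⟨
          ι 6 * ((+ 1 / 6) * (q - p))            ≤⟨ *-monoˡ-≤-nonNeg (ι 6) (sixth i≥ 0≤p p≤q q≤2 (≤-trans 1≤p p≤q)) ⟩
          ι 6 * (cosSum i p - cosSum i q)        ≡⟨ cong (ι 6 *_) (0≤p⇒∣p∣≡p 0≤D) ⟨
          ι 6 * ∣ cosSum i p - cosSum i q ∣      ∎
          where
          0≤p = ≤-trans 0≤1 1≤p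
          0≤D : 0ℚ ≤ cosSum i p - cosSum i q
          0≤D = ≤-trans (0≤* {+ 1 / 6} (*≤* (ℤ.+≤+ z≤n)) (0≤q-p p≤q)) (sixth i≥ 0≤p p≤q q≤2 (≤-trans 1≤p p≤q))
        go : _ → ∣ p - q ∣ ≤ ι 6 * ∣ cosSum i p - cosSum i q ∣
        go (inj₁ p≤q) = half 1≤p p≤q q≤2
        go (inj₂ q≤p) = subst₂ _≤_ (∣-∣-comm q p) (cong (ι 6 *_) (∣-∣-comm (cosSum i q) (cosSum i p))) (half 1≤q q≤p p≤2)

      s-cauchy : Cauchy s
      s-cauchy = Null-scale {λ i j → r i + r j} (λ i j → s i - s j) (ι 6 * (K + K)) {{C>0}} 2 bd null-s
        where
        open ≤-Reasoning
        C>0 : Positive (ι 6 * (K + K))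
        C>0 = pos*pos⇒pos (ι 6) (K + K) {{pos+pos⇒pos K {{K>0}} K {{K>0}}}}
        K≥0 = pos⇒nonNeg K {{K>0}}
        three : ∀ p q r → p - r ≡ p + ((q - r) - q)
        three = solve 3 (λ p q r → p :- r := p :+ ((q :- r) :- q)) refl
        bd : ∀ {i j} → 2 ℕ.≤ i → 2 ℕ.≤ j → ∣ s i - s j ∣ ≤ ι 6 * (K + K) * ∣ r i + r j ∣
        bd {i} {j} i≥ j≥ = begin
          ∣ s i - s j ∣                         ≤⟨ inv-lip i≥ (1≤s i≥) (s≤2 i≥) (1≤s j≥) (s≤2 j≥) ⟩
          ι 6 * ∣ Sii - Sij ∣                   ≤⟨ *-monoˡ-≤-nonNeg (ι 6) inner ⟩
          ι 6 * ((K + K) * ∣ r i + r j ∣)       ≡⟨ *-assoc (ι 6) (K + K) ∣ r i + r j ∣ ⟨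
          ι 6 * (K + K) * ∣ r i + r j ∣         ∎
          where
          Sii = cosSum i (s i)
          Sij = cosSum i (s j)
          Sjj = cosSum j (s j)
          ∣s∣ : ∣ r i + r j ∣ ≡ r i + r j
          ∣s∣ = 0≤p⇒∣p∣≡p (0≤+ (½^-nonNeg i) (½^-nonNeg j))
          rearr : ∀ p q r → p - q ≡ (p - r) + (r - q)
          rearr = solve 3 (λ p q r → p :- q := (p :- r) :+ (r :- q)) refl
          sum≡ : ∀ k a b → (k * a + k * b) + k * (a + b) ≡ (k + k) * (a + b)
          sum≡ = solve 3 (λ k a b → (k :* a :+ k :* b) :+ k :* (a :+ b) := (k :+ k) :* (a :+ b)) refl
          inner : ∣ Sii - Sij ∣ ≤ (K + K) * ∣ r i + r j ∣
          inner = begin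
            ∣ Sii - Sij ∣                                   ≤⟨ ∣sum∣≤ (Sii - Sjj) (Sjj - Sij) (rearr Sii Sij Sjj) ⟩
            ∣ Sii - Sjj ∣ + ∣ Sjj - Sij ∣                   ≤⟨ +-mono-≤ (≤-trans (∣p-q∣≤∣p∣+∣q∣ Sii Sjj) (+-mono-≤ (cos-s≤ i≥) (cos-s≤ j≥)))
                                                                 (≤-trans (≤-reflexive (∣-∣-comm Sjj Sij)) (tail-sym (s j) (∣s∣≤ j≥) i j)) ⟩
            (K * r i + K * r j) + K * ∣ r i + r j ∣         ≡⟨ cong (λ t → (K * r i + K * r j) + K * t) ∣s∣ ⟩
            (K * r i + K * r j) + K * (r i + r j)           ≡⟨ sum≡ K (r i) (r j) ⟩
            (K + K) * (r i + r j)                           ≡⟨ cong ((K + K) *_) ∣s∣ ⟨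
            (K + K) * ∣ r i + r j ∣                         ∎

      root : Null (λ i j → cosSum i (s i) - 0ℚ)
      root = Null-scale {λ i j → r i} (λ i j → cosSum i (s i) - 0ℚ) K {{K>0}} 2 bd null-r₁
        where
        bd : ∀ {i j} → 2 ℕ.≤ i → 2 ℕ.≤ j → ∣ cosSum i (s i) - 0ℚ ∣ ≤ K * ∣ r i ∣
        bd {i} i≥ _ = subst₂ _≤_ (sym (cong ∣_∣ (+-identityʳ (cosSum i (s i))))) (cong (K *_) (sym (0≤p⇒∣p∣≡p (½^-nonNeg i)))) (cos-s≤ i≥)

    module Root₁ = Root 1 ≤-refl

  open Bisection

  -- The least positive zero of cos, as 0<π/2, cos-π/2 and π/2-least confirm.
  π/2 : ℝ
  π/2 = mkℝ rootApprox Root₁.s-cauchy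

  0<π/2 : fromℚ 0ℚ <ʳ π/2
  0<π/2 = ½ , *<* (ℤ.+<+ (s≤s z≤n)) , 2 , λ {i} i≥ →
    subst (½ <_) (sym (+-identityʳ (rootApprox i))) (<-≤-trans (*<* (ℤ.+<+ (s≤s (s≤s z≤n)))) (Root₁.1≤s i≥))

  cos-π/2 : cos π/2 ≈ʳ fromℚ 0ℚ
  cos-π/2 0<ε = let N , bd = Root₁.root 0<ε in N , λ i≥ → bd i≥ i≥

  π/2-least : ∀ x → fromℚ 0ℚ <ʳ x → cos x ≈ʳ fromℚ 0ℚ → ¬ (x <ʳ π/2)
  π/2-least x (δ , 0<δ , N₁ , x>) cosx (ε , 0<ε , N₂ , x<) = <-irrefl refl (begin-strict
    η                        <⟨ *-monoʳ-<-pos (+ 1 / 6) (x< i≥₂) ⟩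
    (+ 1 / 6) * (si - xi)    ≤⟨ Root₁.sixth i≥ 0≤x (q-p≥0 (<⇒≤ (<-trans 0<ε (x< i≥₂)))) (Root₁.s≤2 i≥) (Root₁.1≤s i≥) ⟩
    cosSum i xi - cosSum i si ≤⟨ p-q≤p (Root₁.0≤cos-s i≥) ⟩
    cosSum i xi              ≤⟨ p≤∣p∣ (cosSum i xi) ⟩
    ∣ cosSum i xi ∣          ≡⟨ cong ∣_∣ (+-identityʳ (cosSum i xi)) ⟨
    ∣ cosSum i xi - 0ℚ ∣     <⟨ proj₂ (cosx 0<η) i≥₃ ⟩
    η                        ∎)
    where
    open ≤-Reasoning
    η = (+ 1 / 6) * ε
    0<η : 0ℚ < η
    0<η = *-monoʳ-<-pos (+ 1 / 6) 0<ε
    N₃ = proj₁ (cosx 0<η)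
    i = 2 ℕ.+ (N₁ ℕ.+ (N₂ ℕ.+ N₃))
    i≥ : 2 ℕ.≤ i
    i≥ = ℕ.m≤m+n 2 _
    i≥₁ : N₁ ℕ.≤ i
    i≥₁ = ℕ.≤-trans (ℕ.m≤m+n N₁ (N₂ ℕ.+ N₃)) (ℕ.m≤n+m _ 2)
    i≥₂ : N₂ ℕ.≤ i
    i≥₂ = ℕ.≤-trans (ℕ.m≤m+n N₂ N₃) (ℕ.≤-trans (ℕ.m≤n+m (N₂ ℕ.+ N₃) N₁) (ℕ.m≤n+m _ 2))
    i≥₃ : N₃ ℕ.≤ i
    i≥₃ = ℕ.≤-trans (ℕ.m≤n+m N₃ N₂) (ℕ.≤-trans (ℕ.m≤n+m (N₂ ℕ.+ N₃) N₁) (ℕ.m≤n+m _ 2))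
    xi = seq x i
    si = rootApprox i
    0≤x : 0ℚ ≤ xi
    0≤x = <⇒≤ (<-trans 0<δ (subst (δ <_) (+-identityʳ xi) (x> i≥₁)))
    p≤∣p∣ : ∀ p → p ≤ ∣ p ∣
    p≤∣p∣ p = q-p≥0 (go (≤-total 0ℚ p))
      where
      go : _ → 0ℚ ≤ ∣ p ∣ - p
      go (inj₁ 0≤p) = 0≤q-p (≤-reflexive (sym (0≤p⇒∣p∣≡p 0≤p)))
      go (inj₂ p≤0) = 0≤q-p (≤-trans p≤0 (0≤∣p∣ p))

  π : ℝ
  π = RawRing._*_ ℝ-rawRing (fromℚ (+ 2 / 1)) π/2

open Reals public using (ℝ; _≈ʳ_; ℝ-rawRing; cos; π)

import Data.Rational.Base as ℚ
open import Data.Fin.Base using (Fin; toℕ; opposite)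
open import Data.Nat.Base using (NonZero)

infix 4 _≈ᶜ_

record ℂ : Set where
  constructor _+i_
  field
    re im : ℝ
open ℂ public

_≈ᶜ_ : ℂ → ℂ → Set
z ≈ᶜ w = (re z ≈ʳ re w) × (im z ≈ʳ im w)

ℂ-rawRing : RawRing 0ℓ 0ℓ
ℂ-rawRing = record
  { Carrier = ℂ
  ; _≈_     = _≈ᶜ_
  ; _+_     = λ z w → (re z + re w) +i (im z + im w)
  ; _*_     = λ z w → (re z * re w + - (im z * im w)) +i (re z * im w + im z * re w)
  ; -_      = λ z → (- re z) +i (- im z)
  ; 0#      = 0# +i 0#
  ; 1#      = 1# +i 0#
  }
  where open RawRing ℝ-rawRing using (_+_; _*_; -_; 0#; 1#)

fromℝ : ℝ → ℂ
fromℝ x = x +i RawRing.0# ℝ-rawRing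

𝕚 : ℂ
𝕚 = RawRing.0# ℝ-rawRing +i RawRing.1# ℝ-rawRing

module RingNotation (R : RawRing 0ℓ 0ℓ) where
  open RawRing R using (Carrier; 1#; rawSemiring) renaming (_+_ to _⊕_; _*_ to _⊛_; -_ to ⊖_)
  open import Algebra.Definitions.RawSemiring rawSemiring using ()
    renaming (_×_ to _×ᴿ_; product to productᴿ)

  fromℕ : ℕ → Carrier
  fromℕ n = n ×ᴿ 1#

  -- ∏[1… n ] f = f 1 * f 2 * ⋯ * f n
  ∏[1…_] : ∀ n → (ℕ → Carrier) → Carrier
  ∏[1… n ] f = productᴿ {n} (λ k → f (suc (toℕ k)))

  T : ℕ → Carrier → Carrier
  T zero          x = 1#
  T (suc zero)    x = x
  T (suc (suc j)) x = ((fromℕ 2 ⊛ x) ⊛ T (suc j) x) ⊕ (⊖ T j x)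

fromℕʳ : ℕ → ℝ
fromℕʳ = RingNotation.fromℕ ℝ-rawRing

fromℕᶜ : ℕ → ℂ
fromℕᶜ = RingNotation.fromℕ ℂ-rawRing

ζ : ℤ → (d : ℕ) .{{_ : NonZero d}} → ℝ
ζ h d = cos (Reals.fromℚ (ℚ._/_ (+ 2 ℤ.* h ℤ.- + 1) (4 ℕ.* d) {{ℕ.m*n≢0 4 d}}) *ʳ π)
  where open RawRing ℝ-rawRing using () renaming (_*_ to _*ʳ_)

chebyshevProduct : (m n : ℕ) .{{_ : NonZero m}} → ℂ
chebyshevProduct m n =
  (- 1#) ^ (m ℕ.* n) * fromℕ 2 ^ m * ∏[1… m ] (λ h → T (2 ℕ.* n) (𝕚 * fromℝ (ζ (+ h) m)))
  where
  open RawRing ℂ-rawRing using (_*_; -_; 1#; rawSemiring)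
  open import Algebra.Definitions.RawSemiring rawSemiring using (_^_)
  open RingNotation ℂ-rawRing

cosineProduct : (m n : ℕ) .{{_ : NonZero m}} .{{_ : NonZero n}} → ℝ
cosineProduct m n =
  ∏[1… m ] (λ h → ∏[1… n ] (λ k → fromℕ 4 * ζ (+ h) m ^ 2 + fromℕ 4 * ζ (+ k) n ^ 2))
  where
  open RawRing ℝ-rawRing using (_+_; _*_; rawSemiring)
  open import Algebra.Definitions.RawSemiring rawSemiring using (_^_)
  open RingNotation ℝ-rawRing

import Data.Fin.Properties as Fin
open import Data.Bool.Base using (if_then_else_)
open import Data.List.Base using (List; []; _∷_; _++_; map; filter; length; upTo; allFin; cartesianProduct)
open import Data.Nat.ListAction using (sum; product)
open import Data.List.Relation.Unary.All using (All; all?)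
open import Data.Nat.Base using (_+_; _*_; _∸_; _≤_; ∣_-_∣)
open import Data.Product.Properties using (≡-dec)
open import Data.Sum.Base using (_⊎_)
open import Function.Bundles using (Inverse)
open import Relation.Binary.Bundles using (Setoid)
open import Relation.Binary.Construct.Closure.ReflexiveTransitive using (Star)
import Relation.Binary.Construct.On as On
open import Relation.Nullary.Decidable using (Dec; does; _⊎-dec_)

Vertex : ℕ → ℕ → Set
Vertex p q = Fin p × Fin q

module _ {p q : ℕ} where

  infix 4 _≟ᵥ_

  _≟ᵥ_ : (v w : Vertex p q) → Dec (v ≡ w)
  _≟ᵥ_ = ≡-dec Fin._≟_ Fin._≟_

  Adjacent : Vertex p q → Vertex p q → Set
  Adjacent (a , b) (a′ , b′) = ∣ toℕ a - toℕ a′ ∣ + ∣ toℕ b - toℕ b′ ∣ ≡ 1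

  adjacent? : ∀ v w → Dec (Adjacent v w)
  adjacent? (a , b) (a′ , b′) = ∣ toℕ a - toℕ a′ ∣ + ∣ toℕ b - toℕ b′ ∣ ℕ.≟ 1

Config : ℕ → ℕ → Set
Config p q = Vertex p q → ℕ

module _ {p q : ℕ} where

  Stable : Config p q → Set
  Stable c = ∀ v → ¬ (4 ≤ c v)

  -- The sink is implicit: every vertex loses 4 grains, and those not sent to grid
  -- neighbours are lost.
  fire : Vertex p q → Config p q → Config p q
  fire v c w = if does (v ≟ᵥ w) then c w ∸ 4
               else if does (adjacent? v w) then c w + 1
               else c w

  _⟶_ : Config p q → Config p q → Set
  c ⟶ d = ∃[ v ] 4 ≤ c v × d ≗ fire v c

  _StabilisesTo_ : Config p q → Config p q → Set
  c StabilisesTo d = ∃[ e ] Star _⟶_ c e × e ≗ d × Stable d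

  Recurrent : Config p q → Set
  Recurrent c = Stable c × (∀ (a : Config p q) → Σ[ b ∈ Config p q ] (λ v → a v + b v) StabilisesTo c)

  -- opposite is the reflection b ↦ q - b + 1 of [q].
  Symmetric : Config p q → Set
  Symmetric c = ∀ a b → c (a , b) ≡ c (a , opposite b) × c (a , b) ≡ c (opposite a , b)

-- Configurations are functions, hence compared pointwise.
SymmetricRecurrents : ℕ → ℕ → Setoid 0ℓ 0ℓ
SymmetricRecurrents p q =
  On.setoid {B = ∃[ c ] (Recurrent {p} {q} c × Symmetric c)} (Vertex p q →-setoid ℕ) proj₁

HasCardinality : Setoid 0ℓ 0ℓ → ℕ → Set
HasCardinality S N = Inverse (setoid (Fin N)) S

sublists : {A : Set} → List A → List (List A)
sublists []       = [] ∷ []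
sublists (x ∷ xs) = map (x ∷_) (sublists xs) ++ sublists xs

pairs : {A : Set} → List A → List (A × A)
pairs []       = []
pairs (x ∷ xs) = map (x ,_) xs ++ pairs xs

vertices : ∀ p q → List (Vertex p q)
vertices p q = cartesianProduct (allFin p) (allFin q)

-- Each undirected edge {v , w} is listed once, as the pair with v lexicographically
-- before w.
edges : ∀ p q → List (Vertex p q × Vertex p q)
edges p q = filter (λ (v , w) → adjacent? v w) (pairs (vertices p q))

module _ {p q : ℕ} where

  incident? : (v : Vertex p q) (e : Vertex p q × Vertex p q) → Dec (v ≡ proj₁ e ⊎ v ≡ proj₂ e)
  incident? v (w , w′) = (v ≟ᵥ w) ⊎-dec (v ≟ᵥ w′)

  PerfectMatching : List (Vertex p q × Vertex p q) → Set
  PerfectMatching M = All (λ v → length (filter (incident? v) M) ≡ 1) (vertices p q)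

  perfectMatching? : ∀ M → Dec (PerfectMatching M)
  perfectMatching? M = all? (λ v → length (filter (incident? v) M) ℕ.≟ 1) (vertices p q)

perfectMatchings : ∀ p q → List (List (Vertex p q × Vertex p q))
perfectMatchings p q = filter (perfectMatching? {p} {q}) (sublists (edges p q))

-- Written in 1-based coordinates, in the orientation used by edges.
weight2Edges : ℕ → ℕ → List ((ℕ × ℕ) × (ℕ × ℕ))
weight2Edges m n =
     map (λ h → (2 * m ∸ 2 * h , 2 * n ∸ 1) , (2 * m ∸ 2 * h , 2 * n)) (upTo m)
  ++ map (λ k → (2 * m ∸ 1 , 2 * n ∸ 2 * k) , (2 * m , 2 * n ∸ 2 * k)) (upTo n)

coordinates : ∀ {p q} → Vertex p q → ℕ × ℕ
coordinates (a , b) = suc (toℕ a) , suc (toℕ b)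

module _ (m n : ℕ) where

  edgeWeight : Vertex (2 * m) (2 * n) × Vertex (2 * m) (2 * n) → ℕ
  edgeWeight (v , w) = if does ((coordinates v , coordinates w) ∈? weight2Edges m n) then 2 else 1
    where open import Data.List.Membership.DecPropositional (≡-dec (≡-dec ℕ._≟_ ℕ._≟_) (≡-dec ℕ._≟_ ℕ._≟_)) using (_∈?_)

  weightedDominoTilings : ℕ
  weightedDominoTilings = sum (map (λ M → product (map edgeWeight M)) (perfectMatchings (2 * m) (2 * n)))

{-# OPTIONS --safe #-}

-- All four numbers equal the determinant of S_m(Z), where S_j(x) = 2 T_j(x / 2) and Z is
-- the n × n tridiagonal matrix with 4 on the diagonal and 1 next to it, except for a 2 in
-- the last entry above the diagonal.
--
-- Recurrents: a recurrent configuration is determined by its class modulo the reduced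
-- Laplacian. Symmetric configurations live on one quarter of the grid, where the
-- Laplacian is block tridiagonal; eliminating row after row identifies its cokernel with
-- that of S_m(Z), which has |det S_m(Z)| elements. Least action stabilises symmetrically.
--
-- Tilings: reading a matching of the checkerboard row by row makes the dominoes hops of
-- free fermions, and two consecutive rows act on the exterior algebra as the map induced
-- by one step of the recursion for S_j. The weights 2 give the first and last rows.
--
-- Products: the roots of S_m(2 + x) are x = - 4 ζ_{h,m}², distinct by the monotonicity of
-- cos on [0, π / 2], so that det S_m(Z) = ∏_h det(Z - 2 + 4 ζ_{h,m}²) = ∏_h S_n(2 + 4 ζ_{h,m}²),
-- and the same factorisation applies to S_n.
-- Moreover S_n(2 - 4 x²) = (-1)^n 2 T_{2n}(x), here with x = i ζ_{h,m}.
module Submission where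

open import Algebra.Bundles using (CommutativeRing)
open import Level using (0ℓ)
open import Algebra.Bundles.Raw using (RawRing)

-- The determinant is needed over two rings at once: over the integers it is the index of a lattice,
-- over the reals it factors. It is therefore defined over any commutative ring, as a top
-- coefficient in the exterior algebra, where the tiling count is found as well. The cokernel
-- argument sees only the absolute value of the determinant and needs it to be nonzero. The sign is
-- settled because the determinant is a tiling count; that this count is nonzero comes back from
-- analysis, where the cosine product has a positive rational lower bound. Equality of reals is
-- undecidable, so roots are split off under the condition that their differences are regular (not
-- zero divisors), which such lower bounds provide. Trigonometry enters through the recursion
-- `c (k + 2) + c k = 2 c 1 c (k + 1)` satisfied by `cos kθ`, a case of the formula for
-- `cos (x + y) + cos (x - y)`. The numbers `T_k(x)` satisfy the same recursion, so one lemma serves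
-- both the roots and the Chebyshev product. The complex formula is obtained from the real
-- factorisation by the inclusion of ℝ in ℂ.

-- Matchings as sums over the edges taken one after another

module EdgeSums where
  open import Defs
  open import Data.Bool.Base using (Bool; true; false; _∧_; _∨_; not; if_then_else_)
  import Data.Bool.Properties as Bool
  open import Data.Bool.Solver using (module ∨-∧-Solver)
  open import Data.Empty using (⊥; ⊥-elim)
  open import Data.Fin.Base using (Fin; zero; suc; toℕ)
  import Data.Fin.Properties as Fin
  open import Data.List.Base as List using (List; []; _∷_; _++_; map; filter; foldr; length; allFin; tabulate; cartesianProduct)
  open import Data.List.Membership.Propositional using (_∈_)
  open import Data.List.Membership.Propositional.Properties using (∈-allFin; ∈-cartesianProduct⁺)
  import Data.List.Properties as List
  open import Data.List.Relation.Binary.Permutation.Propositional as Perm using (_↭_; prep; swap; ↭-refl)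
  open import Data.List.Relation.Binary.Permutation.Propositional.Properties using (++⁺ˡ; shifts; filter-↭)
  open import Data.List.Relation.Unary.All as All using (All; []; _∷_; all?)
  open import Data.List.Relation.Unary.AllPairs using ([]; _∷_)
  open import Data.Nat.Base using (ℕ; zero; suc; _+_; _*_; ∣_-_∣)
  open import Data.Nat.ListAction using (sum; product)
  open import Data.Nat.ListAction.Properties using (sum-++)
  import Data.Nat.Properties as ℕ
  open import Data.Nat.Solver using (module +-*-Solver)
  open import Data.Product.Base using (_×_; _,_; proj₁; proj₂)
  open import Data.Sum.Base using (inj₁; inj₂)
  open import Data.Vec.Base as Vec using ([]; _∷_)
  open import Function.Base using (_∘_)
  open import Relation.Binary.Definitions using (DecidableEquality)
  open import Relation.Binary.PropositionalEquality
  open import Relation.Nullary.Decidable using (Dec; yes; no; does; dec-true; dec-false)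
  open import Relation.Unary using (Decidable)

  when : Bool → ℕ → ℕ
  when b n = if b then n else 0

  module EdgeSum (X : Set) (_≟_ : DecidableEquality X) where
    Edge : Set
    Edge = X × X

    -- A state marks the vertices still to be covered.
    State : Set
    State = X → Bool

    apart : X → Edge → Bool
    apart u (v , w) = not (does (u ≟ v)) ∧ not (does (u ≟ w))

    remove : Edge → State → State
    remove e d u = d u ∧ apart u e

    allows : State → Edge → Bool
    allows d (v , w) = d v ∧ d w

    -- Taking or leaving `e`: a taken edge contributes its weight and its endpoints leave the state.
    -- Folding `step` over a list sums over the sets of disjoint edges inside the state, with `φ`
    -- weighing what stays uncovered.
    step : (Edge → ℕ) → Edge → (State → ℕ) → State → ℕ
    step ω e φ d = when (allows d e) (ω e * φ (remove e d)) + φ d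

    steps : (Edge → ℕ) → List Edge → (State → ℕ) → State → ℕ
    steps ω es φ = foldr (step ω) φ es

    Extensional : (State → ℕ) → Set
    Extensional φ = ∀ {d d'} → d ≗ d' → φ d ≡ φ d'

    step-ext : ∀ ω e {φ} → Extensional φ → Extensional (step ω e φ)
    step-ext ω e@(v , w) ext d≗ = cong₂ _+_
      (cong₂ when (cong₂ _∧_ (d≗ v) (d≗ w)) (cong (ω e *_) (ext (λ u → cong (_∧ apart u e) (d≗ u))))) (ext d≗)

    steps-ext : ∀ ω es {φ} → Extensional φ → Extensional (steps ω es φ)
    steps-ext ω [] ext = ext
    steps-ext ω (e ∷ es) ext = step-ext ω e (steps-ext ω es ext)

    step-cong : ∀ {ω ω'} e {φ ψ} → ω e ≡ ω' e → φ ≗ ψ → step ω e φ ≗ step ω' e ψ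
    step-cong e ω≡ φ≗ d = cong₂ _+_ (cong (when (allows d e)) (cong₂ _*_ ω≡ (φ≗ _))) (φ≗ d)

    steps-cong : ∀ {ω ω'} es {φ ψ} → ω ≗ ω' → φ ≗ ψ → steps ω es φ ≗ steps ω' es ψ
    steps-cong [] ω≗ φ≗ = φ≗
    steps-cong {ω} {ω'} (e ∷ es) ω≗ φ≗ = step-cong {ω} {ω'} e (ω≗ e) (steps-cong es ω≗ φ≗)

    steps-scale : ∀ ω es c φ d → steps ω es (λ d → c * φ d) d ≡ c * steps ω es φ d
    steps-scale ω [] c φ d = refl
    steps-scale ω (e ∷ es) c φ d = trans (cong₂ (λ x y → when (allows d e) (ω e * x) + y) (steps-scale ω es c φ _) (steps-scale ω es c φ d))
      (scale (allows d e) (ω e) _ _)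
      where
      open +-*-Solver
      scale : ∀ b w x y → when b (w * (c * x)) + c * y ≡ c * (when b (w * x) + y)
      scale true w x y = solve 4 (λ c w x y → w :* (c :* x) :+ c :* y := c :* (w :* x :+ y)) refl c w x y
      scale false w x y = refl

    ≟-sym : ∀ x y → does (x ≟ y) ≡ does (y ≟ x)
    ≟-sym x y with x ≟ y | y ≟ x
    ... | yes _ | yes _ = refl
    ... | no _  | no _  = refl
    ... | yes p | no ¬p = ⊥-elim (¬p (sym p))
    ... | no ¬p | yes p = ⊥-elim (¬p (sym p))

    -- Both orders expand into the same four terms: both edges, one of the two, none. Using both
    -- requires that all four endpoints are to be covered and that the edges are disjoint, a
    -- condition symmetric in `e` and `f`. This allows the edges to be regrouped by rows.
    step-comm : ∀ ω e f {φ} → Extensional φ → step ω e (step ω f φ) ≗ step ω f (step ω e φ)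
    step-comm ω e@(v , w) f@(v' , w') {φ} ext d = begin
      when E (we * (when E/f (wf * φ ef) + φ (remove e d))) + (when F (wf * φ (remove f d)) + φ d)
        ≡⟨ expand E E/f we wf (φ ef) _ _ ⟩
      when (E ∧ E/f) (we * wf * φ ef) + when E (we * φ (remove e d)) + (when F (wf * φ (remove f d)) + φ d)
        ≡⟨ cong₂ (λ b x → when b x + when E (we * φ (remove e d)) + (when F (wf * φ (remove f d)) + φ d)) swap-allowed
             (cong₂ _*_ (ℕ.*-comm we wf) (ext (λ u → ∧-swap (d u) (apart u e) (apart u f)))) ⟩
      when (F ∧ F/e) (wf * we * φ fe) + when E (we * φ (remove e d)) + (when F (wf * φ (remove f d)) + φ d)
        ≡⟨ rearrange (when (F ∧ F/e) (wf * we * φ fe)) (when E (we * φ (remove e d))) (when F (wf * φ (remove f d))) (φ d) ⟩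
      when (F ∧ F/e) (wf * we * φ fe) + when F (wf * φ (remove f d)) + (when E (we * φ (remove e d)) + φ d)
        ≡⟨ expand F F/e wf we (φ fe) _ _ ⟨
      when F (wf * (when F/e (we * φ fe) + φ (remove f d))) + (when E (we * φ (remove e d)) + φ d) ∎
      where
      open ≡-Reasoning
      E = allows d e
      F = allows d f
      E/f = allows (remove e d) f
      F/e = allows (remove f d) e
      we = ω e
      wf = ω f
      ef = remove f (remove e d)
      fe = remove e (remove f d)
      rearrange : ∀ a b c x → a + b + (c + x) ≡ a + c + (b + x)
      rearrange = solve 4 (λ a b c x → a :+ b :+ (c :+ x) := a :+ c :+ (b :+ x)) refl
        where open +-*-Solver
      ∧-swap : ∀ a b c → (a ∧ b) ∧ c ≡ (a ∧ c) ∧ b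
      ∧-swap = solve 3 (λ a b c → (a :* b) :* c := (a :* c) :* b) refl
        where open ∨-∧-Solver
      expand : ∀ b c x y z u t → when b (x * (when c (y * z) + u)) + t ≡ when (b ∧ c) (x * y * z) + when b (x * u) + t
      expand true true x y z u t = solve 5 (λ x y z u t → x :* (y :* z :+ u) :+ t := x :* y :* z :+ x :* u :+ t) refl x y z u t
        where open +-*-Solver
      expand true false x y z u t = refl
      expand false c x y z u t = refl
      swap-allowed : E ∧ E/f ≡ F ∧ F/e
      swap-allowed rewrite ≟-sym v v' | ≟-sym v w' | ≟-sym w v' | ≟-sym w w' =
        solve 8 (λ a b c d x y z t → (a :* b) :* ((c :* (x :* y)) :* (d :* (z :* t))) := (c :* d) :* ((a :* (x :* z)) :* (b :* (y :* t)))) refl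
          (d v) (d w) (d v') (d w') (not (does (v' ≟ v))) (not (does (v' ≟ w))) (not (does (w' ≟ v))) (not (does (w' ≟ w)))
        where open ∨-∧-Solver

    steps-↭ : ∀ ω {es fs φ} → Extensional φ → es ↭ fs → steps ω es φ ≗ steps ω fs φ
    steps-↭ ω ext Perm.refl d = refl
    steps-↭ ω ext (prep e p) = step-cong {ω} {ω} e refl (steps-↭ ω ext p)
    steps-↭ ω {e ∷ f ∷ es} ext (swap _ _ p) d = trans (step-comm ω e f (steps-ext ω es ext) d)
      (step-cong {ω} {ω} f refl (step-cong {ω} {ω} e refl (steps-↭ ω ext p)) d)
    steps-↭ ω ext (Perm.trans p q) d = trans (steps-↭ ω ext p d) (steps-↭ ω ext q d)

    steps-++ : ∀ ω es fs φ → steps ω (es ++ fs) φ ≡ steps ω es (steps ω fs φ)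
    steps-++ ω es fs φ = List.foldr-++ (step ω) φ es fs

  -- Edges inside the image of ι act only on the part of the state that ι sees.
  module Transport {X Y : Set} (_≟₁_ : DecidableEquality X) (_≟₂_ : DecidableEquality Y) (ι : X → Y)
    (ι-does : ∀ x y → does (ι x ≟₂ ι y) ≡ does (x ≟₁ y))
    (glue : (Y → Bool) → (X → Bool) → Y → Bool)
    (glue-self : ∀ d → glue d (d ∘ ι) ≗ d)
    (glue-cong : ∀ d {s s'} → s ≗ s' → glue d s ≗ glue d s')
    (glue-remove : ∀ e d s → glue (EdgeSum.remove Y _≟₂_ (ι (proj₁ e) , ι (proj₂ e)) d) s ≗ glue d s)
    where
    private
      module A = EdgeSum X _≟₁_
      module B = EdgeSum Y _≟₂_

    ι² : X × X → Y × Y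
    ι² (x , y) = ι x , ι y

    steps-transport : ∀ ω es {ψ} → B.Extensional ψ → ∀ d →
      B.steps ω (map ι² es) ψ d ≡ A.steps (ω ∘ ι²) es (λ s → ψ (glue d s)) (d ∘ ι)
    steps-transport ω [] ext d = ext (λ y → sym (glue-self d y))
    steps-transport ω (e@(v , w) ∷ es) {ψ} ext d = cong₂ _+_ (cong (λ x → when (B.allows d (ι² e)) (ω (ι² e) * x)) removed) (steps-transport ω es ext d)
      where
      removed : B.steps ω (map ι² es) ψ (B.remove (ι² e) d) ≡ A.steps (ω ∘ ι²) es (λ s → ψ (glue d s)) (A.remove e (d ∘ ι))
      removed = trans (steps-transport ω es ext (B.remove (ι² e) d))
        (trans (A.steps-cong {ω ∘ ι²} {ω ∘ ι²} es (λ _ → refl) (λ s → ext (glue-remove e d s)) _)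
          (A.steps-ext (ω ∘ ι²) es (λ s≗ → ext (glue-cong d s≗))
            (λ u → cong (d (ι u) ∧_) (cong₂ (λ a b → not a ∧ not b) (ι-does u v) (ι-does u w)))))

  bit : Bool → ℕ
  bit b = if b then 1 else 0

  module _ {p q : ℕ} where
    open EdgeSum (Vertex p q) _≟ᵥ_

    Covers : State → List Edge → Set
    Covers d M = All (λ v → length (filter (incident? v) M) ≡ bit (d v)) (vertices p q)

    covers? : ∀ d M → Dec (Covers d M)
    covers? d M = all? (λ v → length (filter (incident? v) M) ℕ.≟ bit (d v)) (vertices p q)

    weight : (Edge → ℕ) → List Edge → ℕ
    weight ω M = product (map ω M)

    coverings : (Edge → ℕ) → List (List Edge) → State → ℕ
    coverings ω Ms d = sum (map (weight ω) (filter (covers? d) Ms))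

    -- The empty matching covers the state or not, so this is 1 on the empty state and 0 elsewhere.
    -- Written as a covering count it is the base case of `coverings-steps`.
    finished : State → ℕ
    finished d = coverings (λ _ → 1) ([] ∷ []) d

    ∈-vertices : ∀ v → v ∈ vertices p q
    ∈-vertices (a , b) = ∈-cartesianProduct⁺ (∈-allFin a) (∈-allFin b)

    apart-incident : ∀ u (e : Edge) → apart u e ≡ not (does (incident? u e))
    apart-incident u (v , w) = deMorgan (does (u ≟ᵥ v)) (does (u ≟ᵥ w))
      where
      deMorgan : ∀ a b → not a ∧ not b ≡ not (a ∨ b)
      deMorgan true b = refl
      deMorgan false b = refl

    private
      degree : Vertex p q → List Edge → ℕ
      degree u M = length (filter (incident? u) M)

      degree-∷ : ∀ u e M → degree u (e ∷ M) ≡ bit (does (incident? u e)) + degree u M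
      degree-∷ u e M with does (incident? u e)
      ... | true = refl
      ... | false = refl

      incident⇒allowed : ∀ d e u → allows d e ≡ true → does (incident? u e) ≡ true → d u ≡ true
      incident⇒allowed d (v , w) u ok inc with u ≟ᵥ v | u ≟ᵥ w | d v in dv | d w in dw
      ... | yes refl | _ | true | _ = dv
      ... | no _ | yes refl | true | true = dw

      covers-remove : ∀ d e M → allows d e ≡ true → ∀ u →
        (degree u (e ∷ M) ≡ bit (d u) → degree u M ≡ bit (remove e d u)) ×
        (degree u M ≡ bit (remove e d u) → degree u (e ∷ M) ≡ bit (d u))
      covers-remove d e M ok u =
        (λ eq → trans (proj₁ core′ (trans (sym (degree-∷ u e M)) eq)) (sym bits)) ,
        (λ eq → trans (degree-∷ u e M) (proj₂ core′ (trans eq bits)))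
        where
        core : ∀ i n b → (i ≡ true → b ≡ true) →
               (bit i + n ≡ bit b → n ≡ bit (b ∧ not i)) × (n ≡ bit (b ∧ not i) → bit i + n ≡ bit b)
        core true n b i⇒b rewrite i⇒b refl = ℕ.suc-injective , cong suc
        core false n b i⇒b rewrite Bool.∧-identityʳ b = (λ x → x) , (λ x → x)
        core′ = core (does (incident? u e)) (degree u M) (d u) (incident⇒allowed d e u ok)
        bits : bit (remove e d u) ≡ bit (d u ∧ not (does (incident? u e)))
        bits = cong (λ x → bit (d u ∧ x)) (apart-incident u e)

      -- An endpoint of `e` that is not to be covered must have degree 0, yet `e` contributes 1 to
      -- it.
      covers-forbidden : ∀ d e M → allows d e ≡ false → Covers d (e ∷ M) → ⊥
      covers-forbidden d e@(v , w) M no! c with d v in dv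
      ... | false = absurd (trans (sym (degree-∷ v e M)) (trans (All.lookup c (∈-vertices v)) (cong bit dv)))
        where
        absurd : bit (does (incident? v e)) + degree v M ≡ 0 → ⊥
        absurd eq rewrite dec-true (incident? v e) (inj₁ refl) with () ← eq
      ... | true = absurd (trans (sym (degree-∷ w e M)) (trans {j = bit (d w)} (All.lookup c (∈-vertices w)) (cong bit no!)))
        where
        absurd : bit (does (incident? w e)) + degree w M ≡ 0 → ⊥
        absurd eq rewrite dec-true (incident? w e) (inj₂ refl) with () ← eq

    coverings-∷ : ∀ ω e Ms d → coverings ω (map (e ∷_) Ms) d ≡ when (allows d e) (ω e * coverings ω Ms (remove e d))
    coverings-∷ ω e Ms d with allows d e in ok
    ... | false = none Ms
      where
      none : ∀ Ms → coverings ω (map (e ∷_) Ms) d ≡ 0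
      none [] = refl
      none (M ∷ Ms) rewrite dec-false (covers? d (e ∷ M)) (covers-forbidden d e M ok) = none Ms
    ... | true = some Ms
      where
      some : ∀ Ms → coverings ω (map (e ∷_) Ms) d ≡ ω e * coverings ω Ms (remove e d)
      some [] = sym (ℕ.*-zeroʳ (ω e))
      some (M ∷ Ms) with covers? (remove e d) M
      ... | yes c rewrite dec-true (covers? d (e ∷ M)) (All.map (λ {u} → proj₂ (covers-remove d e M ok u)) c) =
        trans (cong (ω e * weight ω M +_) (some Ms)) (sym (ℕ.*-distribˡ-+ (ω e) (weight ω M) _))
      ... | no ¬c rewrite dec-false (covers? d (e ∷ M)) (λ c → ¬c (All.map (λ {u} → proj₁ (covers-remove d e M ok u)) c)) = some Ms

    coverings-++ : ∀ ω Ms Ns d → coverings ω (Ms ++ Ns) d ≡ coverings ω Ms d + coverings ω Ns d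
    coverings-++ ω Ms Ns d = begin
      sum (map (weight ω) (filter (covers? d) (Ms ++ Ns)))                       ≡⟨ cong (sum ∘ map (weight ω)) (List.filter-++ (covers? d) Ms Ns) ⟩
      sum (map (weight ω) (filter (covers? d) Ms ++ filter (covers? d) Ns))      ≡⟨ cong sum (List.map-++ (weight ω) (filter (covers? d) Ms) _) ⟩
      sum (map (weight ω) (filter (covers? d) Ms) ++ map (weight ω) (filter (covers? d) Ns)) ≡⟨ sum-++ (map (weight ω) (filter (covers? d) Ms)) _ ⟩
      coverings ω Ms d + coverings ω Ns d ∎
      where open ≡-Reasoning

    -- Splitting the sublists by whether they contain the first edge mirrors the two cases of
    -- `step`; `coverings-∷` handles the sublists that do.
    coverings-steps : ∀ ω es → coverings ω (sublists es) ≗ steps ω es finished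
    coverings-steps ω [] d with covers? d []
    ... | yes _ = refl
    ... | no _ = refl
    coverings-steps ω (e ∷ es) d = trans (coverings-++ ω (map (e ∷_) (sublists es)) (sublists es) d)
      (cong₂ _+_ (trans (coverings-∷ ω e (sublists es) d) (cong (λ x → when (allows d e) (ω e * x)) (coverings-steps ω es (remove e d))))
                 (coverings-steps ω es d))

    finished-ext : Extensional finished
    finished-ext {d} {d'} d≗d' with covers? d [] | covers? d' []
    ... | yes _ | yes _ = refl
    ... | no _  | no _  = refl
    ... | yes c | no ¬c = ⊥-elim (¬c (All.map (λ {v} eq → trans eq (cong bit (d≗d' v))) c))
    ... | no ¬c | yes c = ⊥-elim (¬c (All.map (λ {v} eq → trans eq (cong bit (sym (d≗d' v)))) c))

    finished-1 : ∀ d → (∀ v → d v ≡ false) → finished d ≡ 1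
    finished-1 d d≡ rewrite dec-true (covers? d []) (All.tabulate (λ {v} _ → cong bit (sym (d≡ v)))) = refl

    finished-0 : ∀ d v → d v ≡ true → finished d ≡ 0
    finished-0 d v dv with covers? d []
    ... | no _ = refl
    ... | yes c with () ← trans (All.lookup c (∈-vertices v)) (cong bit dv)

  filter-does : {A : Set} {P Q : A → Set} (P? : Decidable P) (Q? : Decidable Q) → (∀ x → does (P? x) ≡ does (Q? x)) →
                ∀ xs → filter P? xs ≡ filter Q? xs
  filter-does P? Q? P≡Q [] = refl
  filter-does P? Q? P≡Q (x ∷ xs) with does (P? x) | does (Q? x) | P≡Q x
  ... | true  | true  | _ = cong (x ∷_) (filter-does P? Q? P≡Q xs)
  ... | false | false | _ = filter-does P? Q? P≡Q xs

  filter-map : {A B : Set} {P : B → Set} {Q : A → Set} (P? : Decidable P) (Q? : Decidable Q) (f : A → B) →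
               (∀ x → does (P? (f x)) ≡ does (Q? x)) → ∀ xs → filter P? (map f xs) ≡ map f (filter Q? xs)
  filter-map P? Q? f P≡Q [] = refl
  filter-map P? Q? f P≡Q (x ∷ xs) with does (P? (f x)) | does (Q? x) | P≡Q x
  ... | true  | true  | _ = cong (f x ∷_) (filter-map P? Q? f P≡Q xs)
  ... | false | false | _ = filter-map P? Q? f P≡Q xs

  map² : {A B : Set} → (A → B) → A × A → B × B
  map² f (x , y) = f x , f y

  cross : {A : Set} → List A → List A → List (A × A)
  cross [] ys = []
  cross (x ∷ xs) ys = map (x ,_) ys ++ cross xs ys

  pairs-++ : {A : Set} (xs ys : List A) → pairs (xs ++ ys) ↭ pairs xs ++ cross xs ys ++ pairs ys
  pairs-++ [] ys = ↭-refl
  pairs-++ (x ∷ xs) ys = begin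
    map (x ,_) (xs ++ ys) ++ pairs (xs ++ ys)
      ≡⟨ cong (_++ pairs (xs ++ ys)) (List.map-++ (x ,_) xs ys) ⟩
    (map (x ,_) xs ++ map (x ,_) ys) ++ pairs (xs ++ ys)
      ≡⟨ List.++-assoc (map (x ,_) xs) _ _ ⟩
    map (x ,_) xs ++ map (x ,_) ys ++ pairs (xs ++ ys)
      ↭⟨ ++⁺ˡ (map (x ,_) xs) (++⁺ˡ (map (x ,_) ys) (pairs-++ xs ys)) ⟩
    map (x ,_) xs ++ map (x ,_) ys ++ pairs xs ++ cross xs ys ++ pairs ys
      ↭⟨ ++⁺ˡ (map (x ,_) xs) (shifts (map (x ,_) ys) (pairs xs)) ⟩
    map (x ,_) xs ++ pairs xs ++ map (x ,_) ys ++ cross xs ys ++ pairs ys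
      ≡⟨ cong (λ t → map (x ,_) xs ++ pairs xs ++ t) (sym (List.++-assoc (map (x ,_) ys) _ _)) ⟩
    map (x ,_) xs ++ pairs xs ++ cross (x ∷ xs) ys ++ pairs ys
      ≡⟨ List.++-assoc (map (x ,_) xs) (pairs xs) _ ⟨
    pairs (x ∷ xs) ++ cross (x ∷ xs) ys ++ pairs ys ∎
    where open Perm.PermutationReasoning

  pairs-map : {A B : Set} (f : A → B) (xs : List A) → pairs (map f xs) ≡ map (map² f) (pairs xs)
  pairs-map f [] = refl
  pairs-map f (x ∷ xs) = trans (cong₂ _++_ (trans (sym (List.map-∘ xs)) (List.map-∘ xs)) (pairs-map f xs))
    (sym (List.map-++ (map² f) (map (x ,_) xs) (pairs xs)))

  below : ∀ {p q} → Vertex p q → Vertex (suc p) q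
  below (a , b) = suc a , b

  first : ∀ {p q} → Fin q → Vertex (suc p) q
  first b = zero , b

  allFin-suc : ∀ n → allFin (suc n) ≡ zero ∷ map suc (allFin n)
  allFin-suc n = cong (zero ∷_) (sym (List.map-tabulate (λ i → i) suc))

  vertices-suc : ∀ p q → vertices (suc p) q ≡ map first (allFin q) ++ map below (vertices p q)
  vertices-suc p q = cong (map first (allFin q) ++_) (trans (cong (λ as → cartesianProduct as (allFin q)) (sym (List.map-tabulate (λ i → i) suc)))
    (shift (allFin p)))
    where
    shift : ∀ as → cartesianProduct (map suc as) (allFin q) ≡ map below (cartesianProduct as (allFin q))
    shift [] = refl
    shift (a ∷ as) = trans (cong₂ _++_ (List.map-∘ (allFin q)) (shift as)) (sym (List.map-++ below (map (a ,_) (allFin q)) _))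

  consecutive? : ∀ {q} (e : Fin q × Fin q) → Dec (∣ toℕ (proj₁ e) - toℕ (proj₂ e) ∣ ≡ 1)
  consecutive? (b , b') = ∣ toℕ b - toℕ b' ∣ ℕ.≟ 1

  pathEdges : ∀ q → List (Fin q × Fin q)
  pathEdges q = filter consecutive? (pairs (allFin q))

  ladder : ∀ {p q} → Fin q → Vertex (suc (suc p)) q × Vertex (suc (suc p)) q
  ladder b = (zero , b) , (suc zero , b)

  equal? : ∀ {q} (b b' : Fin q) → Dec (1 + ∣ toℕ b - toℕ b' ∣ ≡ 1)
  equal? b b' = 1 + ∣ toℕ b - toℕ b' ∣ ℕ.≟ 1

  filter-equal : ∀ {q} (b : Fin q) → filter (equal? b) (allFin q) ≡ b ∷ []
  filter-equal {suc q} b = trans (cong (filter (equal? b)) (allFin-suc q)) (go b)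
    where
    go : ∀ (b : Fin (suc q)) → filter (equal? b) (zero ∷ map suc (allFin q)) ≡ b ∷ []
    go zero = cong (zero ∷_) (trans (filter-map (equal? zero) never? suc (λ _ → refl) (allFin q)) (cong (map suc) (List.filter-none never? {allFin q} (All.tabulate (λ _ ())))))
      where
      never? : (b : Fin q) → Dec (2 ≡ 1)
      never? _ = no λ ()
    go (suc b) = trans (filter-map (equal? (suc b)) (equal? b) suc (λ _ → refl) (allFin q)) (cong (map suc) (filter-equal b))

  -- An adjacent pair lies inside the first row, joins it to the second row, or avoids it. The
  -- lexicographic listing mixes these kinds, hence a permutation and not an equality.
  edges-suc : ∀ p q → edges (suc (suc p)) q ↭
    map (map² first) (pathEdges q) ++ map ladder (allFin q) ++ map (map² below) (edges (suc p) q)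
  edges-suc p q = begin
    filter adj (pairs (vertices (suc (suc p)) q))
      ≡⟨ cong (filter adj ∘ pairs) (vertices-suc (suc p) q) ⟩
    filter adj (pairs (row ++ rest))
      ↭⟨ filter-↭ adj (pairs-++ row rest) ⟩
    filter adj (pairs row ++ cross row rest ++ pairs rest)
      ≡⟨ trans (List.filter-++ adj (pairs row) _) (cong (filter adj (pairs row) ++_) (List.filter-++ adj (cross row rest) (pairs rest))) ⟩
    filter adj (pairs row) ++ filter adj (cross row rest) ++ filter adj (pairs rest)
      ≡⟨ cong₂ _++_ horizontal (cong₂ _++_ (vertical (allFin q)) lower) ⟩
    map (map² first) (pathEdges q) ++ map ladder (allFin q) ++ map (map² below) (edges (suc p) q) ∎
    where
    open Perm.PermutationReasoning
    row rest : List (Vertex (suc (suc p)) q)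
    row = map first (allFin q)
    rest = map below (vertices (suc p) q)
    adj : (e : Vertex (suc (suc p)) q × Vertex (suc (suc p)) q) → Dec (Adjacent (proj₁ e) (proj₂ e))
    adj (v , w) = adjacent? v w
    adj' : (e : Vertex (suc p) q × Vertex (suc p) q) → Dec (Adjacent (proj₁ e) (proj₂ e))
    adj' (v , w) = adjacent? v w
    horizontal : filter adj (pairs row) ≡ map (map² first) (pathEdges q)
    horizontal = trans (cong (filter adj) (pairs-map first (allFin q)))
      (filter-map adj consecutive? (map² first) (λ _ → refl) (pairs (allFin q)))
    lower : filter adj (pairs rest) ≡ map (map² below) (edges (suc p) q)
    lower = trans (cong (filter adj) (pairs-map below (vertices (suc p) q)))
      (filter-map adj adj' (map² below) (λ _ → refl) (pairs (vertices (suc p) q)))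
    neighbour : ∀ b → filter adj (map (first b ,_) rest) ≡ ladder b ∷ []
    neighbour b = trans (cong (filter adj) (sym (List.map-∘ (vertices (suc p) q))))
      (trans (cong (λ vs → filter adj (map (λ v → first b , below v) vs)) (vertices-suc p q))
      (trans (cong (filter adj) (List.map-++ (λ v → first b , below v) (map first (allFin q)) _))
      (trans (List.filter-++ adj (map (λ v → first b , below v) (map first (allFin q))) _)
      (cong₂ _++_
        (trans (cong (filter adj) (sym (List.map-∘ (allFin q))))
          (trans (filter-map adj (equal? b) (λ b' → first b , below (first b')) (λ _ → refl) (allFin q))
            (cong (map (λ b' → first b , below (first b'))) (filter-equal b))))
        (trans (cong (filter adj) (sym (List.map-∘ (vertices p q))))
          (List.filter-none adj {map (λ v → first b , below (below v)) (vertices p q)} (far (vertices p q))))))))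
      where
      far : ∀ vs → All (λ e → Adjacent (proj₁ e) (proj₂ e) → ⊥) (map (λ v → first b , below (below v)) vs)
      far [] = []
      far (v ∷ vs) = (λ ()) ∷ far vs
    vertical : ∀ bs → filter adj (cross (map first bs) rest) ≡ map ladder bs
    vertical [] = refl
    vertical (b ∷ bs) = trans (List.filter-++ adj (map (first b ,_) rest) _) (cong₂ _++_ (neighbour b) (vertical bs))

  edges-one : ∀ q → edges 1 q ≡ map (map² first) (pathEdges q)
  edges-one q = trans (cong (filter adj ∘ pairs) (trans (vertices-suc 0 q) (List.++-identityʳ _)))
    (trans (cong (filter adj) (pairs-map first (allFin q))) (filter-map adj consecutive? (map² first) (λ _ → refl) (pairs (allFin q))))
    where
    adj : (e : Vertex 1 q × Vertex 1 q) → Dec (Adjacent (proj₁ e) (proj₂ e))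
    adj (v , w) = adjacent? v w

  pathEdges-suc : ∀ q → pathEdges (suc (suc q)) ≡ (zero , suc zero) ∷ map (map² suc) (pathEdges (suc q))
  pathEdges-suc q = trans (cong (filter consecutive? ∘ pairs) (allFin-suc (suc q)))
    (trans (List.filter-++ consecutive? (map (zero ,_) (map suc (allFin (suc q)))) _)
      (cong₂ _++_ start (trans (cong (filter consecutive?) (pairs-map suc (allFin (suc q))))
        (filter-map consecutive? consecutive? (map² suc) (λ _ → refl) (pairs (allFin (suc q)))))))
    where
    start : filter consecutive? (map (zero ,_) (map suc (allFin (suc q)))) ≡ (zero , suc zero) ∷ []
    start = trans (cong (λ bs → filter consecutive? (map (zero ,_) (map suc bs))) (allFin-suc q))
      (cong ((zero , suc zero) ∷_) (trans (cong (filter consecutive?) (trans (sym (List.map-∘ (map suc (allFin q)))) (sym (List.map-∘ (allFin q)))))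
        (List.filter-none consecutive? {map (λ b → zero , suc (suc b)) (allFin q)} (far (allFin q)))))
      where
      far : ∀ (bs : List (Fin q)) → All (λ e → ∣ toℕ (proj₁ e) - toℕ (proj₂ e) ∣ ≡ 1 → ⊥) (map (λ b → (Fin.zero {suc q}) , suc (suc b)) bs)
      far [] = []
      far (b ∷ bs) = (λ ()) ∷ far bs

-- Tilings computed row by row

module RowTransfer where
  open import Defs
  open EdgeSums
  open import Data.Bool.Base using (Bool; true; false; _∧_; _∨_; not; if_then_else_)
  import Data.Bool.Properties as Bool
  open import Data.Empty using (⊥-elim)
  open import Data.Fin.Base using (Fin; zero; suc; toℕ)
  import Data.Fin.Properties as Fin
  open import Data.List.Base as List using (List; []; _∷_; _++_; map; allFin)
  open import Data.List.Membership.Propositional using (_∈_)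
  open import Data.List.Membership.Propositional.Properties using (∈-allFin)
  import Data.List.Properties as List
  open import Data.List.Relation.Unary.All as All using (All; []; _∷_)
  open import Data.List.Relation.Unary.Any using (here; there)
  open import Data.List.Relation.Unary.AllPairs using ([]; _∷_)
  open import Data.List.Relation.Unary.Unique.Propositional using (Unique)
  open import Data.List.Relation.Unary.Unique.Propositional.Properties using (allFin⁺)
  open import Data.Nat.Base using (ℕ; zero; suc; _+_; _*_; _<_)
  open import Data.Nat.ListAction using (sum; product)
  import Data.Nat.Properties as ℕ
  open import Data.Product.Base using (_×_; _,_; ∃)
  open import Data.Sum.Base using (_⊎_; inj₁; inj₂)
  open import Data.Vec.Base as Vec using (Vec; []; _∷_; lookup; tabulate; replicate)
  import Data.Vec.Properties as Vec
  open import Function.Base using (_∘_)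
  open import Relation.Binary.PropositionalEquality
  open import Relation.Nullary.Decidable using (Dec; yes; no; does; dec-true; dec-false)

  rest : {A : Set} {q : ℕ} → Bool → (Vec Bool (suc q) → A) → Vec Bool q → A
  rest b φ s = φ (b ∷ s)

  -- Runs through the horizontal edges of a row from left to right: the domino on the first two
  -- cells is used, which closes both, or left out, and then the first cell is settled. `h` gives
  -- the weights, `φ` values the cells left to vertical dominoes.
  hops : (ℕ → ℕ) → ∀ {q} → (Vec Bool q → ℕ) → Vec Bool q → ℕ
  hops h φ [] = φ []
  hops h φ (b ∷ []) = φ (b ∷ [])
  hops h φ (b ∷ b' ∷ s) =
    when (b ∧ b') (h 0 * hops (h ∘ suc) (rest false φ) (false ∷ s)) + hops (h ∘ suc) (rest b φ) (b' ∷ s)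

  hops-cong : ∀ h {q} {φ ψ : Vec Bool q → ℕ} → φ ≗ ψ → hops h φ ≗ hops h ψ
  hops-cong h φ≗ [] = φ≗ []
  hops-cong h φ≗ (b ∷ []) = φ≗ (b ∷ [])
  hops-cong h φ≗ (b ∷ b' ∷ s) = cong₂ _+_ (cong (λ x → when (b ∧ b') (h 0 * x)) (hops-cong (h ∘ suc) (φ≗ ∘ (false ∷_)) (false ∷ s)))
    (hops-cong (h ∘ suc) (φ≗ ∘ (b ∷_)) (b' ∷ s))

  none : ∀ {q} → Vec Bool q → ℕ
  none [] = 1
  none (true ∷ s) = 0
  none (false ∷ s) = none s

  vweight : (ℕ → ℕ) → ∀ {q} → Vec Bool q → ℕ
  vweight v [] = 1
  vweight v (b ∷ s) = (if b then v 0 else 1) * vweight (v ∘ suc) s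

  -- transfer p h v s sums the weights of the coverings of p + 1 rows, of which the
  -- first one has its cells at s still to be covered.
  transfer : ℕ → (h v : ℕ → ℕ → ℕ) → ∀ {q} → Vec Bool q → ℕ
  transfer zero h v = hops (h 0) none
  transfer (suc p) h v = hops (h 0) (λ s → vweight (v 0) s * transfer p (h ∘ suc) (v ∘ suc) (Vec.map not s))

  cons : ∀ {q} → Bool → (Fin q → Bool) → Fin (suc q) → Bool
  cons b s zero = b
  cons b s (suc i) = s i

  cons-self : ∀ {q} (d : Fin (suc q) → Bool) → cons (d zero) (d ∘ suc) ≗ d
  cons-self d zero = refl
  cons-self d (suc i) = refl

  cons-cong : ∀ {q} {b b'} {s s' : Fin q → Bool} → b ≡ b' → s ≗ s' → cons b s ≗ cons b' s'
  cons-cong b≡ s≗ zero = b≡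
  cons-cong b≡ s≗ (suc i) = s≗ i

  cons-lookup : ∀ {q} b (s : Vec Bool q) → cons b (lookup s) ≗ lookup (b ∷ s)
  cons-lookup b s zero = refl
  cons-lookup b s (suc i) = refl

  module Path {q : ℕ} = EdgeSum (Fin q) Fin._≟_

  module Shift {q : ℕ} = Transport (Fin._≟_ {q}) (Fin._≟_ {suc q}) suc (λ _ _ → refl) (λ d → cons (d zero))
    cons-self (λ d s≗ → cons-cong refl s≗) (λ e d s → cons-cong (Bool.∧-identityʳ (d zero)) (λ _ → refl))

  pathWeight : ∀ {q} → (ℕ → ℕ → ℕ) → Fin q × Fin q → ℕ
  pathWeight w (b , b') = w (toℕ b) (toℕ b')

  PathHops : ℕ → Set
  PathHops q = ∀ w {φ} → Path.Extensional {q} φ → ∀ d →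
    Path.steps (pathWeight w) (pathEdges q) φ d ≡ hops (λ c → w c (suc c)) (φ ∘ lookup) (tabulate d)

  path-hops-suc : ∀ q → PathHops (suc q) → ∀ w {φ} → Path.Extensional φ → ∀ d →
    Path.steps (pathWeight w) (map (map² suc) (pathEdges (suc q))) φ d ≡
    hops (λ c → w (suc c) (suc (suc c))) (λ s → φ (lookup (d zero ∷ s))) (tabulate (d ∘ suc))
  path-hops-suc q IH w {φ} ext d = trans (Shift.steps-transport (pathWeight w) (pathEdges (suc q)) ext d)
    (trans (IH (λ i j → w (suc i) (suc j)) (λ s≗ → ext (cons-cong refl s≗)) (d ∘ suc))
      (hops-cong _ (λ s → ext (cons-lookup (d zero) s)) (tabulate (d ∘ suc))))

  -- The first edge of the path touches only the first two cells, and the remaining edges are a path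
  -- shifted by one, which `Shift` transports to the tail of the state.
  path-hops : ∀ q → PathHops q
  path-hops zero w ext d = ext (λ ())
  path-hops (suc zero) w ext d = ext λ { zero → refl }
  path-hops (suc (suc q)) w {φ} ext d = trans (cong (λ es → Path.steps (pathWeight w) es φ d) (pathEdges-suc q))
    (cong₂ _+_ (cong (λ x → when (d zero ∧ d (suc zero)) (w 0 1 * x))
                (trans (path-hops-suc q (path-hops (suc q)) w ext (Path.remove (zero , suc zero) d))
                  (cong₂ (λ b t → hops (λ c → w (suc c) (suc (suc c))) (λ s → φ (lookup (b ∷ s))) t) (Bool.∧-zeroʳ (d zero))
                    (cong₂ _∷_ (Bool.∧-zeroʳ (d (suc zero))) (Vec.tabulate-cong λ i → Bool.∧-identityʳ (d (suc (suc i))))))))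
               (path-hops-suc q (path-hops (suc q)) w ext d))

  does-iff : {A B : Set} (A? : Dec A) (B? : Dec B) → (A → B) → (B → A) → does A? ≡ does B?
  does-iff (yes a) B? f g = sym (dec-true B? (f a))
  does-iff (no ¬a) B? f g = sym (dec-false B? (λ b → ¬a (g b)))

  module Grid {p q : ℕ} = EdgeSum (Vertex p q) _≟ᵥ_

  gridWeight : ∀ {p q} → (ℕ → ℕ → ℕ → ℕ → ℕ) → Vertex p q × Vertex p q → ℕ
  gridWeight w ((a , b) , (a' , b')) = w (toℕ a) (toℕ b) (toℕ a') (toℕ b')

  withFirst : ∀ {p q} → (Fin q → Bool) → (Vertex p q → Bool) → Vertex (suc p) q → Bool
  withFirst s d (zero , b) = s b
  withFirst s d (suc a , b) = d (a , b)

  withFirst-cong : ∀ {p q} {s s' : Fin q → Bool} {d d' : Vertex p q → Bool} → s ≗ s' → d ≗ d' → withFirst s d ≗ withFirst s' d'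
  withFirst-cong s≗ d≗ (zero , b) = s≗ b
  withFirst-cong s≗ d≗ (suc a , b) = d≗ (a , b)

  withFirst-self : ∀ {p q} (d : Vertex (suc p) q → Bool) → withFirst (d ∘ first) (d ∘ below) ≗ d
  withFirst-self d (zero , b) = refl
  withFirst-self d (suc a , b) = refl

  first-does : ∀ {p q} (b b' : Fin q) → does (first {p} b ≟ᵥ first b') ≡ does (b Fin.≟ b')
  first-does b b' = refl

  below-does : ∀ {p q} (v w : Vertex p q) → does (below v ≟ᵥ below w) ≡ does (v ≟ᵥ w)
  below-does v w = does-iff (below v ≟ᵥ below w) (v ≟ᵥ w) (λ { refl → refl }) (λ { refl → refl })

  first-remove : ∀ {p q} (e : Fin q × Fin q) (d : Vertex (suc p) q → Bool) s →
    withFirst s (Grid.remove (map² first e) d ∘ below) ≗ withFirst s (d ∘ below)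
  first-remove e d s = withFirst-cong (λ _ → refl) (λ v → Bool.∧-identityʳ (d (below v)))

  below-remove : ∀ {p q} (e : Vertex p q × Vertex p q) (d : Vertex (suc p) q → Bool) (s : Vertex p q → Bool) →
    withFirst (Grid.remove (map² below e) d ∘ first {p}) s ≗ withFirst (d ∘ first {p}) s
  below-remove {p} e d s = withFirst-cong (λ b → Bool.∧-identityʳ (d (first {p} b))) (λ _ → refl)

  module First {p q : ℕ} = Transport (Fin._≟_ {q}) (_≟ᵥ_ {suc p} {q}) first (first-does {p}) (λ d s → withFirst s (d ∘ below))
    withFirst-self (λ d s≗ → withFirst-cong s≗ (λ _ → refl)) first-remove

  module Below {p q : ℕ} = Transport (_≟ᵥ_ {p} {q}) (_≟ᵥ_ {suc p} {q}) below below-does (λ d s → withFirst (d ∘ first {p}) s)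
    withFirst-self (λ d s≗ → withFirst-cong (λ _ → refl) s≗) below-remove

  none-true : ∀ {q} (s : Vec Bool q) b → lookup s b ≡ true → none s ≡ 0
  none-true (true ∷ s) b eq = refl
  none-true (false ∷ s) (suc b) eq = none-true s b eq

  none-false : ∀ {q} (s : Vec Bool q) → (∀ b → lookup s b ≡ false) → none s ≡ 1
  none-false [] eq = refl
  none-false (true ∷ s) eq with () ← eq zero
  none-false (false ∷ s) eq = none-false s (eq ∘ suc)

  search : ∀ {q} (s : Fin q → Bool) → (∀ b → s b ≡ false) ⊎ (∃ λ b → s b ≡ true)
  search {zero} s = inj₁ λ ()
  search {suc q} s with s zero in eq | search (s ∘ suc)
  ... | true  | _ = inj₂ (zero , eq)
  ... | false | inj₁ f = inj₁ λ { zero → eq ; (suc b) → f b }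
  ... | false | inj₂ (b , t) = inj₂ (suc b , t)

  finished-suc : ∀ {p q} (d : Vertex (suc p) q → Bool) → finished d ≡ none (tabulate (d ∘ first)) * finished (d ∘ below)
  finished-suc {p} {q} d with search (d ∘ first)
  ... | inj₂ (b , t) = trans (finished-0 d (first b) t) (sym (cong (_* finished (d ∘ below)) (none-true (tabulate (d ∘ first)) b (trans (Vec.lookup∘tabulate (d ∘ first) b) t))))
  ... | inj₁ f = trans lower (sym (trans (cong (_* finished (d ∘ below)) (none-false (tabulate (d ∘ first)) (λ b → trans (Vec.lookup∘tabulate (d ∘ first) b) (f b)))) (ℕ.*-identityˡ _)))
    where
    lower : finished d ≡ finished (d ∘ below)
    lower with covers? (d ∘ below) []
    ... | yes c = finished-1 d λ { (zero , b) → f b ; (suc a , b) → bit-false (sym (All.lookup c (∈-vertices (a , b)))) }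
      where
      bit-false : ∀ {b} → bit b ≡ 0 → b ≡ false
      bit-false {false} _ = refl
    ... | no ¬c with covers? d []
    ...   | no _ = refl
    ...   | yes c = ⊥-elim (¬c (All.tabulate λ {v} _ → All.lookup c (∈-vertices (below v))))

  mem : ∀ {q} → Fin q → List (Fin q) → Bool
  mem c [] = false
  mem c (b ∷ bs) = does (c Fin.≟ b) ∨ mem c bs

  mem-∈ : ∀ {q} {c : Fin q} {bs} → c ∈ bs → mem c bs ≡ true
  mem-∈ {c = c} (here refl) rewrite dec-true (c Fin.≟ c) refl = refl
  mem-∈ {c = c} {b ∷ bs} (there c∈) rewrite mem-∈ c∈ = Bool.∨-zeroʳ (does (c Fin.≟ b))

  mem-∉ : ∀ {q} {c : Fin q} {bs} → All (λ b → c ≢ b) bs → mem c bs ≡ false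
  mem-∉ [] = refl
  mem-∉ {c = c} {b ∷ bs} (c≢b ∷ c∉) rewrite dec-false (c Fin.≟ b) c≢b = mem-∉ c∉

  module Ladder {p q : ℕ} (ω : Grid.Edge {suc (suc p)} {q} → ℕ) (A : Grid.State {suc (suc p)} {q} → ℕ) (A-ext : Grid.Extensional A)
    (A-zero : ∀ d b → d (zero , b) ≡ true → A d ≡ 0) where
    open Grid {suc (suc p)} {q}

    -- The state after the forced vertical dominoes in the columns `bs`: where the first-row cell
    -- was open, both cells of the column get closed.
    clear : List (Fin q) → State → State
    clear bs d (zero , c) = d (zero , c) ∧ not (mem c bs ∧ d (zero , c))
    clear bs d (suc zero , c) = d (suc zero , c) ∧ not (mem c bs ∧ d (zero , c))
    clear bs d (suc (suc a) , c) = d (suc (suc a) , c)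

    factor : State → Fin q → ℕ
    factor d b = if d (zero , b) then ω (ladder b) else 1

    clear-[] : ∀ d → clear [] d ≗ d
    clear-[] d (zero , c) = Bool.∧-identityʳ _
    clear-[] d (suc zero , c) = Bool.∧-identityʳ _
    clear-[] d (suc (suc a) , c) = refl

    clear-remove : ∀ b bs d → d (zero , b) ≡ true → clear bs (remove (ladder b) d) ≗ clear (b ∷ bs) d
    clear-remove b bs d db (zero , c) = bits (does (c Fin.≟ b)) (mem c bs) (d (zero , c))
      where
      bits : ∀ e m x → (x ∧ (not e ∧ true)) ∧ not (m ∧ (x ∧ (not e ∧ true))) ≡ x ∧ not ((e ∨ m) ∧ x)
      bits true m true = refl
      bits false true true = refl
      bits false false true = refl
      bits e m false = refl
    clear-remove b bs d db (suc zero , c) = bits (does (c Fin.≟ b)) (mem c bs) (d (zero , c)) (d (suc zero , c)) c=b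
      where
      c=b : does (c Fin.≟ b) ≡ true → d (zero , c) ≡ true
      c=b eq with yes refl ← c Fin.≟ b = db
      bits : ∀ e m x y → (e ≡ true → x ≡ true) → (y ∧ not e) ∧ not (m ∧ (x ∧ (not e ∧ true))) ≡ y ∧ not ((e ∨ m) ∧ x)
      bits true m x false h = refl
      bits true m x true h rewrite h refl = refl
      bits false m x y h rewrite Bool.∧-identityʳ y | Bool.∧-identityʳ x = refl
    clear-remove b bs d db (suc (suc a) , c) = Bool.∧-identityʳ _

    clear-skip : ∀ b bs d → d (zero , b) ≡ false → clear bs d ≗ clear (b ∷ bs) d
    clear-skip b bs d db = λ where
        (zero , c) → bits (does (c Fin.≟ b)) (mem c bs) (d (zero , c)) (d (zero , c)) (c=b c)
        (suc zero , c) → bits (does (c Fin.≟ b)) (mem c bs) (d (zero , c)) (d (suc zero , c)) (c=b c)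
        (suc (suc a) , c) → refl
      where
      c=b : ∀ c → does (c Fin.≟ b) ≡ true → d (zero , c) ≡ false
      c=b c eq with yes refl ← c Fin.≟ b = db
      bits : ∀ e m x y → (e ≡ true → x ≡ false) → y ∧ not (m ∧ x) ≡ y ∧ not ((e ∨ m) ∧ x)
      bits false m x y h = refl
      bits true m x y h rewrite h refl | Bool.∧-zeroʳ m = refl

    -- By `A-zero` nothing after the vertical edges can cover the first row. Hence an open first-row
    -- cell forces its vertical domino and a closed one forbids it, and the sum over sets of
    -- vertical edges collapses to one term. The last hypothesis keeps the second-row cells open in
    -- the columns still to be treated.
    steps-ladder : ∀ bs → Unique bs → ∀ d → (∀ b → d (suc zero , b) ≡ true ⊎ mem b bs ≡ false) →
      steps ω (map ladder bs) A d ≡ product (map (factor d) bs) * A (clear bs d)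
    steps-ladder [] _ d _ = sym (trans (ℕ.*-identityˡ _) (A-ext (clear-[] d)))
    steps-ladder (b ∷ bs) (b∉ ∷ u) d d1 = go (d (zero , b)) refl
      where
      open ≡-Reasoning
      later : ∀ c → d (suc zero , c) ≡ true ⊎ mem c bs ≡ false
      later c with d1 c
      ... | inj₁ t = inj₁ t
      ... | inj₂ f with does (c Fin.≟ b)
      ...   | false = inj₂ f
      d1b : d (suc zero , b) ≡ true
      d1b with d1 b
      ... | inj₁ t = t
      ... | inj₂ f rewrite dec-true (b Fin.≟ b) refl with () ← f
      go : ∀ x → d (zero , b) ≡ x → steps ω (map ladder (b ∷ bs)) A d ≡ product (map (factor d) (b ∷ bs)) * A (clear (b ∷ bs) d)
      go false db rewrite db = trans (steps-ladder bs u d later)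
        (cong₂ _*_ (sym (ℕ.*-identityˡ (product (map (factor d) bs)))) (A-ext (clear-skip b bs d db)))
      go true db rewrite db | d1b = begin
        ω (ladder b) * steps ω (map ladder bs) A d⁻ + steps ω (map ladder bs) A d
          ≡⟨ cong₂ (λ x y → ω (ladder b) * x + y) (steps-ladder bs u d⁻ later⁻) (trans (steps-ladder bs u d later) vanish) ⟩
        ω (ladder b) * (product (map (factor d⁻) bs) * A (clear bs d⁻)) + 0
          ≡⟨ trans (ℕ.+-identityʳ _) (sym (ℕ.*-assoc (ω (ladder b)) _ _)) ⟩
        ω (ladder b) * product (map (factor d⁻) bs) * A (clear bs d⁻)
          ≡⟨ cong₂ (λ x y → ω (ladder b) * product x * y) (List.map-cong-local (All.map same b∉)) (A-ext (clear-remove b bs d db)) ⟩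
        ω (ladder b) * product (map (factor d) bs) * A (clear (b ∷ bs) d) ∎
        where
        d⁻ = remove (ladder b) d
        -- Leaving out the edge keeps the first-row cell open for good, since the later vertical
        -- edges lie in other columns.
        vanish : product (map (factor d) bs) * A (clear bs d) ≡ 0
        vanish = trans (cong (product (map (factor d) bs) *_) (A-zero (clear bs d) b kept)) (ℕ.*-zeroʳ (product (map (factor d) bs)))
          where
          kept : d (zero , b) ∧ not (mem b bs ∧ d (zero , b)) ≡ true
          kept rewrite mem-∉ b∉ | db = refl
        same : ∀ {c} → b ≢ c → factor d⁻ c ≡ factor d c
        same {c} b≢c rewrite dec-false (c Fin.≟ b) (b≢c ∘ sym) | Bool.∧-identityʳ (d (zero , c)) = refl
        later⁻ : ∀ c → d⁻ (suc zero , c) ≡ true ⊎ mem c bs ≡ false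
        later⁻ c with later c | c Fin.≟ b
        ... | inj₂ f | _ = inj₂ f
        ... | inj₁ t | yes refl = inj₂ (mem-∉ b∉)
        ... | inj₁ t | no _ rewrite t = inj₁ refl

  product-vweight : ∀ {q} (v : ℕ → ℕ) (s : Fin q → Bool) → product (map (λ b → if s b then v (toℕ b) else 1) (allFin q)) ≡ vweight v (tabulate s)
  product-vweight {zero} v s = refl
  product-vweight {suc q} v s = trans (cong (product ∘ map f) (allFin-suc q))
    (cong (f zero *_) (trans (cong product (sym (List.map-∘ {g = f} {suc} (allFin q)))) (product-vweight (v ∘ suc) (s ∘ suc))))
    where
    f : Fin (suc q) → ℕ
    f b = if s b then v (toℕ b) else 1

  tilings : ∀ p {q} → (ℕ → ℕ → ℕ → ℕ → ℕ) → Vec Bool q → ℕ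
  tilings p {q} w s = Grid.steps (gridWeight w) (edges (suc p) q) finished (withFirst (lookup s) (λ _ → true))

  shift : (ℕ → ℕ → ℕ → ℕ → ℕ) → ℕ → ℕ → ℕ → ℕ → ℕ
  shift w a b a' b' = w (suc a) b (suc a') b'

  horizontal vertical : (ℕ → ℕ → ℕ → ℕ → ℕ) → ℕ → ℕ → ℕ
  horizontal w a b = w a b a (suc b)
  vertical w a b = w a b (suc a) b

  none-finished : ∀ {q} (s : Vec Bool q) (d : Vertex 0 q → Bool) → finished (withFirst (lookup s) d) ≡ none s
  none-finished {q} s d = trans (finished-suc (withFirst (lookup s) d))
    (trans (cong₂ _*_ (cong none (Vec.tabulate∘lookup s)) (finished-1 d λ ())) (ℕ.*-identityʳ _))

  tilings-zero : ∀ {q} w (s : Vec Bool q) → tilings 0 w s ≡ transfer 0 (horizontal w) (vertical w) s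
  tilings-zero {q} w s = begin
    Grid.steps (gridWeight w) (edges 1 q) finished d
      ≡⟨ cong (λ es → Grid.steps (gridWeight w) es finished d) (edges-one q) ⟩
    Grid.steps (gridWeight w) (map (map² first) (pathEdges q)) finished d
      ≡⟨ First.steps-transport (gridWeight w) (pathEdges q) finished-ext d ⟩
    Path.steps (pathWeight w₀) (pathEdges q) (λ t → finished (withFirst t (d ∘ below))) (lookup s)
      ≡⟨ path-hops q w₀ (λ t≗ → finished-ext (withFirst-cong t≗ (λ _ → refl))) (lookup s) ⟩
    hops (horizontal w 0) (λ t → finished (withFirst (lookup t) (d ∘ below))) (tabulate (lookup s))
      ≡⟨ cong (hops (horizontal w 0) _) (Vec.tabulate∘lookup s) ⟩
    hops (horizontal w 0) (λ t → finished (withFirst (lookup t) (d ∘ below))) s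
      ≡⟨ hops-cong (horizontal w 0) (λ t → none-finished t (d ∘ below)) s ⟩
    hops (horizontal w 0) none s ∎
    where
    open ≡-Reasoning
    d : Vertex 1 q → Bool
    d = withFirst (lookup s) (λ _ → true)
    w₀ : ℕ → ℕ → ℕ
    w₀ b b' = w 0 b 0 b'

  module _ {p q : ℕ} (w : ℕ → ℕ → ℕ → ℕ → ℕ) where
    private
      es = edges (suc p) q
      ω : Grid.Edge {suc (suc p)} {q} → ℕ
      ω = gridWeight w
      remaining : Grid.State {suc (suc p)} {q} → ℕ
      remaining = Grid.steps ω (map (map² below) es) finished

    remaining-ext : Grid.Extensional remaining
    remaining-ext = Grid.steps-ext ω (map (map² below) es) finished-ext

    remaining≡ : ∀ d → remaining d ≡ none (tabulate (d ∘ first)) * Grid.steps (gridWeight (shift w)) es finished (d ∘ below)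
    remaining≡ d = begin
      Grid.steps ω (map (map² below) es) finished d
        ≡⟨ Below.steps-transport ω es finished-ext d ⟩
      Grid.steps (gridWeight (shift w)) es (λ s → finished (withFirst (d ∘ first) s)) (d ∘ below)
        ≡⟨ Grid.steps-cong {ω = gridWeight (shift w)} {gridWeight (shift w)} es (λ _ → refl) (λ s → finished-suc (withFirst (d ∘ first) s)) (d ∘ below) ⟩
      Grid.steps (gridWeight (shift w)) es (λ s → none (tabulate (d ∘ first)) * finished s) (d ∘ below)
        ≡⟨ Grid.steps-scale (gridWeight (shift w)) es (none (tabulate (d ∘ first))) finished (d ∘ below) ⟩
      none (tabulate (d ∘ first)) * Grid.steps (gridWeight (shift w)) es finished (d ∘ below) ∎
      where open ≡-Reasoning

    remaining-zero : ∀ d b → d (zero , b) ≡ true → remaining d ≡ 0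
    remaining-zero d b db = trans (remaining≡ d) (cong (_* Grid.steps (gridWeight (shift w)) es finished (d ∘ below))
      (none-true (tabulate (d ∘ first)) b (trans (Vec.lookup∘tabulate (d ∘ first) b) db)))

    open Ladder ω remaining remaining-ext remaining-zero

    -- All cells below the first row were open; the vertical dominoes close exactly the second-row
    -- cells under open first-row cells, which leaves the complement.
    verticals : ∀ (s : Vec Bool q) → Grid.steps ω (map ladder (allFin q)) remaining (withFirst (lookup s) (λ _ → true)) ≡
      vweight (vertical w 0) s * tilings p (shift w) (Vec.map not s)
    verticals s = begin
      Grid.steps ω (map ladder (allFin q)) remaining d
        ≡⟨ steps-ladder (allFin q) (allFin⁺ q) d (λ _ → inj₁ refl) ⟩
      product (map (factor d) (allFin q)) * remaining d'
        ≡⟨ cong₂ _*_ (trans (product-vweight (vertical w 0) (lookup s)) (cong (vweight (vertical w 0)) (Vec.tabulate∘lookup s))) (remaining≡ d') ⟩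
      vweight (vertical w 0) s * (none (tabulate (d' ∘ first)) * Grid.steps (gridWeight (shift w)) es finished (d' ∘ below))
        ≡⟨ cong (vweight (vertical w 0) s *_) (trans (cong₂ _*_ emptied (Grid.steps-ext (gridWeight (shift w)) es finished-ext flipped)) (ℕ.*-identityˡ _)) ⟩
      vweight (vertical w 0) s * tilings p (shift w) (Vec.map not s) ∎
      where
      open ≡-Reasoning
      d d' : Vertex (suc (suc p)) q → Bool
      d = withFirst (lookup s) (λ _ → true)
      d' = clear (allFin q) d
      emptied : none (tabulate (d' ∘ first)) ≡ 1
      emptied = none-false (tabulate (d' ∘ first)) λ b → trans (Vec.lookup∘tabulate (d' ∘ first) b)
        (trans (cong (λ m → lookup s b ∧ not (m ∧ lookup s b)) (mem-∈ (∈-allFin b))) (Bool.∧-inverseʳ (lookup s b)))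
      flipped : d' ∘ below ≗ withFirst (lookup (Vec.map not s)) (λ _ → true)
      flipped (zero , b) = trans (cong (λ m → not (m ∧ lookup s b)) (mem-∈ (∈-allFin b))) (sym (Vec.lookup-map b not s))
      flipped (suc a , b) = refl

    tilings-suc : ∀ s → tilings (suc p) w s ≡ hops (horizontal w 0) (λ t → vweight (vertical w 0) t * tilings p (shift w) (Vec.map not t)) s
    tilings-suc s = begin
      Grid.steps ω (edges (suc (suc p)) q) finished d
        ≡⟨ Grid.steps-↭ ω finished-ext (edges-suc p q) d ⟩
      Grid.steps ω (map (map² first) (pathEdges q) ++ map ladder (allFin q) ++ map (map² below) es) finished d
        ≡⟨ cong (λ f → f d) (trans (Grid.steps-++ ω (map (map² first) (pathEdges q)) _ finished)
             (cong (Grid.steps ω (map (map² first) (pathEdges q))) (Grid.steps-++ ω (map ladder (allFin q)) _ finished))) ⟩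
      Grid.steps ω (map (map² first) (pathEdges q)) below-row d
        ≡⟨ First.steps-transport ω (pathEdges q) below-row-ext d ⟩
      Path.steps (pathWeight w₀) (pathEdges q) (λ t → below-row (withFirst t (λ _ → true))) (lookup s)
        ≡⟨ path-hops q w₀ (λ t≗ → below-row-ext (withFirst-cong t≗ (λ _ → refl))) (lookup s) ⟩
      hops (horizontal w 0) (λ t → below-row (withFirst (lookup t) (λ _ → true))) (tabulate (lookup s))
        ≡⟨ cong (hops (horizontal w 0) _) (Vec.tabulate∘lookup s) ⟩
      hops (horizontal w 0) (λ t → below-row (withFirst (lookup t) (λ _ → true))) s
        ≡⟨ hops-cong (horizontal w 0) verticals s ⟩
      hops (horizontal w 0) (λ t → vweight (vertical w 0) t * tilings p (shift w) (Vec.map not t)) s ∎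
      where
      open ≡-Reasoning
      d : Vertex (suc (suc p)) q → Bool
      d = withFirst (lookup s) (λ _ → true)
      w₀ : ℕ → ℕ → ℕ
      w₀ b b' = w 0 b 0 b'
      below-row : Grid.State {suc (suc p)} {q} → ℕ
      below-row = Grid.steps ω (map ladder (allFin q)) remaining
      below-row-ext : Grid.Extensional below-row
      below-row-ext = Grid.steps-ext ω (map ladder (allFin q)) remaining-ext

  tilings-transfer : ∀ p {q} w (s : Vec Bool q) → tilings p w s ≡ transfer p (horizontal w) (vertical w) s
  tilings-transfer zero w s = tilings-zero w s
  tilings-transfer (suc p) w s = trans (tilings-suc {p} w s)
    (hops-cong (horizontal w 0) (λ t → cong (vweight (vertical w 0) t *_) (tilings-transfer p (shift w) (Vec.map not t))) s)

  weighted-tilings : ∀ p q w → sum (map (weight {suc p} {q} (gridWeight w)) (perfectMatchings (suc p) q)) ≡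
    transfer p (horizontal w) (vertical w) (replicate q true)
  weighted-tilings p q w = begin
    coverings {suc p} {q} (gridWeight w) (sublists (edges (suc p) q)) (λ _ → true)
      ≡⟨ coverings-steps (gridWeight w) (edges (suc p) q) (λ _ → true) ⟩
    Grid.steps (gridWeight w) (edges (suc p) q) finished (λ _ → true)
      ≡⟨ Grid.steps-ext (gridWeight w) (edges (suc p) q) finished-ext all-true ⟩
    tilings p w (replicate q true)
      ≡⟨ tilings-transfer p w (replicate q true) ⟩
    transfer p (horizontal w) (vertical w) (replicate q true) ∎
    where
    open ≡-Reasoning
    all-true : (λ _ → true) ≗ withFirst {p} {q} (lookup (replicate q true)) (λ _ → true)
    all-true (zero , b) = sym (Vec.lookup-replicate b true)
    all-true (suc a , b) = refl

  -- Reduces by two constructors at a time, so that rows and columns can be matched in pairs.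
  double : ℕ → ℕ
  double zero = 0
  double (suc n) = suc (suc (double n))

  -- 0-based: endWeight n is 2 at 2n and 1 elsewhere, columnWeight is 2 at odd numbers.
  endWeight : ℕ → ℕ → ℕ
  endWeight zero zero = 2
  endWeight zero (suc c) = 1
  endWeight (suc n) zero = 1
  endWeight (suc n) (suc zero) = 1
  endWeight (suc n) (suc (suc c)) = endWeight n c

  columnWeight : ℕ → ℕ
  columnWeight zero = 1
  columnWeight (suc zero) = 2
  columnWeight (suc (suc c)) = columnWeight c

  -- Rows come in pairs: counted from 0, even rows have unit horizontal weights, odd rows a 2 on the
  -- last edge, and of the vertical edges only those between the last two rows carry `columnWeight`,
  -- which is prescribed inside the board.
  Checkerboard : ℕ → ℕ → (h v : ℕ → ℕ → ℕ) → Set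
  Checkerboard n zero h v = (∀ c → h 0 c ≡ 1) × (∀ c → h 1 c ≡ endWeight n c) × (∀ c → c < double (suc n) → v 0 c ≡ columnWeight c)
  Checkerboard n (suc m) h v = (∀ c → h 0 c ≡ 1) × (∀ c → h 1 c ≡ endWeight n c) × (∀ c → v 0 c ≡ 1) × (∀ c → v 1 c ≡ 1) ×
    Checkerboard n m (λ r → h (suc (suc r))) (λ r → v (suc (suc r)))

-- A ring solver with integer constants

module IntegerCoefficients where

  module IntegerSolver (R : CommutativeRing 0ℓ 0ℓ) where
    open CommutativeRing R
    open import Data.Nat.Base as ℕ using (ℕ; zero; suc)
    open import Data.Integer.Base as ℤ using (ℤ; +_; -[1+_]; _⊖_; _◃_)
    import Data.Integer.Properties as ℤ
    open import Data.Maybe.Base using (Maybe; just; nothing)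
    import Data.Sign.Base as Sign
    import Relation.Binary.PropositionalEquality as ≡
    open import Relation.Nullary.Decidable.Core using (yes; no)
    open import Algebra.Properties.Semiring.Mult.TCOptimised semiring using (_×_; ×-homo-+; ×1-homo-*; 1+×)
    open import Algebra.Properties.Ring ring using (-0#≈0#; -‿involutive; -‿distribˡ-*; -‿distribʳ-*)
    open import Algebra.Properties.AbelianGroup +-abelianGroup using (⁻¹-∙-comm)
    open import Algebra.Solver.Ring.AlmostCommutativeRing using (fromCommutativeRing; _-Raw-AlmostCommutative⟶_)
    open import Relation.Binary.Reasoning.Setoid setoid

    private
      -- The optimised multiple makes `con (+ 4)` unfold to `1# + 1# + 1# + 1#`, the form in which
      -- constants are written below. Coefficients are compared in ℤ, so the solver also works where
      -- equality in the ring is undecidable.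
      ⟦_⟧ᶻ : ℤ → Carrier
      ⟦ + n ⟧ᶻ      = n × 1#
      ⟦ -[1+ n ] ⟧ᶻ = - (suc n × 1#)

      neg-homo : ∀ z → ⟦ ℤ.- z ⟧ᶻ ≈ - ⟦ z ⟧ᶻ
      neg-homo (+ zero)   = sym -0#≈0#
      neg-homo (+ suc n)  = refl
      neg-homo (-[1+ n ]) = sym (-‿involutive _)

      cancel : ∀ x y → (1# + x) + - (1# + y) ≈ x + - y
      cancel x y = begin
        (1# + x) + - (1# + y)    ≈⟨ +-cong (+-comm 1# x) (sym (⁻¹-∙-comm 1# y)) ⟩
        (x + 1#) + (- 1# + - y)  ≈⟨ +-assoc x 1# _ ⟩
        x + (1# + (- 1# + - y))  ≈⟨ +-congˡ (sym (+-assoc 1# (- 1#) (- y))) ⟩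
        x + ((1# + - 1#) + - y)  ≈⟨ +-congˡ (+-congʳ (-‿inverseʳ 1#)) ⟩
        x + (0# + - y)           ≈⟨ +-congˡ (+-identityˡ _) ⟩
        x + - y                  ∎

      ⊖-homo : ∀ m n → ⟦ m ⊖ n ⟧ᶻ ≈ m × 1# + - (n × 1#)
      ⊖-homo m zero = sym (trans (+-congˡ -0#≈0#) (+-identityʳ _))
      ⊖-homo zero (suc n) = sym (+-identityˡ _)
      ⊖-homo (suc m) (suc n) = begin
        ⟦ suc m ⊖ suc n ⟧ᶻ                 ≡⟨ ≡.cong ⟦_⟧ᶻ (ℤ.[1+m]⊖[1+n]≡m⊖n m n) ⟩
        ⟦ m ⊖ n ⟧ᶻ                         ≈⟨ ⊖-homo m n ⟩
        m × 1# + - (n × 1#)                ≈⟨ sym (cancel _ _) ⟩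
        (1# + m × 1#) + - (1# + n × 1#)    ≈⟨ sym (+-cong (1+× m 1#) (-‿cong (1+× n 1#))) ⟩
        suc m × 1# + - (suc n × 1#)        ∎

      +-homo : ∀ x y → ⟦ x ℤ.+ y ⟧ᶻ ≈ ⟦ x ⟧ᶻ + ⟦ y ⟧ᶻ
      +-homo (+ m) (+ n) = ×-homo-+ 1# m n
      +-homo (+ m) (-[1+ n ]) = ⊖-homo m (suc n)
      +-homo (-[1+ m ]) (+ n) = trans (⊖-homo n (suc m)) (+-comm _ _)
      +-homo (-[1+ m ]) (-[1+ n ]) = begin
        - (suc (suc (m ℕ.+ n)) × 1#)           ≡⟨ ≡.cong (λ k → - (suc k × 1#)) (≡.sym (ℕ.+-suc m n)) ⟩
        - ((suc m ℕ.+ suc n) × 1#)             ≈⟨ -‿cong (×-homo-+ 1# (suc m) (suc n)) ⟩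
        - (suc m × 1# + suc n × 1#)            ≈⟨ sym (⁻¹-∙-comm _ _) ⟩
        - (suc m × 1#) + - (suc n × 1#)        ∎
        where import Data.Nat.Properties as ℕ

      +◃ : ∀ n → ⟦ Sign.+ ◃ n ⟧ᶻ ≈ n × 1#
      +◃ zero = refl
      +◃ (suc n) = refl

      -◃ : ∀ n → ⟦ Sign.- ◃ n ⟧ᶻ ≈ - (n × 1#)
      -◃ zero = sym -0#≈0#
      -◃ (suc n) = refl

      *-homo : ∀ x y → ⟦ x ℤ.* y ⟧ᶻ ≈ ⟦ x ⟧ᶻ * ⟦ y ⟧ᶻ
      *-homo (+ m) (+ n) = trans (+◃ (m ℕ.* n)) (×1-homo-* m n)
      *-homo (+ m) (-[1+ n ]) = trans (-◃ (m ℕ.* suc n)) (trans (-‿cong (×1-homo-* m (suc n))) (-‿distribʳ-* _ _))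
      *-homo (-[1+ m ]) (+ n) = trans (-◃ (suc m ℕ.* n)) (trans (-‿cong (×1-homo-* (suc m) n)) (-‿distribˡ-* _ _))
      *-homo (-[1+ m ]) (-[1+ n ]) = begin
        (suc m ℕ.* suc n) × 1#               ≈⟨ ×1-homo-* (suc m) (suc n) ⟩
        (suc m × 1#) * (suc n × 1#)          ≈⟨ sym (-‿involutive _) ⟩
        - - ((suc m × 1#) * (suc n × 1#))    ≈⟨ -‿cong (-‿distribʳ-* _ _) ⟩
        - ((suc m × 1#) * - (suc n × 1#))    ≈⟨ -‿distribˡ-* _ _ ⟩
        - (suc m × 1#) * - (suc n × 1#)      ∎

      homomorphism : ℤ.+-*-rawRing -Raw-AlmostCommutative⟶ fromCommutativeRing R
      homomorphism = record
        { ⟦_⟧ = ⟦_⟧ᶻ ; +-homo = +-homo ; *-homo = *-homo ; -‿homo = neg-homo ; 0-homo = refl ; 1-homo = refl }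

      coeff≟ : ∀ a b → Maybe (⟦ a ⟧ᶻ ≈ ⟦ b ⟧ᶻ)
      coeff≟ a b with a ℤ.≟ b
      ... | yes ≡.refl = just refl
      ... | no _ = nothing

    open import Algebra.Solver.Ring ℤ.+-*-rawRing (fromCommutativeRing R) homomorphism coeff≟ public
      using (solve; _:+_; _:*_; _:-_; :-_; _:=_; con)

-- Exterior algebras and determinants over a commutative ring

module ExteriorAlgebra (R : CommutativeRing 0ℓ 0ℓ) where
  open IntegerCoefficients
  open CommutativeRing R hiding (zero)
  open IntegerSolver R
  open import Data.Bool.Base using (Bool; true; false)
  open import Data.Fin.Base using (Fin; zero; suc)
  open import Data.Integer.Base using (+_)
  open import Data.Nat.Base using (ℕ; zero; suc; s≤s; _≤_)
  import Data.Nat.Properties as ℕ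
  open import Data.Sum.Base using (_⊎_; inj₁; inj₂)
  open import Data.Vec.Base as Vec using (Vec; []; _∷_; replicate)
  open import Function.Base using (_∘_)
  open import Relation.Binary.PropositionalEquality as ≡ using (_≡_)
  import Relation.Binary.Reasoning.Setoid setoid as ≈-R
  open import Algebra.Properties.Ring ring using (-0#≈0#)

  V : ℕ → Set
  V k = Fin k → Carrier

  -- The exterior algebra of V k: the coefficient at s belongs to the wedge of the
  -- basis vectors selected by s, in increasing order.
  Λ : ℕ → Set
  Λ k = Vec Bool k → Carrier

  infix 4 _≋_ _≈Λ_

  _≋_ : ∀ {k} → V k → V k → Set
  u ≋ v = ∀ i → u i ≈ v i

  _≈Λ_ : ∀ {k} → Λ k → Λ k → Set
  f ≈Λ g = ∀ s → f s ≈ g s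

  tail : ∀ {k} → V (suc k) → V k
  tail v i = v (suc i)

  infixr 5 _▹_
  _▹_ : ∀ {k} → Carrier → V k → V (suc k)
  (a ▹ v) zero = a
  (a ▹ v) (suc i) = v i

  lin : ∀ {A : Set} → Carrier → (A → Carrier) → Carrier → (A → Carrier) → A → Carrier
  lin a f b g s = a * f s + b * g s

  -- With the first basis vector `e` split off, `v = v₀ e + v'` and `f = f₀ + e ∧ f₁`, one has
  -- `v ∧ f = v' ∧ f₀ + e ∧ (v₀ f₀ - v' ∧ f₁)`; the sign comes from moving `v'` past `e`.
  wedge : ∀ {k} → V k → Λ k → Λ k
  wedge v f [] = 0#
  wedge v f (false ∷ s) = wedge (tail v) (f ∘ (false ∷_)) s
  wedge v f (true ∷ s) = v zero * f (false ∷ s) - wedge (tail v) (f ∘ (true ∷_)) s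

  unit : ∀ {k} → Λ k
  unit [] = 1#
  unit (false ∷ s) = unit s
  unit (true ∷ s) = 0#

  wedge-cong : ∀ {k} {u v : V k} {f g : Λ k} → u ≋ v → f ≈Λ g → wedge u f ≈Λ wedge v g
  wedge-cong u≋v f≈g [] = refl
  wedge-cong u≋v f≈g (false ∷ s) = wedge-cong (u≋v ∘ suc) (f≈g ∘ (false ∷_)) s
  wedge-cong u≋v f≈g (true ∷ s) =
    +-cong (*-cong (u≋v zero) (f≈g (false ∷ s))) (-‿cong (wedge-cong (u≋v ∘ suc) (f≈g ∘ (true ∷_)) s))

  wedge-linʳ : ∀ {k} (v : V k) a f b g → wedge v (lin a f b g) ≈Λ lin a (wedge v f) b (wedge v g)
  wedge-linʳ v a f b g [] = solve 2 (λ a b → con (+ 0) := a :* con (+ 0) :+ b :* con (+ 0)) refl a b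
  wedge-linʳ v a f b g (false ∷ s) = wedge-linʳ (tail v) a _ b _ s
  wedge-linʳ v a f b g (true ∷ s) = trans (+-congˡ (-‿cong (wedge-linʳ (tail v) a _ b _ s)))
    (solve 7 (λ v a f b g x y → v :* (a :* f :+ b :* g) :- (a :* x :+ b :* y) := a :* (v :* f :- x) :+ b :* (v :* g :- y))
      refl (v zero) a (f (false ∷ s)) b (g (false ∷ s)) _ _)

  wedge-linˡ : ∀ {k} a (u : V k) b v f → wedge (lin a u b v) f ≈Λ lin a (wedge u f) b (wedge v f)
  wedge-linˡ a u b v f [] = solve 2 (λ a b → con (+ 0) := a :* con (+ 0) :+ b :* con (+ 0)) refl a b
  wedge-linˡ a u b v f (false ∷ s) = wedge-linˡ a (tail u) b (tail v) _ s
  wedge-linˡ a u b v f (true ∷ s) = trans (+-congˡ (-‿cong (wedge-linˡ a (tail u) b (tail v) _ s)))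
    (solve 7 (λ f a u b v x y → (a :* u :+ b :* v) :* f :- (a :* x :+ b :* y) := a :* (u :* f :- x) :+ b :* (v :* f :- y))
      refl (f (false ∷ s)) a (u zero) b (v zero) _ _)

  wedge-zeroʳ : ∀ {k} (v : V k) {f} → (∀ s → f s ≈ 0#) → ∀ s → wedge v f s ≈ 0#
  wedge-zeroʳ v f≈0 [] = refl
  wedge-zeroʳ v f≈0 (false ∷ s) = wedge-zeroʳ (tail v) (f≈0 ∘ (false ∷_)) s
  wedge-zeroʳ v f≈0 (true ∷ s) = trans (+-cong (*-congˡ (f≈0 (false ∷ s))) (-‿cong (wedge-zeroʳ (tail v) (f≈0 ∘ (true ∷_)) s)))
    (solve 1 (λ v → v :* con (+ 0) :- con (+ 0) := con (+ 0)) refl (v zero))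

  wedge-zeroˡ : ∀ {k} {v : V k} f → (∀ i → v i ≈ 0#) → ∀ s → wedge v f s ≈ 0#
  wedge-zeroˡ f v≈0 [] = refl
  wedge-zeroˡ f v≈0 (false ∷ s) = wedge-zeroˡ _ (v≈0 ∘ suc) s
  wedge-zeroˡ f v≈0 (true ∷ s) = trans (+-cong (*-congʳ (v≈0 zero)) (-‿cong (wedge-zeroˡ _ (v≈0 ∘ suc) s)))
    (solve 1 (λ v → con (+ 0) :* v :- con (+ 0) := con (+ 0)) refl (f (false ∷ s)))

  wedge-expand : ∀ {k} (w : V k) a g h s → wedge w (λ s → a * g s - h s) s ≈ a * wedge w g s - wedge w h s
  wedge-expand w a g h s = trans (wedge-cong (λ _ → refl) (λ s → solve 2 (λ x y → x :- y := x :+ (:- con (+ 1)) :* y) refl (a * g s) (h s)) s)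
      (trans (wedge-linʳ w a g (- 1#) h s) (solve 2 (λ x y → x :+ (:- con (+ 1)) :* y := x :- y) refl _ _))

  wedge-anti : ∀ {k} (u v : V k) f s → wedge u (wedge v f) s ≈ - wedge v (wedge u f) s
  wedge-anti u v f [] = sym -0#≈0#
  wedge-anti u v f (false ∷ s) = wedge-anti (tail u) (tail v) _ s
  wedge-anti u v f (true ∷ s) = begin
    u₀ * wedge v' f₀ s - wedge u' (λ s → v₀ * f₀ s - wedge v' f₁ s) s
      ≈⟨ +-congˡ (-‿cong (wedge-expand u' v₀ f₀ (wedge v' f₁) s)) ⟩
    u₀ * wedge v' f₀ s - (v₀ * wedge u' f₀ s - wedge u' (wedge v' f₁) s)
      ≈⟨ +-congˡ (-‿cong (+-congˡ (-‿cong (wedge-anti u' v' f₁ s)))) ⟩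
    u₀ * wedge v' f₀ s - (v₀ * wedge u' f₀ s - - wedge v' (wedge u' f₁) s)
      ≈⟨ solve 5 (λ u v x y z → u :* x :- (v :* y :- :- z) := :- (v :* y :- (u :* x :- z))) refl u₀ v₀ _ _ _ ⟩
    - (v₀ * wedge u' f₀ s - (u₀ * wedge v' f₀ s - wedge v' (wedge u' f₁) s))
      ≈⟨ -‿cong (+-congˡ (-‿cong (wedge-expand v' u₀ f₀ (wedge u' f₁) s))) ⟨
    - (v₀ * wedge u' f₀ s - wedge v' (λ s → u₀ * f₀ s - wedge u' f₁ s) s) ∎
    where
    open ≈-R
    u₀ = u zero
    v₀ = v zero
    u' = tail u
    v' = tail v
    f₀ = f ∘ (false ∷_)
    f₁ = f ∘ (true ∷_)

  -- Proved on its own: antisymmetry only shows that twice the product is 0, and 2 may be a zero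
  -- divisor.
  wedge-square : ∀ {k} (v : V k) f s → wedge v (wedge v f) s ≈ 0#
  wedge-square v f [] = refl
  wedge-square v f (false ∷ s) = wedge-square (tail v) _ s
  wedge-square v f (true ∷ s) = begin
    v zero * wedge v' f₀ s - wedge v' (λ s → v zero * f₀ s - wedge v' f₁ s) s
      ≈⟨ +-congˡ (-‿cong (trans (wedge-expand v' (v zero) f₀ (wedge v' f₁) s) (+-congˡ (-‿cong (wedge-square v' f₁ s))))) ⟩
    v zero * wedge v' f₀ s - (v zero * wedge v' f₀ s - 0#)
      ≈⟨ solve 1 (λ x → x :- (x :- con (+ 0)) := con (+ 0)) refl _ ⟩
    0# ∎
    where
    open ≈-R
    v' = tail v
    f₀ = f ∘ (false ∷_)
    f₁ = f ∘ (true ∷_)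

  wedges : ∀ {k l} → Vec (V k) l → Λ k
  wedges [] = unit
  wedges (v ∷ vs) = wedge v (wedges vs)

  comb : ∀ {k l} → Vec (V k) l → V l → V k
  comb [] a i = 0#
  comb (v ∷ vs) a i = a zero * v i + comb vs (tail a) i

  basis : ∀ {k} → Vec (V k) k
  basis {zero} = []
  basis {suc k} = (1# ▹ λ _ → 0#) ∷ Vec.map (0# ▹_) basis

  top : ∀ {k} → Vec Bool k
  top = replicate _ true

  det : ∀ {k} → (V k → V k) → Carrier
  det L = wedges (Vec.map L basis) top

  -- The algebra homomorphism Λ l → Λ k sending the i-th basis vector to the i-th
  -- vector of the family.
  ext : ∀ {k l} → Vec (V k) l → Λ l → Λ k
  ext [] f s = f [] * unit s
  ext (v ∷ vs) f s = ext vs (f ∘ (false ∷_)) s + wedge v (ext vs (f ∘ (true ∷_))) s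

  ext-cong : ∀ {k l} (vs : Vec (V k) l) {f g} → f ≈Λ g → ext vs f ≈Λ ext vs g
  ext-cong [] f≈g s = *-congʳ (f≈g [])
  ext-cong (v ∷ vs) f≈g s = +-cong (ext-cong vs (f≈g ∘ (false ∷_)) s) (wedge-cong (λ _ → refl) (ext-cong vs (f≈g ∘ (true ∷_))) s)

  ext-lin : ∀ {k l} (vs : Vec (V k) l) a f b g → ext vs (lin a f b g) ≈Λ lin a (ext vs f) b (ext vs g)
  ext-lin [] a f b g s = solve 5 (λ a f b g u → (a :* f :+ b :* g) :* u := a :* (f :* u) :+ b :* (g :* u)) refl a (f []) b (g []) (unit s)
  ext-lin (v ∷ vs) a f b g s = trans
    (+-cong (ext-lin vs a _ b _ s) (trans (wedge-cong (λ _ → refl) (ext-lin vs a _ b _) s) (wedge-linʳ v a _ b _ s)))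
    (solve 6 (λ a b x y z w → (a :* x :+ b :* y) :+ (a :* z :+ b :* w) := a :* (x :+ z) :+ b :* (y :+ w)) refl a b _ _ _ _)

  ext-unit : ∀ {k l} (vs : Vec (V k) l) → ext vs unit ≈Λ unit
  ext-unit [] s = *-identityˡ _
  ext-unit (v ∷ vs) s = trans (+-cong (ext-unit vs s) (wedge-zeroʳ v (ext-zero vs) s)) (+-identityʳ _)
    where
    ext-zero : ∀ {k l} (vs : Vec (V k) l) s → ext vs (λ _ → 0#) s ≈ 0#
    ext-zero [] s = zeroˡ _
    ext-zero (v ∷ vs) s = trans (+-cong (ext-zero vs s) (wedge-zeroʳ v (ext-zero vs) s)) (+-identityʳ _)

  -- The vector `u` is `u₀` times the first basis vector plus `u'`. The image of `u'` is moved past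
  -- `v` by antisymmetry; the term containing `v` twice, which is inserted to collect the sum, is 0
  -- by `wedge-square`.
  ext-wedge : ∀ {k l} (vs : Vec (V k) l) u f → ext vs (wedge u f) ≈Λ wedge (comb vs u) (ext vs f)
  ext-wedge [] u f s = trans (zeroˡ _) (sym (wedge-zeroˡ _ (λ _ → refl) s))
  ext-wedge (v ∷ vs) u f s = begin
    X (wedge u' f₀) s + wedge v (X (λ s → u₀ * f₀ s - wedge u' f₁ s)) s
      ≈⟨ +-cong (ext-wedge vs u' f₀ s) (wedge-cong (λ _ → refl) (λ s → trans (expand u₀ f₀ (wedge u' f₁) s) (+-congˡ (-‿cong (ext-wedge vs u' f₁ s)))) s) ⟩
    wedge w (X f₀) s + wedge v (λ s → u₀ * X f₀ s - wedge w (X f₁) s) s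
      ≈⟨ +-congˡ (trans (wedge-expand v u₀ (X f₀) _ s) (+-congˡ (-‿cong (wedge-anti v w (X f₁) s)))) ⟩
    wedge w (X f₀) s + (u₀ * wedge v (X f₀) s - - wedge w (wedge v (X f₁)) s)
      ≈⟨ solve 5 (λ u a b c d → a :+ (u :* b :- :- c) := con (+ 1) :* (u :* b :+ con (+ 1) :* a) :+ con (+ 1) :* (u :* con (+ 0) :+ con (+ 1) :* c)) refl
           u₀ _ _ _ 1# ⟩
    1# * (u₀ * wedge v (X f₀) s + 1# * wedge w (X f₀) s) + 1# * (u₀ * 0# + 1# * wedge w (wedge v (X f₁)) s)
      ≈⟨ +-cong (*-congˡ (wedge-linˡ u₀ v 1# w (X f₀) s))
           (*-congˡ (trans (wedge-linˡ u₀ v 1# w (wedge v (X f₁)) s) (+-congʳ (*-congˡ (wedge-square v (X f₁) s))))) ⟨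
    1# * wedge uvw (X f₀) s + 1# * wedge uvw (wedge v (X f₁)) s
      ≈⟨ wedge-linʳ uvw 1# (X f₀) 1# (wedge v (X f₁)) s ⟨
    wedge uvw (lin 1# (X f₀) 1# (wedge v (X f₁))) s
      ≈⟨ wedge-cong (λ i → +-congˡ (*-identityˡ _)) (λ s → +-cong (*-identityˡ _) (*-identityˡ _)) s ⟩
    wedge (comb (v ∷ vs) u) (ext (v ∷ vs) f) s ∎
    where
    open ≈-R
    X = ext vs
    u₀ = u zero
    u' = tail u
    f₀ = f ∘ (false ∷_)
    f₁ = f ∘ (true ∷_)
    w = comb vs u'
    uvw = lin u₀ v 1# w
    expand : ∀ a g h s → X (λ s → a * g s - h s) s ≈ a * X g s - X h s
    expand a g h s = trans (ext-cong vs (λ s → solve 2 (λ x y → x :- y := x :+ (:- con (+ 1)) :* y) refl (a * g s) (h s)) s)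
      (trans (ext-lin vs a g (- 1#) h s) (solve 2 (λ x y → x :+ (:- con (+ 1)) :* y := x :- y) refl _ _))

  record Linear {k l} (L : V k → V l) : Set where
    field
      cong  : ∀ {u v} → u ≋ v → L u ≋ L v
      linear : ∀ a u b v → L (lin a u b v) ≋ lin a (L u) b (L v)

    zeros : ∀ {v} → (∀ i → v i ≈ 0#) → ∀ i → L v i ≈ 0#
    zeros {v} v≈0 i = trans (cong (λ i → trans (v≈0 i) (solve 1 (λ x → con (+ 0) := con (+ 0) :* x :+ con (+ 0) :* x) refl (v i))) i)
      (trans (linear 0# v 0# v i) (solve 1 (λ x → con (+ 0) :* x :+ con (+ 0) :* x := con (+ 0)) refl (L v i)))

  module _ {k l : ℕ} {L : V k → V l} (L-linear : Linear L) where
    open Linear L-linear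

    comb-map : ∀ {j} (vs : Vec (V k) j) a → comb (Vec.map L vs) a ≋ L (comb vs a)
    comb-map [] a i = sym (zeros (λ _ → refl) i)
    comb-map (v ∷ vs) a i = trans (+-congˡ (comb-map vs (tail a) i)) (sym (trans
      (cong (λ _ → +-congˡ (sym (*-identityˡ _))) i)
      (trans (linear (a zero) v 1# (comb vs (tail a)) i) (+-congˡ (*-identityˡ _)))))

  comb-basis : ∀ {k} (v : V k) → comb basis v ≋ v
  comb-basis {suc k} v zero = trans (+-cong (*-identityʳ _) (shifted basis (tail v))) (+-identityʳ _)
    where
    shifted : ∀ {j} (vs : Vec (V k) j) a → comb (Vec.map (0# ▹_) vs) a zero ≈ 0#
    shifted [] a = refl
    shifted (w ∷ vs) a = trans (+-cong (zeroʳ _) (shifted vs (tail a))) (+-identityʳ _)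
  comb-basis {suc k} v (suc i) = trans (+-cong (zeroʳ _) (shifted basis (tail v))) (trans (+-identityˡ _) (comb-basis (tail v) i))
    where
    shifted : ∀ {j} (vs : Vec (V k) j) a → comb (Vec.map (0# ▹_) vs) a (suc i) ≈ comb vs a i
    shifted [] a = refl
    shifted (w ∷ vs) a = +-congˡ (shifted vs (tail a))

  comb-linear : ∀ {k l} {L : V k → V l} → Linear L → ∀ v → comb (Vec.map L basis) v ≋ L v
  comb-linear lL v i = trans (comb-map lL basis v i) (Linear.cong lL (comb-basis v) i)

  -- These properties single out the homomorphism of exterior algebras extending `h`. Operators
  -- given by direct formulas on the selections can thus be recognised without being written as
  -- `ext`.
  record Induced {k l} (h : V k → V l) (O : Λ k → Λ l) : Set where
    field
      O-cong  : ∀ {f g} → f ≈Λ g → O f ≈Λ O g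
      O-lin   : ∀ a f b g → O (lin a f b g) ≈Λ lin a (O f) b (O g)
      O-wedge : ∀ v f → O (wedge v f) ≈Λ wedge (h v) (O f)
      O-unit  : O unit ≈Λ unit

    O-wedges : ∀ {j} (vs : Vec (V k) j) → O (wedges vs) ≈Λ wedges (Vec.map h vs)
    O-wedges [] = O-unit
    O-wedges (v ∷ vs) s = trans (O-wedge v (wedges vs) s) (wedge-cong (λ _ → refl) (O-wedges vs) s)

  induced-∘ : ∀ {k l j} {h : V k → V l} {O : Λ k → Λ l} {h' : V l → V j} {O' : Λ l → Λ j} →
              Induced h' O' → Induced h O → Induced (h' ∘ h) (O' ∘ O)
  induced-∘ I' I = record
    { O-cong  = λ f≈g → I'.O-cong (I.O-cong f≈g)
    ; O-lin   = λ a f b g s → trans (I'.O-cong (I.O-lin a f b g) s) (I'.O-lin a _ b _ s)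
    ; O-wedge = λ v f s → trans (I'.O-cong (I.O-wedge v f) s) (I'.O-wedge _ _ s)
    ; O-unit  = λ s → trans (I'.O-cong I.O-unit s) (I'.O-unit s)
    }
    where
    module I' = Induced I'
    module I = Induced I

  linear⇒induced : ∀ {k l} {L : V k → V l} → Linear L → Induced L (ext (Vec.map L basis))
  linear⇒induced {L = L} lL = record
    { O-cong  = ext-cong M
    ; O-lin   = ext-lin M
    ; O-wedge = λ v f s → trans (ext-wedge M v f s) (wedge-cong (comb-linear lL v) (λ _ → refl) s)
    ; O-unit  = ext-unit M
    }
    where M = Vec.map L basis

  δ : ∀ {k} → Λ k
  δ [] = 1#
  δ (false ∷ s) = 0#
  δ (true ∷ s) = δ s

  wedges-cong : ∀ {k l j} {g h : V k → V l} → (∀ v → g v ≋ h v) → (vs : Vec (V k) j) →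
                wedges (Vec.map g vs) ≈Λ wedges (Vec.map h vs)
  wedges-cong g≋h [] s = refl
  wedges-cong g≋h (v ∷ vs) = wedge-cong (g≋h v) (wedges-cong g≋h vs)

  wedges-false : ∀ {k l} (vs : Vec (V (suc k)) l) s → wedges vs (false ∷ s) ≈ wedges (Vec.map tail vs) s
  wedges-false [] s = refl
  wedges-false (v ∷ vs) s = wedge-cong (λ _ → refl) (wedges-false vs) s

  wedges-true : ∀ {k l j} (h : V j → V (suc k)) → (∀ v → h v zero ≈ 0#) → (vs : Vec (V j) l) →
                ∀ s → wedges (Vec.map h vs) (true ∷ s) ≈ 0#
  wedges-true h h≈0 [] s = refl
  wedges-true h h≈0 (v ∷ vs) s = trans
    (+-cong (*-congʳ (h≈0 v)) (-‿cong (wedge-zeroʳ _ (wedges-true h h≈0 vs) s)))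
    (solve 1 (λ x → con (+ 0) :* x :- con (+ 0) := con (+ 0)) refl _)

  map-tail : ∀ {k l j} (h : V j → V (suc k)) (vs : Vec (V j) l) s →
             wedges (Vec.map h vs) (false ∷ s) ≈ wedges (Vec.map (tail ∘ h) vs) s
  map-tail h [] s = refl
  map-tail h (v ∷ vs) s = wedge-cong (λ _ → refl) (map-tail h vs) s

  map-id : ∀ {k l} (vs : Vec (V k) l) → wedges (Vec.map (λ v → v) vs) ≈Λ wedges vs
  map-id [] s = refl
  map-id (v ∷ vs) = wedge-cong (λ _ → refl) (map-id vs)

  map-∘ : ∀ {k l i j} (g : V j → V k) (h : V i → V j) (vs : Vec (V i) l) →
          wedges (Vec.map g (Vec.map h vs)) ≈Λ wedges (Vec.map (g ∘ h) vs)
  map-∘ g h [] s = refl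
  map-∘ g h (v ∷ vs) = wedge-cong (λ _ → refl) (map-∘ g h vs)

  wedges-basis : ∀ {k} → wedges (basis {k}) ≈Λ δ
  wedges-basis {zero} [] = refl
  wedges-basis {suc k} (false ∷ s) = wedge-zeroˡ _ (λ _ → refl) s
  wedges-basis {suc k} (true ∷ s) = trans
    (+-cong (*-congˡ (trans (map-tail (0# ▹_) basis s) (trans (map-id basis s) (wedges-basis s)))) (-‿cong (wedge-zeroˡ _ (λ _ → refl) s)))
    (solve 1 (λ x → con (+ 1) :* x :- con (+ 0) := x) refl (δ s))

  -- `δ` is the wedge of the basis vectors, so an induced operator sends it to the wedge of their
  -- images.
  det-induced : ∀ {k} {h : V k → V k} {O : Λ k → Λ k} → Induced h O → O δ top ≈ det h
  det-induced I = trans (sym (O-cong wedges-basis top)) (O-wedges basis top)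
    where open Induced I

  det-cong : ∀ {k} {g h : V k → V k} → (∀ v → g v ≋ h v) → det g ≈ det h
  det-cong g≋h = wedges-cong g≋h basis top

  count : ∀ {k} → Vec Bool k → ℕ
  count [] = 0
  count (false ∷ s) = count s
  count (true ∷ s) = suc (count s)

  Homogeneous : ∀ {k} → ℕ → Λ k → Set
  Homogeneous d f = ∀ s → count s ≡ d ⊎ f s ≈ 0#

  wedge-homogeneous : ∀ {k d} (v : V k) {f} → Homogeneous d f → Homogeneous (suc d) (wedge v f)
  wedge-homogeneous v hf [] = inj₂ refl
  wedge-homogeneous v hf (false ∷ s) = wedge-homogeneous (tail v) (hf ∘ (false ∷_)) s
  wedge-homogeneous {d = zero} v {f} hf (true ∷ s) with hf (false ∷ s)
  ... | inj₁ s≡d = inj₁ (≡.cong suc s≡d)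
  ... | inj₂ f≈0 = inj₂ (trans (+-cong (*-congˡ f≈0) (-‿cong (wedge-zeroʳ (tail v) f₁≈0 s)))
                         (solve 1 (λ x → x :* con (+ 0) :- con (+ 0) := con (+ 0)) refl (v zero)))
    where
    f₁≈0 : ∀ s → f (true ∷ s) ≈ 0#
    f₁≈0 s with hf (true ∷ s)
    ... | inj₂ f≈0 = f≈0
  wedge-homogeneous {d = suc d} v {f} hf (true ∷ s) with hf (false ∷ s) | wedge-homogeneous {d = d} (tail v) hf₁ s
    where
    hf₁ : Homogeneous d (f ∘ (true ∷_))
    hf₁ s with hf (true ∷ s)
    ... | inj₁ s≡d = inj₁ (ℕ.suc-injective s≡d)
    ... | inj₂ f≈0 = inj₂ f≈0
  ... | inj₁ s≡d | _ = inj₁ (≡.cong suc s≡d)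
  ... | inj₂ _ | inj₁ s≡d = inj₁ (≡.cong suc s≡d)
  ... | inj₂ f≈0 | inj₂ g≈0 = inj₂ (trans (+-cong (*-congˡ f≈0) (-‿cong g≈0))
                         (solve 1 (λ x → x :* con (+ 0) :- con (+ 0) := con (+ 0)) refl (v zero)))

  unit-homogeneous : ∀ {k} → Homogeneous {k} 0 unit
  unit-homogeneous [] = inj₁ ≡.refl
  unit-homogeneous (false ∷ s) = unit-homogeneous s
  unit-homogeneous (true ∷ s) = inj₂ refl

  wedges-homogeneous : ∀ {k l} (vs : Vec (V k) l) → Homogeneous l (wedges vs)
  wedges-homogeneous [] = unit-homogeneous
  wedges-homogeneous (v ∷ vs) = wedge-homogeneous v (wedges-homogeneous vs)

  count≤ : ∀ {k} (s : Vec Bool k) → count s ≤ k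
  count≤ [] = ℕ.≤-refl
  count≤ (false ∷ s) = ℕ.m≤n⇒m≤1+n (count≤ s)
  count≤ (true ∷ s) = s≤s (count≤ s)

  -- Only the full selection has `k` elements.
  homogeneous-top : ∀ {k} {f : Λ k} → Homogeneous k f → ∀ s → f s ≈ f top * δ s
  homogeneous-top {zero} hf [] = sym (*-identityʳ _)
  homogeneous-top {suc k} hf (true ∷ s) = homogeneous-top (λ s → Data.Sum.Base.map₁ ℕ.suc-injective (hf (true ∷ s))) s
    where import Data.Sum.Base
  homogeneous-top {suc k} hf (false ∷ s) with hf (false ∷ s)
  ... | inj₁ s≡ = ⊥-elim (ℕ.<-irrefl s≡ (s≤s (count≤ s)))
    where open import Data.Empty using (⊥-elim)
  ... | inj₂ f≈0 = trans f≈0 (sym (zeroʳ _))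

  -- The top degree is one-dimensional: there the operator induced by `L` multiplies by `det L`, and
  -- it maps the wedge of the columns of `M` to that of the columns of `L ∘ M`.
  det-∘ : ∀ {k} {L M : V k → V k} → Linear L → det (L ∘ M) ≈ det L * det M
  det-∘ {L = L} {M} lL = begin
    det (L ∘ M)                                        ≈⟨ map-∘ L M basis top ⟨
    wedges (Vec.map L (Vec.map M basis)) top           ≈⟨ I.O-wedges (Vec.map M basis) top ⟨
    O (wedges (Vec.map M basis)) top                   ≈⟨ I.O-cong (λ s → trans (homogeneous-top (wedges-homogeneous (Vec.map M basis)) s)
                                                            (solve 2 (λ x y → x :* y := x :* y :+ con (+ 0) :* y) refl (det M) (δ s))) top ⟩
    O (lin (det M) δ 0# δ) top                         ≈⟨ I.O-lin (det M) δ 0# δ top ⟩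
    det M * O δ top + 0# * O δ top                     ≈⟨ solve 2 (λ x y → x :* y :+ con (+ 0) :* y := y :* x) refl (det M) (O δ top) ⟩
    O δ top * det M                                    ≈⟨ *-congʳ (det-induced (linear⇒induced lL)) ⟩
    det L * det M                                      ∎
    where
    open ≈-R
    O = ext (Vec.map L basis)
    module I = Induced (linear⇒induced lL)

  superdiagonal : ℕ → Carrier
  superdiagonal zero = 1# + 1#
  superdiagonal (suc _) = 1#

  -- The adjacency operator of a path, with the last entry above the diagonal doubled.
  path : ∀ {n} → V n → V n
  path {suc zero} v zero = 0#
  path {suc (suc n)} v zero = superdiagonal n * v (suc zero)
  path {suc (suc n)} v (suc zero) = v zero + path (tail v) zero
  path {suc (suc n)} v (suc (suc i)) = path (tail v) (suc i)

  shiftedPath : ∀ {n} → Carrier → V n → V n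
  shiftedPath c v i = c * v i + path v i

  -- doubledT c j = 2 T_j(c / 2)
  doubledT : Carrier → ℕ → Carrier
  doubledT c zero = 1# + 1#
  doubledT c (suc zero) = c
  doubledT c (suc (suc j)) = c * doubledT c (suc j) - doubledT c j

  -- The recursion of `doubledT` with an operator in place of the number: `S_j(B)` applied to a
  -- vector.
  opT : ∀ {k} → (V k → V k) → ℕ → V k → V k
  opT B zero v i = v i + v i
  opT B (suc zero) v = B v
  opT B (suc (suc j)) v i = B (opT B (suc j) v) i - opT B j v i

  path-cong : ∀ {n} {u v : V n} → u ≋ v → path u ≋ path v
  path-cong {suc zero} u≋v zero = refl
  path-cong {suc (suc n)} u≋v zero = *-congˡ (u≋v (suc zero))
  path-cong {suc (suc n)} u≋v (suc zero) = +-cong (u≋v zero) (path-cong (u≋v ∘ suc) zero)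
  path-cong {suc (suc n)} u≋v (suc (suc i)) = path-cong (u≋v ∘ suc) (suc i)

  path-linear : ∀ {n} a (u : V n) b v → path (lin a u b v) ≋ lin a (path u) b (path v)
  path-linear {suc zero} a u b v zero = solve 2 (λ a b → con (+ 0) := a :* con (+ 0) :+ b :* con (+ 0)) refl a b
  path-linear {suc (suc n)} a u b v zero =
    solve 5 (λ s a u b v → s :* (a :* u :+ b :* v) := a :* (s :* u) :+ b :* (s :* v)) refl (superdiagonal n) a (u (suc zero)) b (v (suc zero))
  path-linear {suc (suc n)} a u b v (suc zero) = trans (+-congˡ (path-linear a (tail u) b (tail v) zero))
    (solve 6 (λ a u b v x y → a :* u :+ b :* v :+ (a :* x :+ b :* y) := a :* (u :+ x) :+ b :* (v :+ y)) refl a (u zero) b (v zero) _ _)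
  path-linear {suc (suc n)} a u b v (suc (suc i)) = path-linear a (tail u) b (tail v) (suc i)

  path-isLinear : ∀ {n} → Linear (path {n})
  path-isLinear = record { cong = path-cong ; linear = path-linear }

  shiftedPath-linear : ∀ {n} c → Linear (shiftedPath {n} c)
  shiftedPath-linear c = record
    { cong = λ u≋v i → +-cong (*-congˡ (u≋v i)) (path-cong u≋v i)
    ; linear = λ a u b v i → trans (+-congˡ (path-linear a u b v i))
        (solve 7 (λ c a u b v x y → c :* (a :* u :+ b :* v) :+ (a :* x :+ b :* y) := a :* (c :* u :+ x) :+ b :* (c :* v :+ y)) refl
          c a (u i) b (v i) _ _)
    }

  opT-linear : ∀ {k} {B : V k → V k} → Linear B → ∀ j → Linear (opT B j)
  opT-linear lB zero = record
    { cong = λ u≋v i → +-cong (u≋v i) (u≋v i)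
    ; linear = λ a u b v i → solve 4 (λ a u b v → (a :* u :+ b :* v) :+ (a :* u :+ b :* v) := a :* (u :+ u) :+ b :* (v :+ v)) refl a (u i) b (v i)
    }
  opT-linear lB (suc zero) = lB
  opT-linear lB (suc (suc j)) = record
    { cong = λ u≋v i → +-cong (B.cong (P.cong u≋v) i) (-‿cong (Q.cong u≋v i))
    ; linear = λ a u b v i → trans (+-cong (trans (B.cong (P.linear a u b v) i) (B.linear a _ b _ i)) (-‿cong (Q.linear a u b v i)))
        (solve 6 (λ a b x y z w → (a :* x :+ b :* y) :- (a :* z :+ b :* w) := a :* (x :- z) :+ b :* (y :- w)) refl a b _ _ _ _)
    }
    where
    module B = Linear lB
    module P = Linear (opT-linear lB (suc j))
    module Q = Linear (opT-linear lB j)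

  shiftedPath-inject : ∀ {n} c (v : V (suc n)) → tail (shiftedPath c (0# ▹ v)) ≋ shiftedPath c v
  shiftedPath-inject c v zero = +-congˡ (+-identityˡ _)
  shiftedPath-inject c v (suc i) = refl

  shiftedPath-inject² : ∀ {n} c (v : V n) → shiftedPath c (0# ▹ 0# ▹ v) zero ≈ 0#
  shiftedPath-inject² {n} c v = solve 2 (λ x y → x :* con (+ 0) :+ y :* con (+ 0) := con (+ 0)) refl c (superdiagonal n)

  wedges-inject : ∀ {k j} c (vs : Vec (V (suc k)) j) s →
    wedges (Vec.map (shiftedPath c) (Vec.map (0# ▹_) vs)) (false ∷ s) ≈ wedges (Vec.map (shiftedPath c) vs) s
  wedges-inject c vs s = trans (map-∘ (shiftedPath c) (0# ▹_) vs (false ∷ s))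
    (trans (map-tail (λ v → shiftedPath c (0# ▹ v)) vs s) (wedges-cong (shiftedPath-inject c) vs s))

  -- Expansion along the first column gives the three-term recursion of `doubledT`. The doubled last
  -- entry makes the recursion end in 2 and not in 1, hence Chebyshev polynomials of the first and
  -- not of the second kind.
  det-shiftedPath : ∀ n c → det (shiftedPath {suc n} c) ≈ doubledT c (suc n)
  det-shiftedPath zero c = solve 1 (λ c → (c :* con (+ 1) :+ con (+ 0)) :* con (+ 1) :- con (+ 0) := c) refl c
  det-shiftedPath (suc n) c = begin
    P e zero * X (false ∷ top {suc n}) - wedge (tail (P e)) (X ∘ (true ∷_)) (top {suc n})
      ≈⟨ +-cong (*-cong (solve 2 (λ c s → c :* con (+ 1) :+ s :* con (+ 0) := c) refl c (superdiagonal n))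
                (trans (wedges-inject c (basis {suc n}) top) (det-shiftedPath n c)))
              (-‿cong (wedge-cong Pe X-true top)) ⟩
    c * doubledT c (suc n) - (1# * (superdiagonal n * W' (false ∷ top {n})) - wedge (λ _ → 0#) (λ s → superdiagonal n * W' (true ∷ s)) (top {n}))
      ≈⟨ +-congˡ (-‿cong (+-cong (trans (*-identityˡ _) (W'-false n)) (-‿cong (wedge-zeroˡ (λ s → superdiagonal n * W' (true ∷ s)) (λ _ → refl) top)))) ⟩
    c * doubledT c (suc n) - (doubledT c n - 0#)
      ≈⟨ solve 2 (λ x y → x :- (y :- con (+ 0)) := x :- y) refl _ _ ⟩
    c * doubledT c (suc n) - doubledT c n ∎
    where
    open ≈-R
    P = shiftedPath {suc (suc n)} c
    e : V (suc (suc n))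
    e = 1# ▹ λ _ → 0#
    X W : Λ (suc (suc n))
    X = wedges (Vec.map P (Vec.map (0# ▹_) (basis {suc n})))
    W = wedges (Vec.map P (Vec.map (0# ▹_) (Vec.map (0# ▹_) (basis {n}))))
    W' : Λ (suc n)
    W' = wedges (Vec.map (shiftedPath {suc n} c) (Vec.map (0# ▹_) (basis {n})))
    -- From the third basis vector on, the images have no first component.
    W-true : ∀ s → W (true ∷ s) ≈ 0#
    W-true s = trans (map-∘ P (0# ▹_) (Vec.map (0# ▹_) (basis {n})) (true ∷ s))
      (trans (map-∘ (λ v → P (0# ▹ v)) (0# ▹_) (basis {n}) (true ∷ s))
        (wedges-true (λ v → P (0# ▹ 0# ▹ v)) (shiftedPath-inject² c) (basis {n}) s))
    Pe : tail (P e) ≋ 1# ▹ λ _ → 0#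
    Pe zero = trans (+-congˡ (+-congˡ (Linear.zeros (path-isLinear {suc n}) (λ _ → refl) zero)))
      (solve 1 (λ c → c :* con (+ 0) :+ (con (+ 1) :+ con (+ 0)) := con (+ 1)) refl c)
    Pe (suc i) = trans (+-congˡ (Linear.zeros (path-isLinear {suc n}) (λ _ → refl) (suc i)))
      (solve 1 (λ c → c :* con (+ 0) :+ con (+ 0) := con (+ 0)) refl c)
    X-true : ∀ s → X (true ∷ s) ≈ superdiagonal n * W' s
    X-true s = trans (+-cong (*-cong (solve 2 (λ c s → c :* con (+ 0) :+ s :* con (+ 1) := s) refl c (superdiagonal n))
                                 (wedges-inject c (Vec.map (0# ▹_) (basis {n})) s))
                         (-‿cong (wedge-zeroʳ _ W-true s)))
      (solve 1 (λ x → x :- con (+ 0) := x) refl _)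
    W'-false : ∀ n → superdiagonal n * wedges (Vec.map (shiftedPath c) (Vec.map (0# ▹_) (basis {n}))) (false ∷ top {n}) ≈ doubledT c n
    W'-false zero = *-identityʳ _
    W'-false (suc n) = trans (*-identityˡ _) (trans (wedges-inject c (basis {suc n}) top) (det-shiftedPath n c))

-- Dominoes as hops of free fermions

module FreeFermions (R : CommutativeRing 0ℓ 0ℓ) where
  open IntegerCoefficients
  open ExteriorAlgebra R
  open RowTransfer using (hops; none; vweight; transfer; double; endWeight; columnWeight; Checkerboard)
  open CommutativeRing R hiding (zero)
  open IntegerSolver R
  open import Algebra.Properties.Semiring.Mult semiring using (_×_; ×-homo-+; ×1-homo-*)
  open import Data.Bool.Base using (Bool; true; false; not; if_then_else_; _xor_)
  open import Data.Fin.Base using (zero; suc)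
  open import Data.Integer.Base using (+_)
  open import Data.Nat.Base as ℕ using (ℕ; zero; suc; s≤s; z≤n)
  import Data.Nat.Properties as ℕ
  open import Data.Product.Base using (_,_) renaming (_×_ to _∧′_)
  open import Data.Vec.Base as Vec using (Vec; []; _∷_; replicate)
  open import Function.Base using (_∘_; id)
  open import Relation.Binary.PropositionalEquality as ≡ using (_≡_)
  import Relation.Binary.Reasoning.Setoid setoid as ≈-R

  nat : ℕ → Carrier
  nat n = n × 1#

  under : ∀ {k} → (Λ k → Λ k) → Λ (suc k) → Λ (suc k)
  under O f (x ∷ s) = O (λ s → f (x ∷ s)) s

  underV : ∀ {k} → (V k → V k) → V (suc k) → V (suc k)
  underV h v = v zero ▹ h (tail v)

  under-induced : ∀ {k} {h : V k → V k} {O} → Induced h O → Induced (underV h) (under O)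
  under-induced {h = h} {O} I = record
    { O-cong  = λ { f≈g (x ∷ s) → O-cong (f≈g ∘ (x ∷_)) s }
    ; O-lin   = λ { a f b g (x ∷ s) → O-lin a _ b _ s }
    ; O-wedge = λ { v f (false ∷ s) → O-wedge (tail v) _ s ; v f (true ∷ s) → wedge-true v f s }
    ; O-unit  = λ { (false ∷ s) → O-unit s ; (true ∷ s) → trans (O-zero s) refl }
    }
    where
    open Induced I
    O-zero : ∀ s → O (λ _ → 0#) s ≈ 0#
    O-zero s = trans (O-cong (λ _ → solve 0 (con (+ 0) := con (+ 0) :* con (+ 0) :+ con (+ 0) :* con (+ 0)) refl) s)
      (trans (O-lin 0# (λ _ → 0#) 0# (λ _ → 0#) s) (solve 1 (λ x → con (+ 0) :* x :+ con (+ 0) :* x := con (+ 0)) refl _))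
    wedge-true : ∀ v f s → under O (wedge v f) (true ∷ s) ≈ wedge (underV h v) (under O f) (true ∷ s)
    wedge-true v f s = trans
      (trans (O-cong (λ s → solve 3 (λ a x y → a :* x :- y := a :* x :+ (:- con (+ 1)) :* y) refl (v zero) (f (false ∷ s)) _) s)
             (O-lin (v zero) _ (- 1#) _ s))
      (trans (+-congˡ (*-congˡ (O-wedge (tail v) _ s)))
        (solve 3 (λ a x y → a :* x :+ (:- con (+ 1)) :* y := a :* x :- y) refl (v zero) _ _))

  -- The flag says whether the first or the second of the two sites is the source.
  exchange : Bool → Carrier → ∀ {k} → Λ (suc (suc k)) → Λ (suc (suc k))
  exchange true c f (false ∷ true ∷ s) = f (false ∷ true ∷ s) + c * f (true ∷ false ∷ s)
  exchange false c f (true ∷ false ∷ s) = f (true ∷ false ∷ s) + c * f (false ∷ true ∷ s)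
  exchange _ c f s = f s

  exchangeV : Bool → Carrier → ∀ {k} → V (suc (suc k)) → V (suc (suc k))
  exchangeV true c v = v zero ▹ v (suc zero) + c * v zero ▹ tail (tail v)
  exchangeV false c v = v zero + c * v (suc zero) ▹ tail v

  -- A particle moving to a neighbouring site passes no other particle, so the formula on occupied
  -- sites carries no sign.
  exchange-induced : ∀ t c {k} → Induced (exchangeV t c {k}) (exchange t c)
  exchange-induced true c = record
    { O-cong = λ { f≈ (false ∷ false ∷ s) → f≈ _ ; f≈ (false ∷ true ∷ s) → +-cong (f≈ _) (*-congˡ (f≈ _))
                 ; f≈ (true ∷ false ∷ s) → f≈ _ ; f≈ (true ∷ true ∷ s) → f≈ _ }
    ; O-lin = λ { a f b g (false ∷ false ∷ s) → refl
                ; a f b g (false ∷ true ∷ s) → solve 7 (λ c a b x y z w → (a :* x :+ b :* y) :+ c :* (a :* z :+ b :* w) := a :* (x :+ c :* z) :+ b :* (y :+ c :* w)) refl c a b _ _ _ _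
                ; a f b g (true ∷ false ∷ s) → refl ; a f b g (true ∷ true ∷ s) → refl }
    ; O-wedge = λ { v f (false ∷ false ∷ s) → refl
                  ; v f (false ∷ true ∷ s) → trans
                      (solve 6 (λ c v0 v1 x y z → (v1 :* x :- y) :+ c :* (v0 :* x :- z) := (v1 :+ c :* v0) :* x :- (con (+ 1) :* y :+ c :* z)) refl c (v zero) (v (suc zero)) _ _ _)
                      (+-congˡ (-‿cong (sym (trans (wedge-cong (λ _ → refl) (λ s → +-congʳ (sym (*-identityˡ _))) s) (wedge-linʳ (tail (tail v)) 1# _ c _ s)))))
                  ; v f (true ∷ false ∷ s) → refl
                  ; v f (true ∷ true ∷ s) →
                      solve 6 (λ c v0 v1 x y z → v0 :* x :- (v1 :* y :- z) := v0 :* (x :+ c :* y) :- ((v1 :+ c :* v0) :* y :- z)) refl c (v zero) (v (suc zero)) _ _ _ }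
    ; O-unit = λ { (false ∷ false ∷ s) → refl ; (false ∷ true ∷ s) → solve 1 (λ c → con (+ 0) :+ c :* con (+ 0) := con (+ 0)) refl c
                 ; (true ∷ false ∷ s) → refl ; (true ∷ true ∷ s) → refl }
    }
  exchange-induced false c = record
    { O-cong = λ { f≈ (false ∷ false ∷ s) → f≈ _ ; f≈ (true ∷ false ∷ s) → +-cong (f≈ _) (*-congˡ (f≈ _))
                 ; f≈ (false ∷ true ∷ s) → f≈ _ ; f≈ (true ∷ true ∷ s) → f≈ _ }
    ; O-lin = λ { a f b g (false ∷ false ∷ s) → refl
                ; a f b g (true ∷ false ∷ s) → solve 7 (λ c a b x y z w → (a :* x :+ b :* y) :+ c :* (a :* z :+ b :* w) := a :* (x :+ c :* z) :+ b :* (y :+ c :* w)) refl c a b _ _ _ _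
                ; a f b g (false ∷ true ∷ s) → refl ; a f b g (true ∷ true ∷ s) → refl }
    ; O-wedge = λ { v f (false ∷ false ∷ s) → refl
                  ; v f (true ∷ false ∷ s) → trans
                      (solve 6 (λ c v0 v1 x y z → (v0 :* x :- y) :+ c :* (v1 :* x :- z) := (v0 :+ c :* v1) :* x :- (con (+ 1) :* y :+ c :* z)) refl c (v zero) (v (suc zero)) _ _ _)
                      (+-congˡ (-‿cong (sym (trans (wedge-cong (λ _ → refl) (λ s → +-congʳ (sym (*-identityˡ _))) s) (wedge-linʳ (tail (tail v)) 1# _ c _ s)))))
                  ; v f (false ∷ true ∷ s) → refl
                  ; v f (true ∷ true ∷ s) →
                      solve 6 (λ c v0 v1 x y z → v0 :* x :- (v1 :* y :- z) := (v0 :+ c :* v1) :* x :- (v1 :* (y :+ c :* x) :- z)) refl c (v zero) (v (suc zero)) _ _ _ }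
    ; O-unit = λ { (false ∷ false ∷ s) → refl ; (true ∷ false ∷ s) → solve 1 (λ c → con (+ 0) :+ c :* con (+ 0) := con (+ 0)) refl c
                 ; (false ∷ true ∷ s) → refl ; (true ∷ true ∷ s) → refl }
    }

  -- Sources and targets alternate along the row, because `alternate` flips every second cell.
  hop : Bool → (ℕ → Carrier) → ∀ {k} → Λ k → Λ k
  hop t h {zero} f = f
  hop t h {suc zero} f = f
  hop t h {suc (suc k)} f = exchange t (h 0) (under (hop (not t) (h ∘ suc)) f)

  hopV : Bool → (ℕ → Carrier) → ∀ {k} → V k → V k
  hopV t h {zero} v = v
  hopV t h {suc zero} v = v
  hopV t h {suc (suc k)} v = exchangeV t (h 0) (underV (hopV (not t) (h ∘ suc)) v)

  id-induced : ∀ {k} → Induced (id {A = V k}) id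
  id-induced = record { O-cong = id ; O-lin = λ _ _ _ _ _ → refl ; O-wedge = λ _ _ _ → refl ; O-unit = λ _ → refl }

  hop-induced : ∀ t h {k} → Induced (hopV t h {k}) (hop t h)
  hop-induced t h {zero} = id-induced
  hop-induced t h {suc zero} = id-induced
  hop-induced t h {suc (suc k)} = induced-∘ (exchange-induced t (h 0)) (under-induced (hop-induced (not t) (h ∘ suc)))

  diagWeight : (ℕ → Carrier) → ∀ {k} → Λ k
  diagWeight w [] = 1#
  diagWeight w (x ∷ s) = (if x then w 0 else 1#) * diagWeight (w ∘ suc) s

  diag : (ℕ → Carrier) → ∀ {k} → Λ k → Λ k
  diag w f s = diagWeight w s * f s

  diagV : (ℕ → Carrier) → ∀ {k} → V k → V k
  diagV w v zero = w 0 * v zero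
  diagV w v (suc i) = diagV (w ∘ suc) (tail v) i

  diag-wedge : ∀ w {k} (v : V k) f → diag w (wedge v f) ≈Λ wedge (diagV w v) (diag w f)
  diag-wedge w v f [] = zeroʳ _
  diag-wedge w v f (false ∷ s) = trans (*-congʳ (*-identityˡ _)) (trans (diag-wedge (w ∘ suc) (tail v) _ s)
    (wedge-cong (λ _ → refl) (λ s → *-congʳ (sym (*-identityˡ _))) s))
  diag-wedge w v f (true ∷ s) = trans
    (solve 5 (λ w d v x y → w :* d :* (v :* x :- y) := w :* v :* (con (+ 1) :* d :* x) :- w :* (d :* y)) refl (w 0) (diagWeight (w ∘ suc) s) (v zero) _ _)
    (+-congˡ (-‿cong (trans (*-congˡ (diag-wedge (w ∘ suc) (tail v) _ s)) (sym (trans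
      (wedge-cong (λ _ → refl) (λ s → solve 3 (λ w d x → w :* d :* x := w :* (d :* x) :+ con (+ 0) :* (d :* x)) refl (w 0) _ _) s)
      (trans (wedge-linʳ (diagV (w ∘ suc) (tail v)) (w 0) _ 0# _ s) (solve 2 (λ w x → w :* x :+ con (+ 0) :* x := w :* x) refl (w 0) _)))))))

  diag-induced : ∀ w {k} → Induced (diagV w {k}) (diag w)
  diag-induced w = record
    { O-cong = λ f≈ s → *-congˡ (f≈ s)
    ; O-lin = λ a f b g s → solve 5 (λ d a x b y → d :* (a :* x :+ b :* y) := a :* (d :* x) :+ b :* (d :* y)) refl (diagWeight w s) a (f s) b (g s)
    ; O-wedge = diag-wedge w
    ; O-unit = diag-unit w
    }
    where
    diag-unit : ∀ w {k} → diag w unit ≈Λ unit {k}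
    diag-unit w [] = *-identityˡ _
    diag-unit w (false ∷ s) = trans (*-congʳ (*-identityˡ _)) (diag-unit (w ∘ suc) s)
    diag-unit w (true ∷ s) = zeroʳ _

  embed : ∀ {n} → Λ n → Λ (double n)
  embed {zero} f = f
  embed {suc n} f (true ∷ x ∷ s) = 0#
  embed {suc n} f (false ∷ x ∷ s) = embed (λ s → f (x ∷ s)) s

  mix : ∀ {n} → V n → V n → V (double n)
  mix {zero} q x = x
  mix {suc n} q x = q zero ▹ x zero ▹ mix (tail q) (tail x)

  embedV : ∀ {n} → V n → V (double n)
  embedV x = mix (λ _ → 0#) x

  project : ∀ {n} → Λ (double n) → Λ n
  project {zero} f = f
  project {suc n} f (x ∷ s) = project (λ s → f (false ∷ x ∷ s)) s

  projectV : ∀ {n} → V (double n) → V n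
  projectV {suc n} v zero = v (suc zero)
  projectV {suc n} v (suc i) = projectV (tail (tail v)) i

  embed-cong : ∀ {n} {f g : Λ n} → f ≈Λ g → embed f ≈Λ embed g
  embed-cong {zero} f≈ = f≈
  embed-cong {suc n} f≈ (true ∷ x ∷ s) = refl
  embed-cong {suc n} f≈ (false ∷ x ∷ s) = embed-cong (f≈ ∘ (x ∷_)) s

  embed-lin : ∀ {n} a (f : Λ n) b g → embed (lin a f b g) ≈Λ lin a (embed f) b (embed g)
  embed-lin {zero} a f b g s = refl
  embed-lin {suc n} a f b g (true ∷ x ∷ s) = solve 2 (λ a b → con (+ 0) := a :* con (+ 0) :+ b :* con (+ 0)) refl a b
  embed-lin {suc n} a f b g (false ∷ x ∷ s) = embed-lin a _ b _ s

  embed-wedge : ∀ {n} (v : V n) f → embed (wedge v f) ≈Λ wedge (embedV v) (embed f)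
  embed-wedge {zero} v f [] = refl
  embed-wedge {suc n} v f (false ∷ false ∷ s) = embed-wedge (tail v) _ s
  embed-wedge {suc n} v f (false ∷ true ∷ s) = trans
    (embed-cong (λ s → solve 3 (λ v x y → v :* x :- y := v :* x :+ (:- con (+ 1)) :* y) refl (v zero) _ _) s)
    (trans (embed-lin (v zero) _ (- 1#) _ s) (trans (+-congˡ (*-congˡ (embed-wedge (tail v) _ s)))
      (solve 3 (λ v x y → v :* x :+ (:- con (+ 1)) :* y := v :* x :- y) refl (v zero) _ _)))
  embed-wedge {suc n} v f (true ∷ x ∷ s) = sym (trans (+-cong (zeroˡ _) (-‿cong (wedge-zeroʳ (tail (embedV v)) (λ { (y ∷ t) → refl }) (x ∷ s))))
    (solve 0 (con (+ 0) :- con (+ 0) := con (+ 0)) refl))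

  embed-induced : ∀ {n} → Induced (embedV {n}) embed
  embed-induced {n} = record { O-cong = embed-cong ; O-lin = embed-lin {n} ; O-wedge = embed-wedge ; O-unit = embed-unit {n} }
    where
    embed-zero : ∀ {n} s → embed {n} (λ _ → 0#) s ≈ 0#
    embed-zero {zero} s = refl
    embed-zero {suc n} (true ∷ x ∷ s) = refl
    embed-zero {suc n} (false ∷ x ∷ s) = embed-zero {n} s
    embed-unit : ∀ {n} → embed {n} unit ≈Λ unit
    embed-unit {zero} s = refl
    embed-unit {suc n} (true ∷ x ∷ s) = refl
    embed-unit {suc n} (false ∷ false ∷ s) = embed-unit {n} s
    embed-unit {suc n} (false ∷ true ∷ s) = embed-zero {n} s

  project-induced : ∀ {n} → Induced (projectV {n}) project
  project-induced {n} = record { O-cong = project-cong {n} ; O-lin = project-lin {n} ; O-wedge = project-wedge {n} ; O-unit = project-unit {n} }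
    where
    project-cong : ∀ {n} {f g : Λ (double n)} → f ≈Λ g → project f ≈Λ project g
    project-cong {zero} f≈ = f≈
    project-cong {suc n} f≈ (x ∷ s) = project-cong {n} (λ s → f≈ (false ∷ x ∷ s)) s
    project-lin : ∀ {n} a (f : Λ (double n)) b g → project (lin a f b g) ≈Λ lin a (project f) b (project g)
    project-lin {zero} a f b g s = refl
    project-lin {suc n} a f b g (x ∷ s) = project-lin {n} a _ b _ s
    project-wedge : ∀ {n} (v : V (double n)) f → project (wedge v f) ≈Λ wedge (projectV v) (project f)
    project-wedge {zero} v f [] = refl
    project-wedge {suc n} v f (false ∷ s) = project-wedge {n} (tail (tail v)) _ s
    project-wedge {suc n} v f (true ∷ s) = trans
      (project-cong {n} (λ s → solve 3 (λ v x y → v :* x :- y := v :* x :+ (:- con (+ 1)) :* y) refl (v (suc zero)) _ _) s)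
      (trans (project-lin {n} (v (suc zero)) _ (- 1#) _ s) (trans (+-congˡ (*-congˡ (project-wedge {n} (tail (tail v)) _ s)))
        (solve 3 (λ v x y → v :* x :+ (:- con (+ 1)) :* y := v :* x :- y) refl (v (suc zero)) _ _)))
    project-zero : ∀ {n} s → project {n} (λ _ → 0#) s ≈ 0#
    project-zero {zero} s = refl
    project-zero {suc n} (x ∷ s) = project-zero {n} s
    project-unit : ∀ {n} → project {n} unit ≈Λ unit
    project-unit {zero} s = refl
    project-unit {suc n} (false ∷ s) = project-unit {n} s
    project-unit {suc n} (true ∷ s) = project-zero {n} s

  nat-+ : ∀ m n → nat (m ℕ.+ n) ≈ nat m + nat n
  nat-+ = ×-homo-+ 1#

  nat-* : ∀ m n → nat (m ℕ.* n) ≈ nat m * nat n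
  nat-* = ×1-homo-*

  -- A particle-hole exchange in every second column. It turns open cells into particles whose
  -- number is preserved, since a horizontal domino closes one cell of either kind.
  alternate : Bool → ∀ {k} → Vec Bool k → Vec Bool k
  alternate t [] = []
  alternate t (x ∷ s) = (t xor x) ∷ alternate (not t) s

  hop-cong : ∀ t h {k} {f g : Λ k} → f ≈Λ g → hop t h f ≈Λ hop t h g
  hop-cong t h = Induced.O-cong (hop-induced t h)

  -- In alternating coordinates covering two neighbouring vertices moves a particle.
  hops-alternate : ∀ t h g → (∀ c → nat (h c) ≈ g c) → ∀ {k} (φ : Vec Bool k → ℕ) →
    (λ s → nat (hops h φ (alternate t s))) ≈Λ hop t g (λ s → nat (φ (alternate t s)))
  hops-alternate t h g h≈g φ [] = refl
  hops-alternate t h g h≈g φ (x ∷ []) = refl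
  hops-alternate true h g h≈g φ (false ∷ true ∷ s) = trans (nat-+ (h 0 ℕ.* _) _) (trans (+-comm _ _) (+-cong
    (hops-alternate false (h ∘ suc) (g ∘ suc) (h≈g ∘ suc) (λ s → φ (true ∷ s)) (true ∷ s))
    (trans (nat-* (h 0) _) (*-cong (h≈g 0) (hops-alternate false (h ∘ suc) (g ∘ suc) (h≈g ∘ suc) (λ s → φ (false ∷ s)) (false ∷ s))))))
  hops-alternate true h g h≈g φ (false ∷ false ∷ s) =
    hops-alternate false (h ∘ suc) (g ∘ suc) (h≈g ∘ suc) (λ s → φ (true ∷ s)) (false ∷ s)
  hops-alternate true h g h≈g φ (true ∷ x ∷ s) =
    hops-alternate false (h ∘ suc) (g ∘ suc) (h≈g ∘ suc) (λ s → φ (false ∷ s)) (x ∷ s)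
  hops-alternate false h g h≈g φ (true ∷ false ∷ s) = trans (nat-+ (h 0 ℕ.* _) _) (trans (+-comm _ _) (+-cong
    (hops-alternate true (h ∘ suc) (g ∘ suc) (h≈g ∘ suc) (λ s → φ (true ∷ s)) (false ∷ s))
    (trans (nat-* (h 0) _) (*-cong (h≈g 0) (hops-alternate true (h ∘ suc) (g ∘ suc) (h≈g ∘ suc) (λ s → φ (false ∷ s)) (true ∷ s))))))
  hops-alternate false h g h≈g φ (true ∷ true ∷ s) =
    hops-alternate true (h ∘ suc) (g ∘ suc) (h≈g ∘ suc) (λ s → φ (true ∷ s)) (true ∷ s)
  hops-alternate false h g h≈g φ (false ∷ x ∷ s) = hops-alternate true (h ∘ suc) (g ∘ suc) (h≈g ∘ suc) (λ s → φ (false ∷ s)) (x ∷ s)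

  nat-1 : nat 1 ≈ 1#
  nat-1 = +-identityʳ 1#

  vweight-1 : ∀ v → (∀ c → v c ≡ 1) → ∀ {k} (s : Vec Bool k) → vweight v s ≡ 1
  vweight-1 v v≡1 [] = ≡.refl
  vweight-1 v v≡1 (true ∷ s) rewrite v≡1 0 | vweight-1 (v ∘ suc) (v≡1 ∘ suc) s = ≡.refl
  vweight-1 v v≡1 (false ∷ s) rewrite vweight-1 (v ∘ suc) (v≡1 ∘ suc) s = ≡.refl

  -- The flipped cells lie in the first column of each pair, where the vertical weight is 1, so the
  -- flip does not affect the weight.
  vweight-column : ∀ v {k} → (∀ c → c ℕ.< k → v c ≡ columnWeight c) → (s : Vec Bool k) →
    nat (vweight v (alternate true s)) ≈ diagWeight (nat ∘ columnWeight) s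
  vweight-column v v≡ [] = nat-1
  vweight-column v v≡ (x ∷ s) = trans (nat-* (if not x then v 0 else 1) _) (*-cong (first x) (second v v≡ s))
    where
    first : ∀ x → nat (if not x then v 0 else 1) ≈ (if x then nat 1 else 1#)
    first true = refl
    first false = trans (reflexive (≡.cong nat (v≡ 0 (s≤s z≤n)))) nat-1
    second : ∀ v {k} → (∀ c → c ℕ.< suc k → v c ≡ columnWeight c) → (s : Vec Bool k) →
      nat (vweight (v ∘ suc) (alternate false s)) ≈ diagWeight (nat ∘ columnWeight ∘ suc) s
    second v v≡ [] = nat-1
    second v v≡ (x ∷ s) = trans (nat-* (if x then v 1 else 1) _) (*-cong (value x)
      (vweight-column (λ c → v (suc (suc c))) (λ c c<k → v≡ (suc (suc c)) (s≤s (s≤s c<k))) s))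
      where
      value : ∀ x → nat (if x then v 1 else 1) ≈ (if x then nat 2 else 1#)
      value true = reflexive (≡.cong nat (v≡ 1 (s≤s (s≤s z≤n))))
      value false = nat-1

  -- Passing to the next row complements the open cells and also exchanges the flipped and the
  -- unflipped columns. Together this means that vertical dominoes leave the particles in place.
  not-alternate : ∀ t {k} (s : Vec Bool k) → Vec.map not (alternate t s) ≡ alternate (not t) s
  not-alternate t [] = ≡.refl
  not-alternate true (true ∷ s) = ≡.cong (true ∷_) (not-alternate false s)
  not-alternate true (false ∷ s) = ≡.cong (false ∷_) (not-alternate false s)
  not-alternate false (true ∷ s) = ≡.cong (false ∷_) (not-alternate true s)
  not-alternate false (false ∷ s) = ≡.cong (true ∷_) (not-alternate true s)

  -- After the last row no cell is open. In alternating coordinates the second site of every pair is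
  -- then occupied and the first is empty, which is the image of `δ` under `embed`.
  none-alternate : ∀ n (s : Vec Bool (double n)) → nat (none (alternate false s)) ≈ embed δ s
  none-alternate zero [] = nat-1
  none-alternate (suc n) (true ∷ x ∷ s) = refl
  none-alternate (suc n) (false ∷ false ∷ s) = sym (zero-embed n s)
    where
    zero-embed : ∀ n s → embed {n} (λ _ → 0#) s ≈ 0#
    zero-embed zero s = refl
    zero-embed (suc n) (true ∷ x ∷ s) = refl
    zero-embed (suc n) (false ∷ x ∷ s) = zero-embed n s
  none-alternate (suc n) (false ∷ true ∷ s) = none-alternate n s

  ones columns : ℕ → Carrier
  ones _ = 1#
  columns c = nat (columnWeight c)

  endsOf : ℕ → ℕ → Carrier
  endsOf n c = nat (endWeight n c)

  -- Starts from the last two rows, where `diag columns` stands for the weighted vertical edges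
  -- between them; each further step puts two rows on top.
  evolve : ∀ n (m : ℕ) → Λ (suc n) → Λ (double (suc n))
  evolve n zero f = hop true ones (diag columns (hop false (endsOf n) (embed f)))
  evolve n (suc m) f = hop true ones (hop false (endsOf n) (evolve n m f))

  evolveV : ∀ n (m : ℕ) → V (suc n) → V (double (suc n))
  evolveV n zero v = hopV true ones (diagV columns (hopV false (endsOf n) (embedV v)))
  evolveV n (suc m) v = hopV true ones (hopV false (endsOf n) (evolveV n m v))

  evolve-induced : ∀ n (m : ℕ) → Induced (evolveV n m) (evolve n m)
  evolve-induced n zero = induced-∘ (hop-induced true ones) (induced-∘ (diag-induced columns) (induced-∘ (hop-induced false (endsOf n)) embed-induced))
  evolve-induced n (suc m) = induced-∘ (hop-induced true ones) (induced-∘ (hop-induced false (endsOf n)) (evolve-induced n m))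

  unweighted-row : ∀ v → (∀ c → v c ≡ 1) → ∀ t {k} (χ : Vec Bool k → ℕ) s →
    nat (vweight v (alternate t s) ℕ.* χ (Vec.map not (alternate t s))) ≈ nat (χ (alternate (not t) s))
  unweighted-row v v≡1 t χ s = reflexive (≡.cong nat (≡.trans (≡.cong₂ ℕ._*_ (vweight-1 v v≡1 (alternate t s)) (≡.cong χ (not-alternate t s)))
    (ℕ.*-identityˡ _)))

  transfer-evolve : ∀ n (m : ℕ) h v → Checkerboard n m h v → ∀ s →
    nat (transfer (suc (double m)) h v (alternate true s)) ≈ evolve n m δ s
  transfer-evolve n zero h v (h0 , h1 , v0) s = trans
    (hops-alternate true (h 0) ones (λ c → trans (reflexive (≡.cong nat (h0 c))) nat-1) _ s)
    (hop-cong true ones (λ s → trans (nat-* (vweight (v 0) (alternate true s)) _) (*-cong (vweight-column (v 0) v0 s)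
      (trans (reflexive (≡.cong (λ t → nat (hops (h 1) none t)) (not-alternate true s)))
        (trans (hops-alternate false (h 1) (endsOf n) (λ c → reflexive (≡.cong nat (h1 c))) none s)
          (hop-cong false (endsOf n) (none-alternate (suc n)) s))))) s)
  transfer-evolve n (suc m) h v (h0 , h1 , v0 , v1 , good) s = trans
    (hops-alternate true (h 0) ones (λ c → trans (reflexive (≡.cong nat (h0 c))) nat-1) _ s)
    (hop-cong true ones (λ s → trans (unweighted-row (v 0) v0 true (hops (h 1) lower) s)
      (trans (hops-alternate false (h 1) (endsOf n) (λ c → reflexive (≡.cong nat (h1 c))) lower s)
        (hop-cong false (endsOf n) {g = evolve n m δ} (λ s → trans (unweighted-row (v 1) v1 false upper s)
          (transfer-evolve n m (λ r → h (suc (suc r))) (λ r → v (suc (suc r))) good s)) s))) s)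
    where
    upper lower : Vec Bool (double (suc n)) → ℕ
    upper = transfer (suc (double m)) (λ r → h (suc (suc r))) (λ r → v (suc (suc r)))
    lower s = vweight (v 1) s ℕ.* upper (Vec.map not s)

  alternate-true : ∀ n → alternate true (alternate true (replicate n true)) ≡ replicate n true
  alternate-true zero = ≡.refl
  alternate-true (suc zero) = ≡.refl
  alternate-true (suc (suc n)) = ≡.cong (λ s → true ∷ true ∷ s) (alternate-true n)

  project-top : ∀ n (f : Λ (double n)) → project {n} f top ≡ f (alternate true (replicate (double n) true))
  project-top zero f = ≡.refl
  project-top (suc n) f = project-top n (λ s → f (false ∷ true ∷ s))

  -- At the start all cells are open, so again exactly the second sites are occupied: the
  -- coefficient in question is the top one after `project`.
  transfer-det : ∀ n (m : ℕ) h v → Checkerboard n m h v →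
    nat (transfer (suc (double m)) h v (replicate (double (suc n)) true)) ≈ det (projectV {suc n} ∘ evolveV n m)
  transfer-det n m h v good = begin
    nat (transfer (suc (double m)) h v (replicate (double (suc n)) true))
      ≡⟨ ≡.cong (λ s → nat (transfer (suc (double m)) h v s)) (alternate-true (double (suc n))) ⟨
    nat (transfer (suc (double m)) h v (alternate true (alternate true (replicate (double (suc n)) true))))
      ≈⟨ transfer-evolve n m h v good (alternate true (replicate (double (suc n)) true)) ⟩
    evolve n m δ (alternate true (replicate (double (suc n)) true))
      ≡⟨ project-top (suc n) (evolve n m δ) ⟨
    project {suc n} (evolve n m δ) top
      ≈⟨ det-induced (induced-∘ (project-induced {suc n}) (evolve-induced n m)) ⟩
    det (projectV {suc n} ∘ evolveV n m) ∎
    where open ≈-R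

  -- `pairSum` carries amplitudes from the first sites of the pairs to the second ones, `spread`
  -- carries them back. Their composition is `2 + path`, by `pairSum-spread`; the last weight 2 of
  -- the odd rows becomes the doubled entry of `path`.
  pairSum : ∀ {n} → V n → V n
  pairSum {suc zero} q zero = q zero
  pairSum {suc (suc n)} q zero = q zero + q (suc zero)
  pairSum {suc (suc n)} q (suc i) = pairSum (tail q) i

  spread : ∀ {n} → V n → V n
  spread {suc zero} x zero = (1# + 1#) * x zero
  spread {suc (suc n)} x zero = x zero
  spread {suc (suc n)} x (suc zero) = x zero + spread (tail x) zero
  spread {suc (suc n)} x (suc (suc i)) = spread (tail x) (suc i)

  mix-cong : ∀ {n} {q q' x x' : V n} → q ≋ q' → x ≋ x' → mix q x ≋ mix q' x'
  mix-cong {suc n} q≋ x≋ zero = q≋ zero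
  mix-cong {suc n} q≋ x≋ (suc zero) = x≋ zero
  mix-cong {suc n} q≋ x≋ (suc (suc i)) = mix-cong (q≋ ∘ suc) (x≋ ∘ suc) i

  hopV-cong : ∀ t h {k} {u v : V k} → u ≋ v → hopV t h u ≋ hopV t h v
  hopV-cong t h {zero} u≋v = u≋v
  hopV-cong t h {suc zero} u≋v = u≋v
  hopV-cong true h {suc (suc k)} u≋v zero = u≋v zero
  hopV-cong true h {suc (suc k)} u≋v (suc zero) = +-cong (hopV-cong false (h ∘ suc) (u≋v ∘ suc) zero) (*-congˡ (u≋v zero))
  hopV-cong true h {suc (suc k)} u≋v (suc (suc i)) = hopV-cong false (h ∘ suc) (u≋v ∘ suc) (suc i)
  hopV-cong false h {suc (suc k)} u≋v zero = +-cong (u≋v zero) (*-congˡ (hopV-cong true (h ∘ suc) (u≋v ∘ suc) zero))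
  hopV-cong false h {suc (suc k)} u≋v (suc i) = hopV-cong true (h ∘ suc) (u≋v ∘ suc) i

  hop-true : ∀ {n} (q x : V n) → hopV true ones (mix q x) ≋ mix q (λ i → x i + pairSum q i)
  hop-true {suc zero} q x zero = refl
  hop-true {suc zero} q x (suc zero) = +-congˡ (*-identityˡ _)
  hop-true {suc (suc n)} q x zero = refl
  hop-true {suc (suc n)} q x (suc zero) =
    solve 3 (λ x q q' → (x :+ con (+ 1) :* q') :+ con (+ 1) :* q := x :+ (q :+ q')) refl (x zero) (q zero) (q (suc zero))
  hop-true {suc (suc n)} q x (suc (suc i)) = hop-true (tail q) (tail x) i

  nat-2 : nat 2 ≈ 1# + 1#
  nat-2 = +-congˡ (+-identityʳ 1#)

  hop-false : ∀ n (q x : V (suc n)) → hopV false (endsOf n) (mix q x) ≋ mix (λ i → q i + spread x i) x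
  hop-false zero q x zero = +-congˡ (*-congʳ nat-2)
  hop-false zero q x (suc zero) = refl
  hop-false (suc n) q x zero = +-congˡ (trans (*-congʳ nat-1) (*-identityˡ _))
  hop-false (suc n) q x (suc zero) = refl
  hop-false (suc n) q x (suc (suc zero)) = trans (+-cong (hop-false n (tail q) (tail x) zero) (*-congʳ nat-1))
    (solve 3 (λ q s x → (q :+ s) :+ con (+ 1) :* x := q :+ (x :+ s)) refl (q (suc zero)) _ (x zero))
  hop-false (suc n) q x (suc (suc (suc i))) = trans (hop-false n (tail q) (tail x) (suc i)) (tail-spread n q x i)
    where
    tail-spread : ∀ n (q x : V (suc (suc n))) i →
      mix (λ i → q (suc i) + spread (tail x) i) (tail x) (suc i) ≈ mix (λ i → q (suc i) + spread x (suc i)) (tail x) (suc i)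
    tail-spread n q x zero = refl
    tail-spread (suc n) q x (suc i) = refl

  diag-columns : ∀ {n} (q x : V n) → diagV columns (mix q x) ≋ mix q (λ i → x i + x i)
  diag-columns {suc n} q x zero = trans (*-congʳ nat-1) (*-identityˡ _)
  diag-columns {suc n} q x (suc zero) = trans (*-congʳ nat-2) (solve 1 (λ x → con (+ 2) :* x := x :+ x) refl (x zero))
  diag-columns {suc n} q x (suc (suc i)) = diag-columns (tail q) (tail x) i

  project-mix : ∀ {n} (q x : V n) → projectV (mix q x) ≋ x
  project-mix {suc n} q x zero = refl
  project-mix {suc n} q x (suc i) = project-mix (tail q) (tail x) i

  pairSum-cong : ∀ {n} {u v : V n} → u ≋ v → pairSum u ≋ pairSum v
  pairSum-cong {suc zero} u≋v zero = u≋v zero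
  pairSum-cong {suc (suc n)} u≋v zero = +-cong (u≋v zero) (u≋v (suc zero))
  pairSum-cong {suc (suc n)} u≋v (suc i) = pairSum-cong (u≋v ∘ suc) i

  pairSum-+ : ∀ {n} (u v : V n) → pairSum (λ i → u i + v i) ≋ λ i → pairSum u i + pairSum v i
  pairSum-+ {suc zero} u v zero = refl
  pairSum-+ {suc (suc n)} u v zero = solve 4 (λ a b c d → (a :+ b) :+ (c :+ d) := (a :+ c) :+ (b :+ d)) refl _ _ _ _
  pairSum-+ {suc (suc n)} u v (suc i) = pairSum-+ (tail u) (tail v) i

  pairSum-spread : ∀ {n} (x : V n) → pairSum (spread x) ≋ λ i → x i + x i + path x i
  pairSum-spread {suc zero} x zero = solve 1 (λ x → con (+ 2) :* x := x :+ x :+ con (+ 0)) refl (x zero)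
  pairSum-spread {suc (suc n)} x zero = trans (+-congˡ (+-congˡ (spread-zero n x))) (sym (+-assoc _ _ _))
    where
    spread-zero : ∀ n (x : V (suc (suc n))) → spread (tail x) zero ≈ superdiagonal n * x (suc zero)
    spread-zero zero x = refl
    spread-zero (suc n) x = sym (*-identityˡ _)
  pairSum-spread {suc (suc n)} x (suc i) = trans (pairSum-cong shifted i) (trans (pairSum-+ (x zero ▹ λ _ → 0#) (spread (tail x)) i)
    (trans (+-cong (kick n x i) (pairSum-spread (tail x) i)) (assemble i)))
    where
    shifted : tail (spread x) ≋ λ i → (x zero ▹ λ _ → 0#) i + spread (tail x) i
    shifted zero = refl
    shifted (suc i) = sym (+-identityˡ _)
    pairSum-0 : ∀ {n} i → pairSum {n} (λ _ → 0#) i ≈ 0#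
    pairSum-0 {suc zero} zero = refl
    pairSum-0 {suc (suc n)} zero = +-identityʳ _
    pairSum-0 {suc (suc n)} (suc i) = pairSum-0 {suc n} i
    kick : ∀ n (x : V (suc (suc n))) i → pairSum {suc n} (x zero ▹ λ _ → 0#) i ≈ (x zero ▹ λ _ → 0#) i
    kick zero x zero = refl
    kick (suc n) x zero = +-identityʳ _
    kick (suc n) x (suc i) = pairSum-0 {suc n} i
    assemble : ∀ i → (x zero ▹ λ _ → 0#) i + (x (suc i) + x (suc i) + path (tail x) i) ≈ x (suc i) + x (suc i) + path x (suc i)
    assemble zero = solve 3 (λ a b p → a :+ (b :+ b :+ p) := b :+ b :+ (a :+ p)) refl _ _ _
    assemble (suc i) = +-identityˡ _

  four : Carrier
  four = 1# + 1# + 1# + 1#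

  -- The amplitudes at the first sites after `m` further pairs of rows, while the second sites carry
  -- `S_(m+1)(4 + path)`.
  charge : ∀ {n} → ℕ → V (suc n) → V (suc n)
  charge zero v i = 0# + spread v i
  charge (suc m) v i = charge m v i + spread (opT (shiftedPath four) (suc m) v) i

  -- Let `t_m` be the value of `opT` and `q_m` the charge. From `q_(m+1) = q_m + spread t_(m+1)` one
  -- gets `t_(m+1) + pairSum q_(m+1) = t_(m+1) + (t_(m+1) - t_m) + (2 + path)
  -- t_(m+1)`, the right side of the recursion for `t_(m+2)`.
  pairSum-charge : ∀ {n} m (v : V (suc n)) i →
    opT (shiftedPath four) (suc m) v i ≈ opT (shiftedPath four) m v i + pairSum (charge m v) i
  pairSum-charge zero v i = sym (trans (+-congˡ (trans (pairSum-cong (λ i → +-identityˡ (spread v i)) i) (pairSum-spread v i)))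
    (solve 2 (λ v p → v :+ v :+ (v :+ v :+ p) := con (+ 4) :* v :+ p) refl (v i) (path v i)))
  pairSum-charge (suc m) v i = sym (trans (+-congˡ (trans (pairSum-+ (charge m v) _ i) (+-congˡ (pairSum-spread (opT (shiftedPath four) (suc m) v) i))))
    (trans (+-congʳ (pairSum-charge m v i))
    (trans (solve 4 (λ a b x p → (a :+ b) :+ (b :+ (x :+ x :+ p)) := ((a :+ b) :+ (a :+ b)) :+ (x :+ x) :+ p :- a) refl
       (opT (shiftedPath four) m v i) (pairSum (charge m v) i) (opT (shiftedPath four) (suc m) v i) (path (opT (shiftedPath four) (suc m) v) i))
    (trans (+-congʳ (+-congʳ (+-congʳ (sym (+-cong (pairSum-charge m v i) (pairSum-charge m v i))))))
      (solve 3 (λ x p a → (x :+ x) :+ (x :+ x) :+ p :- a := con (+ 4) :* x :+ p :- a) refl _ _ _)))))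

  -- In the last pair of rows the vertical weight 2 turns `v` into `v + v`, which supplies the
  -- initial value `S_0 = 2`.
  evolveV-mix : ∀ n m v → evolveV n m v ≋ mix (charge m v) (opT (shiftedPath four) (suc m) v)
  evolveV-mix n zero v i = trans (hopV-cong true ones (λ i → trans (diagV-cong columns (hop-false n (λ _ → 0#) v) i) (diag-columns (charge zero v) v i)) i)
    (trans (hop-true (charge zero v) (λ i → v i + v i) i) (mix-cong {q = charge zero v} (λ _ → refl) (λ i → sym (pairSum-charge zero v i)) i))
    where
    diagV-cong : ∀ w {k} {u v : V k} → u ≋ v → diagV w u ≋ diagV w v
    diagV-cong w u≋v zero = *-congˡ (u≋v zero)
    diagV-cong w u≋v (suc i) = diagV-cong (w ∘ suc) (u≋v ∘ suc) i
  evolveV-mix n (suc m) v i = trans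
    (hopV-cong true ones (λ i → trans (hopV-cong false (endsOf n) (evolveV-mix n m v) i) (hop-false n (charge m v) (opT (shiftedPath four) (suc m) v) i)) i)
    (trans (hop-true (charge (suc m) v) (opT (shiftedPath four) (suc m) v) i)
      (mix-cong {q = charge (suc m) v} (λ _ → refl) (λ i → sym (pairSum-charge (suc m) v i)) i))

  transfer≈det : ∀ n (m : ℕ) h v → Checkerboard n m h v →
    nat (transfer (suc (double m)) h v (replicate (double (suc n)) true)) ≈ det {suc n} (opT (shiftedPath four) (suc m))
  transfer≈det n m h v good = trans (transfer-det n m h v good)
    (det-cong {suc n} λ v i → trans (projectV-cong {suc n} (evolveV-mix n m v) i) (project-mix (charge m v) (opT (shiftedPath four) (suc m) v) i))
    where
    projectV-cong : ∀ {n} {u v : V (double n)} → u ≋ v → projectV {n} u ≋ projectV v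
    projectV-cong {suc n} u≋v zero = u≋v (suc zero)
    projectV-cong {suc n} u≋v (suc i) = projectV-cong {n} (λ j → u≋v (suc (suc j))) i

-- Counting the cokernel of an integer matrix

module Cokernel where
  open import Data.Integer.Properties as ℤ using (+-*-commutativeRing)
  open ExteriorAlgebra +-*-commutativeRing
  open IntegerCoefficients
  open IntegerSolver +-*-commutativeRing
  open import Data.Empty using (⊥-elim)
  open import Data.Fin.Base using (Fin; zero; suc; toℕ; fromℕ<; combine; remQuot)
  import Data.Fin.Properties as Fin
  open import Data.Integer.Base using (ℤ; +_; 0ℤ; 1ℤ; _+_; _*_; -_; _-_; ∣_∣; NonZero; ≢-nonZero; _⊖_)
  open import Data.Integer.DivMod using (_/_; _%_; a≡a%n+[a/n]*n; n%d<d)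
  open import Data.Nat.Base as ℕ using (ℕ; zero; suc; _<_)
  import Data.Nat.Properties as ℕ
  open import Data.Product.Base using (_×_; _,_; proj₁; proj₂; ∃; ∃₂)
  open import Data.Sum.Base using (_⊎_; inj₁; inj₂)
  open import Data.Vec.Base as Vec using (Vec; []; _∷_)
  open import Function.Base using (_∘_)
  open import Induction.WellFounded using (Acc; acc)
  open import Data.Nat.Induction using (<-wellFounded)
  open import Relation.Binary.PropositionalEquality
  open import Relation.Nullary.Decidable using (yes; no)

  infixl 6 _⊝_
  _⊝_ : ∀ {k} → V k → V k → V k
  (x ⊝ y) i = x i - y i

  minus : ∀ {k} → V k → ℤ → V k → V k
  minus x a v i = x i - a * v i

  -- Membership by subtracting multiples of one vector at a time, so that elimination can act on the
  -- first vectors and leave the rest of the witness alone.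
  Span : ∀ {k l} → Vec (V k) l → V k → Set
  Span [] x = ∀ i → x i ≡ 0ℤ
  Span (v ∷ vs) x = ∃ λ a → Span vs (minus x a v)

  Span-resp : ∀ {k l} (vs : Vec (V k) l) {x y} → x ≋ y → Span vs x → Span vs y
  Span-resp [] x≋y x≡0 i = trans (sym (x≋y i)) (x≡0 i)
  Span-resp (v ∷ vs) x≋y (a , s) = a , Span-resp vs (λ i → cong (_- a * v i) (x≋y i)) s

  Span-comb : ∀ {k l} (vs : Vec (V k) l) {x} → Span vs x → ∃ λ a → x ≋ comb vs a
  Span-comb [] x≡0 = (λ ()) , x≡0
  Span-comb (v ∷ vs) {x} (a , s) with Span-comb vs s
  ... | b , eq = a ▹ b , λ i → trans (solve 2 (λ x y → x := y :+ (x :- y)) refl (x i) (a * v i)) (cong (_+_ (a * v i)) (eq i))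

  comb-Span : ∀ {k l} (vs : Vec (V k) l) a → Span vs (comb vs a)
  comb-Span [] a i = refl
  comb-Span (v ∷ vs) a = a zero , Span-resp vs (λ i → solve 2 (λ x y → y := (x :+ y) :- x) refl (a zero * v i) _) (comb-Span vs (tail a))

  UpToSign : ∀ {k} → Λ k → Λ k → Set
  UpToSign f g = f ≈Λ g ⊎ (∀ s → f s ≡ - g s)

  -- Same span and, up to sign, same determinant: both the classes and their expected number stay
  -- fixed during elimination.
  record _∼_ {k l} (us vs : Vec (V k) l) : Set where
    field
      to    : ∀ {x} → Span us x → Span vs x
      from  : ∀ {x} → Span vs x → Span us x
      same  : UpToSign (wedges us) (wedges vs)
  open _∼_

  ∼-trans : ∀ {k l} {us vs ws : Vec (V k) l} → us ∼ vs → vs ∼ ws → us ∼ ws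
  ∼-trans p q = record { to = to q ∘ to p ; from = from p ∘ from q ; same = signs (same p) (same q) }
    where
    signs : ∀ {k} {f g h : Λ k} → UpToSign f g → UpToSign g h → UpToSign f h
    signs (inj₁ p) (inj₁ q) = inj₁ λ s → trans (p s) (q s)
    signs (inj₁ p) (inj₂ q) = inj₂ λ s → trans (p s) (q s)
    signs (inj₂ p) (inj₁ q) = inj₂ λ s → trans (p s) (cong -_ (q s))
    signs (inj₂ p) (inj₂ q) = inj₁ λ s → trans (p s) (trans (cong -_ (q s)) (ℤ.neg-involutive _))

  wedge-neg : ∀ {k} (v : V k) f s → wedge v (λ s → - f s) s ≡ - wedge v f s
  wedge-neg v f s = trans (wedge-cong (λ _ → refl) (λ s → solve 1 (λ x → :- x := con (+ 0) :* x :- x) refl (f s)) s)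
    (trans (wedge-expand v 0ℤ f f s) (solve 1 (λ x → con (+ 0) :* x :- x := :- x) refl (wedge v f s)))

  ∼-∷ : ∀ {k l} v {us vs : Vec (V k) l} → us ∼ vs → (v ∷ us) ∼ (v ∷ vs)
  ∼-∷ v {us} {vs} p = record { to = λ (a , s) → a , to p s ; from = λ (a , s) → a , from p s ; same = signs (same p) }
    where
    signs : UpToSign (wedges us) (wedges vs) → UpToSign (wedge v (wedges us)) (wedge v (wedges vs))
    signs (inj₁ q) = inj₁ (wedge-cong (λ _ → refl) q)
    signs (inj₂ q) = inj₂ λ s → trans (wedge-cong (λ _ → refl) q s) (wedge-neg v (wedges vs) s)

  ∼-head : ∀ {k l} {u v : V k} → u ≋ v → (vs : Vec (V k) l) → (u ∷ vs) ∼ (v ∷ vs)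
  ∼-head u≋v vs = record
    { to = λ {x} (a , s) → a , Span-resp vs (λ i → cong (λ t → x i - a * t) (u≋v i)) s
    ; from = λ {x} (a , s) → a , Span-resp vs (λ i → cong (λ t → x i - a * t) (sym (u≋v i))) s
    ; same = inj₁ (wedge-cong u≋v (λ _ → refl)) }

  -- Replacing `u , v` by `v , u - q v` exchanges the two vectors, whence the sign; the added
  -- multiple of `v` is killed by `wedge-square`.
  ∼-euclid : ∀ {k l} (u v : V k) q (vs : Vec (V k) l) → (u ∷ v ∷ vs) ∼ (v ∷ minus u q v ∷ vs)
  ∼-euclid u v q vs = record
    { to = λ {x} (a , b , s) → b + q * a , a , Span-resp vs
        (λ i → solve 6 (λ x a b q u v → x :- a :* u :- b :* v := x :- (b :+ q :* a) :* v :- a :* (u :- q :* v)) refl (x i) a b q (u i) (v i)) s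
    ; from = λ {x} (c , a , s) → a , c - q * a , Span-resp vs
        (λ i → solve 6 (λ x a c q u v → x :- c :* v :- a :* (u :- q :* v) := x :- a :* u :- (c :- q :* a) :* v) refl (x i) a c q (u i) (v i)) s
    ; same = inj₂ λ s → trans (wedge-anti u v (wedges vs) s) (cong -_ (sym (begin
        wedge v (wedge (minus u q v) W) s
          ≡⟨ wedge-cong (λ _ → refl) (λ s → trans (wedge-cong (λ i → solve 3 (λ u q v → u :- q :* v := con (+ 1) :* u :+ (:- q) :* v) refl (u i) q (v i)) (λ _ → refl) s)
               (wedge-linˡ 1ℤ u (- q) v W s)) s ⟩
        wedge v (lin 1ℤ (wedge u W) (- q) (wedge v W)) s
          ≡⟨ wedge-linʳ v 1ℤ (wedge u W) (- q) (wedge v W) s ⟩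
        1ℤ * wedge v (wedge u W) s + - q * wedge v (wedge v W) s
          ≡⟨ cong (λ t → 1ℤ * wedge v (wedge u W) s + - q * t) (wedge-square v W s) ⟩
        1ℤ * wedge v (wedge u W) s + - q * 0ℤ
          ≡⟨ solve 2 (λ x q → con (+ 1) :* x :+ (:- q) :* con (+ 0) := x) refl (wedge v (wedge u W) s) q ⟩
        wedge v (wedge u W) s ∎)))
    }
    where
    open ≡-Reasoning
    W = wedges vs

  -- The Euclidean algorithm on the first coordinates of two vectors, which ends when one of them is
  -- 0.
  euclid : ∀ {k l} (u v : V (suc k)) (vs : Vec (V (suc k)) l) → Acc _<_ ∣ v zero ∣ →
    ∃₂ λ (u' : V (suc k)) (v' : V k) → (u ∷ v ∷ vs) ∼ (u' ∷ (0ℤ ▹ v') ∷ vs)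
  euclid u v vs (acc rec) with v zero ℤ.≟ 0ℤ
  ... | yes v₀≡0 = u , tail v , ∼-∷ u (∼-head (λ { zero → v₀≡0 ; (suc i) → refl }) vs)
  ... | no v₀≢0 with euclid v (minus u q v) vs (rec smaller)
    where
    instance
      v₀-nonZero : NonZero (v zero)
      v₀-nonZero = ≢-nonZero v₀≢0
    q = u zero / v zero
    smaller : ∣ minus u q v zero ∣ < ∣ v zero ∣
    smaller = subst (λ t → ∣ t ∣ < ∣ v zero ∣) (sym (trans (cong (_- q * v zero) (a≡a%n+[a/n]*n (u zero) (v zero)))
      (solve 2 (λ r t → (r :+ t) :- t := r) refl (+ (u zero % v zero)) (q * v zero)))) (n%d<d (u zero) (v zero))
  ...   | u' , v' , p = u' , v' , ∼-trans (∼-euclid u v (_/_ (u zero) (v zero) {{≢-nonZero v₀≢0}}) vs) p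

  eliminate : ∀ {k l} (vs : Vec (V (suc k)) (suc l)) → ∃₂ λ (v : V (suc k)) (ws : Vec (V k) l) → vs ∼ (v ∷ Vec.map (0ℤ ▹_) ws)
  eliminate (v ∷ []) = v , [] , ∼-head (λ _ → refl) []
  eliminate (u ∷ vs@(_ ∷ _)) with eliminate vs
  ... | v , ws , p with euclid u v (Vec.map (0ℤ ▹_) ws) (<-wellFounded _)
  ...   | u' , v' , q = u' , v' ∷ ws , ∼-trans (∼-∷ u p) q

  -- The difference of the remainders is a multiple of `g` that is smaller than `g` in absolute
  -- value.
  division-unique : ∀ {g r r' q q'} → r < ∣ g ∣ → r' < ∣ g ∣ → + r + q * g ≡ + r' + q' * g → r ≡ r' × q ≡ q'
  division-unique {g} {r} {r'} {q} {q'} r< r'< eq = ℤ.+-injective (r≡r') , sym (ℤ.i-j≡0⇒i≡j q' q q'-q)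
    where
    open ℕ.≤-Reasoning
    difference : (q' - q) * g ≡ + r - + r'
    difference = trans (solve 4 (λ q q' g r' → (q' :- q) :* g := (r' :+ q' :* g) :- (q :* g :+ r')) refl q q' g (+ r'))
      (trans (cong (_- (q * g + + r')) (sym eq)) (solve 4 (λ r q g r' → (r :+ q :* g) :- (q :* g :+ r') := r :- r') refl (+ r) q g (+ r')))
    small : ∣ q' - q ∣ ℕ.* ∣ g ∣ < ∣ g ∣
    small = begin-strict
      ∣ q' - q ∣ ℕ.* ∣ g ∣  ≡⟨ ℤ.abs-* (q' - q) g ⟨
      ∣ (q' - q) * g ∣      ≡⟨ cong ∣_∣ (trans difference (ℤ.m-n≡m⊖n r r')) ⟩
      ∣ r ⊖ r' ∣            ≤⟨ ℤ.∣m⊝n∣≤m⊔n r r' ⟩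
      r ℕ.⊔ r'              <⟨ ℕ.⊔-lub r< r'< ⟩
      ∣ g ∣                 ∎
    k≡0 : ∀ k → k ℕ.* ∣ g ∣ < ∣ g ∣ → k ≡ 0
    k≡0 zero _ = refl
    k≡0 (suc k) lt = ⊥-elim (ℕ.<⇒≱ lt (ℕ.m≤m+n ∣ g ∣ (k ℕ.* ∣ g ∣)))
    q'-q : q' - q ≡ 0ℤ
    q'-q = ℤ.∣i∣≡0⇒i≡0 (k≡0 ∣ q' - q ∣ small)
    r≡r' : + r ≡ + r'
    r≡r' = ℤ.i-j≡0⇒i≡j (+ r) (+ r') (trans (sym difference) (trans (cong (_* g) q'-q) refl))

  -- A numbering of the residue classes with a computable class and chosen representatives, from
  -- which a bijection with `Fin N` can be read off.
  record Transversal {k} (P : V k → Set) (N : ℕ) : Set where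
    field
      class     : V k → Fin N
      rep       : Fin N → V k
      class-rep : ∀ i → class (rep i) ≡ i
      sound     : ∀ x y → class x ≡ class y → P (x ⊝ y)
      complete  : ∀ x y → P (x ⊝ y) → class x ≡ class y

  transversal-⇔ : ∀ {k N} {P Q : V k → Set} → (∀ {x} → P x → Q x) → (∀ {x} → Q x → P x) → Transversal P N → Transversal Q N
  transversal-⇔ P⇒Q Q⇒P T = record
    { class = class ; rep = rep ; class-rep = class-rep ; sound = λ x y eq → P⇒Q (sound x y eq) ; complete = λ x y q → complete x y (Q⇒P q) }
    where open Transversal T

  Span-inject : ∀ {k l} (ws : Vec (V k) l) {x : V (suc k)} → x zero ≡ 0ℤ → Span ws (tail x) → Span (Vec.map (0ℤ ▹_) ws) x
  Span-inject [] x₀ s zero = x₀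
  Span-inject [] x₀ s (suc i) = s i
  Span-inject (w ∷ ws) {x} x₀ (a , s) = a , Span-inject ws (trans (cong (_- a * 0ℤ) x₀) (solve 1 (λ a → con (+ 0) :- a :* con (+ 0) := con (+ 0)) refl a)) s

  Span-project : ∀ {k l} (ws : Vec (V k) l) {x : V (suc k)} → Span (Vec.map (0ℤ ▹_) ws) x → x zero ≡ 0ℤ × Span ws (tail x)
  Span-project [] s = s zero , s ∘ suc
  Span-project (w ∷ ws) {x} (a , s) with Span-project ws s
  ... | x₀ , s' = trans (solve 2 (λ x a → x := x :- a :* con (+ 0)) refl (x zero) a) x₀ , a , s'

  module Extend {k N : ℕ} (v : V (suc k)) (ws : Vec (V k) k) (v₀≢0 : v zero ≢ 0ℤ) (T : Transversal (Span ws) N) where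
    open Transversal T
    private
      g = v zero
      instance
        g-nonZero : NonZero g
        g-nonZero = ≢-nonZero v₀≢0

    remainder : V (suc k) → V k
    remainder x i = x (suc i) - x zero / g * v (suc i)

    -- The family is triangular: divide the first coordinate by `g`, subtract the quotient times
    -- `v`, and classify what remains modulo `ws`. The remainder and this class together number the
    -- residue classes.
    class′ : V (suc k) → Fin (∣ g ∣ ℕ.* N)
    class′ x = combine (fromℕ< (n%d<d (x zero) g)) (class (remainder x))

    rep′ : Fin (∣ g ∣ ℕ.* N) → V (suc k)
    rep′ i = + toℕ (proj₁ (remQuot {∣ g ∣} N i)) ▹ rep (proj₂ (remQuot {∣ g ∣} N i))

    divMod : ∀ x → x ≡ + (x % g) + (x / g) * g
    divMod x = a≡a%n+[a/n]*n x g

    family : Vec (V (suc k)) (suc k)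
    family = v ∷ Vec.map (0ℤ ▹_) ws

    Span-0 : ∀ {x} → (∀ i → x i ≡ 0ℤ) → Span ws x
    Span-0 x≡0 = Span-resp ws (λ i → trans (zeros ws i) (sym (x≡0 i))) (comb-Span ws (λ _ → 0ℤ))
      where
      zeros : ∀ {l} (ws : Vec (V k) l) i → comb ws (λ _ → 0ℤ) i ≡ 0ℤ
      zeros [] i = refl
      zeros (w ∷ ws) i = trans (cong (_+ comb ws (λ _ → 0ℤ) i) (ℤ.*-zeroˡ (w i))) (trans (ℤ.+-identityˡ _) (zeros ws i))

    extend : Transversal (Span family) (∣ g ∣ ℕ.* N)
    extend = record { class = class′ ; rep = rep′ ; class-rep = class-rep′ ; sound = sound′ ; complete = complete′ }
      where
      class-rep′ : ∀ i → class′ (rep′ i) ≡ i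
      class-rep′ i = trans (cong₂ (combine {∣ g ∣}) first second) (Fin.combine-remQuot {∣ g ∣} N i)
        where
        r = proj₁ (remQuot {∣ g ∣} N i)
        unique : (+ toℕ r) % g ≡ toℕ r × (+ toℕ r) / g ≡ 0ℤ
        unique = division-unique (n%d<d (+ toℕ r) g) (Fin.toℕ<n r)
          (trans (sym (divMod (+ toℕ r))) (solve 2 (λ r g → r := r :+ con (+ 0) :* g) refl (+ toℕ r) g))
        first : fromℕ< (n%d<d (+ toℕ r) g) ≡ r
        first = Fin.toℕ-injective (trans (Fin.toℕ-fromℕ< _) (proj₁ unique))
        second : class (remainder (rep′ i)) ≡ proj₂ (remQuot {∣ g ∣} N i)
        second = trans (complete (remainder (rep′ i)) (rep (proj₂ (remQuot {∣ g ∣} N i))) (Span-0 λ j → trans (cong (λ q → rep (proj₂ (remQuot {∣ g ∣} N i)) j - q * v (suc j) - rep (proj₂ (remQuot {∣ g ∣} N i)) j) (proj₂ unique))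
            (solve 2 (λ x v → x :- con (+ 0) :* v :- x := con (+ 0)) refl (rep (proj₂ (remQuot {∣ g ∣} N i)) j) (v (suc j)))))
          (class-rep _)
      sound′ : ∀ x y → class′ x ≡ class′ y → Span family (x ⊝ y)
      sound′ x y eq with Fin.combine-injective (fromℕ< (n%d<d (x zero) g)) (class (remainder x)) (fromℕ< (n%d<d (y zero) g)) (class (remainder y)) eq
      ... | r≡ , c≡ = qx - qy , Span-inject ws first (Span-resp ws later (sound _ _ c≡))
        where
        qx = x zero / g
        qy = y zero / g
        same-remainder : x zero % g ≡ y zero % g
        same-remainder = trans (sym (Fin.toℕ-fromℕ< _)) (trans (cong toℕ r≡) (Fin.toℕ-fromℕ< _))
        first : x zero - y zero - (qx - qy) * g ≡ 0ℤ
        first = trans (cong₂ (λ a b → a - b - (qx - qy) * g) (divMod (x zero)) (trans (divMod (y zero)) (cong (λ r → + r + qy * g) (sym same-remainder))))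
          (solve 4 (λ r p q g → (r :+ p :* g) :- (r :+ q :* g) :- (p :- q) :* g := con (+ 0)) refl (+ (x zero % g)) qx qy g)
        later : remainder x ⊝ remainder y ≋ tail (minus (x ⊝ y) (qx - qy) v)
        later i = solve 5 (λ x y p q v → (x :- p :* v) :- (y :- q :* v) := x :- y :- (p :- q) :* v) refl (x (suc i)) (y (suc i)) qx qy (v (suc i))
      complete′ : ∀ x y → Span family (x ⊝ y) → class′ x ≡ class′ y
      complete′ x y (a , s) with Span-project ws s
      ... | first , later = cong₂ (combine {∣ g ∣}) (Fin.toℕ-injective (trans (Fin.toℕ-fromℕ< _) (trans (proj₁ unique) (sym (Fin.toℕ-fromℕ< _)))))
          (complete (remainder x) (remainder y) (Span-resp ws shifted later))
        where
        qx = x zero / g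
        qy = y zero / g
        unique : x zero % g ≡ y zero % g × qx ≡ qy + a
        unique = division-unique (n%d<d (x zero) g) (n%d<d (y zero) g) (trans (sym (divMod (x zero))) (trans
          (solve 3 (λ x y t → x := (x :- y :- t) :+ (y :+ t)) refl (x zero) (y zero) (a * g))
          (trans (cong (_+ (y zero + a * g)) first) (trans (ℤ.+-identityˡ _) (trans (cong (_+ a * g) (divMod (y zero)))
            (solve 4 (λ r q a g → r :+ q :* g :+ a :* g := r :+ (q :+ a) :* g) refl (+ (y zero % g)) qy a g))))))
        shifted : tail (minus (x ⊝ y) a v) ≋ remainder x ⊝ remainder y
        shifted i = trans (solve 5 (λ x y a q v → x :- y :- a :* v := (x :- (q :+ a) :* v) :- (y :- q :* v)) refl (x (suc i)) (y (suc i)) a qy (v (suc i)))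
          (cong (λ q → (x (suc i) - q * v (suc i)) - remainder y i) (sym (proj₂ unique)))

  ∣UpToSign∣ : ∀ {k} {f g : Λ k} → UpToSign f g → ∀ s → ∣ f s ∣ ≡ ∣ g s ∣
  ∣UpToSign∣ (inj₁ p) s = cong ∣_∣ (p s)
  ∣UpToSign∣ {g = g} (inj₂ p) s = trans (cong ∣_∣ (p s)) (ℤ.∣-i∣≡∣i∣ (g s))

  -- After elimination the determinant is, up to sign, the pivot times a smaller determinant, and
  -- `Extend` multiplies the number of classes by the absolute value of the same pivot.
  transversal : ∀ {k} (vs : Vec (V k) k) → ∣ wedges vs top ∣ ≢ 0 → Transversal (Span vs) ∣ wedges vs top ∣
  transversal {zero} [] _ = record
    { class = λ _ → zero ; rep = λ _ () ; class-rep = λ { zero → refl } ; sound = λ _ _ _ () ; complete = λ _ _ _ → refl }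
  transversal {suc k} vs det≢0 with eliminate vs
  ... | v , ws , p = transversal-⇔ (from p) (to p) (subst (Transversal _) (sym det≡)
        (Extend.extend v ws v₀≢0 (transversal ws ws≢0)))
    where
    det≡ : ∣ wedges vs top ∣ ≡ ∣ v zero ∣ ℕ.* ∣ wedges ws top ∣
    det≡ = trans (∣UpToSign∣ (same p) top) (trans (cong ∣_∣ expand) (ℤ.abs-* (v zero) (wedges ws top)))
      where
      expand : wedges (v ∷ Vec.map (0ℤ ▹_) ws) top ≡ v zero * wedges ws top
      expand = trans (cong₂ (λ a b → v zero * a - b) (trans (map-tail (0ℤ ▹_) ws top) (map-id ws top)) (wedge-zeroʳ (tail v) (wedges-true (0ℤ ▹_) (λ _ → refl) ws) top))
        (ℤ.+-identityʳ _)
    v₀≢0 : v zero ≢ 0ℤ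
    v₀≢0 v₀≡0 = det≢0 (trans det≡ (cong (λ t → ∣ t ∣ ℕ.* ∣ wedges ws top ∣) v₀≡0))
    ws≢0 : ∣ wedges ws top ∣ ≢ 0
    ws≢0 ws≡0 = det≢0 (trans det≡ (trans (cong (∣ v zero ∣ ℕ.*_) ws≡0) (ℕ.*-zeroʳ ∣ v zero ∣)))

  cokernel : ∀ {k} {L : V k → V k} → Linear L → ∣ det L ∣ ≢ 0 → Transversal (λ x → ∃ λ v → x ≋ L v) ∣ det L ∣
  cokernel {L = L} lL det≢0 = transversal-⇔
    (λ s → let a , eq = Span-comb (Vec.map L basis) s in a , λ i → trans (eq i) (comb-linear lL a i))
    (λ (v , eq) → Span-resp (Vec.map L basis) (λ i → trans (comb-linear lL v i) (sym (eq i))) (comb-Span (Vec.map L basis) v))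
    (transversal (Vec.map L basis) det≢0)

-- Firing, allowed configurations and recurrence

module Sandpile where
  open import Defs
  open EdgeSums using (∈-vertices; bit)
  open import Data.Bool.Base using (Bool; true; false; _∧_; not)
  open import Data.Empty using (⊥; ⊥-elim)
  open import Data.Fin.Base using (Fin; zero; suc; toℕ)
  import Data.Fin.Properties as Fin
  open import Data.Integer.Base using (ℤ; +_; 0ℤ; 1ℤ; _+_; _*_; -_; _-_; _≤_; _<_; ∣_∣; +≤+)
  import Data.Integer.Properties as ℤ
  open import Data.Integer.Solver using (module +-*-Solver)
  open +-*-Solver
  open import Data.List.Base using (List; []; _∷_)
  open import Data.List.Membership.Propositional using (_∈_)
  open import Data.List.Relation.Unary.Any using (here; there)
  open import Data.List.Relation.Unary.All as All using (All; []; _∷_)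
  open import Data.Nat.Base as ℕ using (ℕ; zero; suc; z≤n; s≤s)
  import Data.Nat.Properties as ℕ
  open import Data.Product.Base using (∃-syntax; _×_; _,_; proj₁; proj₂; ∃)
  open import Data.Sum.Base using (_⊎_; inj₁; inj₂)
  open import Function.Base using (_∘_)
  open import Induction.WellFounded using (Acc; acc)
  open import Data.Nat.Induction using (<-wellFounded)
  open import Relation.Binary.Construct.Closure.ReflexiveTransitive using (Star; ε; _◅_)
  open import Relation.Binary.PropositionalEquality
  open import Relation.Nullary.Decidable using (yes; no; does; dec-true; dec-false)
  open import Relation.Nullary.Negation using (¬_)

  0≤-difference : ∀ {x y} → x ≤ y → 0ℤ ≤ y - x
  0≤-difference = ℤ.i≤j⇒0≤j-i

  by-difference : ∀ {x y d} → 0ℤ ≤ d → y ≡ x + d → x ≤ y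
  by-difference {x} {y} {d} 0≤d y≡ = ℤ.0≤i-j⇒j≤i (subst (0ℤ ≤_) (trans (solve 2 (λ x d → d := x :+ d :- x) refl x d) (cong (_- x) (sym y≡))) 0≤d)

  0≤+ : ∀ {x y} → 0ℤ ≤ x → 0ℤ ≤ y → 0ℤ ≤ x + y
  0≤+ = ℤ.+-mono-≤ {0ℤ} {_} {0ℤ}

  -- The sum of the values at the neighbours in a path.
  line : ∀ {p} → (Fin p → ℤ) → Fin p → ℤ
  line {suc zero} f zero = 0ℤ
  line {suc (suc p)} f zero = f (suc zero)
  line {suc (suc p)} f (suc zero) = f zero + line (f ∘ suc) zero
  line {suc (suc p)} f (suc (suc i)) = line (f ∘ suc) (suc i)

  line-cong : ∀ {p} {f g : Fin p → ℤ} → f ≗ g → line f ≗ line g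
  line-cong {suc zero} f≗g zero = refl
  line-cong {suc (suc p)} f≗g zero = f≗g (suc zero)
  line-cong {suc (suc p)} f≗g (suc zero) = cong₂ _+_ (f≗g zero) (line-cong (f≗g ∘ suc) zero)
  line-cong {suc (suc p)} f≗g (suc (suc i)) = line-cong (f≗g ∘ suc) (suc i)

  line-lin : ∀ {p} a (f : Fin p → ℤ) b g i → line (λ i → a * f i + b * g i) i ≡ a * line f i + b * line g i
  line-lin {suc zero} a f b g zero = solve 2 (λ a b → con 0ℤ := a :* con 0ℤ :+ b :* con 0ℤ) refl a b
  line-lin {suc (suc p)} a f b g zero = refl
  line-lin {suc (suc p)} a f b g (suc zero) = trans (cong (λ t → a * f zero + b * g zero + t) (line-lin a (f ∘ suc) b (g ∘ suc) zero))
    (solve 6 (λ a b x y z w → a :* x :+ b :* y :+ (a :* z :+ b :* w) := a :* (x :+ z) :+ b :* (y :+ w)) refl a b (f zero) (g zero) _ _)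
  line-lin {suc (suc p)} a f b g (suc (suc i)) = line-lin a (f ∘ suc) b (g ∘ suc) (suc i)

  line-mono : ∀ {p} {f g : Fin p → ℤ} → (∀ i → f i ≤ g i) → ∀ i → line f i ≤ line g i
  line-mono {suc zero} f≤g zero = ℤ.≤-refl
  line-mono {suc (suc p)} f≤g zero = f≤g (suc zero)
  line-mono {suc (suc p)} f≤g (suc zero) = ℤ.+-mono-≤ (f≤g zero) (line-mono (f≤g ∘ suc) zero)
  line-mono {suc (suc p)} f≤g (suc (suc i)) = line-mono (f≤g ∘ suc) (suc i)

  line-1≤2 : ∀ {p} (i : Fin p) → line (λ _ → 1ℤ) i ≤ + 2
  line-1≤2 {suc zero} zero = +≤+ z≤n
  line-1≤2 {suc (suc p)} zero = +≤+ (s≤s z≤n)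
  line-1≤2 {suc (suc zero)} (suc zero) = +≤+ (s≤s z≤n)
  line-1≤2 {suc (suc (suc p))} (suc zero) = +≤+ (s≤s (s≤s z≤n))
  line-1≤2 {suc (suc p)} (suc (suc i)) = line-1≤2 {suc p} (suc i)

  indicator : Bool → ℤ
  indicator b = + bit b

  link : ℕ → ℤ
  link k = indicator (does (k ℕ.≟ 1))

  line-0 : ∀ {p} (i : Fin p) → line (λ _ → 0ℤ) i ≡ 0ℤ
  line-0 {suc zero} zero = refl
  line-0 {suc (suc p)} zero = refl
  line-0 {suc (suc p)} (suc zero) = trans (ℤ.+-identityˡ _) (line-0 {suc p} zero)
  line-0 {suc (suc p)} (suc (suc i)) = line-0 {suc p} (suc i)

  line-point : ∀ {p} (a i : Fin p) → line (λ i → indicator (does (a Fin.≟ i))) i ≡ link ℕ.∣ toℕ a - toℕ i ∣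
  line-point {suc zero} zero zero = refl
  line-point {suc (suc p)} zero zero = refl
  line-point {suc (suc p)} (suc zero) zero = refl
  line-point {suc (suc p)} (suc (suc a)) zero = refl
  line-point {suc (suc p)} zero (suc zero) = cong (_+_ 1ℤ) (line-0 {suc p} zero)
  line-point {suc (suc p)} zero (suc (suc i)) = line-0 {suc p} (suc i)
  line-point {suc (suc p)} (suc a) (suc zero) = trans (ℤ.+-identityˡ _) (line-point a zero)
  line-point {suc (suc p)} (suc a) (suc (suc i)) = line-point a (suc i)

  module _ {p q : ℕ} where
    Field : Set
    Field = Vertex p q → ℤ

    neighbours : Field → Field
    neighbours σ (a , b) = line (λ a → σ (a , b)) a + line (λ b → σ (a , b)) b

    -- The reduced Laplacian: the diagonal is 4 at every vertex, since the edges to the sink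
    -- complete the degree.
    laplacian : Field → Field
    laplacian σ v = + 4 * σ v - neighbours σ v

    neighbours-cong : ∀ {σ τ} → σ ≗ τ → neighbours σ ≗ neighbours τ
    neighbours-cong σ≗τ (a , b) = cong₂ _+_ (line-cong (λ a → σ≗τ (a , b)) a) (line-cong (λ b → σ≗τ (a , b)) b)

    neighbours-lin : ∀ x σ y τ v → neighbours (λ v → x * σ v + y * τ v) v ≡ x * neighbours σ v + y * neighbours τ v
    neighbours-lin x σ y τ (a , b) = trans (cong₂ _+_ (line-lin x _ y _ a) (line-lin x _ y _ b))
      (solve 6 (λ x y r s t u → x :* r :+ y :* s :+ (x :* t :+ y :* u) := x :* (r :+ t) :+ y :* (s :+ u)) refl x y _ _ _ _)

    laplacian-cong : ∀ {σ τ} → σ ≗ τ → laplacian σ ≗ laplacian τ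
    laplacian-cong σ≗τ v = cong₂ (λ x y → + 4 * x - y) (σ≗τ v) (neighbours-cong σ≗τ v)

    laplacian-lin : ∀ x σ y τ v → laplacian (λ v → x * σ v + y * τ v) v ≡ x * laplacian σ v + y * laplacian τ v
    laplacian-lin x σ y τ v = trans (cong (λ t → + 4 * (x * σ v + y * τ v) - t) (neighbours-lin x σ y τ v))
      (solve 6 (λ x y r s t u → con (+ 4) :* (x :* r :+ y :* s) :- (x :* t :+ y :* u) := x :* (con (+ 4) :* r :- t) :+ y :* (con (+ 4) :* s :- u)) refl
        x y (σ v) (τ v) _ _)

    laplacian-neg : ∀ σ v → laplacian (λ v → - σ v) v ≡ - laplacian σ v
    laplacian-neg σ v = begin
      laplacian (λ v → - σ v) v                     ≡⟨ laplacian-cong (λ v → solve 1 (λ s → :- s := (:- con 1ℤ) :* s :+ con 0ℤ :* s) refl (σ v)) v ⟩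
      laplacian (λ v → - 1ℤ * σ v + 0ℤ * σ v) v     ≡⟨ laplacian-lin (- 1ℤ) σ 0ℤ σ v ⟩
      - 1ℤ * laplacian σ v + 0ℤ * laplacian σ v     ≡⟨ solve 1 (λ l → (:- con 1ℤ) :* l :+ con 0ℤ :* l := :- l) refl (laplacian σ v) ⟩
      - laplacian σ v                               ∎
      where open ≡-Reasoning

    laplacian-minus : ∀ σ τ v → laplacian (λ v → σ v - τ v) v ≡ laplacian σ v - laplacian τ v
    laplacian-minus σ τ v = begin
      laplacian (λ v → σ v - τ v) v                 ≡⟨ laplacian-cong (λ v → solve 2 (λ s t → s :- t := con 1ℤ :* s :+ (:- con 1ℤ) :* t) refl (σ v) (τ v)) v ⟩
      laplacian (λ v → 1ℤ * σ v + - 1ℤ * τ v) v     ≡⟨ laplacian-lin 1ℤ σ (- 1ℤ) τ v ⟩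
      1ℤ * laplacian σ v + - 1ℤ * laplacian τ v     ≡⟨ solve 2 (λ s t → con 1ℤ :* s :+ (:- con 1ℤ) :* t := s :- t) refl (laplacian σ v) (laplacian τ v) ⟩
      laplacian σ v - laplacian τ v                 ∎
      where open ≡-Reasoning

    laplacian-scale : ∀ k σ v → laplacian (λ v → k * σ v) v ≡ k * laplacian σ v
    laplacian-scale k σ v = begin
      laplacian (λ v → k * σ v) v                   ≡⟨ laplacian-cong (λ v → solve 2 (λ k s → k :* s := k :* s :+ con 0ℤ :* s) refl k (σ v)) v ⟩
      laplacian (λ v → k * σ v + 0ℤ * σ v) v        ≡⟨ laplacian-lin k σ 0ℤ σ v ⟩
      k * laplacian σ v + 0ℤ * laplacian σ v        ≡⟨ solve 2 (λ k l → k :* l :+ con 0ℤ :* l := k :* l) refl k (laplacian σ v) ⟩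
      k * laplacian σ v                             ∎
      where open ≡-Reasoning

    laplacian-0 : ∀ {σ} → (∀ v → σ v ≡ 0ℤ) → ∀ v → laplacian σ v ≡ 0ℤ
    laplacian-0 σ≡0 v = trans (laplacian-cong σ≡0 v) (cong₂ (λ a b → + 4 * 0ℤ - (a + b)) (line-0 (proj₁ v)) (line-0 (proj₂ v)))

    neighbours-mono : ∀ {σ τ} → (∀ v → σ v ≤ τ v) → ∀ v → neighbours σ v ≤ neighbours τ v
    neighbours-mono σ≤τ (a , b) = ℤ.+-mono-≤ (line-mono (λ a → σ≤τ (a , b)) a) (line-mono (λ b → σ≤τ (a , b)) b)

    neighbours-0≤ : ∀ {σ} → (∀ v → 0ℤ ≤ σ v) → ∀ v → 0ℤ ≤ neighbours σ v
    neighbours-0≤ {σ} 0≤σ v@(a , b) = subst (_≤ neighbours σ v) (cong₂ _+_ (line-0 a) (line-0 b)) (neighbours-mono 0≤σ v)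

    degree≤4 : ∀ v → neighbours (λ _ → 1ℤ) v ≤ + 4
    degree≤4 (a , b) = ℤ.+-mono-≤ (line-1≤2 a) (line-1≤2 b)

    point : Vertex p q → Field
    point v w = indicator (does (v ≟ᵥ w))

    ≟ᵥ-does : ∀ (a : Fin p) (b : Fin q) (a' : Fin p) (b' : Fin q) → does ((a , b) ≟ᵥ (a' , b')) ≡ does (a Fin.≟ a') ∧ does (b Fin.≟ b')
    ≟ᵥ-does a b a' b' with a Fin.≟ a'
    ... | no _ = refl
    ... | yes refl with b Fin.≟ b'
    ...   | yes _ = refl
    ...   | no _ = refl

    indicator-∧ : ∀ a b → indicator (a ∧ b) ≡ indicator a * indicator b
    indicator-∧ true b = sym (ℤ.*-identityˡ _)
    indicator-∧ false b = refl

    distance-0 : ∀ {n} (a b : Fin n) → does (a Fin.≟ b) ≡ does (ℕ.∣ toℕ a - toℕ b ∣ ℕ.≟ 0)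
    distance-0 a b with a Fin.≟ b
    ... | yes refl = sym (dec-true (ℕ.∣ toℕ a - toℕ a ∣ ℕ.≟ 0) (ℕ.∣n-n∣≡0 (toℕ a)))
    ... | no a≢b = sym (dec-false (ℕ.∣ toℕ a - toℕ b ∣ ℕ.≟ 0) (λ eq → a≢b (Fin.toℕ-injective (ℕ.∣m-n∣≡0⇒m≡n eq))))

    -- Distance 1 in the grid means distance 1 in one coordinate and 0 in the other.
    neighbours-point : ∀ v w → neighbours (point v) w ≡ indicator (does (adjacent? v w))
    neighbours-point (a , b) (a' , b') = begin
      line (λ i → point (a , b) (i , b')) a' + line (λ j → point (a , b) (a' , j)) b'
        ≡⟨ cong₂ _+_ (trans (line-cong (λ i → split i b') a') (scaled a' (λ i → indicator (does (a Fin.≟ i))) (indicator (does (b Fin.≟ b')))))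
                     (trans (line-cong (λ j → trans (split a' j) (ℤ.*-comm (indicator (does (a Fin.≟ a'))) _)) b') (scaled b' (λ j → indicator (does (b Fin.≟ j))) (indicator (does (a Fin.≟ a'))))) ⟩
      line (λ i → indicator (does (a Fin.≟ i))) a' * indicator (does (b Fin.≟ b')) + line (λ j → indicator (does (b Fin.≟ j))) b' * indicator (does (a Fin.≟ a'))
        ≡⟨ cong₂ _+_ (cong₂ _*_ (line-point a a') (cong indicator (distance-0 b b'))) (cong₂ _*_ (line-point b b') (cong indicator (distance-0 a a'))) ⟩
      link x * indicator (does (y ℕ.≟ 0)) + link y * indicator (does (x ℕ.≟ 0))
        ≡⟨ combine x y ⟩
      indicator (does (x ℕ.+ y ℕ.≟ 1)) ∎
      where
      open ≡-Reasoning
      x = ℕ.∣ toℕ a - toℕ a' ∣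
      y = ℕ.∣ toℕ b - toℕ b' ∣
      split : ∀ i j → point (a , b) (i , j) ≡ indicator (does (a Fin.≟ i)) * indicator (does (b Fin.≟ j))
      split i j = trans (cong indicator (≟ᵥ-does a b i j)) (indicator-∧ (does (a Fin.≟ i)) (does (b Fin.≟ j)))
      scaled : ∀ {n} i (f : Fin n → ℤ) c → line (λ i → f i * c) i ≡ line f i * c
      scaled i f c = trans (line-cong (λ i → solve 2 (λ f c → f :* c := c :* f :+ con 0ℤ :* con 0ℤ) refl (f i) c) i)
        (trans (line-lin c f 0ℤ (λ _ → 0ℤ) i) (solve 3 (λ c x y → c :* x :+ con 0ℤ :* y := x :* c) refl c (line f i) (line (λ _ → 0ℤ) i)))
      combine : ∀ x y → link x * indicator (does (y ℕ.≟ 0)) + link y * indicator (does (x ℕ.≟ 0)) ≡ indicator (does (x ℕ.+ y ℕ.≟ 1))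
      combine zero zero = refl
      combine zero (suc zero) = refl
      combine zero (suc (suc y)) = refl
      combine (suc zero) zero = refl
      combine (suc zero) (suc zero) = refl
      combine (suc zero) (suc (suc y)) = refl
      combine (suc (suc x)) zero = refl
      combine (suc (suc x)) (suc zero) = refl
      combine (suc (suc x)) (suc (suc y)) = refl

    not-self-adjacent : ∀ v → ¬ Adjacent {p} {q} v v
    not-self-adjacent v eq with () ← trans (sym (cong₂ ℕ._+_ (ℕ.∣n-n∣≡0 (toℕ (proj₁ v))) (ℕ.∣n-n∣≡0 (toℕ (proj₂ v))))) eq

    fire-laplacian : ∀ v (c : Config p q) → 4 ℕ.≤ c v → ∀ w → + fire v c w ≡ + c w - laplacian (point v) w
    fire-laplacian v c 4≤c w rewrite neighbours-point v w with v ≟ᵥ w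
    ... | yes refl rewrite dec-false (adjacent? v v) (not-self-adjacent v) = sym (ℤ.⊖-≥ 4≤c)
    ... | no _ with does (adjacent? v w)
    ...   | true = refl
    ...   | false = sym (ℤ.+-identityʳ _)

  decide : ∀ {n} {P Q : Fin n → Set} → (∀ i → P i ⊎ Q i) → (∀ i → P i) ⊎ ∃ Q
  decide {zero} d = inj₁ λ ()
  decide {suc n} d with d zero | decide (d ∘ suc)
  ... | inj₂ q | _ = inj₂ (zero , q)
  ... | inj₁ p | inj₁ ps = inj₁ λ { zero → p ; (suc i) → ps i }
  ... | inj₁ p | inj₂ (i , q) = inj₂ (suc i , q)

  truth : ∀ b → b ≡ false ⊎ b ≡ true
  truth false = inj₁ refl
  truth true = inj₂ refl

  total : {A : Set} → (A → ℕ) → List A → ℕ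
  total σ [] = 0
  total σ (x ∷ xs) = σ x ℕ.+ total σ xs

  total-mono : ∀ {A : Set} {σ τ : A → ℕ} → (∀ v → σ v ℕ.≤ τ v) → ∀ xs → total σ xs ℕ.≤ total τ xs
  total-mono σ≤τ [] = z≤n
  total-mono σ≤τ (x ∷ xs) = ℕ.+-mono-≤ (σ≤τ x) (total-mono σ≤τ xs)

  total-< : ∀ {A : Set} {σ τ : A → ℕ} → (∀ v → σ v ℕ.≤ τ v) → ∀ {v xs} → v ∈ xs → σ v ℕ.< τ v → total σ xs ℕ.< total τ xs
  total-< σ≤τ {xs = x ∷ xs} (here refl) lt = ℕ.+-mono-<-≤ lt (total-mono σ≤τ xs)
  total-< σ≤τ {xs = x ∷ xs} (there v∈) lt = ℕ.+-mono-≤-< (σ≤τ x) (total-< σ≤τ v∈ lt)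

  lower : {A : Set} → (A → Bool) → (A → ℕ) → A → ℕ
  lower W σ w = σ w ℕ.∸ bit (W w)

  lower-≤ : ∀ {A : Set} W (σ : A → ℕ) w → lower W σ w ℕ.≤ σ w
  lower-≤ W σ w = ℕ.m∸n≤m (σ w) (bit (W w))

  lower-< : ∀ {A : Set} W (σ : A → ℕ) w → W w ≡ true → 1 ℕ.≤ σ w → lower W σ w ℕ.< σ w
  lower-< W σ w Ww 1≤σ rewrite Ww with suc k ← σ w = ℕ.≤-refl

  lower-ℤ : ∀ {A : Set} W (σ : A → ℕ) → (∀ w → W w ≡ true → 1 ℕ.≤ σ w) → ∀ w → + lower W σ w ≡ + σ w - indicator (W w)
  lower-ℤ W σ 1≤σ w with W w in eq
  ... | true = sym (ℤ.⊖-≥ (1≤σ w eq))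
  ... | false = sym (ℤ.+-identityʳ _)

  module _ {p q : ℕ} where
    search : {P Q : Vertex p q → Set} → (∀ v → P v ⊎ Q v) → (∀ v → P v) ⊎ ∃ Q
    search d with decide (λ a → decide (λ b → d (a , b)))
    ... | inj₁ ps = inj₁ λ (a , b) → ps a b
    ... | inj₂ (a , b , q) = inj₂ ((a , b) , q)

    -- The absence of forbidden subconfigurations.
    Allowed : Field → Set
    Allowed x = ∀ (U : Vertex p q → Bool) → ∃[ v ] U v ≡ true → ∃[ v ] (U v ≡ true × neighbours (indicator ∘ U) v ≤ x v)

    Allowed-cong : ∀ {x y} → x ≗ y → Allowed x → Allowed y
    Allowed-cong x≗y allowed U ne with allowed U ne
    ... | v , Uv , le = v , Uv , ℤ.≤-trans le (ℤ.≤-reflexive (x≗y v))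

    indicator≤1 : ∀ b → indicator b ≤ 1ℤ
    indicator≤1 true = ℤ.≤-refl
    indicator≤1 false = +≤+ z≤n

    allowed-large : ∀ x → (∀ v → + 4 ≤ x v) → Allowed x
    allowed-large x 4≤x U (v , Uv) = v , Uv , ℤ.≤-trans (ℤ.≤-trans (neighbours-mono (λ w → indicator≤1 (U w)) v) (degree≤4 v)) (4≤x v)

    ∧-not : ∀ a b → a ∧ not b ≡ true → a ≡ true × b ≡ false
    ∧-not true false _ = refl , refl

    -- If `U` lies in `W`, independence leaves its vertices without neighbours in `U`, and at least
    -- 0 grains remain after firing. Otherwise some vertex of `U` outside `W` has enough grains for
    -- its neighbours in the difference of `U` and `W`; firing gives it one grain from each
    -- neighbour in `W`, which makes up for those left out.
    allowed-fire : ∀ {x} W → Allowed x → (∀ v → W v ≡ true → + 4 ≤ x v) → (∀ v → W v ≡ true → neighbours (indicator ∘ W) v ≡ 0ℤ) →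
      Allowed (λ w → x w - laplacian (indicator ∘ W) w)
    allowed-fire {x} W allowed unstable independent U (u , Uu) with search (λ v → truth (U v ∧ not (W v)))
    ... | inj₁ U⊆W = u , Uu , by-difference {d = (x u - + 4) + (nW - nU)} (0≤+ (0≤-difference (unstable u Wu)) (0≤-difference (neighbours-mono mono u)))
          (trans (cong (λ i → x u - (+ 4 * indicator i - nW)) Wu)
            (trans (cong (λ n → x u - (+ 4 * 1ℤ - n)) (independent u Wu))
              (trans (solve 2 (λ x u → x :- (con (+ 4) :* con 1ℤ :- con 0ℤ) := u :+ (x :- con (+ 4) :+ (con 0ℤ :- u))) refl (x u) nU)
                (cong (λ n → nU + (x u - + 4 + (n - nU))) (sym (independent u Wu))))))
      where
      nU = neighbours (indicator ∘ U) u
      nW = neighbours (indicator ∘ W) u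
      inside : ∀ v → U v ≡ true → W v ≡ true
      inside v Uv with W v | U⊆W v
      ... | true | _ = refl
      ... | false | eq rewrite Uv with () ← eq
      Wu = inside u Uu
      mono : ∀ v → indicator (U v) ≤ indicator (W v)
      mono v with U v in eq
      ... | true rewrite inside v eq = ℤ.≤-refl
      ... | false = +≤+ z≤n
    ... | inj₂ (v , UWv) with allowed (λ v → U v ∧ not (W v)) (v , UWv)
    ...   | w , UWw , le = w , Uw , by-difference {d = (x w - nUW) + ((1ℤ * nUW + 1ℤ * nW) - nU)}
            (0≤+ (0≤-difference le) (0≤-difference (subst (nU ≤_) (neighbours-lin 1ℤ (λ v → indicator (U v ∧ not (W v))) 1ℤ (indicator ∘ W) w) (neighbours-mono cover w))))
            (trans (cong (λ i → x w - (+ 4 * indicator i - nW)) ¬Ww)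
              (solve 4 (λ x a b u → x :- (con (+ 4) :* con 0ℤ :- b) := u :+ ((x :- a) :+ ((con 1ℤ :* a :+ con 1ℤ :* b) :- u))) refl (x w) nUW nW nU))
      where
      nU = neighbours (indicator ∘ U) w
      nW = neighbours (indicator ∘ W) w
      nUW = neighbours (λ v → indicator (U v ∧ not (W v))) w
      Uw : U w ≡ true
      Uw = proj₁ (∧-not (U w) (W w) UWw)
      ¬Ww : W w ≡ false
      ¬Ww = proj₂ (∧-not (U w) (W w) UWw)
      cover : ∀ v → indicator (U v) ≤ 1ℤ * indicator (U v ∧ not (W v)) + 1ℤ * indicator (W v)
      cover v with U v | W v
      ... | true | true = ℤ.≤-refl
      ... | true | false = ℤ.≤-refl
      ... | false | true = +≤+ z≤n
      ... | false | false = ℤ.≤-refl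

    argmax : (f : Field) (v : Vertex p q) → ∃[ u ] (f v ≤ f u × ∀ w → f w ≤ f u)
    argmax f v with go (vertices p q)
      where
      go : ∀ xs → ∃[ u ] (f v ≤ f u × All (λ w → f w ≤ f u) xs)
      go [] = v , ℤ.≤-refl , []
      go (x ∷ xs) with go xs
      ... | u , v≤u , ws with ℤ.≤-total (f x) (f u)
      ...   | inj₁ x≤u = u , v≤u , x≤u ∷ ws
      ...   | inj₂ u≤x = x , ℤ.≤-trans v≤u u≤x , ℤ.≤-refl ∷ All.map (λ w≤u → ℤ.≤-trans w≤u u≤x) ws
    ... | u , v≤u , ws = u , v≤u , λ w → All.lookup ws (∈-vertices w)

    level : Field → ℤ → Vertex p q → Bool
    level σ s w = does (σ w ℤ.≟ s)

    -- Neighbours on the top level contribute `s` and the others at most `s - 1`, so `σ` is bounded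
    -- by `s - 1` plus the indicator of the level. A vertex has at most 4 neighbours, so
    -- `(s - 1) (4 - deg)` is nonnegative.
    laplacian-max : ∀ σ v → (∀ w → σ w ≤ σ v) → 1ℤ ≤ σ v → + 4 - neighbours (indicator ∘ level σ (σ v)) v ≤ laplacian σ v
    laplacian-max σ v max 1≤σ = by-difference {d = (s - 1ℤ) * (+ 4 - deg) + (((s - 1ℤ) * deg + 1ℤ * nU) - nσ)}
      (0≤+ (0≤* (0≤-difference 1≤σ) (0≤-difference (degree≤4 v))) (0≤-difference (subst (nσ ≤_) (neighbours-lin (s - 1ℤ) (λ _ → 1ℤ) 1ℤ (indicator ∘ level σ s) v) (neighbours-mono bound v))))
      (solve 4 (λ s d u n → con (+ 4) :* s :- n := (con (+ 4) :- u) :+ ((s :- con 1ℤ) :* (con (+ 4) :- d) :+ (((s :- con 1ℤ) :* d :+ con 1ℤ :* u) :- n))) refl s deg nU nσ)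
      where
      s = σ v
      deg = neighbours (λ _ → 1ℤ) v
      nU = neighbours (indicator ∘ level σ s) v
      nσ = neighbours σ v
      0≤* : ∀ {x y} → 0ℤ ≤ x → 0ℤ ≤ y → 0ℤ ≤ x * y
      0≤* {x} {y} 0≤x 0≤y = subst (_≤ x * y) (ℤ.*-zeroʳ x) (ℤ.*-monoˡ-≤-nonNeg x {{Data.Integer.Base.nonNegative 0≤x}} 0≤y)
      bound : ∀ w → σ w ≤ (s - 1ℤ) * 1ℤ + 1ℤ * indicator (level σ s w)
      bound w with σ w ℤ.≟ s
      ... | yes eq = ℤ.≤-reflexive (trans eq (solve 1 (λ s → s := (s :- con 1ℤ) :* con 1ℤ :+ con 1ℤ :* con 1ℤ) refl s))
      ... | no neq = by-difference {d = s - (1ℤ + σ w)} (0≤-difference (ℤ.i<j⇒suc[i]≤j (ℤ.≤∧≢⇒< (max w) neq)))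
        (solve 2 (λ s t → (s :- con 1ℤ) :* con 1ℤ :+ con 1ℤ :* con 0ℤ := t :+ (s :- (con 1ℤ :+ t))) refl s (σ w))

    -- The allowed condition is applied to the set where `σ` is maximal: some vertex there has at
    -- least as many grains as neighbours in the set, and by `laplacian-max` the Laplacian supplies
    -- the rest up to 4.
    allowed-max : ∀ {x} σ → Allowed x → ∀ v → 1ℤ ≤ σ v → ∃[ u ] (1ℤ ≤ σ u × + 4 ≤ x u + laplacian σ u)
    allowed-max {x} σ allowed v 1≤σ with argmax σ v
    ... | m , v≤m , max with allowed (level σ (σ m)) (m , dec-true (σ m ℤ.≟ σ m) refl)
    ...   | u , Uu , le = u , 1≤u , by-difference {d = (x u - nU) + (laplacian σ u - (+ 4 - nU))} (0≤+ (0≤-difference le)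
              (0≤-difference (subst (λ s → + 4 - neighbours (indicator ∘ level σ s) u ≤ laplacian σ u) u≡m (laplacian-max σ u (λ w → subst (σ w ≤_) (sym u≡m) (max w)) 1≤u))))
            (solve 3 (λ x l n → x :+ l := con (+ 4) :+ ((x :- n) :+ (l :- (con (+ 4) :- n)))) refl (x u) (laplacian σ u) nU)
      where
      nU = neighbours (indicator ∘ level σ (σ m)) u
      u≡m : σ u ≡ σ m
      u≡m with yes eq ← σ u ℤ.≟ σ m = eq
      1≤u : 1ℤ ≤ σ u
      1≤u = subst (1ℤ ≤_) (sym u≡m) (ℤ.≤-trans 1≤σ v≤m)

    nonpositive : ∀ {x y : Vertex p q → ℤ} σ → Allowed y → (∀ v → x v ≤ + 3) → (∀ v → x v ≡ y v + laplacian σ v) → ∀ v → σ v ≤ 0ℤ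
    nonpositive {x} {y} σ allowed stable eq v with σ v ℤ.≤? 0ℤ
    ... | yes le = le
    ... | no ≰ = ⊥-elim (contradict (allowed-max {y} σ allowed v (ℤ.i<j⇒suc[i]≤j (ℤ.≰⇒> ≰))))
      where
      absurd : ¬ (+ 4 ≤ + 3)
      absurd (+≤+ (s≤s (s≤s (s≤s ()))))
      contradict : ∃[ u ] (1ℤ ≤ σ u × + 4 ≤ y u + laplacian σ u) → ⊥
      contradict (u , _ , 4≤) = absurd (ℤ.≤-trans (subst (+ 4 ≤_) (sym (eq u)) 4≤) (stable u))

    -- `nonpositive` applies to `σ` and, with the two fields exchanged, to `- σ`.
    unique : ∀ {x y : Vertex p q → ℤ} σ → Allowed x → Allowed y → (∀ v → x v ≤ + 3) → (∀ v → y v ≤ + 3) → (∀ v → x v ≡ y v + laplacian σ v) → x ≗ y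
    unique {x} {y} σ ax ay sx sy eq v = begin
      x v                        ≡⟨ eq v ⟩
      y v + laplacian σ v        ≡⟨ cong (_+_ (y v)) (laplacian-0 σ≡0 v) ⟩
      y v + 0ℤ                   ≡⟨ ℤ.+-identityʳ (y v) ⟩
      y v                        ∎
      where
      open ≡-Reasoning
      negated : ∀ v → y v ≡ x v + laplacian (λ v → - σ v) v
      negated v = begin
        y v                                              ≡⟨ solve 2 (λ y l → y := (y :+ l) :+ :- l) refl (y v) (laplacian σ v) ⟩
        y v + laplacian σ v + - laplacian σ v            ≡⟨ cong₂ _+_ (eq v) (laplacian-neg σ v) ⟨
        x v + laplacian (λ v → - σ v) v                  ∎
      σ≡0 : ∀ v → σ v ≡ 0ℤ
      σ≡0 v = ℤ.≤-antisym (nonpositive σ ay sx eq v) (subst (0ℤ ≤_) (ℤ.neg-involutive (σ v)) (ℤ.neg-mono-≤ (nonpositive (λ v → - σ v) ax sy negated v)))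

    -- Recurrence is used for the configuration with 4 grains everywhere: whatever is added to it,
    -- the sum is allowed, and firing keeps it so.
    recurrent⇒allowed : ∀ {c} → Recurrent {p} {q} c → Allowed (+_ ∘ c)
    recurrent⇒allowed {c} (_ , reach) with reach (λ _ → 4)
    ... | b , e , star , e≗c , _ = Allowed-cong (λ v → cong +_ (e≗c v)) (along star (allowed-large _ (λ v → +≤+ (ℕ.m≤m+n 4 (b v)))))
      where
      along : ∀ {c d} → Star _⟶_ c d → Allowed (+_ ∘ c) → Allowed (+_ ∘ d)
      along ε a = a
      along {c} ((v , 4≤c , d≗) ◅ rest) a = along rest (Allowed-cong (λ w → trans (sym (fire-laplacian v c 4≤c w)) (cong +_ (sym (d≗ w))))
        (allowed-fire (λ w → does (v ≟ᵥ w)) a unstable independent))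
        where
        same : ∀ w → does (v ≟ᵥ w) ≡ true → v ≡ w
        same w eq with yes v≡w ← v ≟ᵥ w = v≡w
        unstable : ∀ w → does (v ≟ᵥ w) ≡ true → + 4 ≤ + c w
        unstable w eq with refl ← same w eq = +≤+ 4≤c
        independent : ∀ w → does (v ≟ᵥ w) ≡ true → neighbours (point v) w ≡ 0ℤ
        independent w eq with refl ← same w eq = trans (neighbours-point v v) (cong indicator (dec-false (adjacent? v v) (not-self-adjacent v)))

    zero-or-positive : ∀ n → n ≡ 0 ⊎ 1 ℕ.≤ n
    zero-or-positive zero = inj₁ refl
    zero-or-positive (suc n) = inj₂ (s≤s z≤n)

    Script : Config p q → Config p q → (Vertex p q → ℕ) → Set
    Script x c σ = ∀ v → + x v ≡ + c v + laplacian (+_ ∘ σ) v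

    script-fire : ∀ {x c σ} u → 4 ℕ.≤ x u → 1 ℕ.≤ σ u → Script x c σ → Script (fire u x) c (lower (λ w → does (u ≟ᵥ w)) σ)
    script-fire {x} {c} {σ} u 4≤x 1≤σ eq v = begin
      + fire u x v                                                        ≡⟨ fire-laplacian u x 4≤x v ⟩
      + x v - laplacian (point u) v                                       ≡⟨ cong (_- laplacian (point u) v) (eq v) ⟩
      + c v + laplacian (+_ ∘ σ) v - laplacian (point u) v                ≡⟨ ℤ.+-assoc (+ c v) (laplacian (+_ ∘ σ) v) (- laplacian (point u) v) ⟩
      + c v + (laplacian (+_ ∘ σ) v - laplacian (point u) v)              ≡⟨ cong (_+_ (+ c v)) (laplacian-minus (+_ ∘ σ) (point u) v) ⟨
      + c v + laplacian (λ w → + σ w - point u w) v                       ≡⟨ cong (_+_ (+ c v)) (laplacian-cong (lower-ℤ W σ positive) v) ⟨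
      + c v + laplacian (+_ ∘ lower W σ) v                                ∎
      where
      open ≡-Reasoning
      W : Vertex p q → Bool
      W w = does (u ≟ᵥ w)
      positive : ∀ w → W w ≡ true → 1 ℕ.≤ σ w
      positive w eq with yes refl ← u ≟ᵥ w = 1≤σ

    script-end : ∀ {x c σ} → Script x c σ → (∀ v → σ v ≡ 0) → x ≗ c
    script-end {x} {c} {σ} eq σ≡0 v = ℤ.+-injective (trans (eq v) (trans (cong (_+_ (+ c v)) (laplacian-0 (λ w → cong +_ (σ≡0 w)) v)) (ℤ.+-identityʳ (+ c v))))

    -- Plays the script in a legal order: as long as `σ` is positive somewhere, `allowed-max` finds
    -- an unstable vertex that `σ` still has to fire. Each firing lowers the total of `σ`.
    run-script : ∀ (x c : Config p q) (σ : Vertex p q → ℕ) → Acc ℕ._<_ (total σ (vertices p q)) → Allowed (+_ ∘ c) →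
      Script x c σ → ∃[ e ] (Star _⟶_ x e × e ≗ c)
    run-script x c σ (acc rec) allowed script = continue (search (λ v → zero-or-positive (σ v)))
      where
      advance : ∃[ u ] (1ℤ ≤ + σ u × + 4 ≤ + c u + laplacian (+_ ∘ σ) u) → ∃[ e ] (Star _⟶_ x e × e ≗ c)
      advance (u , +≤+ 1≤σ , 4≤) =
        let e , star , e≗c = run-script (fire u x) c (lower W σ)
              (rec (total-< (lower-≤ W σ) (∈-vertices u) (lower-< W σ u (dec-true (u ≟ᵥ u) refl) 1≤σ))) allowed (script-fire u 4≤x 1≤σ script)
        in e , (u , 4≤x , λ _ → refl) ◅ star , e≗c
        where
        W : Vertex p q → Bool
        W w = does (u ≟ᵥ w)
        4≤x : 4 ℕ.≤ x u
        4≤x = ℤ.drop‿+≤+ (subst (+ 4 ≤_) (sym (script u)) 4≤)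
      continue : (∀ v → σ v ≡ 0) ⊎ (∃[ v ] (1 ℕ.≤ σ v)) → ∃[ e ] (Star _⟶_ x e × e ≗ c)
      continue (inj₁ σ≡0) = x , ε , script-end script σ≡0
      continue (inj₂ (v , 1≤σ)) = advance (allowed-max (+_ ∘ σ) allowed v (+≤+ 1≤σ))

    -- A superharmonic function makes every configuration reachable.
    allowed⇒recurrent : (h : Vertex p q → ℕ) → (∀ v → 1ℤ ≤ laplacian (+_ ∘ h) v) → ∀ {c} → Stable c → Allowed (+_ ∘ c) → Recurrent c
    allowed⇒recurrent h superharmonic {c} stable allowed = stable , λ a → b a , reached a
      where
      k : Config p q → ℕ
      k a = total a (vertices p q)
      -- The Laplacian of `h` is at least 1, so `k a` copies of `h` raise every vertex by at least
      -- the total of `a`; the field `c + laplacian σ` then dominates `a`, and the surplus is `b`.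
      σ : Config p q → Vertex p q → ℕ
      σ a v = k a ℕ.* h v
      scaled : ∀ a v → laplacian (+_ ∘ σ a) v ≡ + k a * laplacian (+_ ∘ h) v
      scaled a v = trans (laplacian-cong (λ w → ℤ.pos-* (k a) (h w)) v) (laplacian-scale (+ k a) (+_ ∘ h) v)
      bounded : ∀ a {v xs} → v ∈ xs → a v ℕ.≤ total a xs
      bounded a {xs = x ∷ xs} (here refl) = ℕ.m≤m+n (a x) (total a xs)
      bounded a {xs = x ∷ xs} (there v∈) = ℕ.≤-trans (bounded a v∈) (ℕ.m≤n+m (total a xs) (a x))
      a≤ : ∀ a v → + a v ≤ + c v + laplacian (+_ ∘ σ a) v
      a≤ a v = by-difference {d = + c v + ((+ k a - + a v) + + k a * (laplacian (+_ ∘ h) v - 1ℤ))}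
        (0≤+ (+≤+ z≤n) (0≤+ (0≤-difference (+≤+ (bounded a (∈-vertices v))))
          (subst (_≤ + k a * (laplacian (+_ ∘ h) v - 1ℤ)) (ℤ.*-zeroʳ (+ k a)) (ℤ.*-monoˡ-≤-nonNeg (+ k a) (0≤-difference (superharmonic v))))))
        (trans (cong (_+_ (+ c v)) (scaled a v)) (solve 4 (λ c k a l → c :+ k :* l := a :+ (c :+ ((k :- a) :+ k :* (l :- con 1ℤ)))) refl (+ c v) (+ k a) (+ a v) (laplacian (+_ ∘ h) v)))
      b : Config p q → Config p q
      b a v = ∣ + c v + laplacian (+_ ∘ σ a) v - + a v ∣
      start : ∀ a v → + (a v ℕ.+ b a v) ≡ + c v + laplacian (+_ ∘ σ a) v
      start a v = trans (cong (_+_ (+ a v)) (ℤ.0≤i⇒+∣i∣≡i (0≤-difference (a≤ a v)))) (solve 2 (λ a t → a :+ (t :- a) := t) refl (+ a v) (+ c v + laplacian (+_ ∘ σ a) v))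
      reached : ∀ a → (λ v → a v ℕ.+ b a v) StabilisesTo c
      reached a = let e , star , e≗c = run-script (λ v → a v ℕ.+ b a v) c (σ a) (<-wellFounded _) allowed (start a)
                  in e , star , e≗c , stable

-- Folding a symmetric grid along its middle lines

module Folding where
  open import Defs
  open RowTransfer using (double)
  open Sandpile
  open import Data.Empty using (⊥-elim)
  open import Data.Fin.Base using (Fin; zero; suc; toℕ; fromℕ<; opposite)
  import Data.Fin.Properties as Fin
  open import Data.Integer.Base using (ℤ; +_; 0ℤ; 1ℤ; _+_; _*_; _≤_; _<_)
  import Data.Integer.Properties as ℤ
  open import Data.Integer.Solver using (module +-*-Solver)
  open +-*-Solver
  open import Data.Nat.Base as ℕ using (ℕ; zero; suc; s≤s; _⊓_; _∸_)
  import Data.Nat.Properties as ℕ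
  open import Data.Product.Base using (∃-syntax; _×_; _,_)
  open import Data.Sum.Base using (_⊎_; inj₁; inj₂)
  open import Function.Base using (_∘_)
  open import Relation.Binary.Definitions using (tri<; tri≈; tri>)
  open import Relation.Binary.PropositionalEquality

  -- The two neighbours of the middle vertex are mirror images of each other, whence the 2 in the
  -- last row.
  subdiagonal : ℕ → ℤ
  subdiagonal zero = + 2
  subdiagonal (suc _) = 1ℤ

  -- The sum over the neighbours in a path of 2n - 1 vertices of a symmetric function
  -- given by its values on the first n vertices.
  foldPath : ∀ {n} → (Fin n → ℤ) → Fin n → ℤ
  foldPath {suc zero} x zero = 0ℤ
  foldPath {suc (suc n)} x zero = x (suc zero)
  foldPath {suc (suc n)} x (suc zero) = subdiagonal n * x zero + foldPath (x ∘ suc) zero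
  foldPath {suc (suc n)} x (suc (suc i)) = foldPath (x ∘ suc) (suc i)

  foldPath-cong : ∀ {n} {x y : Fin n → ℤ} → x ≗ y → foldPath x ≗ foldPath y
  foldPath-cong {suc zero} x≗y zero = refl
  foldPath-cong {suc (suc n)} x≗y zero = x≗y (suc zero)
  foldPath-cong {suc (suc n)} x≗y (suc zero) = cong₂ (λ a b → subdiagonal n * a + b) (x≗y zero) (foldPath-cong (x≗y ∘ suc) zero)
  foldPath-cong {suc (suc n)} x≗y (suc (suc i)) = foldPath-cong (x≗y ∘ suc) (suc i)

  foldPath-lin : ∀ {n} a (x : Fin n → ℤ) b y i → foldPath (λ i → a * x i + b * y i) i ≡ a * foldPath x i + b * foldPath y i
  foldPath-lin {suc zero} a x b y zero = solve 2 (λ a b → con 0ℤ := a :* con 0ℤ :+ b :* con 0ℤ) refl a b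
  foldPath-lin {suc (suc n)} a x b y zero = refl
  foldPath-lin {suc (suc n)} a x b y (suc zero) = trans (cong (_+_ (subdiagonal n * (a * x zero + b * y zero))) (foldPath-lin a (x ∘ suc) b (y ∘ suc) zero))
    (solve 7 (λ s a b x y z w → s :* (a :* x :+ b :* y) :+ (a :* z :+ b :* w) := a :* (s :* x :+ z) :+ b :* (s :* y :+ w)) refl (subdiagonal n) a b (x zero) (y zero) _ _)
  foldPath-lin {suc (suc n)} a x b y (suc (suc i)) = foldPath-lin a (x ∘ suc) b (y ∘ suc) (suc i)

  -- Values by position, continued by 0, so that end vertices obey the formula for inner ones.
  look : ∀ {n} → (Fin n → ℤ) → ℕ → ℤ
  look {zero} x k = 0ℤ
  look {suc n} x zero = x zero
  look {suc n} x (suc k) = look (x ∘ suc) k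

  look-pred : ∀ {n} → (Fin n → ℤ) → ℕ → ℤ
  look-pred x zero = 0ℤ
  look-pred x (suc k) = look x k

  look-toℕ : ∀ {n} (x : Fin n → ℤ) i → look x (toℕ i) ≡ x i
  look-toℕ x zero = refl
  look-toℕ x (suc i) = look-toℕ (x ∘ suc) i

  look-beyond : ∀ {n} (x : Fin n → ℤ) → look x n ≡ 0ℤ
  look-beyond {zero} x = refl
  look-beyond {suc n} x = look-beyond (x ∘ suc)

  line-look : ∀ {p} (f : Fin p → ℤ) i → line f i ≡ look-pred f (toℕ i) + look f (suc (toℕ i))
  line-look {suc zero} f zero = refl
  line-look {suc (suc p)} f zero = sym (ℤ.+-identityˡ _)
  line-look {suc (suc p)} f (suc zero) = cong (_+_ (f zero)) (trans (line-look (f ∘ suc) zero) (ℤ.+-identityˡ _))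
  line-look {suc (suc p)} f (suc (suc i)) = line-look (f ∘ suc) (suc i)

  foldPath-inner : ∀ {n} (x : Fin n → ℤ) i → suc (toℕ i) ℕ.< n → foldPath x i ≡ look-pred x (toℕ i) + look x (suc (toℕ i))
  foldPath-inner {suc zero} x zero (s≤s ())
  foldPath-inner {suc (suc n)} x zero _ = sym (ℤ.+-identityˡ _)
  foldPath-inner {suc (suc zero)} x (suc zero) (s≤s (s≤s ()))
  foldPath-inner {suc (suc (suc n))} x (suc zero) _ = cong₂ _+_ (ℤ.*-identityˡ (x zero)) refl
  foldPath-inner {suc (suc n)} x (suc (suc i)) (s≤s lt) = foldPath-inner (x ∘ suc) (suc i) lt

  foldPath-last : ∀ {n} (x : Fin n → ℤ) i → suc (toℕ i) ≡ n → foldPath x i ≡ look-pred x (toℕ i) + look-pred x (toℕ i)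
  foldPath-last {suc zero} x zero _ = refl
  foldPath-last {suc (suc zero)} x (suc zero) _ = solve 1 (λ x → con (+ 2) :* x :+ con 0ℤ := x :+ x) refl (x zero)
  foldPath-last {suc (suc (suc n))} x (suc zero) ()
  foldPath-last {suc (suc n)} x (suc (suc i)) eq = foldPath-last (x ∘ suc) (suc i) (ℕ.suc-injective eq)

  double≡ : ∀ n → double n ≡ n ℕ.+ n
  double≡ zero = refl
  double≡ (suc n) = cong suc (trans (cong suc (double≡ n)) (sym (ℕ.+-suc n n)))

  mirror : ℕ → ℕ → ℕ
  mirror n k = k ⊓ (double n ∸ k)

  mirror-left : ∀ n {k} → k ℕ.≤ n → mirror n k ≡ k
  mirror-left n {k} k≤n = ℕ.m≤n⇒m⊓n≡m (subst (λ t → k ℕ.≤ t ∸ k) (sym (double≡ n))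
    (ℕ.≤-trans k≤n (ℕ.≤-trans (ℕ.≤-reflexive (sym (ℕ.m+n∸n≡m n n))) (ℕ.∸-monoʳ-≤ (n ℕ.+ n) k≤n))))

  mirror-right : ∀ n {k j} → k ℕ.+ j ≡ double n → j ℕ.≤ n → mirror n k ≡ j
  mirror-right n {k} {j} eq j≤n = trans (cong (k ⊓_) (trans (cong (_∸ k) (sym eq)) (ℕ.m+n∸m≡n k j))) (ℕ.m≥n⇒m⊓n≡n (ℕ.≤-trans j≤n n≤k))
    where
    n≤k : n ℕ.≤ k
    n≤k = ℕ.+-cancelʳ-≤ n n k (ℕ.≤-trans (ℕ.≤-reflexive (trans (sym (double≡ n)) (sym eq))) (ℕ.+-monoʳ-≤ k j≤n))

  mirror< : ∀ n k → mirror n k ℕ.< suc n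
  mirror< n k with ℕ.≤-total k n
  ... | inj₁ k≤n = s≤s (ℕ.≤-trans (ℕ.m⊓n≤m k _) k≤n)
  ... | inj₂ n≤k = s≤s (ℕ.≤-trans (ℕ.m⊓n≤n k _) (ℕ.≤-trans (ℕ.∸-monoʳ-≤ (double n) n≤k) (ℕ.≤-reflexive (trans (cong (_∸ n) (double≡ n)) (ℕ.m+n∸n≡m n n)))))

  fold : ∀ {n} → Fin (suc (double n)) → Fin (suc n)
  fold {n} a = fromℕ< (mirror< n (toℕ a))

  toℕ-fold : ∀ {n} (a : Fin (suc (double n))) → toℕ (fold a) ≡ mirror n (toℕ a)
  toℕ-fold {n} a = Fin.toℕ-fromℕ< (mirror< n (toℕ a))

  side : ∀ n k → k ℕ.≤ double n → (k ℕ.< n ⊎ k ≡ n) ⊎ ∃[ j ] (k ℕ.+ j ≡ double n × j ℕ.< n)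
  side n k k≤ with ℕ.<-cmp k n
  ... | tri< lt _ _ = inj₁ (inj₁ lt)
  ... | tri≈ _ eq _ = inj₁ (inj₂ eq)
  ... | tri> _ _ gt = inj₂ (double n ∸ k , ℕ.m+[n∸m]≡n k≤ , ℕ.+-cancelˡ-< n _ _ (begin-strict
      n ℕ.+ (double n ∸ k)    <⟨ ℕ.+-monoˡ-< (double n ∸ k) gt ⟩
      k ℕ.+ (double n ∸ k)    ≡⟨ ℕ.m+[n∸m]≡n k≤ ⟩
      double n                ≡⟨ double≡ n ⟩
      n ℕ.+ n                 ∎))
    where open ℕ.≤-Reasoning

  look-fold : ∀ {n} (x : Fin (suc n) → ℤ) k → k ℕ.≤ double n → look (x ∘ fold) k ≡ look x (mirror n k)
  look-fold {n} x k k≤ = begin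
    look (x ∘ fold) k           ≡⟨ cong (look (x ∘ fold)) (sym (Fin.toℕ-fromℕ< (s≤s k≤))) ⟩
    look (x ∘ fold) (toℕ a)     ≡⟨ look-toℕ (x ∘ fold) a ⟩
    x (fold a)                  ≡⟨ look-toℕ x (fold a) ⟨
    look x (toℕ (fold a))       ≡⟨ cong (look x) (trans (toℕ-fold a) (cong (mirror n) (Fin.toℕ-fromℕ< (s≤s k≤)))) ⟩
    look x (mirror n k)         ∎
    where
    open ≡-Reasoning
    a = fromℕ< (s≤s k≤)

  -- Left of the middle the fold changes nothing, right of it the two neighbours exchange their
  -- roles, and in the middle both neighbours fold to the same vertex.
  line-fold : ∀ {n} (x : Fin (suc n) → ℤ) a → line (x ∘ fold) a ≡ foldPath x (fold a)
  line-fold {n} x a = trans (line-look (x ∘ fold) a) (go (side n (toℕ a) a≤))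
    where
    open ≡-Reasoning
    k = toℕ a
    a≤ : k ℕ.≤ double n
    a≤ = ℕ.≤-pred (Fin.toℕ<n a)
    n≤2n : n ℕ.≤ double n
    n≤2n = subst (n ℕ.≤_) (sym (double≡ n)) (ℕ.m≤m+n n n)
    pred-left : ∀ k → k ℕ.≤ n → look-pred (x ∘ fold) k ≡ look-pred x k
    pred-left zero _ = refl
    pred-left (suc k) k<n = trans (look-fold x k (ℕ.≤-trans (ℕ.<⇒≤ k<n) n≤2n)) (cong (look x) (mirror-left n (ℕ.<⇒≤ k<n)))
    -- For `j = 0` the next position lies beyond the path, where `look` is 0 just as `look-pred` is
    -- 0 before the start.
    next-right : ∀ {k} j → k ℕ.+ j ≡ double n → j ℕ.≤ n → look (x ∘ fold) (suc k) ≡ look-pred x j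
    next-right {k} zero eq j≤n = trans (cong (look (x ∘ fold)) (cong suc (trans (sym (ℕ.+-identityʳ k)) eq))) (look-beyond (x ∘ fold))
    next-right {k} (suc j) eq j<n = trans (look-fold x (suc k) (ℕ.m+n≤o⇒m≤o (suc k) (ℕ.≤-reflexive eq′)))
      (cong (look x) (mirror-right n eq′ (ℕ.<⇒≤ j<n)))
      where
      eq′ : suc k ℕ.+ j ≡ double n
      eq′ = trans (sym (ℕ.+-suc k j)) eq
    at-fold : ∀ {j} → mirror n k ≡ j → toℕ (fold a) ≡ j
    at-fold eq = trans (toℕ-fold a) eq
    go : _ → look-pred (x ∘ fold) k + look (x ∘ fold) (suc k) ≡ foldPath x (fold a)
    go (inj₁ (inj₁ k<n)) = begin
      look-pred (x ∘ fold) k + look (x ∘ fold) (suc k)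
        ≡⟨ cong₂ _+_ (pred-left k (ℕ.<⇒≤ k<n)) (trans (look-fold x (suc k) (ℕ.≤-trans k<n n≤2n)) (cong (look x) (mirror-left n k<n))) ⟩
      look-pred x k + look x (suc k)
        ≡⟨ cong (λ t → look-pred x t + look x (suc t)) (at-fold (mirror-left n (ℕ.<⇒≤ k<n))) ⟨
      look-pred x (toℕ (fold a)) + look x (suc (toℕ (fold a)))
        ≡⟨ foldPath-inner x (fold a) (s≤s (subst (ℕ._< n) (sym (at-fold (mirror-left n (ℕ.<⇒≤ k<n)))) k<n)) ⟨
      foldPath x (fold a) ∎
    go (inj₁ (inj₂ k≡n)) = begin
      look-pred (x ∘ fold) k + look (x ∘ fold) (suc k)
        ≡⟨ cong₂ _+_ (pred-left k (ℕ.≤-reflexive k≡n)) (trans (next-right n (trans (cong (ℕ._+ n) k≡n) (sym (double≡ n))) ℕ.≤-refl) (cong (look-pred x) (sym k≡n))) ⟩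
      look-pred x k + look-pred x k
        ≡⟨ cong (λ t → look-pred x t + look-pred x t) fold≡ ⟨
      look-pred x (toℕ (fold a)) + look-pred x (toℕ (fold a))
        ≡⟨ foldPath-last x (fold a) (cong suc (trans fold≡ k≡n)) ⟨
      foldPath x (fold a) ∎
      where
      fold≡ : toℕ (fold a) ≡ k
      fold≡ = at-fold (mirror-left n (ℕ.≤-reflexive k≡n))
    go (inj₂ (j , eq , j<n)) = begin
      look-pred (x ∘ fold) k + look (x ∘ fold) (suc k)
        ≡⟨ cong₂ _+_ (previous k eq) (next-right j eq (ℕ.<⇒≤ j<n)) ⟩
      look x (suc j) + look-pred x j
        ≡⟨ ℤ.+-comm (look x (suc j)) (look-pred x j) ⟩
      look-pred x j + look x (suc j)
        ≡⟨ cong (λ t → look-pred x t + look x (suc t)) fold≡ ⟨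
      look-pred x (toℕ (fold a)) + look x (suc (toℕ (fold a)))
        ≡⟨ foldPath-inner x (fold a) (s≤s (subst (ℕ._< n) (sym fold≡) j<n)) ⟨
      foldPath x (fold a) ∎
      where
      fold≡ : toℕ (fold a) ≡ j
      fold≡ = at-fold (mirror-right n eq (ℕ.<⇒≤ j<n))
      previous : ∀ k → k ℕ.+ j ≡ double n → look-pred (x ∘ fold) k ≡ look x (suc j)
      previous zero eq = ⊥-elim (ℕ.<⇒≱ j<n (subst (n ℕ.≤_) (sym eq) n≤2n))
      previous (suc k) eq = trans (look-fold x k (ℕ.m+n≤o⇒m≤o k (ℕ.≤-reflexive eq′))) (cong (look x) (mirror-right n eq′ j<n))
        where
        eq′ : k ℕ.+ suc j ≡ double n
        eq′ = trans (ℕ.+-suc k j) eq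

  inject : ∀ {n} → Fin (suc n) → Fin (suc (double n))
  inject {n} i = fromℕ< (ℕ.≤-trans (Fin.toℕ<n i) (s≤s (subst (n ℕ.≤_) (sym (double≡ n)) (ℕ.m≤m+n n n))))

  fold-inject : ∀ {n} (i : Fin (suc n)) → fold (inject i) ≡ i
  fold-inject {n} i = Fin.toℕ-injective (trans (toℕ-fold (inject i)) (trans (cong (mirror n) (Fin.toℕ-fromℕ< _)) (mirror-left n (ℕ.≤-pred (Fin.toℕ<n i)))))

  toℕ-opposite : ∀ {n} (a : Fin (suc (double n))) → toℕ (opposite a) ≡ double n ∸ toℕ a
  toℕ-opposite a = Fin.opposite-prop a

  fold-opposite : ∀ {n} (a : Fin (suc (double n))) → fold (opposite a) ≡ fold a
  fold-opposite {n} a = Fin.toℕ-injective (begin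
    toℕ (fold (opposite a))                                       ≡⟨ toℕ-fold (opposite a) ⟩
    mirror n (toℕ (opposite a))                                   ≡⟨ cong (mirror n) (toℕ-opposite a) ⟩
    (double n ∸ toℕ a) ⊓ (double n ∸ (double n ∸ toℕ a))          ≡⟨ cong ((double n ∸ toℕ a) ⊓_) (ℕ.m∸[m∸n]≡n (ℕ.≤-pred (Fin.toℕ<n a))) ⟩
    (double n ∸ toℕ a) ⊓ toℕ a                                    ≡⟨ ℕ.⊓-comm (double n ∸ toℕ a) (toℕ a) ⟩
    mirror n (toℕ a)                                              ≡⟨ toℕ-fold a ⟨
    toℕ (fold a)                                                  ∎)
    where open ≡-Reasoning

  inject-fold : ∀ {n} (a : Fin (suc (double n))) → inject (fold a) ≡ a ⊎ inject (fold a) ≡ opposite a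
  inject-fold {n} a with side n (toℕ a) (ℕ.≤-pred (Fin.toℕ<n a))
  ... | inj₁ (inj₁ lt) = inj₁ (Fin.toℕ-injective (trans (Fin.toℕ-fromℕ< _) (trans (toℕ-fold a) (mirror-left n (ℕ.<⇒≤ lt)))))
  ... | inj₁ (inj₂ eq) = inj₁ (Fin.toℕ-injective (trans (Fin.toℕ-fromℕ< _) (trans (toℕ-fold a) (mirror-left n (ℕ.≤-reflexive eq)))))
  ... | inj₂ (j , eq , lt) = inj₂ (Fin.toℕ-injective (trans (Fin.toℕ-fromℕ< _) (trans (toℕ-fold a) (trans (mirror-right n eq (ℕ.<⇒≤ lt))
      (trans (sym (ℕ.m+n∸m≡n (toℕ a) j)) (trans (cong (_∸ toℕ a) eq) (sym (toℕ-opposite a))))))))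

-- Superharmonic functions and symmetric stabilisation

module SymmetricStabilisation where
  open import Defs
  open EdgeSums using (∈-vertices)
  open RowTransfer using (double)
  open Sandpile
  open Folding
  open import Data.Bool.Base using (Bool; true)
  open import Data.Empty using (⊥; ⊥-elim)
  open import Data.Fin.Base using (Fin; zero; suc)
  import Data.Fin.Properties as Fin
  open import Data.Integer.Base using (ℤ; +_; 0ℤ; 1ℤ; _+_; _*_; -_; _-_; _≤_; _<_; +≤+)
  import Data.Integer.Properties as ℤ
  open import Data.Integer.Solver using (module +-*-Solver)
  open +-*-Solver
  open import Data.Nat.Base as ℕ using (ℕ; zero; suc; z≤n; s≤s)
  import Data.Nat.Properties as ℕ
  open import Data.Product.Base using (_,_; proj₁; proj₂; ∃)
  open import Data.Sum.Base using (_⊎_; inj₁; inj₂)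
  open import Function.Base using (_∘_)
  open import Induction.WellFounded using (Acc; acc)
  open import Relation.Binary.PropositionalEquality
  open import Relation.Nullary.Decidable using (Dec; yes; no; does; dec-true; dec-false)

  foldPath-mono : ∀ {n} {x y : Fin n → ℤ} → (∀ i → x i ≤ y i) → ∀ i → foldPath x i ≤ foldPath y i
  foldPath-mono {suc zero} x≤y zero = ℤ.≤-refl
  foldPath-mono {suc (suc n)} x≤y zero = x≤y (suc zero)
  foldPath-mono {suc (suc n)} x≤y (suc zero) = ℤ.+-mono-≤ (scale n (x≤y zero)) (foldPath-mono (x≤y ∘ suc) zero)
    where
    scale : ∀ n {a b} → a ≤ b → subdiagonal n * a ≤ subdiagonal n * b
    scale zero = ℤ.*-monoˡ-≤-nonNeg (+ 2)
    scale (suc n) = ℤ.*-monoˡ-≤-nonNeg 1ℤ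
  foldPath-mono {suc (suc n)} x≤y (suc (suc i)) = foldPath-mono (x≤y ∘ suc) (suc i)

  foldPath-elsewhere : ∀ {n} {x : Fin n → ℤ} i → (∀ j → i ≢ j → x j ≡ 0ℤ) → foldPath x i ≡ 0ℤ
  foldPath-elsewhere {suc zero} zero x≡0 = refl
  foldPath-elsewhere {suc (suc n)} zero x≡0 = x≡0 (suc zero) λ ()
  foldPath-elsewhere {suc (suc n)} (suc zero) x≡0 = cong₂ _+_ (trans (cong (subdiagonal n *_) (x≡0 zero λ ())) (ℤ.*-zeroʳ (subdiagonal n)))
    (foldPath-elsewhere zero λ j 0≢j → x≡0 (suc j) (0≢j ∘ Fin.suc-injective))
  foldPath-elsewhere {suc (suc n)} (suc (suc i)) x≡0 = foldPath-elsewhere (suc i) λ j i≢j → x≡0 (suc j) (i≢j ∘ Fin.suc-injective)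

  foldPath-0 : ∀ {n} (i : Fin n) → foldPath (λ _ → 0ℤ) i ≡ 0ℤ
  foldPath-0 i = foldPath-elsewhere i λ _ _ → refl

  foldPath-1≤2 : ∀ {n} (i : Fin n) → foldPath (λ _ → 1ℤ) i ≤ + 2
  foldPath-1≤2 {suc zero} zero = +≤+ z≤n
  foldPath-1≤2 {suc (suc n)} zero = +≤+ (s≤s z≤n)
  foldPath-1≤2 {suc (suc zero)} (suc zero) = ℤ.≤-refl
  foldPath-1≤2 {suc (suc (suc n))} (suc zero) = ℤ.≤-refl
  foldPath-1≤2 {suc (suc n)} (suc (suc i)) = foldPath-1≤2 {suc n} (suc i)

  -- hill s rises from s by the steps 2n - 1, 2n - 3, ... , 1.
  hill : ∀ {n} → ℕ → Fin n → ℕ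
  hill {suc zero} s zero = s ℕ.+ 1
  hill {suc (suc n)} s zero = s ℕ.+ (1 ℕ.+ 2 ℕ.* suc n)
  hill {suc (suc n)} s (suc i) = hill (s ℕ.+ (1 ℕ.+ 2 ℕ.* suc n)) i

  -- The contribution of a value `s` at an imagined vertex before the first one, weighted as
  -- `foldPath` would weigh it.
  atFirst : ∀ {n} → ℤ → Fin n → ℤ
  atFirst {suc n} s zero = subdiagonal n * s
  atFirst {suc n} s (suc i) = 0ℤ

  hill-first : ∀ n s → + hill {suc n} s zero ≡ + s + (1ℤ + + 2 * + n)
  hill-first zero s = refl
  hill-first (suc n) s = cong (λ t → + s + (1ℤ + t)) (ℤ.pos-* 2 (suc n))

  -- Consecutive steps differ by 2, and at the summit the step 1 is followed by its mirror image:
  -- the second difference is -2 everywhere, with `atFirst` for the value before the start.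
  hill-concave : ∀ {n} s i → + 2 * + hill {n} s i ≡ foldPath (+_ ∘ hill {n} s) i + atFirst (+ s) i + + 2
  hill-concave {suc zero} s zero = solve 1 (λ s → con (+ 2) :* (s :+ con 1ℤ) := con 0ℤ :+ con (+ 2) :* s :+ con (+ 2)) refl (+ s)
  hill-concave {suc (suc n)} s zero = begin
    + 2 * + h                                                  ≡⟨ cong (+ 2 *_) (hill-first (suc n) s) ⟩
    + 2 * (+ s + (1ℤ + + 2 * (1ℤ + + n)))
      ≡⟨ solve 2 (λ s n → con (+ 2) :* (s :+ (con 1ℤ :+ con (+ 2) :* (con 1ℤ :+ n))) :=
           (s :+ (con 1ℤ :+ con (+ 2) :* (con 1ℤ :+ n)) :+ (con 1ℤ :+ con (+ 2) :* n)) :+ con 1ℤ :* s :+ con (+ 2)) refl (+ s) (+ n) ⟩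
    (+ s + (1ℤ + + 2 * (1ℤ + + n)) + (1ℤ + + 2 * + n)) + 1ℤ * + s + + 2
      ≡⟨ cong (λ t → t + (1ℤ + + 2 * + n) + 1ℤ * + s + + 2) (hill-first (suc n) s) ⟨
    (+ h + (1ℤ + + 2 * + n)) + 1ℤ * + s + + 2                  ≡⟨ cong (λ t → t + 1ℤ * + s + + 2) (hill-first n h) ⟨
    + hill h (zero {n}) + 1ℤ * + s + + 2                       ∎
    where
    open ≡-Reasoning
    h = hill {suc (suc n)} s zero
  hill-concave {suc (suc n)} s (suc zero) = trans (hill-concave {suc n} h zero)
    (solve 3 (λ f d h → f :+ d :* h :+ con (+ 2) := d :* h :+ f :+ con 0ℤ :+ con (+ 2)) refl (foldPath (+_ ∘ hill {suc n} h) zero) (subdiagonal n) (+ h))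
    where
    h = hill {suc (suc n)} s zero
  hill-concave {suc (suc n)} s (suc (suc i)) = hill-concave {suc n} (hill {suc (suc n)} s zero) (suc i)

  module _ {m n : ℕ} where
    -- Symmetric configurations are given by one quarter of the grid.
    Quarter : Set
    Quarter = Vertex (suc m) (suc n)

    foldVertex : Vertex (suc (double m)) (suc (double n)) → Quarter
    foldVertex (a , b) = fold a , fold b

    injectVertex : Quarter → Vertex (suc (double m)) (suc (double n))
    injectVertex (i , j) = inject i , inject j

    foldedNeighbours : (Quarter → ℤ) → Quarter → ℤ
    foldedNeighbours f (i , j) = foldPath (λ i → f (i , j)) i + foldPath (λ j → f (i , j)) j

    foldedLaplacian : (Quarter → ℤ) → Quarter → ℤ
    foldedLaplacian f v = + 4 * f v - foldedNeighbours f v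

    neighbours-fold : ∀ f v → neighbours (f ∘ foldVertex) v ≡ foldedNeighbours f (foldVertex v)
    neighbours-fold f (a , b) = cong₂ _+_ (line-fold (λ i → f (i , fold b)) a) (line-fold (λ j → f (fold a , j)) b)

    laplacian-fold : ∀ f v → laplacian (f ∘ foldVertex) v ≡ foldedLaplacian f (foldVertex v)
    laplacian-fold f v = cong (λ t → + 4 * f (foldVertex v) - t) (neighbours-fold f v)

    foldedNeighbours-cong : ∀ {f g} → f ≗ g → foldedNeighbours f ≗ foldedNeighbours g
    foldedNeighbours-cong f≗g (i , j) = cong₂ _+_ (foldPath-cong (λ i → f≗g (i , j)) i) (foldPath-cong (λ j → f≗g (i , j)) j)

    foldedLaplacian-cong : ∀ {f g} → f ≗ g → foldedLaplacian f ≗ foldedLaplacian g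
    foldedLaplacian-cong f≗g v = cong₂ (λ x y → + 4 * x - y) (f≗g v) (foldedNeighbours-cong f≗g v)

    foldedLaplacian-lin : ∀ x f y g v → foldedLaplacian (λ v → x * f v + y * g v) v ≡ x * foldedLaplacian f v + y * foldedLaplacian g v
    foldedLaplacian-lin x f y g v@(i , j) = trans (cong (λ t → + 4 * (x * f v + y * g v) - t)
      (cong₂ _+_ (foldPath-lin x (λ i → f (i , j)) y (λ i → g (i , j)) i) (foldPath-lin x (λ j → f (i , j)) y (λ j → g (i , j)) j)))
      (solve 8 (λ x y a b r s t u → con (+ 4) :* (x :* a :+ y :* b) :- ((x :* r :+ y :* s) :+ (x :* t :+ y :* u)) :=
        x :* (con (+ 4) :* a :- (r :+ t)) :+ y :* (con (+ 4) :* b :- (s :+ u))) refl x y (f v) (g v) _ _ _ _)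

    foldedLaplacian-minus : ∀ f g v → foldedLaplacian (λ v → f v - g v) v ≡ foldedLaplacian f v - foldedLaplacian g v
    foldedLaplacian-minus f g v = begin
      foldedLaplacian (λ v → f v - g v) v                    ≡⟨ foldedLaplacian-cong (λ v → solve 2 (λ s t → s :- t := con 1ℤ :* s :+ (:- con 1ℤ) :* t) refl (f v) (g v)) v ⟩
      foldedLaplacian (λ v → 1ℤ * f v + - 1ℤ * g v) v        ≡⟨ foldedLaplacian-lin 1ℤ f (- 1ℤ) g v ⟩
      1ℤ * foldedLaplacian f v + - 1ℤ * foldedLaplacian g v  ≡⟨ solve 2 (λ s t → con 1ℤ :* s :+ (:- con 1ℤ) :* t := s :- t) refl (foldedLaplacian f v) (foldedLaplacian g v) ⟩
      foldedLaplacian f v - foldedLaplacian g v              ∎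
      where open ≡-Reasoning

    foldedLaplacian-scale : ∀ k f v → foldedLaplacian (λ v → k * f v) v ≡ k * foldedLaplacian f v
    foldedLaplacian-scale k f v = begin
      foldedLaplacian (λ v → k * f v) v                     ≡⟨ foldedLaplacian-cong (λ v → solve 2 (λ k s → k :* s := k :* s :+ con 0ℤ :* s) refl k (f v)) v ⟩
      foldedLaplacian (λ v → k * f v + 0ℤ * f v) v          ≡⟨ foldedLaplacian-lin k f 0ℤ f v ⟩
      k * foldedLaplacian f v + 0ℤ * foldedLaplacian f v    ≡⟨ solve 2 (λ k l → k :* l :+ con 0ℤ :* l := k :* l) refl k (foldedLaplacian f v) ⟩
      k * foldedLaplacian f v                               ∎
      where open ≡-Reasoning

    foldedNeighbours-0≤ : ∀ {f} → (∀ v → 0ℤ ≤ f v) → ∀ v → 0ℤ ≤ foldedNeighbours f v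
    foldedNeighbours-0≤ {f} 0≤f v@(i , j) = subst (_≤ foldedNeighbours f v) (cong₂ _+_ (foldPath-0 i) (foldPath-0 j))
      (ℤ.+-mono-≤ (foldPath-mono (λ i → 0≤f (i , j)) i) (foldPath-mono (λ j → 0≤f (i , j)) j))

    point-elsewhere : ∀ (v w : Quarter) → v ≢ w → point v w ≡ 0ℤ
    point-elsewhere v w v≢w = cong indicator (dec-false (v ≟ᵥ w) v≢w)

    point-self : ∀ (v : Quarter) → point v v ≡ 1ℤ
    point-self v = cong indicator (dec-true (v ≟ᵥ v) refl)

    -- Mirror images in a side of odd length are at even distance, so an orbit contains no two
    -- neighbours and can be fired at once.
    foldedNeighbours-self : ∀ v → foldedNeighbours (point v) v ≡ 0ℤ
    foldedNeighbours-self v@(i , j) = cong₂ _+_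
      (foldPath-elsewhere i λ i' i≢ → point-elsewhere v (i' , j) (i≢ ∘ cong proj₁))
      (foldPath-elsewhere j λ j' j≢ → point-elsewhere v (i , j') (j≢ ∘ cong proj₂))

    mound : Quarter → ℕ
    mound (i , j) = hill 0 i

    -- The mound varies along one coordinate only. There the second difference contributes 2; along
    -- the other coordinate it is constant, and the contribution is nonnegative because a vertex has
    -- at most two neighbours in a line.
    mound-superharmonic : ∀ v → 1ℤ ≤ foldedLaplacian (+_ ∘ mound) v
    mound-superharmonic v@(i , j) = by-difference {d = 1ℤ + + h * (+ 2 - foldPath (λ _ → 1ℤ) j)}
      (0≤+ (+≤+ z≤n) (subst (_≤ + h * (+ 2 - foldPath (λ _ → 1ℤ) j)) (ℤ.*-zeroʳ (+ h)) (ℤ.*-monoˡ-≤-nonNeg (+ h) (0≤-difference (foldPath-1≤2 j)))))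
      (begin
        + 4 * + h - (foldPath (+_ ∘ hill 0) i + foldPath (λ _ → + h) j)
          ≡⟨ cong (λ t → + 4 * + h - (foldPath (+_ ∘ hill 0) i + t)) constant ⟩
        + 4 * + h - (foldPath (+_ ∘ hill 0) i + + h * foldPath (λ _ → 1ℤ) j)
          ≡⟨ solve 3 (λ h f o → con (+ 4) :* h :- (f :+ h :* o) := con (+ 2) :* h :+ con (+ 2) :* h :- f :- h :* o) refl (+ h) (foldPath (+_ ∘ hill 0) i) (foldPath (λ _ → 1ℤ) j) ⟩
        + 2 * + h + + 2 * + h - foldPath (+_ ∘ hill 0) i - + h * foldPath (λ _ → 1ℤ) j
          ≡⟨ cong (λ t → t + + 2 * + h - foldPath (+_ ∘ hill 0) i - + h * foldPath (λ _ → 1ℤ) j) concave ⟩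
        (foldPath (+_ ∘ hill 0) i + 0ℤ + + 2) + + 2 * + h - foldPath (+_ ∘ hill 0) i - + h * foldPath (λ _ → 1ℤ) j
          ≡⟨ solve 3 (λ h f o → (f :+ con 0ℤ :+ con (+ 2)) :+ con (+ 2) :* h :- f :- h :* o := con 1ℤ :+ (con 1ℤ :+ h :* (con (+ 2) :- o))) refl
               (+ h) (foldPath (+_ ∘ hill 0) i) (foldPath (λ _ → 1ℤ) j) ⟩
        1ℤ + (1ℤ + + h * (+ 2 - foldPath (λ _ → 1ℤ) j)) ∎)
      where
      open ≡-Reasoning
      h = hill 0 i
      atFirst-0 : ∀ {n} (i : Fin n) → atFirst 0ℤ i ≡ 0ℤ
      atFirst-0 {suc n} zero = ℤ.*-zeroʳ (subdiagonal n)
      atFirst-0 {suc n} (suc i) = refl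
      concave : + 2 * + h ≡ foldPath (+_ ∘ hill 0) i + 0ℤ + + 2
      concave = trans (hill-concave 0 i) (cong (λ t → foldPath (+_ ∘ hill 0) i + t + + 2) (atFirst-0 i))
      constant : foldPath (λ _ → + h) j ≡ + h * foldPath (λ _ → 1ℤ) j
      constant = begin
        foldPath (λ _ → + h) j                                     ≡⟨ foldPath-cong (λ _ → solve 1 (λ h → h := h :* con 1ℤ :+ con 0ℤ :* con 1ℤ) refl (+ h)) j ⟩
        foldPath (λ _ → + h * 1ℤ + 0ℤ * 1ℤ) j                      ≡⟨ foldPath-lin (+ h) (λ _ → 1ℤ) 0ℤ (λ _ → 1ℤ) j ⟩
        + h * foldPath (λ _ → 1ℤ) j + 0ℤ * foldPath (λ _ → 1ℤ) j   ≡⟨ solve 2 (λ h o → h :* o :+ con 0ℤ :* o := h :* o) refl (+ h) (foldPath (λ _ → 1ℤ) j) ⟩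
        + h * foldPath (λ _ → 1ℤ) j                                ∎

    record Stabilised (z : Quarter → ℤ) : Set where
      field
        script   : Quarter → ℕ
        result   : Quarter → ℤ
        result≡  : ∀ v → result v ≡ z v + foldedLaplacian (+_ ∘ script) v
        0≤result : ∀ v → 0ℤ ≤ result v
        result≤3 : ∀ v → result v ≤ + 3
        allowed  : Allowed (result ∘ foldVertex)

    -- Firing symmetrically decreases the script g, which bounds the firings from above
    -- because z is stable (the least action principle).
    stabilise : ∀ z y (g : Quarter → ℕ) → Acc ℕ._<_ (total g (vertices (suc m) (suc n))) → (∀ v → z v ≤ + 3) →
      (∀ v → y v ≡ z v + foldedLaplacian (+_ ∘ g) v) → (∀ v → 0ℤ ≤ y v) → Allowed (y ∘ foldVertex) → Stabilised z
    stabilise z y g (acc rec) z≤3 y≡ 0≤y allowed = continue (search (λ v → small-or-large (y v)))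
      where
      small-or-large : ∀ x → x ≤ + 3 ⊎ + 4 ≤ x
      small-or-large x with x ℤ.≤? + 3
      ... | yes le = inj₁ le
      ... | no ≰ = inj₂ (ℤ.i<j⇒suc[i]≤j (ℤ.≰⇒> ≰))
      fireOrbit : ∀ u → + 4 ≤ y u → Stabilised z
      fireOrbit u 4≤y = stabilise z y' (lower W g) (rec (total-< (lower-≤ W g) (∈-vertices u) (lower-< W g u (dec-true (u ≟ᵥ u) refl) 1≤g))) z≤3 y'≡ 0≤y'
        (Allowed-cong fired (allowed-fire (W ∘ foldVertex) allowed unstable independent))
        where
        W : Quarter → Bool
        W w = does (u ≟ᵥ w)
        y' : Quarter → ℤ
        y' v = y v - foldedLaplacian (point u) v
        same : ∀ w → W w ≡ true → u ≡ w
        same w eq with yes u≡w ← u ≟ᵥ w = u≡w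
        positive-or-zero : ∀ k → k ≡ 0 ⊎ 1 ℕ.≤ k
        positive-or-zero zero = inj₁ refl
        positive-or-zero (suc k) = inj₂ (s≤s z≤n)
        absurd : + 4 ≤ + 3 → ⊥
        absurd (+≤+ (s≤s (s≤s (s≤s ()))))
        -- With `g u = 0` the script can only lower the value at `u`, so `y u ≤ z u ≤ 3`, against
        -- the instability of `u`.
        from-positive : g u ≡ 0 ⊎ 1 ℕ.≤ g u → 1 ℕ.≤ g u
        from-positive (inj₂ 1≤g) = 1≤g
        from-positive (inj₁ g≡0) = ⊥-elim (absurd (ℤ.≤-trans 4≤y (ℤ.≤-trans y≤z (z≤3 u))))
          where
          y≤z : y u ≤ z u
          y≤z = by-difference {d = foldedNeighbours (+_ ∘ g) u} (foldedNeighbours-0≤ {+_ ∘ g} (λ _ → +≤+ z≤n) u)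
            (trans (solve 2 (λ z n → z := z :- n :+ n) refl (z u) (foldedNeighbours (+_ ∘ g) u))
              (cong (_+ foldedNeighbours (+_ ∘ g) u) (sym (trans (y≡ u) (trans (cong (λ t → z u + (+ 4 * + t - foldedNeighbours (+_ ∘ g) u)) g≡0)
                (cong (_+_ (z u)) (ℤ.+-identityˡ (- foldedNeighbours (+_ ∘ g) u))))))))
        1≤g : 1 ℕ.≤ g u
        1≤g = from-positive (positive-or-zero (g u))
        y'≡ : ∀ v → y' v ≡ z v + foldedLaplacian (+_ ∘ lower W g) v
        y'≡ v = begin
          y v - foldedLaplacian (point u) v                                            ≡⟨ cong (_- foldedLaplacian (point u) v) (y≡ v) ⟩
          z v + foldedLaplacian (+_ ∘ g) v - foldedLaplacian (point u) v               ≡⟨ ℤ.+-assoc (z v) (foldedLaplacian (+_ ∘ g) v) (- foldedLaplacian (point u) v) ⟩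
          z v + (foldedLaplacian (+_ ∘ g) v - foldedLaplacian (point u) v)             ≡⟨ cong (_+_ (z v)) (foldedLaplacian-minus (+_ ∘ g) (point u) v) ⟨
          z v + foldedLaplacian (λ w → + g w - point u w) v                            ≡⟨ cong (_+_ (z v)) (foldedLaplacian-cong (lower-ℤ W g positive) v) ⟨
          z v + foldedLaplacian (+_ ∘ lower W g) v                                     ∎
          where
          open ≡-Reasoning
          positive : ∀ w → W w ≡ true → 1 ℕ.≤ g w
          positive w eq = subst (λ w → 1 ℕ.≤ g w) (same w eq) 1≤g
        0≤y' : ∀ v → 0ℤ ≤ y' v
        0≤y' v = subst (0ℤ ≤_) (solve 3 (λ y p n → (y :- con (+ 4) :* p) :+ n := y :- (con (+ 4) :* p :- n)) refl (y v) (point u v) (foldedNeighbours (point u) v))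
          (0≤+ (remaining (u ≟ᵥ v)) (foldedNeighbours-0≤ {point u} (λ _ → +≤+ z≤n) v))
          where
          remaining : Dec (u ≡ v) → 0ℤ ≤ y v - + 4 * point u v
          remaining (yes refl) = subst (λ t → 0ℤ ≤ y v - + 4 * t) (sym (point-self v)) (0≤-difference 4≤y)
          remaining (no u≢v) = subst (λ t → 0ℤ ≤ y v - + 4 * t) (sym (point-elsewhere u v u≢v)) (subst (0ℤ ≤_) (sym (ℤ.+-identityʳ (y v))) (0≤y v))
        unstable : ∀ v → W (foldVertex v) ≡ true → + 4 ≤ y (foldVertex v)
        unstable v eq = subst (λ w → + 4 ≤ y w) (same (foldVertex v) eq) 4≤y
        independent : ∀ v → W (foldVertex v) ≡ true → neighbours (λ v → indicator (W (foldVertex v))) v ≡ 0ℤ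
        independent v eq = trans (neighbours-fold (point u) v) (subst (λ w → foldedNeighbours (point u) w ≡ 0ℤ) (same (foldVertex v) eq) (foldedNeighbours-self u))
        fired : ∀ v → y (foldVertex v) - laplacian (λ v → indicator (W (foldVertex v))) v ≡ y' (foldVertex v)
        fired v = cong (λ t → y (foldVertex v) - t) (laplacian-fold (point u) v)
      continue : (∀ v → y v ≤ + 3) ⊎ ∃ (λ v → + 4 ≤ y v) → Stabilised z
      continue (inj₁ y≤3) = record { script = g ; result = y ; result≡ = y≡ ; 0≤result = 0≤y ; result≤3 = y≤3 ; allowed = allowed }
      continue (inj₂ (u , 4≤y)) = fireOrbit u 4≤y

-- Row reduction of the folded Laplacian

module RowReduction where
  open Folding using (foldPath; foldPath-cong; foldPath-lin; subdiagonal)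
  open SymmetricStabilisation using (atFirst)
  open import Data.Fin.Base using (Fin; zero; suc)
  open import Data.Integer.Base using (ℤ; +_; 0ℤ; 1ℤ; _+_; _*_; -_; _-_)
  import Data.Integer.Properties as ℤ
  open ExteriorAlgebra ℤ.+-*-commutativeRing
  open IntegerCoefficients
  open IntegerSolver ℤ.+-*-commutativeRing
  open Cokernel
  open FreeFermions ℤ.+-*-commutativeRing using (diagV; diagWeight; diag-induced; four)
  open import Data.Nat.Base as ℕ using (ℕ; zero; suc)
  open import Data.Product.Base using (∃-syntax; _,_)
  open import Data.Sum.Base using (inj₁; inj₂)
  open import Function.Base using (_∘_)
  open import Relation.Binary.PropositionalEquality

  module Reduction {k : ℕ} (B : V k → V k) (lB : Linear B) where
    module B = Linear lB

    B-minus : ∀ u v → B (u ⊝ v) ≋ B u ⊝ B v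
    B-minus u v j = trans (B.cong (λ j → solve 2 (λ s t → s :- t := con (+ 1) :* s :+ (:- con (+ 1)) :* t) refl (u j) (v j)) j)
      (trans (B.linear 1ℤ u (- 1ℤ) v j) (solve 2 (λ s t → con (+ 1) :* s :+ (:- con (+ 1)) :* t := s :- t) refl (B u j) (B v j)))

    Rows : ℕ → Set
    Rows m = Fin (suc m) → V k

    next : V k → V k → V k → V k
    next c s t j = B t j - s j - c j

    -- Given the row `s` before the first one and the first row `t`, each equation of the block
    -- tridiagonal system determines the next row; `residual` is the defect of the last equation,
    -- which counts its preceding row twice because of the fold.
    residual : ∀ {m} → Rows m → V k → V k → V k
    residual {zero} c s t j = c zero j - (B t j - (s j + s j))
    residual {suc m} c s t = residual (c ∘ suc) t (next (c zero) s t)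

    solution : ∀ {m} → Rows m → V k → V k → Rows m
    solution c s t zero = t
    solution {suc m} c s t (suc i) = solution (c ∘ suc) t (next (c zero) s t) i

    rowLaplacian : ∀ {m} → V k → Rows m → Rows m
    rowLaplacian {zero} s f zero j = B (f zero) j - (s j + s j)
    rowLaplacian {suc m} s f zero j = B (f zero) j - s j - f (suc zero) j
    rowLaplacian {suc m} s f (suc i) = rowLaplacian (f zero) (f ∘ suc) i

    residual-solution : ∀ {m} (c : Rows m) s t → (∀ j → residual c s t j ≡ 0ℤ) → ∀ i → rowLaplacian s (solution c s t) i ≋ c i
    residual-solution {zero} c s t r≡0 zero j = sym (ℤ.i-j≡0⇒i≡j (c zero j) _ (r≡0 j))
    residual-solution {suc m} c s t r≡0 zero j = solve 3 (λ b s c → b :- s :- (b :- s :- c) := c) refl (B t j) (s j) (c zero j)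
    residual-solution {suc m} c s t r≡0 (suc i) = residual-solution (c ∘ suc) t (next (c zero) s t) r≡0 i

    residual-cong : ∀ {m} {c c' : Rows m} {s s' t t'} → (∀ i → c i ≋ c' i) → s ≋ s' → t ≋ t' → residual c s t ≋ residual c' s' t'
    residual-cong {zero} c≋ s≋ t≋ j = cong₂ _-_ (c≋ zero j) (cong₂ _-_ (B.cong t≋ j) (cong₂ _+_ (s≋ j) (s≋ j)))
    residual-cong {suc m} c≋ s≋ t≋ = residual-cong (c≋ ∘ suc) t≋ (λ j → cong₂ _-_ (cong₂ _-_ (B.cong t≋ j) (s≋ j)) (c≋ zero j))

    residual-laplacian : ∀ {m} (f : Rows m) s j → residual (rowLaplacian s f) s (f zero) j ≡ 0ℤ
    residual-laplacian {zero} f s j = ℤ.+-inverseʳ (B (f zero) j - (s j + s j))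
    residual-laplacian {suc m} f s j = trans
      (residual-cong {c = rowLaplacian (f zero) (f ∘ suc)} (λ _ _ → refl) (λ _ → refl)
        (λ j → solve 3 (λ b s f → b :- s :- (b :- s :- f) := f) refl (B (f zero) j) (s j) (f (suc zero) j)) j)
      (residual-laplacian (f ∘ suc) (f zero) j)

    residual-minus : ∀ {m} (c c' : Rows m) s s' t t' → residual (λ i → c i ⊝ c' i) (s ⊝ s') (t ⊝ t') ≋ residual c s t ⊝ residual c' s' t'
    residual-minus {zero} c c' s s' t t' j = trans (cong (λ b → c zero j - c' zero j - (b - (s j - s' j + (s j - s' j)))) (B-minus t t' j))
      (solve 6 (λ c c' b b' s s' → c :- c' :- (b :- b' :- (s :- s' :+ (s :- s'))) := (c :- (b :- (s :+ s))) :- (c' :- (b' :- (s' :+ s')))) refl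
        (c zero j) (c' zero j) (B t j) (B t' j) (s j) (s' j))
    residual-minus {suc m} c c' s s' t t' j = trans
      (residual-cong {c = λ i → c (suc i) ⊝ c' (suc i)} (λ _ _ → refl) (λ _ → refl) (λ j → trans (cong (λ b → b - (s j - s' j) - (c zero j - c' zero j)) (B-minus t t' j))
        (solve 6 (λ c c' b b' s s' → b :- b' :- (s :- s') :- (c :- c') := (b :- s :- c) :- (b' :- s' :- c')) refl (c zero j) (c' zero j) (B t j) (B t' j) (s j) (s' j))) j)
      (residual-minus (c ∘ suc) (c' ∘ suc) t t' (next (c zero) s t) (next (c' zero) s' t') j)

    opT-comm : ∀ m v → opT B m (B v) ≋ B (opT B m v)
    opT-comm zero v j = sym (trans (B.cong (λ j → solve 1 (λ v → v :+ v := con (+ 1) :* v :+ con (+ 1) :* v) refl (v j)) j)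
      (trans (B.linear 1ℤ v 1ℤ v j) (solve 1 (λ b → con (+ 1) :* b :+ con (+ 1) :* b := b :+ b) refl (B v j))))
    opT-comm (suc zero) v j = refl
    opT-comm (suc (suc m)) v j = trans (cong₂ _-_ (B.cong (opT-comm (suc m) v) j) (opT-comm m v j)) (sym (B-minus (B (opT B (suc m) v)) (opT B m v) j))

    opT-minus : ∀ m u v → opT B m (u ⊝ v) ≋ opT B m u ⊝ opT B m v
    opT-minus m u v j = trans (T.cong (λ j → solve 2 (λ s t → s :- t := con (+ 1) :* s :+ (:- con (+ 1)) :* t) refl (u j) (v j)) j)
      (trans (T.linear 1ℤ u (- 1ℤ) v j) (solve 2 (λ s t → con (+ 1) :* s :+ (:- con (+ 1)) :* t := s :- t) refl (opT B m u j) (opT B m v j)))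
      where module T = Linear (opT-linear lB m)

    -- For zero right-hand side the rows satisfy `f_(i+1) = B f_i - f_(i-1)`, the recursion of the
    -- operators `S_j(B)`, and the row counted twice in the last equation corresponds to `S_0 = 2`.
    residual-homogeneous : ∀ m s t → residual {m} (λ _ _ → 0ℤ) s t ≋ opT B m s ⊝ opT B (suc m) t
    residual-homogeneous zero s t j = solve 2 (λ b s → con (+ 0) :- (b :- (s :+ s)) := s :+ s :- b) refl (B t j) (s j)
    residual-homogeneous (suc m) s t j = begin
      residual {m} (λ _ _ → 0ℤ) t (next (λ _ → 0ℤ) s t) j
        ≡⟨ residual-cong {m} (λ _ _ → refl) (λ _ → refl) (λ j → ℤ.+-identityʳ (B t j - s j)) j ⟩
      residual {m} (λ _ _ → 0ℤ) t (B t ⊝ s) j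
        ≡⟨ residual-homogeneous m t (B t ⊝ s) j ⟩
      opT B m t j - opT B (suc m) (B t ⊝ s) j
        ≡⟨ cong (λ x → opT B m t j - x) (trans (opT-minus (suc m) (B t) s j) (cong (_- opT B (suc m) s j) (opT-comm (suc m) t j))) ⟩
      opT B m t j - (B (opT B (suc m) t) j - opT B (suc m) s j)
        ≡⟨ solve 3 (λ a b c → a :- (b :- c) := c :- (b :- a)) refl (opT B m t j) (B (opT B (suc m) t) j) (opT B (suc m) s j) ⟩
      opT B (suc m) s j - (B (opT B (suc m) t) j - opT B m t j) ∎
      where open ≡-Reasoning

    reduce : ∀ {m} → Rows m → V k
    reduce c = residual c (λ _ → 0ℤ) (λ _ → 0ℤ)

    -- The residual is affine in the first row: it splits into the value for `t = 0` and the
    -- homogeneous part.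
    residual-reduce : ∀ {m} (c : Rows m) t → residual c (λ _ → 0ℤ) t ≋ reduce c ⊝ opT B (suc m) t
    residual-reduce {m} c t j = begin
      residual c (λ _ → 0ℤ) t j
        ≡⟨ residual-cong {c' = λ i → c i ⊝ (λ _ → 0ℤ)} (λ i j → sym (ℤ.+-identityʳ (c i j))) (λ _ → refl) (λ j → solve 1 (λ t → t := con (+ 0) :- :- t) refl (t j)) j ⟩
      residual (λ i → c i ⊝ (λ _ → 0ℤ)) ((λ _ → 0ℤ) ⊝ (λ _ → 0ℤ)) ((λ _ → 0ℤ) ⊝ (λ j → - t j)) j
        ≡⟨ residual-minus c (λ _ _ → 0ℤ) (λ _ → 0ℤ) (λ _ → 0ℤ) (λ _ → 0ℤ) (λ j → - t j) j ⟩
      reduce c j - residual {m} (λ _ _ → 0ℤ) (λ _ → 0ℤ) (λ j → - t j) j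
        ≡⟨ cong (λ x → reduce c j - x) (trans (residual-homogeneous m (λ _ → 0ℤ) (λ j → - t j) j)
             (cong₂ _-_ (zeros′ m j) (trans (Linear.cong (opT-linear lB (suc m)) (λ j → sym (ℤ.+-identityˡ (- t j))) j)
               (trans (opT-minus (suc m) (λ _ → 0ℤ) t j) (cong (_- opT B (suc m) t j) (zeros′ (suc m) j)))))) ⟩
      reduce c j - (0ℤ - (0ℤ - opT B (suc m) t j))
        ≡⟨ solve 2 (λ r t → r :- (con (+ 0) :- (con (+ 0) :- t)) := r :- t) refl (reduce c j) (opT B (suc m) t j) ⟩
      reduce c j - opT B (suc m) t j ∎
      where
      open ≡-Reasoning
      zeros′ : ∀ m j → opT B m (λ _ → 0ℤ) j ≡ 0ℤ
      zeros′ m = Linear.zeros (opT-linear lB m) (λ _ → refl)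

    -- Modulo the image of the Laplacian every field is carried by its last row, and that
    -- row is determined modulo opT B (suc m).
    reduce-sound : ∀ {m} (x y : Rows m) → (∃[ v ] (reduce x ⊝ reduce y ≋ opT B (suc m) v)) → ∃[ f ] (∀ i → rowLaplacian (λ _ → 0ℤ) f i ≋ x i ⊝ y i)
    reduce-sound {m} x y (v , eq) = solution (λ i → x i ⊝ y i) (λ _ → 0ℤ) v , residual-solution (λ i → x i ⊝ y i) (λ _ → 0ℤ) v λ j →
      trans (residual-reduce (λ i → x i ⊝ y i) v j) (trans (cong (_- opT B (suc m) v j) (trans (residual-minus x y (λ _ → 0ℤ) (λ _ → 0ℤ) (λ _ → 0ℤ) (λ _ → 0ℤ) j) (eq j)))
        (ℤ.+-inverseʳ (opT B (suc m) v j)))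

    reduce-complete : ∀ {m} (x y : Rows m) f → (∀ i → rowLaplacian (λ _ → 0ℤ) f i ≋ x i ⊝ y i) → ∃[ v ] (reduce x ⊝ reduce y ≋ opT B (suc m) v)
    reduce-complete {m} x y f eq = f zero , λ j → trans (sym (residual-minus x y (λ _ → 0ℤ) (λ _ → 0ℤ) (λ _ → 0ℤ) (λ _ → 0ℤ) j))
      (ℤ.i-j≡0⇒i≡j (reduce (λ i → x i ⊝ y i) j) (opT B (suc m) (f zero) j) (trans (sym (residual-reduce (λ i → x i ⊝ y i) (f zero) j))
        (trans (residual-cong (λ i j → sym (eq i j)) (λ _ → refl) (λ _ → refl) j) (residual-laplacian f (λ _ → 0ℤ) j))))

    -- A field supported on the last row reduces to that row, so every class of the cokernel has a
    -- representative of this form.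
    lastOnly : ∀ {m} → V k → Rows m
    lastOnly {zero} y zero = y
    lastOnly {suc m} y zero = λ _ → 0ℤ
    lastOnly {suc m} y (suc i) = lastOnly y i

    reduce-lastOnly : ∀ {m} y → reduce {m} (lastOnly y) ≋ y
    reduce-lastOnly {zero} y j = trans (cong (λ b → y j - (b - 0ℤ)) (B.zeros (λ _ → refl) j)) (ℤ.+-identityʳ (y j))
    reduce-lastOnly {suc m} y j = trans (residual-cong {m} {c = lastOnly y} (λ _ _ → refl) (λ _ → refl) (λ j → trans (ℤ.+-identityʳ _) (trans (ℤ.+-identityʳ _) (B.zeros (λ _ → refl) j))) j)
      (reduce-lastOnly {m} y j)

  foldedRow : ∀ {n} → V n → V n
  foldedRow v j = + 4 * v j - foldPath v j

  foldedRow-linear : ∀ {n} → Linear (foldedRow {n})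
  foldedRow-linear = record
    { cong = λ u≋v j → cong₂ (λ a b → + 4 * a - b) (u≋v j) (foldPath-cong u≋v j)
    ; linear = λ a u b v j → trans (cong (λ t → + 4 * (a * u j + b * v j) - t) (foldPath-lin a u b v j))
        (solve 6 (λ a b x y z w → con (+ 4) :* (a :* x :+ b :* y) :- (a :* z :+ b :* w) := a :* (con (+ 4) :* x :- z) :+ b :* (con (+ 4) :* y :- w)) refl
          a b (u j) (v j) (foldPath u j) (foldPath v j))
    }

  module _ {k : ℕ} where
    open Reduction (foldedRow {k}) foldedRow-linear

    rowLaplacian-folded : ∀ {m} s (f : Rows m) i j →
      rowLaplacian s f i j ≡ foldedRow (f i) j - foldPath (λ i → f i j) i - atFirst (s j) i
    rowLaplacian-folded {zero} s f zero j =
      solve 2 (λ b s → b :- (s :+ s) := b :- con (+ 0) :- con (+ 2) :* s) refl (foldedRow (f zero) j) (s j)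
    rowLaplacian-folded {suc m} s f zero j =
      solve 3 (λ b s f → b :- s :- f := b :- f :- con (+ 1) :* s) refl (foldedRow (f zero) j) (s j) (f (suc zero) j)
    rowLaplacian-folded {suc m} s f (suc zero) j = trans (rowLaplacian-folded (f zero) (f ∘ suc) zero j)
      (solve 4 (λ b p d f → b :- p :- d :* f := b :- (d :* f :+ p) :- con (+ 0)) refl (foldedRow (f (suc zero)) j) (foldPath (λ i → f (suc i) j) zero) (subdiagonal m) (f zero j))
    rowLaplacian-folded {suc m} s f (suc (suc i)) j = rowLaplacian-folded (f zero) (f ∘ suc) (suc i) j

  alternatingWeight : ℕ → ℕ → ℤ
  alternatingWeight zero c = + 2
  alternatingWeight (suc n) zero = 1ℤ
  alternatingWeight (suc n) (suc c) = - alternatingWeight n c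

  -- This diagonal matrix conjugates path to - foldPath.
  rescale : ∀ {n} → V (suc n) → V (suc n)
  rescale {n} = diagV (alternatingWeight n)

  diagV-neg : ∀ w {k} (v : V k) i → diagV (λ c → - w c) v i ≡ - diagV w v i
  diagV-neg w v zero = solve 2 (λ w v → (:- w) :* v := :- (w :* v)) refl (w 0) (v zero)
  diagV-neg w v (suc i) = diagV-neg (w ∘ suc) (tail v) i

  foldPath-rescale : ∀ {n} (v : V (suc n)) i → foldPath (rescale v) i ≡ - rescale (path v) i
  foldPath-rescale {zero} v zero = refl
  foldPath-rescale {suc zero} v zero = solve 1 (λ v → (:- con (+ 2)) :* v := :- (con (+ 1) :* (con (+ 2) :* v))) refl (v (suc zero))
  foldPath-rescale {suc (suc n)} v zero = solve 1 (λ v → (:- con (+ 1)) :* v := :- (con (+ 1) :* (con (+ 1) :* v))) refl (v (suc zero))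
  foldPath-rescale {suc n} v (suc i) = trans (below i) (cong -_ (sym (diagV-neg (alternatingWeight n) (tail (path v)) i)))
    where
    negated : ∀ i → foldPath (tail (rescale v)) i ≡ rescale (path (tail v)) i
    negated i = begin
      foldPath (tail (rescale v)) i                            ≡⟨ foldPath-cong (λ i → trans (diagV-neg (alternatingWeight n) (tail v) i)
                                                                    (solve 1 (λ x → :- x := (:- con (+ 1)) :* x :+ con (+ 0) :* x) refl (rescale (tail v) i))) i ⟩
      foldPath (λ i → - 1ℤ * rescale (tail v) i + 0ℤ * rescale (tail v) i) i ≡⟨ foldPath-lin (- 1ℤ) (rescale (tail v)) 0ℤ (rescale (tail v)) i ⟩
      - 1ℤ * foldPath (rescale (tail v)) i + 0ℤ * foldPath (rescale (tail v)) i ≡⟨ solve 1 (λ x → (:- con (+ 1)) :* x :+ con (+ 0) :* x := :- x) refl (foldPath (rescale (tail v)) i) ⟩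
      - foldPath (rescale (tail v)) i                          ≡⟨ cong -_ (foldPath-rescale (tail v) i) ⟩
      - - rescale (path (tail v)) i                            ≡⟨ ℤ.neg-involutive _ ⟩
      rescale (path (tail v)) i                                ∎
      where open ≡-Reasoning
    head-weight : ∀ n v₀ p → subdiagonal n * (1ℤ * v₀) + alternatingWeight n 0 * p ≡ alternatingWeight n 0 * (v₀ + p)
    head-weight zero = solve 2 (λ v p → con (+ 2) :* (con (+ 1) :* v) :+ con (+ 2) :* p := con (+ 2) :* (v :+ p)) refl
    head-weight (suc n) = solve 2 (λ v p → con (+ 1) :* (con (+ 1) :* v) :+ con (+ 1) :* p := con (+ 1) :* (v :+ p)) refl
    below : ∀ i → foldPath (rescale v) (suc i) ≡ - - rescale (tail (path v)) i
    below zero = trans (cong (_+_ (subdiagonal n * (1ℤ * v zero))) (negated zero)) (trans (head-weight n (v zero) (path (tail v) zero)) (sym (ℤ.neg-involutive _)))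
    below (suc i) = trans (negated (suc i)) (sym (ℤ.neg-involutive _))

  rescale-linear : ∀ {n} → Linear (rescale {n})
  rescale-linear {n} = record { cong = diagV-cong (alternatingWeight n) ; linear = diagV-linear (alternatingWeight n) }
    where
    diagV-cong : ∀ w {k} {u v : V k} → u ≋ v → diagV w u ≋ diagV w v
    diagV-cong w u≋v zero = cong (w 0 *_) (u≋v zero)
    diagV-cong w u≋v (suc i) = diagV-cong (w ∘ suc) (u≋v ∘ suc) i
    diagV-linear : ∀ w {k} a (u : V k) b v → diagV w (lin a u b v) ≋ lin a (diagV w u) b (diagV w v)
    diagV-linear w a u b v zero = solve 5 (λ w a u b v → w :* (a :* u :+ b :* v) := a :* (w :* u) :+ b :* (w :* v)) refl (w 0) a (u zero) b (v zero)
    diagV-linear w a u b v (suc i) = diagV-linear (w ∘ suc) a (tail u) b (tail v) i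

  det-rescale : ∀ n → det (rescale {n}) ≢ 0ℤ
  det-rescale n det≡0 = nonzero n (trans (sym (ℤ.*-identityʳ _)) (trans (cong (diagWeight (alternatingWeight n) (top {suc n}) *_) (sym (δ-top (suc n))))
      (trans (det-induced (diag-induced (alternatingWeight n) {suc n})) det≡0)))
    where
    δ-top : ∀ k → δ (top {k}) ≡ 1ℤ
    δ-top zero = refl
    δ-top (suc k) = δ-top k
    negated : ∀ w k → diagWeight w (top {k}) ≢ 0ℤ → diagWeight (λ c → - w c) (top {k}) ≢ 0ℤ
    negated w zero ne = ne
    negated w (suc k) ne eq with ℤ.i*j≡0⇒i≡0∨j≡0 (- w 0) eq
    ... | inj₁ w≡0 = ne (trans (cong (_* diagWeight (w ∘ suc) (top {k})) (trans (sym (ℤ.neg-involutive (w 0))) (cong -_ w≡0))) refl)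
    ... | inj₂ rest≡0 = negated (w ∘ suc) k (λ eq' → ne (trans (cong (w 0 *_) eq') (ℤ.*-zeroʳ (w 0)))) rest≡0
    nonzero : ∀ n → diagWeight (alternatingWeight n) (top {suc n}) ≢ 0ℤ
    nonzero zero ()
    nonzero (suc n) eq = negated (alternatingWeight n) (suc n) (nonzero n) (trans (sym (ℤ.*-identityˡ _)) eq)

  rescale-shiftedPath : ∀ {n} (v : V (suc n)) → foldedRow (rescale v) ≋ rescale (shiftedPath four v)
  rescale-shiftedPath v i = trans (cong (λ t → + 4 * rescale v i - t) (foldPath-rescale v i))
    (trans (solve 2 (λ r p → con (+ 4) :* r :- :- p := con (+ 4) :* r :+ con (+ 1) :* p) refl (rescale v i) (rescale (path v) i))
      (sym (trans (Linear.cong rescale-linear (λ i → cong (_+_ (+ 4 * v i)) (sym (ℤ.*-identityˡ (path v i)))) i) (Linear.linear rescale-linear (+ 4) v 1ℤ (path v) i))))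

  opT-rescale : ∀ {n} m (v : V (suc n)) → opT foldedRow m (rescale v) ≋ rescale (opT (shiftedPath four) m v)
  opT-rescale zero v i = sym (trans (Linear.cong rescale-linear (λ i → solve 1 (λ v → v :+ v := con (+ 1) :* v :+ con (+ 1) :* v) refl (v i)) i)
    (trans (Linear.linear rescale-linear 1ℤ v 1ℤ v i) (solve 1 (λ v → con (+ 1) :* v :+ con (+ 1) :* v := v :+ v) refl (rescale v i))))
  opT-rescale (suc zero) v = rescale-shiftedPath v
  opT-rescale (suc (suc m)) v i = trans
    (cong₂ _-_ (trans (Linear.cong foldedRow-linear (opT-rescale (suc m) v) i) (rescale-shiftedPath (opT (shiftedPath four) (suc m) v) i)) (opT-rescale m v i))
    (sym (trans (Linear.cong rescale-linear (λ i → solve 2 (λ s t → s :- t := con (+ 1) :* s :+ (:- con (+ 1)) :* t) refl (shiftedPath four (opT (shiftedPath four) (suc m) v) i) (opT (shiftedPath four) m v i)) i)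
      (trans (Linear.linear rescale-linear 1ℤ (shiftedPath four (opT (shiftedPath four) (suc m) v)) (- 1ℤ) (opT (shiftedPath four) m v) i)
        (solve 2 (λ s t → con (+ 1) :* s :+ (:- con (+ 1)) :* t := s :- t) refl (rescale (shiftedPath four (opT (shiftedPath four) (suc m) v)) i) (rescale (opT (shiftedPath four) m v) i)))))

  -- The doubled entries of `path` and `foldPath` lie on opposite sides of the diagonal. The
  -- diagonal matrix relating them has an entry 2 up to sign and thus no integral inverse, so its
  -- nonzero determinant is cancelled instead.
  det-folded : ∀ n m → det (opT (foldedRow {suc n}) m) ≡ det (opT (shiftedPath {suc n} four) m)
  det-folded n m = ℤ.*-cancelʳ-≡ (det F) (det S) (det P) {{Data.Integer.Base.≢-nonZero (det-rescale n)}} (begin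
    det F * det P     ≡⟨ det-∘ {L = F} {P} (opT-linear foldedRow-linear m) ⟨
    det (F ∘ P)       ≡⟨ det-cong {g = F ∘ P} {P ∘ S} (opT-rescale m) ⟩
    det (P ∘ S)       ≡⟨ det-∘ {L = P} {S} rescale-linear ⟩
    det P * det S     ≡⟨ ℤ.*-comm (det P) (det S) ⟩
    det S * det P     ∎)
    where
    open ≡-Reasoning
    F S P : V (suc n) → V (suc n)
    F = opT foldedRow m
    S = opT (shiftedPath four) m
    P = rescale

-- Symmetric recurrents as classes of the cokernel

module SymmetricCount where
  open import Defs
  open EdgeSums using (∈-vertices)
  open RowTransfer using (double)
  open Sandpile
  open Folding
  open SymmetricStabilisation
  open RowReduction
  open import Data.Fin.Base using (Fin; zero; suc; opposite)
  open import Data.Integer.Base using (ℤ; +_; -[1+_]; -≤+; 0ℤ; 1ℤ; _+_; _*_; -_; _-_; _≤_; ∣_∣; +≤+)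
  import Data.Integer.Properties as ℤ
  open import Data.Integer.Solver using (module +-*-Solver)
  open +-*-Solver
  open ExteriorAlgebra ℤ.+-*-commutativeRing using (V; _≋_; Linear; opT; opT-linear; shiftedPath; det)
  open Cokernel using (Transversal; cokernel; _⊝_)
  open FreeFermions ℤ.+-*-commutativeRing using (four)
  open import Data.List.Membership.Propositional using (_∈_)
  open import Data.List.Relation.Unary.Any using (here; there)
  open import Data.List.Base using (_∷_)
  open import Data.Nat.Base as ℕ using (ℕ; zero; suc; z≤n)
  import Data.Nat.Properties as ℕ
  open import Data.Nat.Induction using (<-wellFounded)
  open import Data.Product.Base using (∃-syntax; _×_; _,_; proj₁; proj₂)
  open import Data.Sum.Base using (_⊎_; inj₁; inj₂)
  open import Function.Base using (_∘_)
  open import Relation.Binary.PropositionalEquality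

  total-bound : ∀ {A : Set} (σ : A → ℕ) {v xs} → v ∈ xs → σ v ℕ.≤ total σ xs
  total-bound σ {xs = x ∷ xs} (here refl) = ℕ.m≤m+n (σ x) (total σ xs)
  total-bound σ {xs = x ∷ xs} (there v∈) = ℕ.≤-trans (total-bound σ v∈) (ℕ.m≤n+m (total σ xs) (σ x))

  module _ {m n : ℕ} where
    open Reduction (foldedRow {suc n}) foldedRow-linear

    private
      Grid : Set
      Grid = Vertex (suc (double m)) (suc (double n))

    rowsOf : (Quarter {m} {n} → ℤ) → Rows m
    rowsOf f i j = f (i , j)

    quarter : Config (suc (double m)) (suc (double n)) → Quarter {m} {n} → ℤ
    quarter c v = + c (injectVertex v)

    symmetric-fold : ∀ {c : Config (suc (double m)) (suc (double n))} → Symmetric c → ∀ v → c (injectVertex (foldVertex v)) ≡ c v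
    symmetric-fold {c} sym-c (a , b) = trans (second (inject-fold b)) (first (inject-fold a))
      where
      second : inject (fold b) ≡ b ⊎ inject (fold b) ≡ opposite b → c (inject (fold a) , inject (fold b)) ≡ c (inject (fold a) , b)
      second (inj₁ eq) = cong (λ b → c (inject (fold a) , b)) eq
      second (inj₂ eq) = trans (cong (λ b → c (inject (fold a) , b)) eq) (sym (proj₁ (sym-c (inject (fold a)) b)))
      first : inject (fold a) ≡ a ⊎ inject (fold a) ≡ opposite a → c (inject (fold a) , b) ≡ c (a , b)
      first (inj₁ eq) = cong (λ a → c (a , b)) eq
      first (inj₂ eq) = trans (cong (λ a → c (a , b)) eq) (sym (proj₂ (sym-c a b)))

    rowLaplacian-quarter : ∀ (f : Rows m) i j → rowLaplacian (λ _ → 0ℤ) f i j ≡ foldedLaplacian (λ v → f (proj₁ v) (proj₂ v)) (i , j)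
    rowLaplacian-quarter f i j = trans (rowLaplacian-folded (λ _ → 0ℤ) f i j)
      (trans (cong (λ t → foldedRow (f i) j - foldPath (λ i → f i j) i - t) (atFirst-0 i))
        (solve 3 (λ x p q → con (+ 4) :* x :- p :- q :- con 0ℤ := con (+ 4) :* x :- (q :+ p)) refl (f i j) (foldPath (f i) j) (foldPath (λ i → f i j) i)))
      where
      atFirst-0 : ∀ {n} (i : Fin n) → atFirst 0ℤ i ≡ 0ℤ
      atFirst-0 {suc n} zero = ℤ.*-zeroʳ (subdiagonal n)
      atFirst-0 {suc n} (suc i) = refl

    stable≤3 : ∀ {c : Config (suc (double m)) (suc (double n))} → Stable c → ∀ v → + c v ≤ + 3
    stable≤3 stable v = +≤+ (ℕ.≤-pred (ℕ.≰⇒> (stable v)))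

    -- Equal classes force equal symmetric recurrents.
    recurrent-unique : ∀ {c c' : Config (suc (double m)) (suc (double n))} → Recurrent c → Symmetric c → Recurrent c' → Symmetric c' →
      ∃[ v ] (reduce (rowsOf (quarter c)) ⊝ reduce (rowsOf (quarter c')) ≋ opT foldedRow (suc m) v) → c ≗ c'
    recurrent-unique {c} {c'} rc sc rc' sc' same v = ℤ.+-injective
      (unique {x = +_ ∘ c} {+_ ∘ c'} (F ∘ foldVertex) (recurrent⇒allowed rc) (recurrent⇒allowed rc') (stable≤3 (proj₁ rc)) (stable≤3 (proj₁ rc')) difference v)
      where
      solved = reduce-sound (rowsOf (quarter c)) (rowsOf (quarter c')) same
      F : Quarter → ℤ
      F v = proj₁ solved (proj₁ v) (proj₂ v)
      folded : ∀ v → foldedLaplacian F v ≡ quarter c v - quarter c' v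
      folded (i , j) = trans (sym (rowLaplacian-quarter (proj₁ solved) i j)) (proj₂ solved i j)
      difference : ∀ v → + c v ≡ + c' v + laplacian (F ∘ foldVertex) v
      difference v = sym (trans (cong (_+_ (+ c' v)) (trans (laplacian-fold F v) (trans (folded (foldVertex v))
          (cong₂ (λ a b → + a - + b) (symmetric-fold sc v) (symmetric-fold sc' v)))))
        (solve 2 (λ a b → b :+ (a :- b) := a) refl (+ c v) (+ c' v)))

    module Representative (x : Quarter {m} {n} → ℤ) where
      M : ℕ
      M = total (λ v → ∣ x v ∣) (vertices (suc m) (suc n))

      L : (Quarter {m} {n} → ℤ) → Quarter {m} {n} → ℤ
      L = foldedLaplacian

      -- `M` bounds the absolute values of `x`, and `h` has Laplacian at least 1. Subtracting `M`
      -- copies makes `z` at most 0, adding `M + 4` copies makes `y` at least 4 and hence allowed.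
      -- Both stay in the class of `x`, and `stabilise` descends from `y` with `z` as its bound.
      h z y : Quarter {m} {n} → ℤ
      h v = + mound v
      z v = x v - + M * L h v
      y v = x v + + (M ℕ.+ 4) * L h v

      g : Quarter {m} {n} → ℕ
      g v = (M ℕ.+ (M ℕ.+ 4)) ℕ.* mound v

      x-bound : ∀ v → ∣ x v ∣ ℕ.≤ M
      x-bound v = total-bound (λ v → ∣ x v ∣) (∈-vertices v)

      i≤∣i∣ : ∀ i → i ≤ + ∣ i ∣
      i≤∣i∣ (+ k) = ℤ.≤-refl
      i≤∣i∣ (-[1+ k ]) = -≤+

      -∣i∣≤i : ∀ i → 0ℤ ≤ i + + ∣ i ∣
      -∣i∣≤i i = subst (0ℤ ≤_) (trans (cong (λ t → + t - - i) (ℤ.∣-i∣≡∣i∣ i)) (solve 2 (λ a i → a :- :- i := i :+ a) refl (+ ∣ i ∣) i)) (0≤-difference (i≤∣i∣ (- i)))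

      excess : ∀ v → 0ℤ ≤ L h v - 1ℤ
      excess v = 0≤-difference (mound-superharmonic {m} {n} v)

      multiple : ∀ k v → 0ℤ ≤ + k * (L h v - 1ℤ)
      multiple k v = subst (_≤ + k * (L h v - 1ℤ)) (ℤ.*-zeroʳ (+ k)) (ℤ.*-monoˡ-≤-nonNeg (+ k) (excess v))

      z≤3 : ∀ v → z v ≤ + 3
      z≤3 v = by-difference {d = + 3 + ((+ M - + ∣ x v ∣) + ((+ ∣ x v ∣ - x v) + + M * (l - 1ℤ)))}
        (0≤+ (+≤+ z≤n) (0≤+ (0≤-difference (+≤+ (x-bound v))) (0≤+ (0≤-difference (i≤∣i∣ (x v))) (multiple M v))))
        (solve 4 (λ x a k l → con (+ 3) := (x :- k :* l) :+ (con (+ 3) :+ ((k :- a) :+ ((a :- x) :+ k :* (l :- con 1ℤ))))) refl (x v) (+ ∣ x v ∣) (+ M) l)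
        where
        l = L h v

      4≤y : ∀ v → + 4 ≤ y v
      4≤y v = by-difference {d = (x v + + ∣ x v ∣) + ((+ M - + ∣ x v ∣) + + (M ℕ.+ 4) * (l - 1ℤ))}
        (0≤+ (-∣i∣≤i (x v)) (0≤+ (0≤-difference (+≤+ (x-bound v))) (multiple (M ℕ.+ 4) v)))
        (solve 4 (λ x a k l → x :+ (k :+ con (+ 4)) :* l := con (+ 4) :+ ((x :+ a) :+ ((k :- a) :+ (k :+ con (+ 4)) :* (l :- con 1ℤ)))) refl (x v) (+ ∣ x v ∣) (+ M) l)
        where
        l = L h v

      scaled : ∀ k v → L (λ v → + (k ℕ.* mound v)) v ≡ + k * L h v
      scaled k v = trans (foldedLaplacian-cong (λ w → ℤ.pos-* k (mound w)) v) (foldedLaplacian-scale (+ k) h v)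

      y≡ : ∀ v → y v ≡ z v + L (+_ ∘ g) v
      y≡ v = sym (trans (cong (_+_ (z v)) (scaled (M ℕ.+ (M ℕ.+ 4)) v))
        (solve 3 (λ x k l → x :- k :* l :+ (k :+ (k :+ con (+ 4))) :* l := x :+ (k :+ con (+ 4)) :* l) refl (x v) (+ M) (L h v)))

      open Stabilised (stabilise {m} {n} z y g (<-wellFounded _) z≤3 y≡ (λ v → ℤ.≤-trans (+≤+ z≤n) (4≤y v)) (allowed-large (y ∘ foldVertex {m} {n}) (λ v → 4≤y (foldVertex v)))) public

      config : Config (suc (double m)) (suc (double n))
      config v = ∣ result (foldVertex v) ∣

      config≡ : ∀ v → + config v ≡ result (foldVertex v)
      config≡ v = ℤ.0≤i⇒+∣i∣≡i (0≤result (foldVertex v))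

      config-stable : Stable config
      config-stable v 4≤c = ℕ.<⇒≱ 4≤c (ℤ.drop‿+≤+ (subst (_≤ + 3) (sym (config≡ v)) (result≤3 (foldVertex v))))

      config-recurrent : Recurrent config
      config-recurrent = allowed⇒recurrent (mound ∘ foldVertex {m} {n})
        (λ v → subst (1ℤ ≤_) (sym (laplacian-fold {m} {n} h v)) (mound-superharmonic {m} {n} (foldVertex v)))
        config-stable (Allowed-cong (λ v → sym (config≡ v)) allowed)

      config-symmetric : Symmetric config
      config-symmetric a b = cong (λ j → ∣ result (fold a , j) ∣) (sym (fold-opposite b)) , cong (λ i → ∣ result (i , fold b) ∣) (sym (fold-opposite a))

      correction : Quarter {m} {n} → ℤ
      correction v = + script v - + M * + mound v

      config-class : ∀ v → L correction v ≡ quarter config v - x v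
      config-class v@(i , j) = sym (begin
        + config (injectVertex v) - x v              ≡⟨ cong (_- x v) (trans (config≡ (injectVertex v)) (cong result (cong₂ _,_ (fold-inject i) (fold-inject j)))) ⟩
        result v - x v                               ≡⟨ cong (_- x v) (result≡ v) ⟩
        x v - + M * L h v + L (+_ ∘ script) v - x v
          ≡⟨ solve 3 (λ x p q → x :- p :+ q :- x := q :- p) refl (x v) (+ M * L h v) (L (+_ ∘ script) v) ⟩
        L (+_ ∘ script) v - + M * L h v   ≡⟨ cong (λ t → L (+_ ∘ script) v - t) (foldedLaplacian-scale (+ M) h v) ⟨
        L (+_ ∘ script) v - L (λ v → + M * + mound v) v ≡⟨ foldedLaplacian-minus (+_ ∘ script) (λ v → + M * + mound v) v ⟨
        L correction v                               ∎)
        where open ≡-Reasoning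

    -- A class is sent to the recurrent representative of a field on the last row; conversely a
    -- configuration is numbered by the class of its reduced quarter. Injectivity of the numbering
    -- gives the second half of the bijection.
    symmetric-recurrents : ∀ N → N ≢ 0 → + N ≡ det (opT (shiftedPath {suc n} four) (suc m)) →
      HasCardinality (SymmetricRecurrents (suc (double m)) (suc (double n))) N
    symmetric-recurrents N N≢0 N≡ = record
      { to = to ; from = from
      ; to-cong = λ { refl v → refl }
      ; from-cong = λ {c} {c'} → from-cong {c} {c'}
      ; inverse = (λ {c} {i} → inverseˡ {c} {i}) , (λ {i} {c} → inverseʳ {i} {c})
      }
      where
      ∣det∣≡N : ∣ det (opT (foldedRow {suc n}) (suc m)) ∣ ≡ N
      ∣det∣≡N = cong ∣_∣ (trans (det-folded n (suc m)) (sym N≡))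
      K : V (suc n) → V (suc n)
      K = opT foldedRow (suc m)
      Image : V (suc n) → Set
      Image x = ∃[ v ] (x ≋ K v)
      transversal-N : Transversal Image N
      transversal-N = subst (Transversal Image) ∣det∣≡N (cokernel {L = K} (opT-linear foldedRow-linear (suc m)) (λ eq → N≢0 (trans (sym ∣det∣≡N) eq)))
      open Transversal transversal-N
      S : Set
      S = ∃[ c ] (Recurrent {suc (double m)} {suc (double n)} c × Symmetric c)
      start : Fin N → Quarter → ℤ
      start i v = lastOnly {m} (rep i) (proj₁ v) (proj₂ v)
      to : Fin N → S
      to i = R.config , R.config-recurrent , R.config-symmetric
        where module R = Representative (start i)
      from : S → Fin N
      from (c , _) = class (reduce (rowsOf (quarter c)))
      class-≋ : ∀ {u v} → u ≋ v → class u ≡ class v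
      class-≋ {u} {v} u≋v = complete u v ((λ _ → 0ℤ) , λ j → trans (cong (_- v j) (u≋v j)) (trans (ℤ.+-inverseʳ (v j))
        (sym (Linear.zeros (opT-linear foldedRow-linear (suc m)) {λ _ → 0ℤ} (λ _ → refl) j))))
      from-cong : ∀ {c c'} → proj₁ c ≗ proj₁ c' → from c ≡ from c'
      from-cong {c , _} {c' , _} c≗c' = class-≋ (residual-cong {m} {rowsOf (quarter c)} {rowsOf (quarter c')} (λ i j → cong +_ (c≗c' (injectVertex (i , j)))) (λ _ → refl) (λ _ → refl))
      from-to : ∀ i → from (to i) ≡ i
      from-to i = trans (complete _ _ (reduce-complete (rowsOf (quarter R.config)) (lastOnly {m} (rep i)) (rowsOf R.correction)
          (λ k j → trans (rowLaplacian-quarter (rowsOf R.correction) k j) (R.config-class (k , j)))))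
        (trans (class-≋ (reduce-lastOnly {m} (rep i))) (class-rep i))
        where module R = Representative (start i)
      injective : ∀ c c' → from c ≡ from c' → proj₁ c ≗ proj₁ c'
      injective (c , rc , sc) (c' , rc' , sc') eq = recurrent-unique rc sc rc' sc' (sound _ _ eq)
      inverseˡ : ∀ {c i} → i ≡ from c → proj₁ (to i) ≗ proj₁ c
      inverseˡ {c} {i} i≡ = injective (to i) c (trans (from-to i) i≡)
      inverseʳ : ∀ {i c} → proj₁ c ≗ proj₁ (to i) → from c ≡ i
      inverseʳ {i} {c} c≗ = trans (from-cong {c} {to i} c≗) (from-to i)

-- The weights of the checkerboard

module CheckerboardWeights where
  open import Defs
  open EdgeSums using (weight)
  open RowTransfer
  open Folding using (double≡)
  open import Data.Bool.Base using (true; if_then_else_)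
  open import Data.Empty using (⊥; ⊥-elim)
  open import Data.List.Base using (List; map; upTo)
  open import Data.List.Membership.Propositional using (_∈_; _∉_)
  open import Data.List.Membership.Propositional.Properties using (∈-map⁺; ∈-map⁻; ∈-++⁺ˡ; ∈-++⁺ʳ; ∈-++⁻; ∈-upTo⁺)
  open import Data.Nat.Base using (ℕ; zero; suc; _+_; _*_; _∸_; _≤_; _<_; z≤n; s≤s)
  import Data.Nat.Properties as ℕ
  open import Data.Nat.ListAction using (sum)
  open import Data.Product.Base using (∃-syntax; _×_; _,_)
  open import Data.Product.Properties using (≡-dec; ,-injectiveˡ; ,-injectiveʳ)
  open import Data.Sum.Base using (_⊎_; inj₁; inj₂)
  open import Data.Vec.Base using (replicate)
  open import Function.Base using (_∘_)
  open import Relation.Binary.PropositionalEquality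
  open import Relation.Nullary.Decidable using (yes; no; does; dec-true; dec-false)
  open import Data.List.Membership.DecPropositional (≡-dec (≡-dec ℕ._≟_ ℕ._≟_) (≡-dec ℕ._≟_ ℕ._≟_)) using (_∈?_)

  2*≡double : ∀ n → 2 * n ≡ double n
  2*≡double n = trans (cong (n +_) (ℕ.+-identityʳ n)) (sym (double≡ n))

  double-∸ : ∀ m h → 2 * m ∸ 2 * h ≡ double (m ∸ h)
  double-∸ m h = trans (sym (ℕ.*-distribˡ-∸ 2 m h)) (2*≡double (m ∸ h))

  even≢odd : ∀ a b → double a ≢ suc (double b)
  even≢odd (suc a) (suc b) eq = even≢odd a b (ℕ.suc-injective (ℕ.suc-injective eq))

  double-injective : ∀ {a b} → double a ≡ double b → a ≡ b
  double-injective {zero} {zero} _ = refl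
  double-injective {suc a} {suc b} eq = cong suc (double-injective (ℕ.suc-injective (ℕ.suc-injective eq)))

  checkerWeight : ℕ → ℕ → ℕ → ℕ → ℕ → ℕ → ℕ
  checkerWeight m n a b a' b' = if does (((suc a , suc b) , (suc a' , suc b')) ∈? weight2Edges m n) then 2 else 1

  module _ (m n : ℕ) where
    private
      E = weight2Edges (suc m) (suc n)

      2m 2n : ℕ
      2m = 2 * suc m
      2n = 2 * suc n

      2m≡ : 2m ≡ suc (suc (double m))
      2m≡ = 2*≡double (suc m)
      2n≡ : 2n ≡ suc (suc (double n))
      2n≡ = 2*≡double (suc n)

    weight2-cases : ∀ {v w} → (v , w) ∈ E →
      (∃[ h ] (v ≡ (double (suc m ∸ h) , suc (double n)) × w ≡ (double (suc m ∸ h) , suc (suc (double n))))) ⊎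
      (∃[ k ] (v ≡ (suc (double m) , double (suc n ∸ k)) × w ≡ (suc (suc (double m)) , double (suc n ∸ k))))
    weight2-cases e∈ with ∈-++⁻ (map (λ h → (2m ∸ 2 * h , 2n ∸ 1) , (2m ∸ 2 * h , 2n)) (upTo (suc m))) e∈
    ... | inj₁ e∈₁ with ∈-map⁻ (λ h → (2m ∸ 2 * h , 2n ∸ 1) , (2m ∸ 2 * h , 2n)) {xs = upTo (suc m)} e∈₁
    ...   | h , _ , eq = inj₁ (h , trans (,-injectiveˡ eq) (cong₂ _,_ (double-∸ (suc m) h) (cong (_∸ 1) 2n≡)) , trans (,-injectiveʳ eq) (cong₂ _,_ (double-∸ (suc m) h) 2n≡))
    weight2-cases e∈ | inj₂ e∈₂ with ∈-map⁻ (λ k → (2m ∸ 1 , 2n ∸ 2 * k) , (2m , 2n ∸ 2 * k)) {xs = upTo (suc n)} e∈₂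
    ...   | k , _ , eq = inj₂ (k , trans (,-injectiveˡ eq) (cong₂ _,_ (cong (_∸ 1) 2m≡) (double-∸ (suc n) k)) , trans (,-injectiveʳ eq) (cong₂ _,_ 2m≡ (double-∸ (suc n) k)))

    -- The list starts with the largest row number, so row `2 (i + 1)` stands at `h = m - i`.
    horizontal-∈ : ∀ i → i ≤ m → ((double (suc i) , suc (double n)) , (double (suc i) , suc (suc (double n)))) ∈ E
    horizontal-∈ i i≤m = subst (_∈ E) (cong₂ (λ r c → (r , c ∸ 1) , (r , c)) (trans (double-∸ (suc m) (m ∸ i)) (cong double row)) 2n≡)
      (∈-++⁺ˡ (∈-map⁺ (λ h → (2m ∸ 2 * h , 2n ∸ 1) , (2m ∸ 2 * h , 2n)) {m ∸ i} (∈-upTo⁺ (s≤s (ℕ.m∸n≤m m i)))))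
      where
      row : suc m ∸ (m ∸ i) ≡ suc i
      row = trans (ℕ.+-∸-assoc 1 (ℕ.m∸n≤m m i)) (cong suc (ℕ.m∸[m∸n]≡n i≤m))

    vertical-∈ : ∀ j → j ≤ n → ((suc (double m) , double (suc j)) , (suc (suc (double m)) , double (suc j))) ∈ E
    vertical-∈ j j≤n = subst (_∈ E) (cong₂ (λ c r → (r ∸ 1 , c) , (r , c)) (trans (double-∸ (suc n) (n ∸ j)) (cong double column)) 2m≡)
      (∈-++⁺ʳ (map (λ h → (2m ∸ 2 * h , 2n ∸ 1) , (2m ∸ 2 * h , 2n)) (upTo (suc m))) (∈-map⁺ (λ k → (2m ∸ 1 , 2n ∸ 2 * k) , (2m , 2n ∸ 2 * k)) {n ∸ j} (∈-upTo⁺ (s≤s (ℕ.m∸n≤m n j)))))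
      where
      column : suc n ∸ (n ∸ j) ≡ suc j
      column = trans (ℕ.+-∸-assoc 1 (ℕ.m∸n≤m n j)) (cong suc (ℕ.m∸[m∸n]≡n j≤n))

    private
      h v : ℕ → ℕ → ℕ
      h = horizontal (checkerWeight (suc m) (suc n))
      v = vertical (checkerWeight (suc m) (suc n))

      light : ∀ {e} → e ∉ E → (if does (e ∈? E) then 2 else 1) ≡ 1
      light {e} e∉ = cong (λ b → if b then 2 else 1) (dec-false (e ∈? E) e∉)

      heavy : ∀ {e} → e ∈ E → (if does (e ∈? E) then 2 else 1) ≡ 2
      heavy {e} e∈ = cong (λ b → if b then 2 else 1) (dec-true (e ∈? E) e∈)

    h-even : ∀ i c → h (double i) c ≡ 1
    h-even i c = light λ e∈ → absurd (weight2-cases e∈)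
      where
      absurd : _ → ⊥
      absurd (inj₁ (x , eq , _)) = even≢odd (suc m ∸ x) i (sym (,-injectiveˡ eq))
      absurd (inj₂ (k , eq , eq')) = ℕ.1+n≢n (trans (sym (,-injectiveˡ eq')) (,-injectiveˡ eq))

    h-odd : ∀ i c → i ≤ m → h (suc (double i)) c ≡ endWeight n c
    h-odd i c i≤m with c ℕ.≟ double n
    ... | yes refl = trans (heavy (horizontal-∈ i i≤m)) (sym (end n))
      where
      end : ∀ n → endWeight n (double n) ≡ 2
      end zero = refl
      end (suc n) = end n
    ... | no c≢ = trans (light λ e∈ → absurd (weight2-cases e∈)) (sym (elsewhere n c c≢))
      where
      elsewhere : ∀ n c → c ≢ double n → endWeight n c ≡ 1
      elsewhere zero zero c≢ = ⊥-elim (c≢ refl)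
      elsewhere zero (suc c) c≢ = refl
      elsewhere (suc n) zero c≢ = refl
      elsewhere (suc n) (suc zero) c≢ = refl
      elsewhere (suc n) (suc (suc c)) c≢ = elsewhere n c (λ eq → c≢ (cong (λ k → suc (suc k)) eq))
      absurd : _ → ⊥
      absurd (inj₁ (x , eq , _)) = c≢ (ℕ.suc-injective (,-injectiveʳ eq))
      absurd (inj₂ (k , eq , eq')) = ℕ.1+n≢n (trans (sym (,-injectiveˡ eq')) (,-injectiveˡ eq))

    v-light : ∀ a c → a ≢ double m → v a c ≡ 1
    v-light a c a≢ = light λ e∈ → absurd (weight2-cases e∈)
      where
      absurd : _ → ⊥
      absurd (inj₁ (x , eq , eq')) = ℕ.1+n≢n (trans (,-injectiveˡ eq') (sym (,-injectiveˡ eq)))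
      absurd (inj₂ (k , eq , _)) = a≢ (ℕ.suc-injective (,-injectiveˡ eq))

    v-last : ∀ c → c < double (suc n) → v (double m) c ≡ columnWeight c
    v-last c c< with parity c
      where
      parity : ∀ c → (∃[ j ] c ≡ double j) ⊎ (∃[ j ] c ≡ suc (double j))
      parity zero = inj₁ (0 , refl)
      parity (suc c) with parity c
      ... | inj₁ (j , eq) = inj₂ (j , cong suc eq)
      ... | inj₂ (j , eq) = inj₁ (suc j , cong suc eq)
    ... | inj₁ (j , refl) = trans (light λ e∈ → absurd (weight2-cases e∈)) (sym (even j))
      where
      even : ∀ j → columnWeight (double j) ≡ 1
      even zero = refl
      even (suc j) = even j
      absurd : _ → ⊥
      absurd (inj₁ (x , eq , eq')) = ℕ.1+n≢n (trans (,-injectiveˡ eq') (sym (,-injectiveˡ eq)))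
      absurd (inj₂ (k , eq , _)) = even≢odd (suc n ∸ k) j (sym (,-injectiveʳ eq))
    ... | inj₂ (j , refl) = trans (heavy (vertical-∈ j (j≤n n j c<))) (sym (odd j))
      where
      odd : ∀ j → columnWeight (suc (double j)) ≡ 2
      odd zero = refl
      odd (suc j) = odd j
      j≤n : ∀ n j → suc (double j) < double (suc n) → j ≤ n
      j≤n n zero _ = z≤n
      j≤n zero (suc j) (s≤s (s≤s ()))
      j≤n (suc n) (suc j) (s≤s (s≤s lt)) = s≤s (j≤n n j lt)

    checkerboard : Checkerboard n m h v
    checkerboard = build m h v (λ i c _ → h-even i c) h-odd (λ i c i<m → v-light (double i) c (λ eq → ℕ.<-irrefl (double-injective eq) i<m))
      (λ i c _ → v-light (suc (double i)) c (even≢odd m i ∘ sym)) v-last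
      where
      build : ∀ m h v → (∀ i c → i ≤ m → h (double i) c ≡ 1) → (∀ i c → i ≤ m → h (suc (double i)) c ≡ endWeight n c) →
        (∀ i c → i < m → v (double i) c ≡ 1) → (∀ i c → i < m → v (suc (double i)) c ≡ 1) →
        (∀ c → c < double (suc n) → v (double m) c ≡ columnWeight c) → Checkerboard n m h v
      build zero h v h0 h1 v0 v1 vl = (λ c → h0 0 c z≤n) , (λ c → h1 0 c z≤n) , vl
      build (suc m) h v h0 h1 v0 v1 vl = (λ c → h0 0 c z≤n) , (λ c → h1 0 c z≤n) , (λ c → v0 0 c (s≤s z≤n)) , (λ c → v1 0 c (s≤s z≤n)) ,
        build m _ _ (λ i c le → h0 (suc i) c (s≤s le)) (λ i c le → h1 (suc i) c (s≤s le))
          (λ i c lt → v0 (suc i) c (s≤s lt)) (λ i c lt → v1 (suc i) c (s≤s lt)) vl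

    -- The side lengths `2 * suc m` and `suc (suc (double m))` agree only propositionally; `count`
    -- keeps them as variables so that they can be exchanged.
    tilings-transferred : weightedDominoTilings (suc m) (suc n) ≡ transfer (suc (double m)) h v (replicate (double (suc n)) true)
    tilings-transferred = trans (cong₂ count 2m≡ 2n≡) (weighted-tilings (suc (double m)) (double (suc n)) (checkerWeight (suc m) (suc n)))
      where
      count : ℕ → ℕ → ℕ
      count p q = sum (map (weight {p} {q} (gridWeight (checkerWeight (suc m) (suc n)))) (perfectMatchings p q))

-- The tiling count as a determinant

module Tilings (R : CommutativeRing 0ℓ 0ℓ) where
  open import Defs using (weightedDominoTilings)
  open ExteriorAlgebra R using (det; opT; shiftedPath)
  open FreeFermions R using (nat; four; transfer≈det)
  open CheckerboardWeights using (checkerboard; tilings-transferred)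
  open CommutativeRing R using (_≈_; trans; reflexive)
  open import Data.Nat.Base using (suc)
  import Relation.Binary.PropositionalEquality as ≡

  tilings≈det : ∀ m n → nat (weightedDominoTilings (suc m) (suc n)) ≈ det {suc n} (opT (shiftedPath four) (suc m))
  tilings≈det m n = trans (reflexive (≡.cong nat (tilings-transferred m n))) (transfer≈det n m _ _ (checkerboard m n))

-- Raw rings and their laws

module RawRings where
  open import Algebra.Structures using (IsCommutativeRing)

  -- A ring keeps its raw ring as an argument, so that formulas over it are literally
  -- those of Defs.
  IsCommutative : RawRing 0ℓ 0ℓ → Set
  IsCommutative R = IsCommutativeRing _≈_ _+_ _*_ -_ 0# 1#
    where open RawRing R

  commutativeRing : (R : RawRing 0ℓ 0ℓ) → IsCommutative R → CommutativeRing 0ℓ 0ℓ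
  commutativeRing R R-commutative = record { isCommutativeRing = R-commutative }

-- Linear factors of the Chebyshev polynomials

module Factorisation (R : CommutativeRing 0ℓ 0ℓ) where
  open IntegerCoefficients
  open ExteriorAlgebra R
  open FreeFermions R using (four)
  open CommutativeRing R hiding (zero)
  open IntegerSolver R
  open import Data.Fin.Base using (zero; suc)
  open import Data.Integer.Base using (+_)
  open import Data.Nat.Base as ℕ using (ℕ; zero; suc; s≤s; z≤n; _≤_; _<_)
  import Data.Nat.Properties as ℕ
  open import Data.Vec.Base as Vec using (Vec; []; _∷_)
  open import Function.Base using (_∘_)
  import Relation.Binary.Reasoning.Setoid setoid as ≈-R
  open import Relation.Binary.PropositionalEquality as ≡ using (_≡_)

  -- The vector of the coefficients of degree less than n stands for a monic
  -- polynomial of degree n.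
  Monic : ℕ → Set
  Monic = Vec Carrier

  module Action {k : ℕ} (A : V k → V k) (lA : Linear A) where
    module A = Linear lA

    A-+ : ∀ u v i → A (λ i → u i + v i) i ≈ A u i + A v i
    A-+ u v i = trans (A.cong (λ i → solve 2 (λ u v → u :+ v := con (+ 1) :* u :+ con (+ 1) :* v) refl (u i) (v i)) i)
      (trans (A.linear 1# u 1# v i) (solve 2 (λ u v → con (+ 1) :* u :+ con (+ 1) :* v := u :+ v) refl (A u i) (A v i)))

    A-scale : ∀ a u i → A (λ i → a * u i) i ≈ a * A u i
    A-scale a u i = trans (A.cong (λ i → solve 2 (λ a u → a :* u := a :* u :+ con (+ 0) :* u) refl a (u i)) i)
      (trans (A.linear a u 0# u i) (solve 2 (λ a u → a :* u :+ con (+ 0) :* u := a :* u) refl a (A u i)))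

    A-minus : ∀ u v i → A (λ i → u i - v i) i ≈ A u i - A v i
    A-minus u v i = trans (A.cong (λ i → solve 2 (λ u v → u :- v := con (+ 1) :* u :+ (:- con (+ 1)) :* v) refl (u i) (v i)) i)
      (trans (A.linear 1# u (- 1#) v i) (solve 2 (λ u v → con (+ 1) :* u :+ (:- con (+ 1)) :* v := u :- v) refl (A u i) (A v i)))

    -- Horner evaluation of the polynomial at the operator `A`.
    act : ∀ {n} → Monic n → V k → V k
    act [] v = v
    act (c ∷ p) v i = c * v i + A (act p v) i

    act-cong : ∀ {n} (p : Monic n) {u v} → u ≋ v → act p u ≋ act p v
    act-cong [] u≋v = u≋v
    act-cong (c ∷ p) u≋v i = +-cong (*-congˡ (u≋v i)) (A.cong (act-cong p u≋v) i)

    factor : Carrier → V k → V k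
    factor r v i = A v i - r * v i

    factors : ∀ {n} → Vec Carrier n → V k → V k
    factors [] v = v
    factors (r ∷ rs) v = factor r (factors rs v)

    factor-linear : ∀ r → Linear (factor r)
    factor-linear r = record
      { cong = λ u≋v i → +-cong (A.cong u≋v i) (-‿cong (*-congˡ (u≋v i)))
      ; linear = λ a u b v i → trans (+-congʳ (A.linear a u b v i))
          (solve 7 (λ r a u b v x y → (a :* x :+ b :* y) :- r :* (a :* u :+ b :* v) := a :* (x :- r :* u) :+ b :* (y :- r :* v)) refl
            r a (u i) b (v i) (A u i) (A v i))
      }

  scalar : Carrier → V 1 → V 1
  scalar z v i = z * v i

  scalar-linear : ∀ z → Linear (scalar z)
  scalar-linear z = record
    { cong = λ u≋v i → *-congˡ (u≋v i)
    ; linear = λ a u b v i → solve 5 (λ z a u b v → z :* (a :* u :+ b :* v) := a :* (z :* u) :+ b :* (z :* v)) refl z a (u i) b (v i)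
    }

  -- Evaluation at a number is the action of a 1 × 1 operator, so that `division` serves both
  -- numbers and operators.
  eval : ∀ {n} → Monic n → Carrier → Carrier
  eval p z = Action.act (scalar z) (scalar-linear z) p (λ _ → 1#) zero

  -- Synthetic division: the coefficients of the quotient by `X - r` are the values at `r` of the
  -- truncated polynomials.
  quotient : ∀ {n} → Monic (suc n) → Carrier → Monic n
  quotient (c ∷ []) r = []
  quotient (c ∷ p@(_ ∷ _)) r = eval p r ∷ quotient p r

  module _ {k : ℕ} (A : V k → V k) (lA : Linear A) where
    open Action A lA

    division : ∀ {n} (p : Monic (suc n)) r v i → act p v i ≈ factor r (act (quotient p r) v) i + eval p r * v i
    division (c ∷ []) r v i = solve 4 (λ c v a r → c :* v :+ a := (a :- r :* v) :+ (c :* con (+ 1) :+ r :* con (+ 1)) :* v) refl c (v i) (A v i) r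
    division (c ∷ p@(_ ∷ _)) r v i = begin
      c * v i + A (act p v) i
        ≈⟨ +-congˡ (trans (A.cong (division p r v) i) (trans (A-+ (factor r w) (λ i → e * v i) i)
             (+-cong (A-minus (A w) (λ i → r * w i) i) (A-scale e v i)))) ⟩
      c * v i + ((A (A w) i - A (λ i → r * w i) i) + e * A v i)
        ≈⟨ +-congˡ (+-congʳ (+-congˡ (-‿cong (A-scale r w i)))) ⟩
      c * v i + ((A (A w) i - r * A w i) + e * A v i)
        ≈⟨ solve 7 (λ c v x y e z r → c :* v :+ ((x :- r :* y) :+ e :* z) := ((e :* z :+ x) :- r :* (e :* v :+ y)) :+ (c :* con (+ 1) :+ r :* e) :* v) refl
             c (v i) (A (A w) i) (A w i) e (A v i) r ⟩
      ((e * A v i + A (A w) i) - r * (e * v i + A w i)) + (c * 1# + r * e) * v i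
        ≈⟨ +-congʳ (+-congʳ (trans (A-+ (λ i → e * v i) (A w) i) (+-congʳ (A-scale e v i)))) ⟨
      factor r (act (e ∷ quotient p r) v) i + eval (c ∷ p) r * v i ∎
      where
      open ≈-R
      e = eval p r
      w = act (quotient p r) v

  -- Takes the place of being nonzero: it is what cancelling a factor requires, and over the reals
  -- it follows from positivity.
  Regular : Carrier → Set
  Regular x = ∀ y → x * y ≈ 0# → y ≈ 0#

  from : (ℕ → Carrier) → ℕ → ∀ n → Vec Carrier n
  from ρ s zero = []
  from ρ s (suc n) = ρ s ∷ from ρ (suc s) n

  module _ {k : ℕ} (A : V k → V k) (lA : Linear A) (ρ : ℕ → Carrier) where
    open Action A lA

    -- After one factor is split off, the other roots are roots of the quotient, because
    -- `(ρ h - r) q(ρ h) = p(ρ h) = 0` and the difference is regular.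
    factorisation : ∀ {n} (p : Monic n) s → (∀ h → s ≤ h → h < s ℕ.+ n → eval p (ρ h) ≈ 0#) →
      (∀ h h' → s ≤ h → h < h' → h' < s ℕ.+ n → Regular (ρ h' - ρ h)) → ∀ v → act p v ≋ factors (from ρ s n) v
    factorisation [] s roots distinct v i = refl
    factorisation {suc n} p@(_ ∷ _) s roots distinct v i = trans (division A lA p r v i)
      (trans (+-cong (Linear.cong (factor-linear r) (factorisation (quotient p r) (suc s) roots′ distinct′ v) i) (*-congʳ (roots s ℕ.≤-refl (ℕ.m<m+n s (s≤s z≤n)))))
        (solve 2 (λ x y → x :+ con (+ 0) :* y := x) refl _ (v i)))
      where
      r = ρ s
      bound : ∀ {h} → h < suc s ℕ.+ n → h < s ℕ.+ suc n
      bound {h} = ≡.subst (h <_) (≡.sym (ℕ.+-suc s n))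
      roots′ : ∀ h → suc s ≤ h → h < suc s ℕ.+ n → eval (quotient p r) (ρ h) ≈ 0#
      roots′ h s<h h< = distinct s h ℕ.≤-refl s<h (bound h<) (eval (quotient p r) (ρ h)) (begin
        (ρ h - r) * q                         ≈⟨ solve 3 (λ h r q → (h :- r) :* q := (h :* q :- r :* q) :+ con (+ 0) :* con (+ 1)) refl (ρ h) r q ⟩
        (ρ h * q - r * q) + 0# * 1#           ≈⟨ +-congˡ (*-congʳ (roots s ℕ.≤-refl (ℕ.m<m+n s (s≤s z≤n)))) ⟨
        (ρ h * q - r * q) + eval p r * 1#     ≈⟨ division (scalar (ρ h)) (scalar-linear (ρ h)) p r (λ _ → 1#) zero ⟨
        eval p (ρ h)                          ≈⟨ roots h (ℕ.<⇒≤ s<h) (bound h<) ⟩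
        0#                                    ∎)
        where
        open ≈-R
        q = eval (quotient p r) (ρ h)
      distinct′ : ∀ h h' → suc s ≤ h → h < h' → h' < suc s ℕ.+ n → Regular (ρ h' - ρ h)
      distinct′ h h' s≤h h<h' h'< = distinct h h' (ℕ.<⇒≤ s≤h) h<h' (bound h'<)

  subtract : ∀ {n} → Monic (suc (suc n)) → Monic n → Monic (suc (suc n))
  subtract (a ∷ p) [] = (a - 1#) ∷ p
  subtract (a ∷ p) (c ∷ q) = (a - c) ∷ subtract p q

  -- The coefficients of `S_(m+1)`. Since `S_0 = 2` is not monic, the recursion starts from
  -- `S_1 = X` and `S_2 = X² - 2`.
  chebyshev : ∀ m → Monic (suc m)
  chebyshev zero = 0# ∷ []
  chebyshev (suc zero) = - (1# + 1#) ∷ 0# ∷ []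
  chebyshev (suc (suc m)) = subtract (0# ∷ chebyshev (suc m)) (chebyshev m)

  module _ {k : ℕ} (A : V k → V k) (lA : Linear A) where
    open Action A lA

    act-subtract : ∀ {n} (p : Monic (suc (suc n))) (q : Monic n) v i → act (subtract p q) v i ≈ act p v i - act q v i
    act-subtract (a ∷ p) [] v i = solve 3 (λ a v x → (a :- con (+ 1)) :* v :+ x := (a :* v :+ x) :- v) refl a (v i) (A (act p v) i)
    act-subtract (a ∷ p) (c ∷ q) v i = trans (+-congˡ (trans (A.cong (act-subtract p q v) i) (A-minus (act p v) (act q v) i)))
      (solve 5 (λ a c v x y → (a :- c) :* v :+ (x :- y) := (a :* v :+ x) :- (c :* v :+ y)) refl a c (v i) (A (act p v) i) (A (act q v) i))

    act-chebyshev : ∀ m v → act (chebyshev m) v ≋ opT A (suc m) v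
    act-chebyshev zero v i = solve 2 (λ v a → con (+ 0) :* v :+ a := a) refl (v i) (A v i)
    act-chebyshev (suc zero) v i = trans (+-congˡ (A.cong (λ i → solve 2 (λ v a → con (+ 0) :* v :+ a := a) refl (v i) (A v i)) i))
      (solve 2 (λ v a → (:- con (+ 2)) :* v :+ a := a :- (v :+ v)) refl (v i) (A (A v) i))
    act-chebyshev (suc (suc m)) v i = trans (act-subtract (0# ∷ chebyshev (suc m)) (chebyshev m) v i)
      (+-cong (trans (+-cong (zeroˡ (v i)) (A.cong (act-chebyshev (suc m) v) i)) (+-identityˡ _)) (-‿cong (act-chebyshev m v i)))

  opT-scalar : ∀ z j → opT (scalar z) j (λ _ → 1#) zero ≈ doubledT z j
  opT-scalar z zero = refl
  opT-scalar z (suc zero) = *-identityʳ z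
  opT-scalar z (suc (suc j)) = +-cong (*-congˡ (opT-scalar z (suc j))) (-‿cong (opT-scalar z j))

  eval-chebyshev : ∀ m z → eval (chebyshev m) z ≈ doubledT z (suc m)
  eval-chebyshev m z = trans (act-chebyshev (scalar z) (scalar-linear z) m (λ _ → 1#) zero) (opT-scalar z (suc m))

  ∏ : ℕ → (ℕ → Carrier) → Carrier
  ∏ zero f = 1#
  ∏ (suc n) f = f 1 * ∏ n (f ∘ suc)

  ∏-cong : ∀ n {f g} → (∀ h → 1 ≤ h → h ≤ n → f h ≈ g h) → ∏ n f ≈ ∏ n g
  ∏-cong zero f≈g = refl
  ∏-cong (suc n) f≈g = *-cong (f≈g 1 ℕ.≤-refl (s≤s z≤n)) (∏-cong n (λ h 1≤h h≤n → f≈g (suc h) (s≤s z≤n) (s≤s h≤n)))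

  -- The numbers `- y h` are the roots of `S_m(2 + x)` in the variable `x`, pairwise distinct in the
  -- strong sense of regular differences.
  record Roots (m : ℕ) (y : ℕ → Carrier) : Set where
    field
      root     : ∀ h → 1 ≤ h → h ≤ m → doubledT (1# + 1# - y h) m ≈ 0#
      distinct : ∀ h h' → 1 ≤ h → h < h' → h' ≤ m → Regular (y h - y h')

  module _ {m : ℕ} {y : ℕ → Carrier} (rs : Roots (suc m) y) where
    open Roots rs

    private
      ρ : ℕ → Carrier
      ρ h = 1# + 1# - y h

    opT-factors : ∀ {k} (A : V k → V k) (lA : Linear A) v → opT A (suc m) v ≋ Action.factors A lA (from ρ 1 (suc m)) v
    opT-factors A lA v i = trans (sym (act-chebyshev A lA m v i))
      (factorisation A lA ρ (chebyshev m) 1 (λ h 1≤h h< → trans (eval-chebyshev m (ρ h)) (root h 1≤h (ℕ.≤-pred h<)))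
        (λ h h' 1≤h h<h' h'< x eq → distinct h h' 1≤h h<h' (ℕ.≤-pred h'<) x (trans
          (*-congʳ (solve 2 (λ y y' → y :- y' := (con (+ 2) :- y') :- (con (+ 2) :- y)) refl (y h) (y h'))) eq)) v i)

    -- For `z = 2 + x` the factor `z - (2 - y h)` is `x + y h`.
    doubledT-product : ∀ x → doubledT (1# + 1# + x) (suc m) ≈ ∏ (suc m) (λ h → x + y h)
    doubledT-product x = trans (sym (opT-scalar z (suc m))) (trans (opT-factors (scalar z) (scalar-linear z) (λ _ → 1#) zero)
      (trans (go (suc m) 0) (∏-cong (suc m) (λ h _ _ → reflexive (≡.cong (λ h → x + y h) (ℕ.+-identityʳ h))))))
      where
      z = 1# + 1# + x
      go : ∀ n s → Action.factors (scalar z) (scalar-linear z) (from ρ (suc s) n) (λ _ → 1#) zero ≈ ∏ n (λ h → x + y (h ℕ.+ s))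
      go zero s = refl
      go (suc n) s = trans
        (solve 3 (λ x y w → (con (+ 2) :+ x) :* w :- (con (+ 2) :- y) :* w := (x :+ y) :* w) refl x (y (suc s)) _)
        (*-congˡ (trans (go n (suc s)) (∏-cong n (λ h _ _ → reflexive (≡.cong (λ h → x + y h) (ℕ.+-suc h s))))))

    det-id : ∀ k → det {k} (λ v → v) ≈ 1#
    det-id k = trans (map-id (basis {k}) (top {k})) (trans (wedges-basis {k} (top {k})) (δ-top k))
      where
      δ-top : ∀ k → δ (top {k}) ≈ 1#
      δ-top zero = refl
      δ-top (suc k) = δ-top k

    -- The factorisation holds for the operator, and `det` is multiplicative. Each factor is
    -- `shiftedPath` at `2 + y h`, as `4 - (2 - y h) = 2 + y h`.
    det-opT : ∀ n → det {suc n} (opT (shiftedPath four) (suc m)) ≈ ∏ (suc m) (λ h → doubledT (1# + 1# + y h) (suc n))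
    det-opT n = trans (det-cong {suc n} (opT-factors (shiftedPath four) (shiftedPath-linear four)))
      (trans (go (suc m) 0) (∏-cong (suc m) (λ h _ _ → reflexive (≡.cong (λ h → doubledT (1# + 1# + y h) (suc n)) (ℕ.+-identityʳ h)))))
      where
      open Action {suc n} (shiftedPath four) (shiftedPath-linear four)
      single : ∀ h → det {suc n} (factor (ρ h)) ≈ doubledT (1# + 1# + y h) (suc n)
      single h = trans (det-cong {suc n} {g = factor (ρ h)} {shiftedPath (1# + 1# + y h)} (λ v i → solve 3 (λ y v p → (con (+ 4) :* v :+ p) :- (con (+ 2) :- y) :* v := (con (+ 2) :+ y) :* v :+ p) refl (y h) (v i) (path v i)))
        (det-shiftedPath n (1# + 1# + y h))
      go : ∀ l s → det {suc n} (factors (from ρ (suc s) l)) ≈ ∏ l (λ h → doubledT (1# + 1# + y (h ℕ.+ s)) (suc n))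
      go zero s = det-id (suc n)
      go (suc l) s = trans (det-∘ {L = factor (ρ (suc s))} {factors (from ρ (suc (suc s)) l)} (factor-linear (ρ (suc s))))
        (*-cong (single (suc s)) (trans (go l (suc s)) (∏-cong l (λ h _ _ → reflexive (≡.cong (λ h → doubledT (1# + 1# + y h) (suc n)) (ℕ.+-suc h s))))))

  -- If c k plays the role of cos (k θ), then c (2 m) ≈ 0 gives a root of the doubled Chebyshev polynomial.
  module _ (c : ℕ → Carrier) (c₀ : c 0 ≈ 1#) (c-step : ∀ k → c (suc (suc k)) + c k ≈ (1# + 1#) * (c 1 * c (suc k))) where
    sign : ℕ → Carrier
    sign zero = 1#
    sign (suc j) = - sign j

    private
      even : ℕ → ℕ
      even zero = 0
      even (suc j) = suc (suc (even j))

      c′ : ∀ k → c (suc (suc k)) ≈ (1# + 1#) * (c 1 * c (suc k)) - c k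
      c′ k = trans (solve 2 (λ x y → x := x :+ y :- y) refl (c (suc (suc k))) (c k)) (+-congʳ (c-step k))

      doubled-step : ∀ k → c (suc (suc (suc (suc k)))) ≈ ((1# + 1# + 1# + 1#) * (c 1 * c 1) - (1# + 1#)) * c (suc (suc k)) - c k
      doubled-step k = begin
        c (suc (suc (suc (suc k))))
          ≈⟨ trans (c′ (suc (suc k))) (+-congʳ (*-congˡ (*-congˡ (c′ (suc k))))) ⟩
        (1# + 1#) * (c 1 * ((1# + 1#) * (c 1 * c (suc (suc k))) - c (suc k))) - c (suc (suc k))
          ≈⟨ solve 4 (λ z a b d → con (+ 2) :* (z :* (con (+ 2) :* (z :* a) :- b)) :- a := (con (+ 4) :* (z :* z) :- con (+ 2)) :* a :- (con (+ 2) :* (z :* b) :- a)) refl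
               (c 1) (c (suc (suc k))) (c (suc k)) (c k) ⟩
        ((1# + 1# + 1# + 1#) * (c 1 * c 1) - (1# + 1#)) * c (suc (suc k)) - ((1# + 1#) * (c 1 * c (suc k)) - c (suc (suc k)))
          ≈⟨ +-congˡ (-‿cong (trans (+-congˡ (-‿cong (c′ k))) (solve 2 (λ x y → x :- (x :- y) := y) refl _ (c k)))) ⟩
        ((1# + 1# + 1# + 1#) * (c 1 * c 1) - (1# + 1#)) * c (suc (suc k)) - c k ∎
        where open ≈-R

    -- In terms of angles: `2 - 4 cos²θ = - 2 cos 2θ`, and `S_j(- 2 cos 2θ) = (-1)^j 2 cos 2jθ`.
    doubledT-even : ∀ y → y ≈ (1# + 1# + 1# + 1#) * (c 1 * c 1) → ∀ j → doubledT (1# + 1# - y) j ≈ sign j * ((1# + 1#) * c (j ℕ.+ j))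
    doubledT-even y y≈ j = trans (go j) (*-congˡ (*-congˡ (reflexive (≡.cong c (even≡ j)))))
      where
      even≡ : ∀ j → even j ≡ j ℕ.+ j
      even≡ zero = ≡.refl
      even≡ (suc j) = ≡.cong suc (≡.trans (≡.cong suc (even≡ j)) (≡.sym (ℕ.+-suc j j)))
      go : ∀ j → doubledT (1# + 1# - y) j ≈ sign j * ((1# + 1#) * c (even j))
      go zero = sym (trans (*-congˡ (*-congˡ c₀)) (solve 0 (con (+ 1) :* (con (+ 2) :* con (+ 1)) := con (+ 2)) refl))
      go (suc zero) = trans (+-congˡ (-‿cong y≈)) (sym (trans (*-congˡ (*-congˡ (trans (c′ 0) (+-congˡ (-‿cong c₀)))))
        (solve 1 (λ z → (:- con (+ 1)) :* (con (+ 2) :* (con (+ 2) :* (z :* z) :- con (+ 1))) := con (+ 2) :- con (+ 4) :* (z :* z)) refl (c 1))))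
      go (suc (suc j)) = trans (+-cong (*-cong (+-congˡ (-‿cong y≈)) (go (suc j))) (-‿cong (go j))) (sym (trans (*-congˡ (*-congˡ (doubled-step (even j))))
        (solve 4 (λ s z a b → (:- :- s) :* (con (+ 2) :* ((con (+ 4) :* (z :* z) :- con (+ 2)) :* a :- b)) :=
          (con (+ 2) :- con (+ 4) :* (z :* z)) :* ((:- s) :* (con (+ 2) :* a)) :- s :* (con (+ 2) :* b)) refl (sign j) (c 1) (c (suc (suc (even j)))) (c (even j)))))

    doubledT-root : ∀ y m → y ≈ (1# + 1# + 1# + 1#) * (c 1 * c 1) → c (m ℕ.+ m) ≈ 0# → doubledT (1# + 1# - y) m ≈ 0#
    doubledT-root y m y≈ c≈0 = trans (doubledT-even y y≈ m) (trans (*-congˡ (*-congˡ c≈0)) (solve 1 (λ s → s :* (con (+ 2) :* con (+ 0)) := con (+ 0)) refl (sign m)))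

  -- The right side of the recursion has the factor `c 1`, so vanishing at one odd index passes to
  -- the next, as with `cos ((2j + 1) θ)` when `cos θ = 0`.
  odd-multiples : (c : ℕ → Carrier) → (∀ k → c (suc (suc k)) + c k ≈ (1# + 1#) * (c 1 * c (suc k))) → c 1 ≈ 0# → ∀ j → c (suc (j ℕ.+ j)) ≈ 0#
  odd-multiples c c-step c₁ zero = c₁
  odd-multiples c c-step c₁ (suc j) = trans (reflexive (≡.cong (λ k → c (suc (suc k))) (ℕ.+-suc j j))) (begin
    c (suc (suc k))                                     ≈⟨ solve 2 (λ x y → x := x :+ y :- y) refl (c (suc (suc k))) (c k) ⟩
    c (suc (suc k)) + c k - c k                         ≈⟨ +-cong (trans (c-step k) (*-congˡ (*-congʳ c₁))) (-‿cong (odd-multiples c c-step c₁ j)) ⟩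
    (1# + 1#) * (0# * c (suc k)) - 0#                   ≈⟨ solve 1 (λ x → con (+ 2) :* (con (+ 0) :* x) :- con (+ 0) := con (+ 0)) refl (c (suc k)) ⟩
    0#                                                  ∎)
    where
    open ≈-R
    k = suc (j ℕ.+ j)

-- Chebyshev polynomials of the first kind

module Chebyshev (R : CommutativeRing 0ℓ 0ℓ) where
  open import Defs using (module RingNotation)
  open IntegerCoefficients
  open ExteriorAlgebra R using (doubledT)
  open Factorisation R
  open CommutativeRing R hiding (zero)
  open IntegerSolver R
  open import Algebra.Definitions.RawSemiring (RawRing.rawSemiring (CommutativeRing.rawRing R)) using (_^_)
  open RingNotation rawRing using (fromℕ; ∏[1…_]; T)
  open import Data.Integer.Base using (+_)
  open import Data.Nat.Base as ℕ using (ℕ; zero; suc)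
  import Data.Nat.Properties as ℕ
  open import Function.Base using (_∘_)
  import Relation.Binary.Reasoning.Setoid setoid as ≈-R
  open import Relation.Binary.PropositionalEquality as ≡ using (_≡_)

  four-square : ∀ {z c} → z ≈ c → fromℕ 4 * z ^ 2 ≈ (1# + 1# + 1# + 1#) * (c * c)
  four-square {z} {c} z≈c = trans (solve 1 (λ z → (con (+ 1) :+ (con (+ 1) :+ (con (+ 1) :+ (con (+ 1) :+ con (+ 0))))) :* (z :* (z :* con (+ 1))) := con (+ 4) :* (z :* z)) refl z)
    (*-congˡ (*-cong z≈c z≈c))

  four-difference : ∀ z w → fromℕ 4 * z ^ 2 - fromℕ 4 * w ^ 2 ≈ fromℕ 4 * ((z - w) * (z + w))
  four-difference z w = solve 3 (λ f z w → f :* (z :* (z :* con (+ 1))) :- f :* (w :* (w :* con (+ 1))) := f :* ((z :- w) :* (z :+ w))) refl (fromℕ 4) z w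

  regular-cong : ∀ {x y} → x ≈ y → Regular y → Regular x
  regular-cong x≈y regular z xz≈0 = regular z (trans (*-congʳ (sym x≈y)) xz≈0)

  product≡∏ : ∀ n f → ∏[1… n ] f ≡ ∏ n f
  product≡∏ zero f = ≡.refl
  product≡∏ (suc n) f = ≡.cong (f 1 *_) (product≡∏ n (f ∘ suc))

  doubledT-cong : ∀ {x y} → x ≈ y → ∀ j → doubledT x j ≈ doubledT y j
  doubledT-cong x≈y zero = refl
  doubledT-cong x≈y (suc zero) = x≈y
  doubledT-cong x≈y (suc (suc j)) = +-cong (*-cong x≈y (doubledT-cong x≈y (suc j))) (-‿cong (doubledT-cong x≈y j))

  -- This is the recursion of `cos kθ`, so `doubledT-even` applies with `c k = T k x`.
  T-step : ∀ x k → T (suc (suc k)) x + T k x ≈ (1# + 1#) * (T 1 x * T (suc k) x)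
  T-step x k = solve 3 (λ x a b → ((con (+ 1) :+ (con (+ 1) :+ con (+ 0))) :* x :* a :+ :- b) :+ b := con (+ 2) :* (x :* a)) refl x (T (suc k) x) (T k x)

  sign-square : ∀ (c : ℕ → Carrier) (c₀ : c 0 ≈ 1#) (cs : ∀ k → c (suc (suc k)) + c k ≈ (1# + 1#) * (c 1 * c (suc k))) j → sign c c₀ cs j * sign c c₀ cs j ≈ 1#
  sign-square c c₀ cs zero = *-identityˡ 1#
  sign-square c c₀ cs (suc j) = trans (solve 1 (λ s → (:- s) :* (:- s) := s :* s) refl (sign c c₀ cs j)) (sign-square c c₀ cs j)

  sign-power : ∀ (c : ℕ → Carrier) (c₀ : c 0 ≈ 1#) (cs : ∀ k → c (suc (suc k)) + c k ≈ (1# + 1#) * (c 1 * c (suc k))) j → (- 1#) ^ j ≈ sign c c₀ cs j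
  sign-power c c₀ cs zero = refl
  sign-power c c₀ cs (suc j) = trans (*-congˡ (sign-power c c₀ cs j)) (solve 1 (λ s → (:- con (+ 1)) :* s := :- s) refl (sign c c₀ cs j))

  -- (-1)^n 2 T_{2n}(x) is the doubled Chebyshev polynomial at 2 - 4 x².
  chebyshev-factor : ∀ n x y → y + (1# + 1# + 1# + 1#) * (x * x) ≈ 0# →
    (- 1#) ^ n * (fromℕ 2 * T (2 ℕ.* n) x) ≈ doubledT (1# + 1# + y) n
  chebyshev-factor n x y y≈ = begin
    (- 1#) ^ n * (fromℕ 2 * T (2 ℕ.* n) x)
      ≈⟨ *-cong (sign-power c refl (T-step x) n) (*-cong (+-congˡ (+-identityʳ 1#)) (reflexive (≡.cong (λ k → T (n ℕ.+ k) x) (ℕ.+-identityʳ n)))) ⟩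
    s * ((1# + 1#) * c (n ℕ.+ n))
      ≈⟨ doubledT-even c refl (T-step x) ((1# + 1# + 1# + 1#) * (x * x)) refl n ⟨
    doubledT (1# + 1# - (1# + 1# + 1# + 1#) * (x * x)) n
      ≈⟨ doubledT-cong (trans (solve 2 (λ y z → con (+ 2) :- z := con (+ 2) :+ y :- (y :+ z)) refl y ((1# + 1# + 1# + 1#) * (x * x)))
           (trans (+-congˡ (-‿cong y≈)) (solve 1 (λ y → con (+ 2) :+ y :- con (+ 0) := con (+ 2) :+ y) refl y))) n ⟩
    doubledT (1# + 1# + y) n ∎
    where
    open ≈-R
    c : ℕ → Carrier
    c k = T k x
    s = sign c refl (T-step x) n

  power-+ : ∀ x a b → x ^ (a ℕ.+ b) ≈ x ^ a * x ^ b
  power-+ x zero b = sym (*-identityˡ _)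
  power-+ x (suc a) b = trans (*-congˡ (power-+ x a b)) (sym (*-assoc x _ _))

  -- The prefactor `(-1)^(mn) 2^m` is dealt out, one `(-1)^n 2` to each of the `m` factors.
  chebyshev-product : ∀ m n (x y : ℕ → Carrier) → (∀ h → y h + (1# + 1# + 1# + 1#) * (x h * x h) ≈ 0#) →
    (- 1#) ^ (m ℕ.* n) * fromℕ 2 ^ m * ∏ m (λ h → T (2 ℕ.* n) (x h)) ≈ ∏ m (λ h → doubledT (1# + 1# + y h) n)
  chebyshev-product zero n x y y≈ = trans (*-congʳ (*-identityˡ 1#)) (*-identityˡ 1#)
  chebyshev-product (suc m) n x y y≈ = begin
    (- 1#) ^ (n ℕ.+ m ℕ.* n) * (fromℕ 2 * fromℕ 2 ^ m) * (t * P)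
      ≈⟨ *-congʳ (*-congʳ (power-+ (- 1#) n (m ℕ.* n))) ⟩
    ((- 1#) ^ n * (- 1#) ^ (m ℕ.* n)) * (fromℕ 2 * fromℕ 2 ^ m) * (t * P)
      ≈⟨ solve 6 (λ a b c d t p → (a :* b) :* (c :* d) :* (t :* p) := (a :* (c :* t)) :* (b :* d :* p)) refl ((- 1#) ^ n) ((- 1#) ^ (m ℕ.* n)) (fromℕ 2) (fromℕ 2 ^ m) t P ⟩
    ((- 1#) ^ n * (fromℕ 2 * t)) * ((- 1#) ^ (m ℕ.* n) * fromℕ 2 ^ m * P)
      ≈⟨ *-cong (chebyshev-factor n (x 1) (y 1) (y≈ 1)) (chebyshev-product m n (x ∘ suc) (y ∘ suc) (y≈ ∘ suc)) ⟩
    ∏ (suc m) (λ h → doubledT (1# + 1# + y h) n) ∎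
    where
    open ≈-R
    t = T (2 ℕ.* n) (x 1)
    P = ∏ m (λ h → T (2 ℕ.* n) (x (suc h)))

  rotated-square : ∀ i z → i * i ≈ - 1# → ∀ {y} → y ≈ (1# + 1# + 1# + 1#) * (z * z) → y + (1# + 1# + 1# + 1#) * ((i * z) * (i * z)) ≈ 0#
  rotated-square i z ii≈ {y} y≈ = begin
    y + (1# + 1# + 1# + 1#) * ((i * z) * (i * z))                              ≈⟨ +-cong y≈ (solve 2 (λ i z → con (+ 4) :* ((i :* z) :* (i :* z)) := (i :* i) :* (con (+ 4) :* (z :* z))) refl i z) ⟩
    (1# + 1# + 1# + 1#) * (z * z) + (i * i) * ((1# + 1# + 1# + 1#) * (z * z))  ≈⟨ +-congˡ (*-congʳ ii≈) ⟩
    (1# + 1# + 1# + 1#) * (z * z) + (- 1#) * ((1# + 1# + 1# + 1#) * (z * z))   ≈⟨ solve 1 (λ w → w :+ (:- con (+ 1)) :* w := con (+ 0)) refl _ ⟩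
    0#                                                                          ∎
    where open ≈-R

-- The double product over an abstract ring

module Formulas (R₀ : RawRing 0ℓ 0ℓ) (R₀-commutative : RawRings.IsCommutative R₀) where
  open RawRings
  open import Data.Integer.Base using (ℤ; +_)
  open import Data.Nat.Base as ℕ using (ℕ; zero; suc; s≤s; z≤n; NonZero)
  open import Defs using (module RingNotation; weightedDominoTilings)
  open ExteriorAlgebra (commutativeRing R₀ R₀-commutative) using (doubledT)
  open Factorisation (commutativeRing R₀ R₀-commutative)
  open Chebyshev (commutativeRing R₀ R₀-commutative)
  open Tilings (commutativeRing R₀ R₀-commutative) using (tilings≈det)
  open RawRing R₀ using (_+_; _*_; -_; 0#; 1#; _≈_)
  open CommutativeRing (commutativeRing R₀ R₀-commutative) hiding (zero; _+_; _*_; -_; 0#; 1#; _≈_)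
  open import Algebra.Definitions.RawSemiring (RawRing.rawSemiring R₀) using (_^_)
  open RingNotation R₀ using (fromℕ; ∏[1…_])
  import Data.Nat.Properties as ℕ
  open import Relation.Binary.PropositionalEquality as ≡ using (_≡_)

  module _ (ζ : ℤ → (d : ℕ) .{{_ : NonZero d}} → Carrier) where

    squares : (d : ℕ) .{{_ : NonZero d}} → ℕ → Carrier
    squares d h = fromℕ 4 * ζ (+ h) d ^ 2

    productFormula : (m n : ℕ) .{{_ : NonZero m}} .{{_ : NonZero n}} → Carrier
    productFormula m n = ∏[1… m ] (λ h → ∏[1… n ] (λ k → fromℕ 4 * ζ (+ h) m ^ 2 + fromℕ 4 * ζ (+ k) n ^ 2))

    module _ (P : Carrier → Set) (P-1 : P 1#) (P-* : ∀ x y → P x → P y → P (x * y)) (P-+ : ∀ x y → P x → P y → P (x + y)) where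

      private
        ∏-closed : ∀ n f → (∀ h → 1 ℕ.≤ h → h ℕ.≤ n → P (f h)) → P (∏[1… n ] f)
        ∏-closed zero f Pf = P-1
        ∏-closed (suc n) f Pf = P-* _ _ (Pf 1 (s≤s z≤n) (s≤s z≤n)) (∏-closed n (λ h → f (suc h)) (λ h 1≤h h≤n → Pf (suc h) (s≤s z≤n) (s≤s h≤n)))

      -- Serves to transfer positivity from the single squares to the whole product.
      productFormula-closed : (∀ d h → 1 ℕ.≤ h → h ℕ.≤ suc d → P (squares (suc d) h)) →
        ∀ m n .{{_ : NonZero m}} .{{_ : NonZero n}} → P (productFormula m n)
      productFormula-closed P-squares (suc m) (suc n) = ∏-closed (suc m) _ (λ h 1≤h h≤m → ∏-closed (suc n) _ (λ k 1≤k k≤n →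
        P-+ _ _ (P-squares m h 1≤h h≤m) (P-squares n k 1≤k k≤n)))

    -- `c h k` stands for `cos kθ` with the angle `θ` of `ζ (+ h) m`. Vanishing at `k = 2m` makes
    -- `4 ζ²` a negated root, and the regularity hypothesis concerns the difference of two such
    -- squares in factored form.
    squares-roots : ∀ m .{{_ : NonZero m}} (c : ℕ → ℕ → Carrier) →
      (∀ h → c h 0 ≈ 1#) → (∀ h k → c h (suc (suc k)) + c h k ≈ (1# + 1#) * (c h 1 * c h (suc k))) →
      (∀ h → 1 ℕ.≤ h → h ℕ.≤ m → ζ (+ h) m ≈ c h 1) → (∀ h → 1 ℕ.≤ h → h ℕ.≤ m → c h (m ℕ.+ m) ≈ 0#) →
      (∀ h h' → 1 ℕ.≤ h → h ℕ.< h' → h' ℕ.≤ m → Regular (fromℕ 4 * ((ζ (+ h) m - ζ (+ h') m) * (ζ (+ h) m + ζ (+ h') m)))) → Roots m (squares m)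
    squares-roots m c c₀ c-step z≈ c≈0 regular = record
      { root = λ h 1≤h h≤m → doubledT-root (c h) (c₀ h) (c-step h) (squares m h) m (four-square (z≈ h 1≤h h≤m)) (c≈0 h 1≤h h≤m)
      ; distinct = λ h h' 1≤h h<h' h'≤m → regular-cong (four-difference (ζ (+ h) m) (ζ (+ h') m)) (regular h h' 1≤h h<h' h'≤m)
      }

    module _ (roots : ∀ d → Roots (suc d) (squares (suc d))) where

      tilings≈doubledT : ∀ m n .{{_ : NonZero m}} .{{_ : NonZero n}} → fromℕ (weightedDominoTilings m n) ≈ ∏ m (λ h → doubledT (1# + 1# + squares m h) n)
      tilings≈doubledT (suc m) (suc n) = trans (tilings≈det m n) (det-opT (roots m) n)

      product≈tilings : ∀ m n .{{_ : NonZero m}} .{{_ : NonZero n}} → productFormula m n ≈ fromℕ (weightedDominoTilings m n)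
      product≈tilings (suc m) (suc n) = trans (reflexive (product≡∏ (suc m) g)) (sym (trans (tilings≈doubledT (suc m) (suc n))
        (∏-cong (suc m) {_} {g} (λ h _ _ → trans (doubledT-product (roots n) (squares (suc m) h)) (reflexive (≡.sym (product≡∏ (suc n) (f h))))))))
        where
        f : ℕ → ℕ → Carrier
        f h k = squares (suc m) h + squares (suc n) k
        g : ℕ → Carrier
        g h = ∏[1… suc n ] (f h)

-- Transport along ring homomorphisms

module RingHomomorphisms where
  open import Defs using (module RingNotation; weightedDominoTilings)
  open RawRings
  open import Data.Nat.Base as ℕ using (ℕ; zero; suc; NonZero)
  open import Data.Integer.Base using (ℤ; +_)

  record IsHom (R S : CommutativeRing 0ℓ 0ℓ) (φ : CommutativeRing.Carrier R → CommutativeRing.Carrier S) : Set where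
    private
      module R' = CommutativeRing R
      module S' = CommutativeRing S
    field
      φ-cong : ∀ {x y} → x R'.≈ y → φ x S'.≈ φ y
      φ-+ : ∀ x y → φ (x R'.+ y) S'.≈ (φ x S'.+ φ y)
      φ-* : ∀ x y → φ (x R'.* y) S'.≈ (φ x S'.* φ y)
      φ-neg : ∀ x → φ (R'.- x) S'.≈ (S'.- φ x)
      φ-0 : φ R'.0# S'.≈ S'.0#
      φ-1 : φ R'.1# S'.≈ S'.1#

  module HomProperties {R S φ} (hom : IsHom R S φ) where
    open IsHom hom
    private
      module R' = CommutativeRing R
      module S' = CommutativeRing S
      module RN = RingNotation R'.rawRing
      module SN = RingNotation S'.rawRing
      module PR = Factorisation R
      module PS = Factorisation S
      module ER = ExteriorAlgebra R
      module ES = ExteriorAlgebra S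
      module CS = Chebyshev S
    open import Algebra.Definitions.RawSemiring (RawRing.rawSemiring R'.rawRing) using () renaming (_^_ to _^ᴿ_)
    open import Algebra.Definitions.RawSemiring (RawRing.rawSemiring S'.rawRing) using () renaming (_^_ to _^ˢ_)

    φ-fromℕ : ∀ n → φ (RN.fromℕ n) S'.≈ SN.fromℕ n
    φ-fromℕ zero = φ-0
    φ-fromℕ (suc n) = S'.trans (φ-+ R'.1# _) (S'.+-cong φ-1 (φ-fromℕ n))

    φ-^ : ∀ x n → φ (x ^ᴿ n) S'.≈ (φ x ^ˢ n)
    φ-^ x zero = φ-1
    φ-^ x (suc n) = S'.trans (φ-* x _) (S'.*-congˡ (φ-^ x n))

    φ-∏ : ∀ n f → φ (PR.∏ n f) S'.≈ PS.∏ n (λ h → φ (f h))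
    φ-∏ zero f = φ-1
    φ-∏ (suc n) f = S'.trans (φ-* (f 1) _) (S'.*-congˡ (φ-∏ n (λ h → f (suc h))))

    φ-doubledT : ∀ x n → φ (ER.doubledT x n) S'.≈ ES.doubledT (φ x) n
    φ-doubledT x zero = S'.trans (φ-+ R'.1# R'.1#) (S'.+-cong φ-1 φ-1)
    φ-doubledT x (suc zero) = S'.refl
    φ-doubledT x (suc (suc n)) = S'.trans (φ-+ _ _) (S'.+-cong (S'.trans (φ-* x _) (S'.*-congˡ (φ-doubledT x (suc n)))) (S'.trans (φ-neg _) (S'.-‿cong (φ-doubledT x n))))

    φ-shifted : ∀ y → φ (R'.1# R'.+ R'.1# R'.+ y) S'.≈ (S'.1# S'.+ S'.1# S'.+ φ y)
    φ-shifted y = S'.trans (φ-+ _ y) (S'.+-congʳ (S'.trans (φ-+ _ _) (S'.+-cong φ-1 φ-1)))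

    φ-product : ∀ N m n (y : ℕ → R'.Carrier) → RN.fromℕ N R'.≈ PR.∏ m (λ h → ER.doubledT (R'.1# R'.+ R'.1# R'.+ y h) n) →
      SN.fromℕ N S'.≈ PS.∏ m (λ h → ES.doubledT (S'.1# S'.+ S'.1# S'.+ φ (y h)) n)
    φ-product N m n y eq = S'.trans (S'.sym (φ-fromℕ N)) (S'.trans (φ-cong eq) (S'.trans (φ-∏ m _)
      (PS.∏-cong m (λ h _ _ → S'.trans (φ-doubledT _ n) (CS.doubledT-cong (φ-shifted (y h)) n)))))

    φ-four-square : ∀ z → φ (RN.fromℕ 4 R'.* z ^ᴿ 2) S'.≈ ((S'.1# S'.+ S'.1# S'.+ S'.1# S'.+ S'.1#) S'.* (φ z S'.* φ z))
    φ-four-square z = S'.trans (φ-* _ _) (S'.trans (S'.*-cong (φ-fromℕ 4) (φ-^ z 2)) (CS.four-square S'.refl))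

  module _ (R₀ S₀ : RawRing 0ℓ 0ℓ) (R₀-commutative : IsCommutative R₀) (S₀-commutative : IsCommutative S₀) where

    private
      S = commutativeRing S₀ S₀-commutative
      module R = RawRing R₀
      module F = Formulas R₀ R₀-commutative
    open RawRing S₀
    open CommutativeRing S using (trans; sym; *-congˡ; reflexive)
    open import Algebra.Definitions.RawSemiring rawSemiring using (_^_)
    open RingNotation S₀
    open Chebyshev S

    module _ (i : Carrier) (φ : R.Carrier → Carrier) (ζ : ℤ → (d : ℕ) .{{_ : NonZero d}} → R.Carrier) where

      chebyshevFormula : (m n : ℕ) .{{_ : NonZero m}} → Carrier
      chebyshevFormula m n = (- 1#) ^ (m ℕ.* n) * fromℕ 2 ^ m * ∏[1… m ] (λ h → T (2 ℕ.* n) (i * φ (ζ (+ h) m)))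

      -- The product of values of `doubledT` is carried over to the second ring. There `x = i φ(ζ)`
      -- satisfies `4 x² = - φ(4 ζ²)`, which turns each factor into a value of `T`.
      chebyshev≈tilings : i * i ≈ - 1# → IsHom (commutativeRing R₀ R₀-commutative) (commutativeRing S₀ S₀-commutative) φ → (∀ d → Factorisation.Roots (commutativeRing R₀ R₀-commutative) (suc d) (F.squares ζ (suc d))) →
        ∀ m n .{{_ : NonZero m}} .{{_ : NonZero n}} → chebyshevFormula m n ≈ fromℕ (weightedDominoTilings m n)
      chebyshev≈tilings i²≈-1 hom roots (suc m) (suc n) = trans (*-congˡ (reflexive (product≡∏ (suc m) (λ h → T (2 ℕ.* suc n) (x h)))))
        (trans (chebyshev-product (suc m) (suc n) x (λ h → φ (y h)) (λ h → rotated-square i (φ (ζ (+ h) (suc m))) i²≈-1 (φ-four-square (ζ (+ h) (suc m)))))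
          (sym (φ-product (weightedDominoTilings (suc m) (suc n)) (suc m) (suc n) y (F.tilings≈doubledT ζ roots (suc m) (suc n)))))
        where
        open HomProperties hom
        x : ℕ → Carrier
        x h = i * φ (ζ (+ h) (suc m))
        y : ℕ → R.Carrier
        y = F.squares ζ (suc m)

-- The ring of real numbers

module RealRing where
  open import Defs
  open Reals
  open Estimates
  open import Data.Nat.Base as ℕ using (ℕ; suc)
  import Data.Nat.Properties as ℕ
  open import Data.Product.Base using (_,_)
  open import Data.Rational.Base
  open import Data.Rational.Properties
  open import Relation.Binary.PropositionalEquality
  open RawRings
  open RawRing ℝ-rawRing using () renaming (_+_ to _+ʳ_; _*_ to _*ʳ_; -_ to -ʳ_; 0# to 0ʳ; 1# to 1ʳ)

  -- The idle second index lets the estimates for Cauchy sequences be applied to equality of reals.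
  difference : ℝ → ℝ → ℕ → ℕ → ℚ
  difference x y i j = seq x i - seq y i

  null⇒≈ : ∀ {x y} → Null (difference x y) → x ≈ʳ y
  null⇒≈ null 0<ε = let N , p = null 0<ε in N , λ i≥ → p i≥ i≥

  ≈⇒null : ∀ {x y} → x ≈ʳ y → Null (difference x y)
  ≈⇒null x≈y 0<ε = let N , p = x≈y 0<ε in N , λ i≥ _ → p i≥

  ≈-pointwise : ∀ {x y} → (∀ i → seq x i ≡ seq y i) → x ≈ʳ y
  ≈-pointwise {x} {y} x≡y {ε} 0<ε = 0 , λ {i} _ → subst (_< ε) (sym (cong ∣_∣ (trans (cong (_- seq y i) (x≡y i)) (+-inverseʳ (seq y i))))) 0<ε

  ≈-sym : ∀ {x y} → x ≈ʳ y → y ≈ʳ x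
  ≈-sym {x} {y} x≈y {ε} 0<ε = let N , p = x≈y 0<ε in N , λ {i} i≥ → subst (_< ε) (∣-∣-comm (seq x i) (seq y i)) (p i≥)

  ≈-trans : ∀ {x y z} → x ≈ʳ y → y ≈ʳ z → x ≈ʳ z
  ≈-trans {x} {y} {z} x≈y y≈z = null⇒≈ {x} {z} (Null-sum (difference x z) (λ i j → ∣sum∣≤ (difference x y i j) (difference y z i j) (split (seq x i) (seq y i) (seq z i)))
    (≈⇒null {x} {y} x≈y) (≈⇒null {y} {z} y≈z))

  +ʳ-cong : ∀ {x x' y y'} → x ≈ʳ x' → y ≈ʳ y' → (x +ʳ y) ≈ʳ (x' +ʳ y')
  +ʳ-cong {x} {x'} {y} {y'} x≈ y≈ = null⇒≈ {x +ʳ y} {x' +ʳ y'} (Null-sum (difference (x +ʳ y) (x' +ʳ y'))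
    (λ i j → ∣sum∣≤ (difference x x' i j) (difference y y' i j) (rearrange-+ (seq x i) (seq x' i) (seq y i) (seq y' i)))
    (≈⇒null {x} {x'} x≈) (≈⇒null {y} {y'} y≈))

  -ʳ-cong : ∀ {x x'} → x ≈ʳ x' → (-ʳ x) ≈ʳ (-ʳ x')
  -ʳ-cong {x} {x'} x≈ {ε} 0<ε = let N , p = x≈ 0<ε in N , λ {i} i≥ →
    subst (_< ε) (sym (trans (cong ∣_∣ (rearrange-neg (seq x i) (seq x' i))) (∣-p∣≡∣p∣ (seq x i - seq x' i)))) (p i≥)

  *ʳ-cong : ∀ {x x' y y'} → x ≈ʳ x' → y ≈ʳ y' → (x *ʳ y) ≈ʳ (x' *ʳ y')
  *ʳ-cong {x} {x'} {y} {y'} x≈ y≈ = null⇒≈ {x *ʳ y} {x' *ʳ y'} (Null-sum {f} {g} (difference (x *ʳ y) (x' *ʳ y'))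
    (λ i j → ∣sum∣≤ (f i j) (g i j) (rearrange-* (seq x i) (seq x' i) (seq y i) (seq y' i))) null-f null-g)
    where
    f g : ℕ → ℕ → ℚ
    f i j = seq x i * (seq y i - seq y' i)
    g i j = seq y' i * (seq x i - seq x' i)
    null-f : Null f
    null-f = let a , A , x≤ = bounded {seq x} (cauchy x) in
      Null-scale {difference y y'} f (ι (suc a)) {{ι-pos a}} A
        (λ {i} {j} i≥ _ → *-mono-∣∣ {seq x i} {seq y i - seq y' i} {ι (suc a)} {∣ seq y i - seq y' i ∣} (x≤ i≥) ≤-refl) (≈⇒null {y} {y'} y≈)
    null-g : Null g
    null-g = let b , B , y≤ = bounded {seq y'} (cauchy y') in
      Null-scale {difference x x'} g (ι (suc b)) {{ι-pos b}} B
        (λ {i} {j} i≥ _ → *-mono-∣∣ {seq y' i} {seq x i - seq x' i} {ι (suc b)} {∣ seq x i - seq x' i ∣} (y≤ i≥) ≤-refl) (≈⇒null {x} {x'} x≈)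

  ℝ-isCommutative : IsCommutative ℝ-rawRing
  ℝ-isCommutative = record
      { isRing = record
        { +-isAbelianGroup = record
          { isGroup = record
            { isMonoid = record
              { isSemigroup = record
                { isMagma = record
                  { isEquivalence = record
                    { refl = λ {x} → ≈-pointwise {x} {x} (λ _ → refl)
                    ; sym = λ {x} {y} → ≈-sym {x} {y}
                    ; trans = λ {x} {y} {z} → ≈-trans {x} {y} {z} }
                  ; ∙-cong = λ {x} {x'} {y} {y'} → +ʳ-cong {x} {x'} {y} {y'} }
                ; assoc = λ x y z → ≈-pointwise {(x +ʳ y) +ʳ z} {x +ʳ (y +ʳ z)} (λ i → +-assoc (seq x i) (seq y i) (seq z i)) }
              ; identity = (λ x → ≈-pointwise {0ʳ +ʳ x} {x} (λ i → +-identityˡ (seq x i))) , (λ x → ≈-pointwise {x +ʳ 0ʳ} {x} (λ i → +-identityʳ (seq x i))) }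
            ; inverse = (λ x → ≈-pointwise {(-ʳ x) +ʳ x} {0ʳ} (λ i → +-inverseˡ (seq x i))) , (λ x → ≈-pointwise {x +ʳ (-ʳ x)} {0ʳ} (λ i → +-inverseʳ (seq x i)))
            ; ⁻¹-cong = λ {x} {x'} → -ʳ-cong {x} {x'} }
          ; comm = λ x y → ≈-pointwise {x +ʳ y} {y +ʳ x} (λ i → +-comm (seq x i) (seq y i)) }
        ; *-cong = λ {x} {x'} {y} {y'} → *ʳ-cong {x} {x'} {y} {y'}
        ; *-assoc = λ x y z → ≈-pointwise {(x *ʳ y) *ʳ z} {x *ʳ (y *ʳ z)} (λ i → *-assoc (seq x i) (seq y i) (seq z i))
        ; *-identity = (λ x → ≈-pointwise {1ʳ *ʳ x} {x} (λ i → *-identityˡ (seq x i))) , (λ x → ≈-pointwise {x *ʳ 1ʳ} {x} (λ i → *-identityʳ (seq x i)))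
        ; distrib = (λ x y z → ≈-pointwise {x *ʳ (y +ʳ z)} {(x *ʳ y) +ʳ (x *ʳ z)} (λ i → *-distribˡ-+ (seq x i) (seq y i) (seq z i)))
                  , (λ x y z → ≈-pointwise {(y +ʳ z) *ʳ x} {(y *ʳ x) +ʳ (z *ʳ x)} (λ i → *-distribʳ-+ (seq x i) (seq y i) (seq z i))) }
      ; *-comm = λ x y → ≈-pointwise {x *ʳ y} {y *ʳ x} (λ i → *-comm (seq x i) (seq y i)) }

  ℝ-ring : CommutativeRing 0ℓ 0ℓ
  ℝ-ring = commutativeRing ℝ-rawRing ℝ-isCommutative

-- The addition formula for the cosine

module CosineAddition where
  open import Defs
  open Reals
  open Estimates
  open CosineSeries
  import Data.Integer.Base as ℤ
  open import Data.Integer.Base using (+_)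
  open import Data.Nat.Base as ℕ using (ℕ; zero; suc; _!)
  import Data.Nat.Properties as ℕ
  open import Data.Nat.Properties using (_!≢0)
  open import Data.Product.Base using (proj₁; proj₂)
  open import Data.Rational.Base
  open import Data.Rational.Properties
  open RealRing using (null⇒≈; ℝ-ring)
  open import Data.Rational.Solver using (module +-*-Solver)
  open import Algebra.Definitions.RawSemiring +-*-rawSemiring using (_^_)
  open import Function.Base using (_∘_)
  open import Relation.Binary.PropositionalEquality
  open RowTransfer using (double)
  open Folding using (double≡)
  open +-*-Solver using (solve; _:+_; _:*_; _:-_; :-_; _:=_; con)

  infixl 7 _⋆_

  -- The Cauchy product of two coefficient sequences.
  _⋆_ : (ℕ → ℚ) → (ℕ → ℚ) → ℕ → ℚ
  (f ⋆ g) zero = f 0 * g 0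
  (f ⋆ g) (suc n) = f 0 * g (suc n) + ((f ∘ suc) ⋆ g) n

  ⋆-cong : ∀ {f f' g g'} → f ≗ f' → g ≗ g' → f ⋆ g ≗ f' ⋆ g'
  ⋆-cong f≗ g≗ zero = cong₂ _*_ (f≗ 0) (g≗ 0)
  ⋆-cong f≗ g≗ (suc n) = cong₂ _+_ (cong₂ _*_ (f≗ 0) (g≗ (suc n))) (⋆-cong (f≗ ∘ suc) g≗ n)

  ⋆-+ˡ : ∀ f f' g n → ((λ k → f k + f' k) ⋆ g) n ≡ (f ⋆ g) n + (f' ⋆ g) n
  ⋆-+ˡ f f' g zero = *-distribʳ-+ (g 0) (f 0) (f' 0)
  ⋆-+ˡ f f' g (suc n) = trans (cong (_+_ ((f 0 + f' 0) * g (suc n))) (⋆-+ˡ (f ∘ suc) (f' ∘ suc) g n))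
    (solve 5 (λ a b g x y → (a :+ b) :* g :+ (x :+ y) := (a :* g :+ x) :+ (b :* g :+ y)) refl (f 0) (f' 0) (g (suc n)) (((f ∘ suc) ⋆ g) n) (((f' ∘ suc) ⋆ g) n))

  ⋆-+ʳ : ∀ f g g' n → (f ⋆ (λ k → g k + g' k)) n ≡ (f ⋆ g) n + (f ⋆ g') n
  ⋆-+ʳ f g g' zero = *-distribˡ-+ (f 0) (g 0) (g' 0)
  ⋆-+ʳ f g g' (suc n) = trans (cong (_+_ (f 0 * (g (suc n) + g' (suc n)))) (⋆-+ʳ (f ∘ suc) g g' n))
    (solve 5 (λ f a b x y → f :* (a :+ b) :+ (x :+ y) := (f :* a :+ x) :+ (f :* b :+ y)) refl (f 0) (g (suc n)) (g' (suc n)) (((f ∘ suc) ⋆ g) n) (((f ∘ suc) ⋆ g') n))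

  ⋆-*ˡ : ∀ c f g n → ((λ k → c * f k) ⋆ g) n ≡ c * (f ⋆ g) n
  ⋆-*ˡ c f g zero = *-assoc c (f 0) (g 0)
  ⋆-*ˡ c f g (suc n) = trans (cong (_+_ (c * f 0 * g (suc n))) (⋆-*ˡ c (f ∘ suc) g n))
    (solve 4 (λ c f g x → c :* f :* g :+ c :* x := c :* (f :* g :+ x)) refl c (f 0) (g (suc n)) (((f ∘ suc) ⋆ g) n))

  ⋆-*ʳ : ∀ c f g n → (f ⋆ (λ k → c * g k)) n ≡ c * (f ⋆ g) n
  ⋆-*ʳ c f g zero = solve 3 (λ c f g → f :* (c :* g) := c :* (f :* g)) refl c (f 0) (g 0)
  ⋆-*ʳ c f g (suc n) = trans (cong (_+_ (f 0 * (c * g (suc n)))) (⋆-*ʳ c (f ∘ suc) g n))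
    (solve 4 (λ c f g x → f :* (c :* g) :+ c :* x := c :* (f :* g :+ x)) refl c (f 0) (g (suc n)) (((f ∘ suc) ⋆ g) n))

  ⋆-shiftʳ : ∀ f g n → g 0 ≡ 0ℚ → (f ⋆ g) (suc n) ≡ (f ⋆ (g ∘ suc)) n
  ⋆-shiftʳ f g zero g₀ = trans (cong (λ t → f 0 * g 1 + f 1 * t) g₀) (solve 2 (λ f h → f :+ h :* con 0ℚ := f) refl (f 0 * g 1) (f 1))
  ⋆-shiftʳ f g (suc n) g₀ = cong (_+_ (f 0 * g (suc (suc n)))) (⋆-shiftʳ (f ∘ suc) g n g₀)

  -- The Euler operator `x d/dx` on the coefficients of a power series, a derivation for the Cauchy
  -- product.
  θ : (ℕ → ℚ) → ℕ → ℚ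
  θ f n = ι n * f n

  ι-suc : ∀ n → ι (suc n) ≡ 1ℚ + ι n
  ι-suc n = ι-+ 1 n

  -- n f_j g_{n-j} = (j f_j) g_{n-j} + f_j ((n-j) g_{n-j}).
  ⋆-leibniz : ∀ f g n → θ (f ⋆ g) n ≡ (θ f ⋆ g) n + (f ⋆ θ g) n
  ⋆-leibniz f g zero = solve 2 (λ f g → con 0ℚ :* (f :* g) := con 0ℚ :* f :* g :+ f :* (con 0ℚ :* g)) refl (f 0) (g 0)
  ⋆-leibniz f g (suc n) = begin
    ι (suc n) * (f 0 * g (suc n) + (f' ⋆ g) n)
      ≡⟨ trans (*-distribˡ-+ (ι (suc n)) _ _) (cong (λ t → ι (suc n) * (f 0 * g (suc n)) + t * (f' ⋆ g) n) (ι-suc n)) ⟩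
    ι (suc n) * (f 0 * g (suc n)) + (1ℚ + ι n) * (f' ⋆ g) n
      ≡⟨ solve 5 (λ i f g n x → i :* (f :* g) :+ (con 1ℚ :+ n) :* x := f :* (i :* g) :+ (n :* x :+ x)) refl (ι (suc n)) (f 0) (g (suc n)) (ι n) ((f' ⋆ g) n) ⟩
    f 0 * θ g (suc n) + (θ (f' ⋆ g) n + (f' ⋆ g) n)
      ≡⟨ cong (λ t → f 0 * θ g (suc n) + (t + (f' ⋆ g) n)) (⋆-leibniz f' g n) ⟩
    f 0 * θ g (suc n) + (((θ f' ⋆ g) n + (f' ⋆ θ g) n) + (f' ⋆ g) n)
      ≡⟨ solve 6 (λ a b c d f g → a :+ ((b :+ c) :+ d) := (con 0ℚ :* f :* g :+ (b :+ d)) :+ (a :+ c)) refl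
           (f 0 * θ g (suc n)) ((θ f' ⋆ g) n) ((f' ⋆ θ g) n) ((f' ⋆ g) n) (f 0) (g (suc n)) ⟩
    (0ℚ * f 0 * g (suc n) + ((θ f' ⋆ g) n + (f' ⋆ g) n)) + (f 0 * θ g (suc n) + (f' ⋆ θ g) n)
      ≡⟨ cong (λ t → (0ℚ * f 0 * g (suc n) + t) + (f 0 * θ g (suc n) + (f' ⋆ θ g) n)) (trans (sym (⋆-+ˡ (θ f') f' g n)) (⋆-cong (λ k → trans
           (solve 2 (λ n f → n :* f :+ f := (con 1ℚ :+ n) :* f) refl (ι k) (f' k)) (cong (_* f' k) (sym (ι-suc k)))) (λ _ → refl) n)) ⟩
    (θ f ⋆ g) (suc n) + (f ⋆ θ g) (suc n) ∎
    where
    open ≡-Reasoning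
    f' = f ∘ suc

  inv : ℕ → ℚ
  inv n = _/_ (+ 1) (n !) {{n !≢0}}

  E : ℚ → ℕ → ℚ
  E x n = x ^ n * inv n

  inv-suc : ∀ n → ι (suc n) * inv (suc n) ≡ inv n
  inv-suc n = begin
    ι (suc n) * inv (suc n)                            ≡⟨ *-identityʳ _ ⟨
    ι (suc n) * inv (suc n) * 1ℚ                       ≡⟨ cong (ι (suc n) * inv (suc n) *_) (ι-inv (n !) {{n !≢0}}) ⟨
    ι (suc n) * inv (suc n) * (ι (n !) * inv n)        ≡⟨ solve 4 (λ a b c d → a :* b :* (c :* d) := a :* c :* b :* d) refl (ι (suc n)) (inv (suc n)) (ι (n !)) (inv n) ⟩
    ι (suc n) * ι (n !) * inv (suc n) * inv n          ≡⟨ cong (λ t → t * inv (suc n) * inv n) (ι-* (suc n) (n !)) ⟨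
    ι (suc n !) * inv (suc n) * inv n                  ≡⟨ cong (_* inv n) (ι-inv (suc n !) {{suc n !≢0}}) ⟩
    1ℚ * inv n                                         ≡⟨ *-identityˡ _ ⟩
    inv n                                              ∎
    where open ≡-Reasoning

  θ-E : ∀ x n → θ (E x) (suc n) ≡ x * E x n
  θ-E x n = trans (solve 4 (λ i x X v → i :* (x :* X :* v) := x :* (X :* (i :* v))) refl (ι (suc n)) x (x ^ n) (inv (suc n)))
    (cong (λ t → x * (x ^ n * t)) (inv-suc n))

  ι-suc-cancel : ∀ n {x y} → ι (suc n) * x ≡ ι (suc n) * y → x ≡ y
  ι-suc-cancel n {x} {y} eq = begin
    x                                      ≡⟨ undo x ⟩
    (+ 1 / suc n) * (ι (suc n) * x)        ≡⟨ cong ((+ 1 / suc n) *_) eq ⟩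
    (+ 1 / suc n) * (ι (suc n) * y)        ≡⟨ undo y ⟨
    y                                      ∎
    where
    open ≡-Reasoning
    undo : ∀ x → x ≡ (+ 1 / suc n) * (ι (suc n) * x)
    undo x = sym (trans (solve 3 (λ v i x → v :* (i :* x) := (i :* v) :* x) refl (+ 1 / suc n) (ι (suc n)) x) (trans (cong (_* x) (ι-inv (suc n))) (*-identityˡ x)))

  -- The exponential law, from the recurrence (n + 1) e_{n+1} = x e_n.
  E-⋆ : ∀ a b n → (E a ⋆ E b) n ≡ E (a + b) n
  E-⋆ a b zero = refl
  E-⋆ a b (suc n) = ι-suc-cancel n (begin
    θ (E a ⋆ E b) (suc n)                                    ≡⟨ ⋆-leibniz (E a) (E b) (suc n) ⟩
    (θ (E a) ⋆ E b) (suc n) + (E a ⋆ θ (E b)) (suc n)        ≡⟨ cong₂ _+_ left right ⟩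
    a * (E a ⋆ E b) n + b * (E a ⋆ E b) n                    ≡⟨ *-distribʳ-+ ((E a ⋆ E b) n) a b ⟨
    (a + b) * (E a ⋆ E b) n                                  ≡⟨ cong ((a + b) *_) (E-⋆ a b n) ⟩
    (a + b) * E (a + b) n                                    ≡⟨ θ-E (a + b) n ⟨
    θ (E (a + b)) (suc n)                                    ∎)
    where
    open ≡-Reasoning
    left : (θ (E a) ⋆ E b) (suc n) ≡ a * (E a ⋆ E b) n
    left = trans (cong (_+ ((θ (E a) ∘ suc) ⋆ E b) n) (solve 2 (λ x y → con 0ℚ :* x :* y := con 0ℚ) refl (E a 0) (E b (suc n))))
      (trans (+-identityˡ _) (trans (⋆-cong (θ-E a) (λ _ → refl) n) (⋆-*ˡ a (E a) (E b) n)))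
    right : (E a ⋆ θ (E b)) (suc n) ≡ b * (E a ⋆ E b) n
    right = trans (⋆-shiftʳ (E a) (θ (E b)) n (*-zeroˡ (E b 0))) (trans (⋆-cong {E a} (λ _ → refl) (θ-E b) n) (⋆-*ʳ b (E a) (E b) n))

  E-neg-even : ∀ b k → E (- b) (double k) ≡ E b (double k)
  E-neg-even b k = cong (_* inv (double k)) (even k)
    where
    even : ∀ k → (- b) ^ double k ≡ b ^ double k
    even zero = refl
    even (suc k) = trans (cong (λ t → - b * (- b * t)) (even k)) (solve 2 (λ b t → (:- b) :* ((:- b) :* t) := b :* (b :* t)) refl b (b ^ double k))

  E-neg-odd : ∀ b k → E b (suc (double k)) + E (- b) (suc (double k)) ≡ 0ℚ
  E-neg-odd b k = trans (cong (λ t → E b (suc (double k)) + t * inv (suc (double k))) (cong (- b *_) (even k)))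
    (solve 3 (λ b t v → b :* t :* v :+ (:- b) :* t :* v := con 0ℚ) refl b (b ^ double k) (inv (suc (double k))))
    where
    even : ∀ k → (- b) ^ double k ≡ b ^ double k
    even zero = refl
    even (suc k) = trans (cong (λ t → - b * (- b * t)) (even k)) (solve 2 (λ b t → (:- b) :* ((:- b) :* t) := b :* (b :* t)) refl b (b ^ double k))

  -- When the odd coefficients of `g` vanish, an even total degree only involves even positions of
  -- `f`.
  ⋆-even : ∀ f g → (∀ k → g (suc (double k)) ≡ 0ℚ) → ∀ n → (f ⋆ g) (double n) ≡ ((f ∘ double) ⋆ (g ∘ double)) n
  ⋆-even f g odd zero = refl
  ⋆-even f g odd (suc n) = cong (_+_ (f 0 * g (double (suc n)))) (trans (cong (_+ ((f ∘ suc ∘ suc) ⋆ g) (double n)) (trans (cong (f 1 *_) (odd n)) (*-zeroʳ (f 1))))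
    (trans (+-identityˡ _) (⋆-even (f ∘ suc ∘ suc) g odd n)))

  sgn : ℕ → ℚ
  sgn k = (- 1ℚ) ^ k

  ⋆-sgn : ∀ f g n → ((λ k → sgn k * f k) ⋆ (λ k → sgn k * g k)) n ≡ sgn n * (f ⋆ g) n
  ⋆-sgn f g zero = solve 2 (λ f g → con 1ℚ :* f :* (con 1ℚ :* g) := con 1ℚ :* (f :* g)) refl (f 0) (g 0)
  ⋆-sgn f g (suc n) = trans (cong (_+_ (1ℚ * f 0 * (- 1ℚ * sgn n * g (suc n))))
      (trans (⋆-cong {g = λ k → sgn k * g k} (λ k → solve 2 (λ s f → (:- con 1ℚ) :* s :* f := (:- con 1ℚ) :* (s :* f)) refl (sgn k) (f (suc k))) (λ _ → refl) n)
        (trans (⋆-*ˡ (- 1ℚ) (λ k → sgn k * f (suc k)) (λ k → sgn k * g k) n) (cong (- 1ℚ *_) (⋆-sgn (f ∘ suc) g n)))))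
    (solve 4 (λ s f g x → con 1ℚ :* f :* ((:- con 1ℚ) :* s :* g) :+ (:- con 1ℚ) :* (s :* x) := (:- con 1ℚ) :* s :* (f :* g :+ x)) refl (sgn n) (f 0) (g (suc n)) (((f ∘ suc) ⋆ g) n))

  cosTerm-E : ∀ x k → cosTerm x k ≡ sgn k * E x (double k)
  cosTerm-E x k = cong (λ j → sgn k * E x j) (trans (cong (k ℕ.+_) (ℕ.+-identityʳ k)) (sym (double≡ k)))

  -- `E b + E (- b)` is twice the even part of `E b`, so the exponential law in even degrees becomes
  -- a product formula for cosine terms; the alternating signs multiply along.
  cosTerm-add : ∀ a b n → cosTerm (a + b) n + cosTerm (a - b) n ≡ (1ℚ + 1ℚ) * (cosTerm a ⋆ cosTerm b) n
  cosTerm-add a b n = begin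
    cosTerm (a + b) n + cosTerm (a - b) n
      ≡⟨ cong₂ _+_ (cosTerm-E (a + b) n) (cosTerm-E (a - b) n) ⟩
    sgn n * E (a + b) (double n) + sgn n * E (a - b) (double n)
      ≡⟨ cong₂ (λ x y → sgn n * x + sgn n * y) (E-⋆ a b (double n)) (E-⋆ a (- b) (double n)) ⟨
    sgn n * (E a ⋆ E b) (double n) + sgn n * (E a ⋆ E (- b)) (double n)
      ≡⟨ trans (sym (*-distribˡ-+ (sgn n) _ _)) (cong (sgn n *_) (sym (⋆-+ʳ (E a) (E b) (E (- b)) (double n)))) ⟩
    sgn n * (E a ⋆ (λ k → E b k + E (- b) k)) (double n)
      ≡⟨ cong (sgn n *_) (⋆-even (E a) (λ k → E b k + E (- b) k) (E-neg-odd b) n) ⟩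
    sgn n * ((E a ∘ double) ⋆ (λ k → E b (double k) + E (- b) (double k))) n
      ≡⟨ cong (sgn n *_) (trans (⋆-cong {E a ∘ double} (λ _ → refl) (λ k → trans (cong (_+_ (E b (double k))) (E-neg-even b k)) (solve 1 (λ x → x :+ x := (con 1ℚ :+ con 1ℚ) :* x) refl (E b (double k)))) n)
           (⋆-*ʳ (1ℚ + 1ℚ) (E a ∘ double) (E b ∘ double) n)) ⟩
    sgn n * ((1ℚ + 1ℚ) * ((E a ∘ double) ⋆ (E b ∘ double)) n)
      ≡⟨ solve 3 (λ s t x → s :* (t :* x) := t :* (s :* x)) refl (sgn n) (1ℚ + 1ℚ) (((E a ∘ double) ⋆ (E b ∘ double)) n) ⟩
    (1ℚ + 1ℚ) * (sgn n * ((E a ∘ double) ⋆ (E b ∘ double)) n)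
      ≡⟨ cong ((1ℚ + 1ℚ) *_) (trans (sym (⋆-sgn (E a ∘ double) (E b ∘ double) n)) (⋆-cong (λ k → sym (cosTerm-E a k)) (λ k → sym (cosTerm-E b k)) n)) ⟩
    (1ℚ + 1ℚ) * (cosTerm a ⋆ cosTerm b) n ∎
    where open ≡-Reasoning

  Sum : (ℕ → ℚ) → ℕ → ℚ
  Sum f zero = 0ℚ
  Sum f (suc n) = Sum f n + f n

  Sum-head : ∀ f n → Sum f (suc n) ≡ f 0 + Sum (f ∘ suc) n
  Sum-head f zero = trans (+-identityˡ (f 0)) (sym (+-identityʳ (f 0)))
  Sum-head f (suc n) = trans (cong (_+ f (suc n)) (Sum-head f n)) (+-assoc (f 0) _ _)

  cosSum-Sum : ∀ n x → cosSum n x ≡ Sum (cosTerm x) n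
  cosSum-Sum zero x = refl
  cosSum-Sum (suc n) x = cong (_+ cosTerm x n) (cosSum-Sum n x)

  cosSum-add : ∀ a b n → cosSum n (a + b) + cosSum n (a - b) ≡ (1ℚ + 1ℚ) * Sum (cosTerm a ⋆ cosTerm b) n
  cosSum-add a b zero = refl
  cosSum-add a b (suc n) = trans (solve 4 (λ a b c d → (a :+ b) :+ (c :+ d) := (a :+ c) :+ (b :+ d)) refl (cosSum n (a + b)) (cosTerm (a + b) n) (cosSum n (a - b)) (cosTerm (a - b) n))
    (trans (cong₂ _+_ (cosSum-add a b n) (cosTerm-add a b n)) (sym (*-distribˡ-+ (1ℚ + 1ℚ) (Sum (cosTerm a ⋆ cosTerm b) n) ((cosTerm a ⋆ cosTerm b) n))))

  Sum-⋆ : ∀ f g n → Sum (f ⋆ g) (suc n) ≡ f 0 * Sum g (suc n) + Sum ((f ∘ suc) ⋆ g) n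
  Sum-⋆ f g zero = solve 3 (λ f g z → con 0ℚ :+ f :* g := f :* (con 0ℚ :+ g) :+ con 0ℚ) refl (f 0) (g 0) 0ℚ
  Sum-⋆ f g (suc n) = trans (cong (_+ (f ⋆ g) (suc n)) (Sum-⋆ f g n))
    (solve 5 (λ f s g t c → f :* s :+ t :+ (f :* g :+ c) := f :* (s :+ g) :+ (t :+ c)) refl (f 0) (Sum g (suc n)) (g (suc n)) (Sum ((f ∘ suc) ⋆ g) n) (((f ∘ suc) ⋆ g) n))

  ¼ : ℚ
  ¼ = ½ * ½

  ¼^-nonNeg : ∀ k → 0ℚ ≤ ¼ ^ k
  ¼^-nonNeg zero = *≤* (ℤ.+≤+ ℕ.z≤n)
  ¼^-nonNeg (suc k) = 0≤* {¼} (*≤* (ℤ.+≤+ ℕ.z≤n)) (¼^-nonNeg k)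

  -- The difference is the sum of `f j` times the tail of `g` from `n - j` to `m`. The tail is only
  -- of order `½ ^ (n - j)`, but the faster decay `¼ ^ j` of `f` keeps the sum below `2 α β ½ ^ n`.
  product-bound : ∀ f g α β n m → n ℕ.≤ m → 0ℚ ≤ α → 0ℚ ≤ β → (∀ j → ∣ f j ∣ ≤ α * ¼ ^ j) →
    (∀ {k} → k ℕ.≤ m → ∣ Sum g m - Sum g k ∣ ≤ β * ½ ^ k) → ∣ Sum f n * Sum g m - Sum (f ⋆ g) n ∣ ≤ (α + α) * β * ½ ^ n
  product-bound f g α β zero m n≤m 0≤α 0≤β f≤ g≤ = subst (_≤ (α + α) * β * 1ℚ) (sym (cong ∣_∣ (solve 1 (λ s → con 0ℚ :* s :- con 0ℚ := con 0ℚ) refl (Sum g m))))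
    (0≤* (0≤* (0≤+ 0≤α 0≤α) 0≤β) (*≤* (ℤ.+≤+ ℕ.z≤n)))
  product-bound f g α β (suc n) m n≤m 0≤α 0≤β f≤ g≤ = begin
    ∣ Sum f (suc n) * Sum g m - Sum (f ⋆ g) (suc n) ∣
      ≤⟨ ∣sum∣≤ (f 0 * (Sum g m - Sum g (suc n))) (Sum (f ∘ suc) n * Sum g m - Sum ((f ∘ suc) ⋆ g) n) rearranged ⟩
    ∣ f 0 * (Sum g m - Sum g (suc n)) ∣ + ∣ Sum (f ∘ suc) n * Sum g m - Sum ((f ∘ suc) ⋆ g) n ∣
      ≤⟨ +-mono-≤ (*-mono-∣∣ {f 0} {Sum g m - Sum g (suc n)} (f≤ 0) (g≤ n≤m))
           (product-bound (f ∘ suc) g (α * ¼) β n m (ℕ.≤-trans (ℕ.n≤1+n n) n≤m) (0≤* 0≤α (*≤* (ℤ.+≤+ ℕ.z≤n))) 0≤β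
             (λ j → subst (∣ f (suc j) ∣ ≤_) (sym (*-assoc α ¼ (¼ ^ j))) (f≤ (suc j))) g≤) ⟩
    α * 1ℚ * (β * (½ * ½ ^ n)) + (α * ¼ + α * ¼) * β * ½ ^ n
      ≡⟨ solve 3 (λ a b r → a :* con 1ℚ :* (b :* (con ½ :* r)) :+ (a :* con ¼ :+ a :* con ¼) :* b :* r := (a :+ a) :* b :* (con ½ :* r)) refl α β (½ ^ n) ⟩
    (α + α) * β * ½ ^ suc n ∎
    where
    open ≤-Reasoning
    rearranged : Sum f (suc n) * Sum g m - Sum (f ⋆ g) (suc n) ≡ f 0 * (Sum g m - Sum g (suc n)) + (Sum (f ∘ suc) n * Sum g m - Sum ((f ∘ suc) ⋆ g) n)
    rearranged = trans (cong₂ (λ x y → x * Sum g m - y) (Sum-head f n) (Sum-⋆ f g n))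
      (solve 5 (λ a s m t w → (a :+ s) :* m :- (a :* t :+ w) := a :* (m :- t) :+ (s :* m :- w)) refl (f 0) (Sum (f ∘ suc) n) (Sum g m) (Sum g (suc n)) (Sum ((f ∘ suc) ⋆ g) n))

  -- A uniform bound for the terms at `2 x` thus becomes the decay `¼ ^ k` at `x` that
  -- `product-bound` asks for.
  cosTerm-halve : ∀ x k → cosTerm x k ≡ cosTerm (x + x) k * ¼ ^ k
  cosTerm-halve x k = begin
    cosTerm x k                                                ≡⟨ cosTerm-E x k ⟩
    sgn k * (x ^ double k * inv (double k))                    ≡⟨ cong (λ t → sgn k * (t * inv (double k))) (powers k) ⟩
    sgn k * ((x + x) ^ double k * ¼ ^ k * inv (double k))
      ≡⟨ solve 4 (λ s p q v → s :* (p :* q :* v) := s :* (p :* v) :* q) refl (sgn k) ((x + x) ^ double k) (¼ ^ k) (inv (double k)) ⟩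
    sgn k * ((x + x) ^ double k * inv (double k)) * ¼ ^ k      ≡⟨ cong (_* ¼ ^ k) (cosTerm-E (x + x) k) ⟨
    cosTerm (x + x) k * ¼ ^ k                                  ∎
    where
    open ≡-Reasoning
    powers : ∀ k → x ^ double k ≡ (x + x) ^ double k * ¼ ^ k
    powers zero = refl
    powers (suc k) = trans (cong (λ t → x * (x * t)) (powers k))
      (solve 3 (λ x p q → x :* (x :* (p :* q)) := (x :+ x) :* ((x :+ x) :* p) :* (con ¼ :* q)) refl x ((x + x) ^ double k) (¼ ^ k))

  ½^≤1 : ∀ k → ½ ^ k ≤ 1ℚ
  ½^≤1 k = subst (λ j → ½ ^ j ≤ 1ℚ) (ℕ.+-identityʳ k) (Bound.r-anti 0 0 k)

  module Addition (b-1 : ℕ) where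
    module B = Bound b-1
    -- The bound `B₂.b` is twice `B.b`, to cover the doubled argument.
    module B₂ = Bound (b-1 ℕ.+ suc b-1)

    α β K : ℚ
    α = ι B₂.M
    β = ι B.M + ι B.M
    -- The summand 1 makes `K` positive, as `Null-scale` requires.
    K = (1ℚ + 1ℚ) * ((α + α) * β) + 1ℚ

    0≤ι : ∀ n → 0ℚ ≤ ι n
    0≤ι n = nonNegative⁻¹ (ι n) {{ι-nonNeg n}}

    K>0 : Positive K
    K>0 = positive (<-≤-trans (*<* (ℤ.+<+ (ℕ.s≤s ℕ.z≤n))) (subst (_≤ K) (+-identityˡ 1ℚ) (+-monoˡ-≤ 1ℚ
      (0≤* {1ℚ + 1ℚ} (*≤* (ℤ.+≤+ ℕ.z≤n)) (0≤* (0≤+ (0≤ι B₂.M) (0≤ι B₂.M)) (0≤+ (0≤ι B.M) (0≤ι B.M)))))))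

    term≤ : ∀ x → ∣ x ∣ ≤ ι (suc b-1) → ∀ k → ∣ cosTerm x k ∣ ≤ α * ¼ ^ k
    term≤ x x≤ k = subst (λ t → ∣ t ∣ ≤ α * ¼ ^ k) (sym (cosTerm-halve x k))
      (*-mono-∣∣ {cosTerm (x + x) k} {¼ ^ k} bound (≤-reflexive (0≤p⇒∣p∣≡p (¼^-nonNeg k))))
      where
      open ≤-Reasoning
      2x≤ : ∣ x + x ∣ ≤ ι B₂.b
      2x≤ = ≤-trans (∣p+q∣≤∣p∣+∣q∣ x x) (≤-trans (+-mono-≤ x≤ x≤) (≤-reflexive (sym (ι-+ (suc b-1) (suc b-1)))))
      bound : ∣ cosTerm (x + x) k ∣ ≤ α
      bound = begin
        ∣ cosTerm (x + x) k ∣    ≤⟨ B₂.term-bound (x + x) (x + x) 2x≤ 2x≤ k ⟩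
        α * ½ ^ k                ≤⟨ *-monoˡ-≤-nonNeg α {{ι-nonNeg B₂.M}} (½^≤1 k) ⟩
        α * 1ℚ                   ≡⟨ *-identityʳ α ⟩
        α                        ∎

    addition : ∀ x y n → ∣ x ∣ ≤ ι (suc b-1) → ∣ y ∣ ≤ ι (suc b-1) →
      ∣ (cosSum n (x + y) + cosSum n (x - y)) - (1ℚ + 1ℚ) * (cosSum n x * cosSum n y) ∣ ≤ K * ½ ^ n
    addition x y n x≤ y≤ = begin
      ∣ (cosSum n (x + y) + cosSum n (x - y)) - (1ℚ + 1ℚ) * (cosSum n x * cosSum n y) ∣
        ≡⟨ cong ∣_∣ (trans (cong₂ (λ s p → s - (1ℚ + 1ℚ) * p) (cosSum-add x y n) (cong₂ _*_ (cosSum-Sum n x) (cosSum-Sum n y)))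
             (solve 2 (λ w p → (con 1ℚ :+ con 1ℚ) :* w :- (con 1ℚ :+ con 1ℚ) :* p := :- ((con 1ℚ :+ con 1ℚ) :* (p :- w))) refl W P)) ⟩
      ∣ - ((1ℚ + 1ℚ) * (P - W)) ∣
        ≡⟨ trans (∣-p∣≡∣p∣ ((1ℚ + 1ℚ) * (P - W))) (∣p*q∣≡∣p∣*∣q∣ (1ℚ + 1ℚ) (P - W)) ⟩
      (1ℚ + 1ℚ) * ∣ P - W ∣
        ≤⟨ *-monoˡ-≤-nonNeg (1ℚ + 1ℚ) (product-bound (cosTerm x) (cosTerm y) α β n n ℕ.≤-refl (0≤ι B₂.M) (0≤+ (0≤ι B.M) (0≤ι B.M)) (term≤ x x≤) tails) ⟩
      (1ℚ + 1ℚ) * ((α + α) * β * ½ ^ n)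
        ≡⟨ trans (sym (*-assoc (1ℚ + 1ℚ) ((α + α) * β) (½ ^ n))) (sym (+-identityʳ _)) ⟩
      (1ℚ + 1ℚ) * ((α + α) * β) * ½ ^ n + 0ℚ
        ≤⟨ +-monoʳ-≤ ((1ℚ + 1ℚ) * ((α + α) * β) * ½ ^ n) (nonNegative⁻¹ (½ ^ n) {{B.r-nonNeg n}}) ⟩
      (1ℚ + 1ℚ) * ((α + α) * β) * ½ ^ n + ½ ^ n
        ≡⟨ solve 2 (λ c r → c :* r :+ r := (c :+ con 1ℚ) :* r) refl ((1ℚ + 1ℚ) * ((α + α) * β)) (½ ^ n) ⟩
      K * ½ ^ n ∎
      where
      open ≤-Reasoning
      P W : ℚ
      P = Sum (cosTerm x) n * Sum (cosTerm y) n
      W = Sum (cosTerm x ⋆ cosTerm y) n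
      tails : ∀ {k} → k ℕ.≤ n → ∣ Sum (cosTerm y) n - Sum (cosTerm y) k ∣ ≤ β * ½ ^ k
      tails {k} k≤n = subst₂ (λ s t → ∣ s - t ∣ ≤ β * ½ ^ k) (cosSum-Sum n y) (cosSum-Sum k y) (B.tail y y y≤ y≤ k≤n)

  open CommutativeRing ℝ-ring using () renaming (_+_ to _+ʳ_; _*_ to _*ʳ_; _-_ to _-ʳ_; 1# to 1ʳ)

  -- Both sides are partial sums with the same index `n`, so the error is at most `K ½ ^ n` as soon
  -- as both sequences are bounded.
  cos-add : ∀ x y → (cos (x +ʳ y) +ʳ cos (x -ʳ y)) ≈ʳ ((1ʳ +ʳ 1ʳ) *ʳ (cos x *ʳ cos y))
  cos-add x y = null⇒≈ {cos (x +ʳ y) +ʳ cos (x -ʳ y)} {(1ʳ +ʳ 1ʳ) *ʳ (cos x *ʳ cos y)}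
    (Null-scale {λ i j → ½ ^ i} _ A.K {{A.K>0}} (N₁ ℕ.⊔ N₂) estimate (Bound.null-r₁ 0))
    where
    bx = bounded {seq x} (cauchy x)
    by = bounded {seq y} (cauchy y)
    N₁ = proj₁ (proj₂ bx)
    N₂ = proj₁ (proj₂ by)
    b = proj₁ bx ℕ.⊔ proj₁ by
    module A = Addition b
    estimate : ∀ {i j} → N₁ ℕ.⊔ N₂ ℕ.≤ i → N₁ ℕ.⊔ N₂ ℕ.≤ j →
      ∣ (cosSum i (seq x i + seq y i) + cosSum i (seq x i - seq y i)) - (1ℚ + 1ℚ) * (cosSum i (seq x i) * cosSum i (seq y i)) ∣ ≤ A.K * ∣ ½ ^ i ∣
    estimate {i} i≥ _ = ≤-trans
      (A.addition (seq x i) (seq y i) i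
        (≤-trans (proj₂ (proj₂ bx) (ℕ.m⊔n≤o⇒m≤o N₁ N₂ i≥)) (ι-mono-≤ (ℕ.s≤s (ℕ.m≤m⊔n (proj₁ bx) (proj₁ by)))))
        (≤-trans (proj₂ (proj₂ by) (ℕ.m⊔n≤o⇒n≤o N₁ N₂ i≥)) (ι-mono-≤ (ℕ.s≤s (ℕ.m≤n⊔m (proj₁ bx) (proj₁ by))))))
      (≤-reflexive (cong (A.K *_) (sym (0≤p⇒∣p∣≡p (nonNegative⁻¹ (½ ^ i) {{Bound.r-nonNeg 0 i}})))))

-- Positivity of reals and values of the cosine

module RealRoots where
  open import Defs
  open Reals
  open Estimates
  open CosineSeries
  open Bisection
  open RealRing
  open CosineAddition using (cos-add)
  open Factorisation using (odd-multiples)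
  import Data.Integer.Base as ℤ
  open import Data.Integer.Base using (ℤ; +_)
  import Data.Integer.Properties as ℤ
  open import Data.Nat.Base as ℕ using (ℕ; suc; s≤s; z≤n)
  import Data.Nat.Properties as ℕ
  open import Data.Product.Base using (∃-syntax; _×_; _,_; proj₁; proj₂)
  open import Data.Rational.Base
  open import Data.Rational.Properties
  open import Data.Rational.Solver using (module +-*-Solver)
  import Data.Rational.Unnormalised.Base as ℚᵘ
  import Data.Rational.Unnormalised.Properties as ℚᵘ
  open import Relation.Binary.PropositionalEquality
  open import Relation.Nullary.Negation using (¬_)
  open +-*-Solver using (solve; _:+_; _:*_; _:-_; :-_; _:=_; con)
  open CommutativeRing ℝ-ring using () renaming (_+_ to _+ʳ_; _*_ to _*ʳ_; _-_ to _-ʳ_; 1# to 1ʳ; 0# to 0ʳ)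
  module R = CommutativeRing ℝ-ring

  Eventually≥ : ℚ → ℝ → Set
  Eventually≥ δ x = ∃[ N ] (∀ {i} → N ℕ.≤ i → δ ≤ seq x i)

  -- Positivity with an explicit rational lower bound for the sequence, which passes to sums and
  -- products and allows cancellation.
  Pos : ℝ → Set
  Pos x = ∃[ δ ] (0ℚ < δ × Eventually≥ δ x)

  0<* : ∀ {p q} → 0ℚ < p → 0ℚ < q → 0ℚ < p * q
  0<* {p} {q} 0<p 0<q = positive⁻¹ (p * q) {{pos*pos⇒pos p {{positive 0<p}} q {{positive 0<q}}}}

  Pos-* : ∀ {x y} → Pos x → Pos y → Pos (x *ʳ y)
  Pos-* (δ , 0<δ , N , p) (ε , 0<ε , M , q) = δ * ε , 0<* 0<δ 0<ε , N ℕ.⊔ M , λ i≥ →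
    *-mono-≤-nonNeg (≤-trans (<⇒≤ 0<δ) (p (ℕ.m⊔n≤o⇒m≤o N M i≥))) (<⇒≤ 0<ε) (p (ℕ.m⊔n≤o⇒m≤o N M i≥)) (q (ℕ.m⊔n≤o⇒n≤o N M i≥))

  Pos-+ : ∀ {x y} → Pos x → Pos y → Pos (x +ʳ y)
  Pos-+ (δ , 0<δ , N , p) (ε , 0<ε , M , q) = δ + ε , <-trans 0<δ (subst (_< δ + ε) (+-identityʳ δ) (+-monoʳ-< δ 0<ε)) , N ℕ.⊔ M , λ i≥ →
    +-mono-≤ (p (ℕ.m⊔n≤o⇒m≤o N M i≥)) (q (ℕ.m⊔n≤o⇒n≤o N M i≥))

  Pos-1 : Pos 1ʳ
  Pos-1 = 1ℚ , *<* (ℤ.+<+ (s≤s z≤n)) , 0 , λ _ → ≤-refl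

  p≤∣p∣ : ∀ p → p ≤ ∣ p ∣
  p≤∣p∣ p = go (≤-total 0ℚ p)
    where
    open import Data.Sum.Base using (inj₁; inj₂)
    go : _ → p ≤ ∣ p ∣
    go (inj₁ 0≤p) = ≤-reflexive (sym (0≤p⇒∣p∣≡p 0≤p))
    go (inj₂ p≤0) = ≤-trans p≤0 (0≤∣p∣ p)

  Pos-≉0 : ∀ {x} → Pos x → ¬ (x ≈ʳ 0ʳ)
  Pos-≉0 {x} (δ , 0<δ , N , p) x≈0 = <-irrefl refl (<-≤-trans (q (ℕ.m≤n⊔m N M)) (≤-trans (p (ℕ.m≤m⊔n N M)) (≤-trans (p≤∣p∣ _) (≤-reflexive (cong ∣_∣ (sym (+-identityʳ _)))))))
    where
    M = proj₁ (x≈0 0<δ)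
    q = proj₂ (x≈0 0<δ)

  -- With `δ` below `x`, the absolute value of `y` is at most that of `x y` divided by the rational
  -- `δ`.
  Pos-regular : ∀ {x} → Pos x → ∀ y → (x *ʳ y) ≈ʳ 0ʳ → y ≈ʳ 0ʳ
  Pos-regular {x} (δ , 0<δ , N , p) y xy≈0 = null⇒≈ {y} {0ʳ} (Null-scale {difference (x *ʳ y) 0ʳ} (difference y 0ʳ) δ⁻¹ {{1/pos⇒pos δ}} N
      (λ {i} {j} i≥ _ → bound i≥) (≈⇒null {x *ʳ y} {0ʳ} xy≈0))
    where
    instance
      δ-pos : Positive δ
      δ-pos = positive 0<δ
      δ-nonZero : NonZero δ
      δ-nonZero = pos⇒nonZero δ
    δ⁻¹ = 1/ δ
    bound : ∀ {i} → N ℕ.≤ i → ∣ seq y i - 0ℚ ∣ ≤ δ⁻¹ * ∣ seq x i * seq y i - 0ℚ ∣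
    bound {i} i≥ = begin
      ∣ Y - 0ℚ ∣                ≡⟨ cong ∣_∣ (+-identityʳ Y) ⟩
      ∣ Y ∣                     ≡⟨ trans (sym (*-identityˡ ∣ Y ∣)) (trans (cong (_* ∣ Y ∣) (sym (*-inverseˡ δ))) (*-assoc δ⁻¹ δ ∣ Y ∣)) ⟩
      δ⁻¹ * (δ * ∣ Y ∣)         ≤⟨ *-monoˡ-≤-nonNeg δ⁻¹ {{pos⇒nonNeg δ⁻¹ {{1/pos⇒pos δ}}}} (*-monoʳ-≤-nonNeg ∣ Y ∣ {{∣-∣-nonNeg Y}} (≤-trans (p i≥) (p≤∣p∣ X))) ⟩
      δ⁻¹ * (∣ X ∣ * ∣ Y ∣)     ≡⟨ cong (δ⁻¹ *_) (trans (sym (∣p*q∣≡∣p∣*∣q∣ X Y)) (cong ∣_∣ (sym (+-identityʳ (X * Y))))) ⟩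
      δ⁻¹ * ∣ X * Y - 0ℚ ∣      ∎
      where
      open ≤-Reasoning
      X = seq x i
      Y = seq y i

  angle : ℚ → ℝ
  angle q = fromℚ q *ʳ π

  multiple : ℚ → ℕ → ℝ
  multiple q k = cos (angle (ι k * q))

  multiple-0 : ∀ q → multiple q 0 R.≈ 1ʳ
  -- The empty partial sum is 0, so the value 1 is attained from index 1 on.
  multiple-0 q {ε} 0<ε = 1 , λ {i} i≥ → subst (_< ε) (sym (cong ∣_∣ (trans (cong (_- 1ℚ) (value i≥)) (+-inverseʳ 1ℚ)))) 0<ε
    where
    value : ∀ {i} → 1 ℕ.≤ i → seq (multiple q 0) i ≡ 1ℚ
    value {suc i} _ = trans (cong (cosSum (suc i)) (solve 2 (λ q p → con 0ℚ :* q :* p := con 0ℚ) refl q (seq π (suc i)))) (cosSum-0 i)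

  ≈-respects : ∀ {x x' y y'} → (∀ i → seq x i ≡ seq x' i) → (∀ i → seq y i ≡ seq y' i) → x' ≈ʳ y' → x ≈ʳ y
  ≈-respects x≡ y≡ x'≈y' {ε} 0<ε = let N , p = x'≈y' 0<ε in N , λ {i} i≥ → subst (_< ε) (cong ∣_∣ (sym (cong₂ _-_ (x≡ i) (y≡ i)))) (p i≥)

  -- `cos-add` at the angles `(k + 1) q π` and `q π`.
  multiple-step : ∀ q k → (multiple q (suc (suc k)) +ʳ multiple q k) R.≈ ((1ʳ +ʳ 1ʳ) *ʳ (multiple q 1 *ʳ multiple q (suc k)))
  multiple-step q k = ≈-respects {multiple q (suc (suc k)) +ʳ multiple q k} {cos (x +ʳ y) +ʳ cos (x -ʳ y)}
    {(1ʳ +ʳ 1ʳ) *ʳ (multiple q 1 *ʳ multiple q (suc k))} {(1ʳ +ʳ 1ʳ) *ʳ (cos x *ʳ cos y)}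
    (λ i → cong₂ (λ s t → cosSum i s + cosSum i t) (plus i) (minus i))
    (λ i → cong ((1ℚ + 1ℚ) *_) (*-comm (seq (cos y) i) (seq (cos x) i))) (cos-add x y)
    where
    x = angle (ι (suc k) * q)
    y = angle (ι 1 * q)
    plus : ∀ i → ι (suc (suc k)) * q * seq π i ≡ ι (suc k) * q * seq π i + ι 1 * q * seq π i
    plus i = trans (cong (λ t → t * q * seq π i) (ι-+ 1 (suc k))) (solve 4 (λ a b q p → (a :+ b) :* q :* p := b :* q :* p :+ a :* q :* p) refl (ι 1) (ι (suc k)) q (seq π i))
    minus : ∀ i → ι k * q * seq π i ≡ ι (suc k) * q * seq π i - ι 1 * q * seq π i
    minus i = sym (trans (cong (λ t → t * q * seq π i - ι 1 * q * seq π i) (ι-+ 1 k)) (solve 4 (λ a b q p → (a :+ b) :* q :* p :- a :* q :* p := b :* q :* p) refl (ι 1) (ι k) q (seq π i)))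

  multiple-half : multiple ½ 1 R.≈ 0ʳ
  multiple-half = ≈-respects {multiple ½ 1} {cos π/2} {0ʳ} {0ʳ}
    (λ i → cong (cosSum i) (solve 1 (λ s → con (ι 1) :* con ½ :* (con (+ 2 / 1) :* s) := s) refl (rootApprox i))) (λ _ → refl) cos-π/2

  multiple-odd : ∀ j → multiple ½ (suc (j ℕ.+ j)) R.≈ 0ʳ
  multiple-odd = odd-multiples ℝ-ring (multiple ½) (multiple-step ½) multiple-half

  fraction : ∀ p n .{{_ : ℕ.NonZero n}} → + p / n ≡ ι p * (+ 1 / n)
  fraction p n@(suc n-1) = toℚᵘ-injective (begin
    toℚᵘ (+ p / n)                          ≈⟨ toℚᵘ-fromℚᵘ (ℚᵘ.mkℚᵘ (+ p) n-1) ⟩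
    ℚᵘ.mkℚᵘ (+ p) n-1                       ≈⟨ ℚᵘ.*≡* (cong₂ ℤ._*_ (sym (ℤ.*-identityʳ (+ p))) (cong (λ k → + suc k) (ℕ.+-identityʳ n-1))) ⟩
    ℚᵘ.mkℚᵘ (+ p) 0 ℚᵘ.* ℚᵘ.mkℚᵘ (+ 1) n-1  ≈⟨ ℚᵘ.*-cong (toℚᵘ-fromℚᵘ (ℚᵘ.mkℚᵘ (+ p) 0)) (toℚᵘ-fromℚᵘ (ℚᵘ.mkℚᵘ (+ 1) n-1)) ⟨
    toℚᵘ (ι p) ℚᵘ.* toℚᵘ (+ 1 / n)          ≈⟨ toℚᵘ-homo-* (ι p) (+ 1 / n) ⟨
    toℚᵘ (ι p * (+ 1 / n))                  ∎)
    where open ℚᵘ.≃-Reasoning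

  -- `Decreasing.lower` at `p s` and `p' s`, where `s` approximates `π / 2` and lies in `[1 , 2]`.
  -- The squares of both points are at most 4, so `12 - (A + B)` is at least 4, and
  -- `4 / 24 = 1 / 6`. The bound does not depend on the index and therefore holds for the limit.
  gap : ∀ {i} → 2 ℕ.≤ i → ∀ {p p'} → 0ℚ ≤ p → p ≤ p' → p' ≤ 1ℚ →
    (+ 1 / 6) * ((p' - p) * (p' + p)) ≤ cosSum i (p * rootApprox i) - cosSum i (p' * rootApprox i)
  gap {suc (suc n)} i≥@(s≤s (s≤s z≤n)) {p} {p'} 0≤p p≤p' p'≤1 = begin
    (+ 1 / 6) * ((p' - p) * (p' + p))
      ≡⟨ solve 1 (λ d → con (+ 1 / 6) :* d := con (+ 1 / 24) :* (d :* con 1ℚ :* con (ι 4))) refl ((p' - p) * (p' + p)) ⟩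
    (+ 1 / 24) * ((p' - p) * (p' + p) * 1ℚ * ι 4)
      ≤⟨ *-monoˡ-≤-nonNeg (+ 1 / 24) (*-mono-≤-nonNeg (0≤* 0≤D (0≤* 0≤s 0≤s)) (*≤* (ℤ.+≤+ z≤n)) (*-monoˡ-≤-nonNeg ((p' - p) * (p' + p)) {{nonNegative 0≤D}} 1≤s²) 4≤) ⟩
    (+ 1 / 24) * ((p' - p) * (p' + p) * (s * s) * (ι 12 - (D.A + D.B)))
      ≡⟨ cong (λ t → (+ 1 / 24) * (t * (ι 12 - (D.A + D.B)))) (solve 3 (λ p q s → (q :- p) :* (q :+ p) :* (s :* s) := (q :* s) :* (q :* s) :- (p :* s) :* (p :* s)) refl p p' s) ⟩
    (+ 1 / 24) * ((D.B - D.A) * (ι 12 - (D.A + D.B)))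
      ≤⟨ D.lower n ⟩
    cosSum (2 ℕ.+ n) (p * s) - cosSum (2 ℕ.+ n) (p' * s) ∎
    where
    open ≤-Reasoning
    s = rootApprox (2 ℕ.+ n)
    1≤s = Root₁.1≤s i≥
    s≤2 = Root₁.s≤2 i≥
    0≤s = ≤-trans 0≤1 1≤s
    0≤D : 0ℚ ≤ (p' - p) * (p' + p)
    0≤D = 0≤* (0≤q-p p≤p') (0≤+ (≤-trans 0≤p p≤p') 0≤p)
    1≤s² : 1ℚ ≤ s * s
    1≤s² = *-mono-≤-nonNeg 0≤s 0≤1 1≤s 1≤s
    p's≤2 : p' * s ≤ ι 2
    p's≤2 = ≤-trans (*-monoʳ-≤-nonNeg s {{nonNegative 0≤s}} p'≤1) (subst (_≤ ι 2) (sym (*-identityˡ s)) s≤2)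
    module D = Decreasing (p * s) (p' * s) (0≤* 0≤p 0≤s) (*-monoʳ-≤-nonNeg s {{nonNegative 0≤s}} p≤p') p's≤2
    4≤ : ι 4 ≤ ι 12 - (D.A + D.B)
    4≤ = +-monoʳ-≤ (ι 12) (neg-antimono-≤ {D.A + D.B} {ι 8} (+-mono-≤ (≤-trans D.A≤B D.B≤4) D.B≤4))

  -- cos (q π) seen through p = 2 q, the angle as a multiple of π / 2.
  angle-half : ∀ q i → q * seq π i ≡ (q + q) * rootApprox i
  angle-half q i = solve 2 (λ q s → q :* (con (+ 2 / 1) :* s) := (q :+ q) :* s) refl q (rootApprox i)

  cos-decreasing : ∀ {q q'} → 0ℚ ≤ q → q < q' → q' + q' ≤ 1ℚ → Pos (cos (angle q) -ʳ cos (angle q'))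
  cos-decreasing {q} {q'} 0≤q q<q' q'≤ = (+ 1 / 6) * ((p' - p) * (p' + p)) , 0<* {+ 1 / 6} (*<* (ℤ.+<+ (s≤s z≤n))) (0<* 0<d 0<sum) , 2 ,
    λ {i} i≥ → subst ((+ 1 / 6) * ((p' - p) * (p' + p)) ≤_) (cong₂ (λ x y → cosSum i x - cosSum i y) (sym (angle-half q i)) (sym (angle-half q' i)))
      (gap i≥ 0≤p (<⇒≤ p<p') q'≤)
    where
    p = q + q
    p' = q' + q'
    0≤p : 0ℚ ≤ p
    0≤p = 0≤+ 0≤q 0≤q
    p<p' : p < p'
    p<p' = +-mono-< q<q' q<q'
    0<d : 0ℚ < p' - p
    0<d = subst (_< p' - p) (+-inverseʳ p) (+-monoˡ-< (- p) p<p')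
    0<sum : 0ℚ < p' + p
    0<sum = <-≤-trans (≤-<-trans 0≤p p<p') (subst (_≤ p' + p) (+-identityʳ p') (+-monoʳ-≤ p' 0≤p))

  -- The comparison is with the approximate zero itself, where the partial sum is nonnegative
  -- because bisection returns the left end of the interval.
  cos-positive : ∀ {q} → 0ℚ ≤ q → q + q < 1ℚ → Pos (cos (angle q))
  cos-positive {q} 0≤q p<1 = (+ 1 / 6) * ((1ℚ - p) * (1ℚ + p)) , 0<* {+ 1 / 6} (*<* (ℤ.+<+ (s≤s z≤n))) (0<* 0<d 0<sum) , 2 ,
    λ {i} i≥ → ≤-trans (gap i≥ 0≤p (<⇒≤ p<1) ≤-refl) (≤-trans (p-q≤p (subst (λ t → 0ℚ ≤ cosSum i t) (sym (*-identityˡ (rootApprox i))) (Root₁.0≤cos-s i≥)))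
      (≤-reflexive (cong (cosSum i) (sym (angle-half q i)))))
    where
    p = q + q
    0≤p : 0ℚ ≤ p
    0≤p = 0≤+ 0≤q 0≤q
    0<d : 0ℚ < 1ℚ - p
    0<d = subst (_< 1ℚ - p) (+-inverseʳ p) (+-monoˡ-< (- p) p<1)
    0<sum : 0ℚ < 1ℚ + p
    0<sum = <-≤-trans (*<* (ℤ.+<+ (s≤s z≤n))) (subst (_≤ 1ℚ + p) (+-identityʳ 1ℚ) (+-monoʳ-≤ 1ℚ 0≤p))

-- The numbers ζ give the roots

module CosineRoots where
  open import Defs
  open Reals
  open Estimates
  open CosineSeries
  open RealRing
  open RawRings using (commutativeRing)
  open RealRoots
  open Factorisation (commutativeRing ℝ-rawRing ℝ-isCommutative) using (Roots)
  open Formulas ℝ-rawRing ℝ-isCommutative using (squares; squares-roots)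
  import Data.Integer.Base as ℤ
  open import Data.Integer.Base using (ℤ; +_)
  open import Data.Nat.Base as ℕ using (ℕ; suc; s≤s; z≤n)
  import Data.Nat.Properties as ℕ
  open import Data.Product.Base using (_,_)
  open import Data.Rational.Base
  open import Data.Rational.Properties
  open import Data.Rational.Solver using (module +-*-Solver)
  open import Relation.Binary.PropositionalEquality
  open +-*-Solver using (solve; _:+_; _:*_; _:=_; con)
  open CommutativeRing ℝ-ring using () renaming (_+_ to _+ʳ_; _*_ to _*ʳ_; _-_ to _-ʳ_; 1# to 1ʳ; 0# to 0ʳ)

  ι-mono-<′ : ∀ {a b} → a ℕ.< b → ι a < ι b
  ι-mono-<′ {a} {b} a<b = <-≤-trans (subst (ι a <_) (sym (ι-+ 1 a)) (subst (_< ι 1 + ι a) (+-identityˡ (ι a)) (+-monoˡ-< (ι a) {0ℚ} {ι 1} (*<* (ℤ.+<+ (s≤s z≤n)))))) (ι-mono-≤ a<b)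

  module _ (e : ℕ) where
    private
      w = + 1 / (4 ℕ.* (suc e))
      instance
        w-pos : Positive w
        w-pos = normalize-pos 1 (4 ℕ.* (suc e))

    odd : ℕ → ℕ
    odd h = suc (h ℕ.+ h)

    ratio : ℕ → ℚ
    ratio h = (+ 2 ℤ.* + h ℤ.- + 1) / (4 ℕ.* (suc e))

    ratio≡ : ∀ h → ratio (suc h) ≡ ι (odd h) * w
    ratio≡ h = trans (cong (λ p → + p / (4 ℕ.* (suc e))) (trans (ℕ.+-suc h (h ℕ.+ 0)) (cong (λ k → suc (h ℕ.+ k)) (ℕ.+-identityʳ h)))) (fraction (odd h) (4 ℕ.* (suc e)))

    ratio-nonNeg : ∀ h → 0ℚ ≤ ratio (suc h)
    ratio-nonNeg h = subst (0ℚ ≤_) (sym (ratio≡ h)) (0≤* (nonNegative⁻¹ (ι (odd h)) {{ι-nonNeg (odd h)}}) (<⇒≤ (positive⁻¹ w)))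

    odd-< : ∀ {a b} → a ℕ.< b → odd a ℕ.< odd b
    odd-< a<b = s≤s (ℕ.+-mono-< a<b a<b)

    ratio-< : ∀ {h h'} → h ℕ.< h' → ratio (suc h) < ratio (suc h')
    ratio-< {h} {h'} h<h' = subst₂ _<_ (sym (ratio≡ h)) (sym (ratio≡ h')) (*-monoˡ-<-pos w (ι-mono-<′ (odd-< h<h')))

    -- For `h < d` one has `2 (2h + 1) < 4d`, which places the angle below `π / 2`.
    ratio-half : ∀ {h} → h ℕ.< (suc e) → ratio (suc h) + ratio (suc h) < 1ℚ
    ratio-half {h} h<d = subst₂ _<_ (trans (cong (_* w) (ι-+ (odd h) (odd h))) (trans (*-distribʳ-+ w (ι (odd h)) (ι (odd h))) (sym (cong₂ _+_ (ratio≡ h) (ratio≡ h)))))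
      (ι-inv (4 ℕ.* (suc e))) (*-monoˡ-<-pos w (ι-mono-<′ bound))
      where
      o≤ : odd h ℕ.< (suc e) ℕ.+ (suc e)
      o≤ = subst (ℕ._≤ (suc e) ℕ.+ (suc e)) (cong suc (ℕ.+-suc h h)) (ℕ.+-mono-≤ h<d h<d)
      bound : odd h ℕ.+ odd h ℕ.< 4 ℕ.* (suc e)
      bound = subst (odd h ℕ.+ odd h ℕ.<_) (trans (ℕ.+-assoc (suc e) (suc e) ((suc e) ℕ.+ (suc e))) (cong (λ k → (suc e) ℕ.+ ((suc e) ℕ.+ ((suc e) ℕ.+ k))) (sym (ℕ.+-identityʳ (suc e))))) (ℕ.+-mono-< o≤ o≤)

    -- `2d` times `(2h + 1) / (4d)` is an odd multiple of a half, so the `2d`-fold angle is an odd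
    -- multiple of `π / 2`, where the cosine vanishes.
    ratio-multiple : ∀ h → ι ((suc e) ℕ.+ (suc e)) * ratio (suc h) ≡ ι (odd h) * ½
    ratio-multiple h = trans (cong (ι ((suc e) ℕ.+ (suc e)) *_) (ratio≡ h)) (trans (solve 3 (λ t o w → t :* (o :* w) := o :* ((t :+ t) :* w :* con ½)) refl (ι ((suc e) ℕ.+ (suc e))) (ι (odd h)) w)
      (cong (ι (odd h) *_) (trans (cong (_* ½) (trans (cong (_* w) (trans (sym (ι-+ ((suc e) ℕ.+ (suc e)) ((suc e) ℕ.+ (suc e)))) (cong ι four))) (ι-inv (4 ℕ.* (suc e))))) (*-identityˡ ½))))
      where
      four : ((suc e) ℕ.+ (suc e)) ℕ.+ ((suc e) ℕ.+ (suc e)) ≡ 4 ℕ.* (suc e)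
      four = trans (ℕ.+-assoc (suc e) (suc e) ((suc e) ℕ.+ (suc e))) (cong (λ k → (suc e) ℕ.+ ((suc e) ℕ.+ ((suc e) ℕ.+ k))) (sym (ℕ.+-identityʳ (suc e))))

    ζ-multiple : ∀ h → ζ (+ h) (suc e) ≈ʳ multiple (ratio h) 1
    ζ-multiple h = ≈-pointwise {ζ (+ h) (suc e)} {multiple (ratio h) 1} (λ i → cong (λ q → cosSum i (q * seq π i)) (sym (*-identityˡ (ratio h))))

    multiple-ratio : ∀ h → multiple (ratio (suc h)) ((suc e) ℕ.+ (suc e)) ≈ʳ 0ʳ
    multiple-ratio h = ≈-respects {multiple (ratio (suc h)) ((suc e) ℕ.+ (suc e))} {multiple ½ (odd h)} {0ʳ} {0ʳ}
      (λ i → cong (λ q → cosSum i (q * seq π i)) (ratio-multiple h)) (λ _ → refl) (multiple-odd h)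

    ζ-positive : ∀ h → 1 ℕ.≤ h → h ℕ.≤ (suc e) → Pos (ζ (+ h) (suc e))
    ζ-positive (suc h) _ h<d = cos-positive (ratio-nonNeg h) (ratio-half h<d)

    ζ-decreasing : ∀ h h' → 1 ℕ.≤ h → h ℕ.< h' → h' ℕ.≤ (suc e) → Pos (ζ (+ h) (suc e) -ʳ ζ (+ h') (suc e))
    ζ-decreasing (suc h) (suc h') _ (s≤s h<h') h'≤d = cos-decreasing (ratio-nonNeg h) (ratio-< h<h') (<⇒≤ (ratio-half h'≤d))

    Pos-4 : Pos (fromℕʳ 4)
    Pos-4 = ι 4 , *<* (ℤ.+<+ (s≤s z≤n)) , 0 , λ _ → ≤-refl

    squares-positive : ∀ h → 1 ℕ.≤ h → h ℕ.≤ (suc e) → Pos (squares ζ (suc e) h)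
    squares-positive h 1≤h h≤d = Pos-* {fromℕʳ 4} {ζ (+ h) (suc e) *ʳ (ζ (+ h) (suc e) *ʳ 1ʳ)} Pos-4 (Pos-* {ζ (+ h) (suc e)} {ζ (+ h) (suc e) *ʳ 1ʳ} ζ>0 (Pos-* {ζ (+ h) (suc e)} {1ʳ} ζ>0 Pos-1))
      where ζ>0 = ζ-positive h 1≤h h≤d

    -- The angles lie between 0 and `π / 2`, where the cosine is positive and decreasing, so both
    -- factors of `4 (ζ - ζ') (ζ + ζ')` are positive and the product is regular.
    ζ-roots : Roots (suc e) (squares ζ (suc e))
    ζ-roots = squares-roots ζ (suc e) (λ h → multiple (ratio h)) (λ h → multiple-0 (ratio h)) (λ h → multiple-step (ratio h)) (λ h _ _ → ζ-multiple h)
      (λ { (suc h) _ _ → multiple-ratio h })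
      (λ h h' 1≤h h<h' h'≤d → let h≤d = ℕ.≤-trans (ℕ.<⇒≤ h<h') h'≤d in
        Pos-regular {fromℕʳ 4 *ʳ ((ζ (+ h) (suc e) -ʳ ζ (+ h') (suc e)) *ʳ (ζ (+ h) (suc e) +ʳ ζ (+ h') (suc e)))} (Pos-* {fromℕʳ 4} {(ζ (+ h) (suc e) -ʳ ζ (+ h') (suc e)) *ʳ (ζ (+ h) (suc e) +ʳ ζ (+ h') (suc e))} Pos-4
          (Pos-* {ζ (+ h) (suc e) -ʳ ζ (+ h') (suc e)} {ζ (+ h) (suc e) +ʳ ζ (+ h') (suc e)} (ζ-decreasing h h' 1≤h h<h' h'≤d)
            (Pos-+ {ζ (+ h) (suc e)} {ζ (+ h') (suc e)} (ζ-positive h 1≤h h≤d) (ζ-positive h' (ℕ.≤-trans 1≤h (ℕ.<⇒≤ h<h')) h'≤d)))))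

-- The ring of complex numbers

module ComplexNumbers where
  open import Defs
  open RealRing
  open IntegerCoefficients
  open RawRings
  open RingHomomorphisms
  open import Data.Product.Base using (_,_)
  open import Data.Integer.Base using (+_)

  -- The laws hold for pairs over any commutative ring; stated there, they are solved for unknowns
  -- instead of Cauchy sequences.
  module ComplexLaws (R₀ : RawRing 0ℓ 0ℓ) (R₀-commutative : IsCommutative R₀) where
    private
      R = commutativeRing R₀ R₀-commutative
    open RawRing R₀ using (_+_; _*_; -_; 0#; 1#; _≈_)
    open CommutativeRing R hiding (_+_; _*_; -_; 0#; 1#; _≈_)
    open IntegerSolver R

    assoc-re : ∀ a b c d e f → (a * c + - (b * d)) * e + - ((a * d + b * c) * f) ≈ a * (c * e + - (d * f)) + - (b * (c * f + d * e))
    assoc-re = solve 6 (λ a b c d e f → (a :* c :+ :- (b :* d)) :* e :+ :- ((a :* d :+ b :* c) :* f) := a :* (c :* e :+ :- (d :* f)) :+ :- (b :* (c :* f :+ d :* e))) refl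

    assoc-im : ∀ a b c d e f → (a * c + - (b * d)) * f + (a * d + b * c) * e ≈ a * (c * f + d * e) + b * (c * e + - (d * f))
    assoc-im = solve 6 (λ a b c d e f → (a :* c :+ :- (b :* d)) :* f :+ (a :* d :+ b :* c) :* e := a :* (c :* f :+ d :* e) :+ b :* (c :* e :+ :- (d :* f))) refl

    comm-re : ∀ a b c d → a * c + - (b * d) ≈ c * a + - (d * b)
    comm-re = solve 4 (λ a b c d → a :* c :+ :- (b :* d) := c :* a :+ :- (d :* b)) refl

    comm-im : ∀ a b c d → a * d + b * c ≈ c * b + d * a
    comm-im = solve 4 (λ a b c d → a :* d :+ b :* c := c :* b :+ d :* a) refl

    identityˡ-re : ∀ a b → 1# * a + - (0# * b) ≈ a
    identityˡ-re = solve 2 (λ a b → con (+ 1) :* a :+ :- (con (+ 0) :* b) := a) refl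

    identityˡ-im : ∀ a b → 1# * b + 0# * a ≈ b
    identityˡ-im = solve 2 (λ a b → con (+ 1) :* b :+ con (+ 0) :* a := b) refl

    identityʳ-re : ∀ a b → a * 1# + - (b * 0#) ≈ a
    identityʳ-re = solve 2 (λ a b → a :* con (+ 1) :+ :- (b :* con (+ 0)) := a) refl

    identityʳ-im : ∀ a b → a * 0# + b * 1# ≈ b
    identityʳ-im = solve 2 (λ a b → a :* con (+ 0) :+ b :* con (+ 1) := b) refl

    distribˡ-re : ∀ a b c d e f → a * (c + e) + - (b * (d + f)) ≈ (a * c + - (b * d)) + (a * e + - (b * f))
    distribˡ-re = solve 6 (λ a b c d e f → a :* (c :+ e) :+ :- (b :* (d :+ f)) := (a :* c :+ :- (b :* d)) :+ (a :* e :+ :- (b :* f))) refl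

    distribˡ-im : ∀ a b c d e f → a * (d + f) + b * (c + e) ≈ (a * d + b * c) + (a * f + b * e)
    distribˡ-im = solve 6 (λ a b c d e f → a :* (d :+ f) :+ b :* (c :+ e) := (a :* d :+ b :* c) :+ (a :* f :+ b :* e)) refl

    distribʳ-re : ∀ a b c d e f → (c + e) * a + - ((d + f) * b) ≈ (c * a + - (d * b)) + (e * a + - (f * b))
    distribʳ-re = solve 6 (λ a b c d e f → (c :+ e) :* a :+ :- ((d :+ f) :* b) := (c :* a :+ :- (d :* b)) :+ (e :* a :+ :- (f :* b))) refl

    distribʳ-im : ∀ a b c d e f → (c + e) * b + (d + f) * a ≈ (c * b + d * a) + (e * b + f * a)
    distribʳ-im = solve 6 (λ a b c d e f → (c :+ e) :* b :+ (d :+ f) :* a := (c :* b :+ d :* a) :+ (e :* b :+ f :* a)) refl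

    *-cong-re : ∀ {a a' b b' c c' d d'} → a ≈ a' → b ≈ b' → c ≈ c' → d ≈ d' → a * c + - (b * d) ≈ a' * c' + - (b' * d')
    *-cong-re a b c d = +-cong (*-cong a c) (-‿cong (*-cong b d))

    *-cong-im : ∀ {a a' b b' c c' d d'} → a ≈ a' → b ≈ b' → c ≈ c' → d ≈ d' → a * d + b * c ≈ a' * d' + b' * c'
    *-cong-im a b c d = +-cong (*-cong a d) (*-cong b c)

    real-re : ∀ a b → a * b ≈ a * b + - (0# * 0#)
    real-re = solve 2 (λ a b → a :* b := a :* b :+ :- (con (+ 0) :* con (+ 0))) refl

    real-im : ∀ a b → 0# ≈ a * 0# + 0# * b
    real-im = solve 2 (λ a b → con (+ 0) := a :* con (+ 0) :+ con (+ 0) :* b) refl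

    zero-+ : 0# ≈ 0# + 0#
    zero-+ = sym (+-identityˡ 0#)

    zero-neg : 0# ≈ - 0#
    zero-neg = solve 0 (con (+ 0) := :- con (+ 0)) refl

    unit-re : 0# * 0# + - (1# * 1#) ≈ - 1#
    unit-re = solve 0 (con (+ 0) :* con (+ 0) :+ :- (con (+ 1) :* con (+ 1)) := :- con (+ 1)) refl

    unit-im : 0# * 1# + 1# * 0# ≈ - 0#
    unit-im = solve 0 (con (+ 0) :* con (+ 1) :+ con (+ 1) :* con (+ 0) := :- con (+ 0)) refl

  private
    module R = CommutativeRing ℝ-ring
    module L = ComplexLaws ℝ-rawRing ℝ-isCommutative

  ℂ-isCommutative : IsCommutative ℂ-rawRing
  ℂ-isCommutative = record
      { isRing = record
        { +-isAbelianGroup = record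
          { isGroup = record
            { isMonoid = record
              { isSemigroup = record
                { isMagma = record
                  { isEquivalence = record
                    { refl = λ {z} → R.refl {re z} , R.refl {im z}
                    ; sym = λ {z} {w} (p , q) → R.sym {re z} {re w} p , R.sym {im z} {im w} q
                    ; trans = λ {z} {w} {u} (p , q) (p' , q') → R.trans {re z} {re w} {re u} p p' , R.trans {im z} {im w} {im u} q q' }
                  ; ∙-cong = λ {z} {z'} {w} {w'} (p , q) (p' , q') → R.+-cong {re z} {re z'} {re w} {re w'} p p' , R.+-cong {im z} {im z'} {im w} {im w'} q q' }
                ; assoc = λ z w u → R.+-assoc (re z) (re w) (re u) , R.+-assoc (im z) (im w) (im u) }
              ; identity = (λ z → R.+-identityˡ (re z) , R.+-identityˡ (im z)) , (λ z → R.+-identityʳ (re z) , R.+-identityʳ (im z)) }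
            ; inverse = (λ z → R.-‿inverseˡ (re z) , R.-‿inverseˡ (im z)) , (λ z → R.-‿inverseʳ (re z) , R.-‿inverseʳ (im z))
            ; ⁻¹-cong = λ {z} {w} (p , q) → R.-‿cong {re z} {re w} p , R.-‿cong {im z} {im w} q }
          ; comm = λ z w → R.+-comm (re z) (re w) , R.+-comm (im z) (im w) }
        ; *-cong = λ {z} {z'} {w} {w'} (p , q) (p' , q') →
            L.*-cong-re {re z} {re z'} {im z} {im z'} {re w} {re w'} {im w} {im w'} p q p' q' ,
            L.*-cong-im {re z} {re z'} {im z} {im z'} {re w} {re w'} {im w} {im w'} p q p' q'
        ; *-assoc = λ z w u → L.assoc-re (re z) (im z) (re w) (im w) (re u) (im u) , L.assoc-im (re z) (im z) (re w) (im w) (re u) (im u)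
        ; *-identity = (λ z → L.identityˡ-re (re z) (im z) , L.identityˡ-im (re z) (im z)) , (λ z → L.identityʳ-re (re z) (im z) , L.identityʳ-im (re z) (im z))
        ; distrib = (λ z w u → L.distribˡ-re (re z) (im z) (re w) (im w) (re u) (im u) , L.distribˡ-im (re z) (im z) (re w) (im w) (re u) (im u))
                  , (λ z w u → L.distribʳ-re (re z) (im z) (re w) (im w) (re u) (im u) , L.distribʳ-im (re z) (im z) (re w) (im w) (re u) (im u)) }
      ; *-comm = λ z w → L.comm-re (re z) (im z) (re w) (im w) , L.comm-im (re z) (im z) (re w) (im w) }

  ℂ-ring : CommutativeRing 0ℓ 0ℓ
  ℂ-ring = commutativeRing ℂ-rawRing ℂ-isCommutative

  private
    module C = CommutativeRing ℂ-ring

  fromℝ-hom : IsHom (commutativeRing ℝ-rawRing ℝ-isCommutative) (commutativeRing ℂ-rawRing ℂ-isCommutative) fromℝ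
  fromℝ-hom = record
    { φ-cong = λ {x} {y} x≈y → x≈y , R.refl {R.0#}
    ; φ-+ = λ x y → R.refl {x R.+ y} , L.zero-+
    ; φ-* = λ x y → L.real-re x y , L.real-im x y
    ; φ-neg = λ x → R.refl {R.- x} , L.zero-neg
    ; φ-0 = R.refl {R.0#} , R.refl {R.0#}
    ; φ-1 = R.refl {R.1#} , R.refl {R.0#}
    }

  𝕚-square : (𝕚 C.* 𝕚) C.≈ (C.- C.1#)
  𝕚-square = L.unit-re , L.unit-im

-- The four numbers agree

open import Defs
open import Data.Nat.Base using (ℕ; _*_; _∸_; NonZero)
open import Data.Product.Base using (∃-syntax; _×_)
open import Relation.Binary.PropositionalEquality using (_≡_)
open RealRing
open RealRoots using (Pos; Pos-*; Pos-+; Pos-1; Pos-≉0)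
open CosineRoots
open ComplexNumbers
open RingHomomorphisms using (chebyshevFormula; chebyshev≈tilings)
open SymmetricCount using (symmetric-recurrents)
open CheckerboardWeights using (2*≡double)
import Data.Integer.Properties as ℤ
import Data.Integer.Base as ℤ
open import Data.Nat.Base using (zero; suc)
open import Data.Product.Base using (_,_)
open import Relation.Binary.PropositionalEquality using (refl; sym; trans; cong; subst; subst₂; _≢_)
open RowTransfer using (double)
open import Relation.Nullary.Negation using (¬_)

fromℕ-ℤ : ∀ n → FreeFermions.nat ℤ.+-*-commutativeRing n ≡ ℤ.+ n
fromℕ-ℤ zero = refl
fromℕ-ℤ (suc n) = cong (ℤ._+_ (ℤ.+ 1)) (fromℕ-ℤ n)

fromℕʳ≡ : ∀ k → RingNotation.fromℕ ℝ-rawRing k ≡ fromℕʳ k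
fromℕʳ≡ k = refl

fromℕᶜ≡ : ∀ k → RingNotation.fromℕ ℂ-rawRing k ≡ fromℕᶜ k
fromℕᶜ≡ k = refl

Pos-≉fromℕ0 : ∀ {x} → Pos x → ¬ (x ≈ʳ fromℕʳ 0)
Pos-≉fromℕ0 {x} = Pos-≉0 {x}

-- Two reals that are equal only up to unfolding are costly to identify, so the two
-- forms of each formula are linked by a propositional equality between unknowns.
module Conversions (tilings : ℕ → ℕ → ℕ)
  (A B : (m n : ℕ) .{{_ : NonZero m}} .{{_ : NonZero n}} → ℝ) (A≡B : ∀ m n .{{_ : NonZero m}} .{{_ : NonZero n}} → A m n ≡ B m n)
  (A≈ : ∀ m n .{{_ : NonZero m}} .{{_ : NonZero n}} → RawRing._≈_ ℝ-rawRing (A m n) (RingNotation.fromℕ ℝ-rawRing (tilings m n)))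
  (A>0 : ∀ m n .{{_ : NonZero m}} .{{_ : NonZero n}} → Pos (A m n))
  (C D : (m n : ℕ) .{{_ : NonZero m}} → ℂ) (C≡D : ∀ m n .{{_ : NonZero m}} → C m n ≡ D m n)
  (C≈ : ∀ m n .{{_ : NonZero m}} .{{_ : NonZero n}} → RawRing._≈_ ℂ-rawRing (C m n) (RingNotation.fromℕ ℂ-rawRing (tilings m n)))
  where

  B≈ : ∀ m n .{{_ : NonZero m}} .{{_ : NonZero n}} → B m n ≈ʳ fromℕʳ (tilings m n)
  B≈ m n = subst (λ x → RawRing._≈_ ℝ-rawRing x (fromℕʳ (tilings m n))) (A≡B m n) (subst (RawRing._≈_ ℝ-rawRing (A m n)) (fromℕʳ≡ (tilings m n)) (A≈ m n))

  D≈ : ∀ m n .{{_ : NonZero m}} .{{_ : NonZero n}} → D m n ≈ᶜ fromℕᶜ (tilings m n)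
  D≈ m n = subst (λ x → RawRing._≈_ ℂ-rawRing x (fromℕᶜ (tilings m n))) (C≡D m n) (subst (RawRing._≈_ ℂ-rawRing (C m n)) (fromℕᶜ≡ (tilings m n)) (C≈ m n))

  -- The positive real product is the image of the count, so the count cannot be 0. This is the
  -- condition under which the cokernel is finite and can be counted.
  tilings≢0 : ∀ m n .{{_ : NonZero m}} .{{_ : NonZero n}} → tilings m n ≢ 0
  tilings≢0 m n N≡0 = Pos-≉fromℕ0 {B m n} (subst Pos (A≡B m n) (A>0 m n)) (subst (λ k → B m n ≈ʳ fromℕʳ k) N≡0 (B≈ m n))

  conclusion : (Cardinality : ℕ → ℕ → ℕ → Set) → ((∀ m n .{{_ : NonZero m}} .{{_ : NonZero n}} → tilings m n ≢ 0) → ∀ m n .{{_ : NonZero m}} .{{_ : NonZero n}} → Cardinality m n (tilings m n)) →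
    ∀ m n .{{_ : NonZero m}} .{{_ : NonZero n}} → ∃[ N ] (Cardinality m n N × tilings m n ≡ N × D m n ≈ᶜ fromℕᶜ N × B m n ≈ʳ fromℕʳ N)
  conclusion Cardinality recurrents m n = tilings m n , recurrents tilings≢0 m n , refl , D≈ m n , B≈ m n

cosine≡ : ∀ m n .{{_ : NonZero m}} .{{_ : NonZero n}} → Formulas.productFormula ℝ-rawRing ℝ-isCommutative ζ m n ≡ cosineProduct m n
cosine≡ m n = refl

chebyshev≡ : ∀ m n .{{_ : NonZero m}} → chebyshevFormula ℝ-rawRing ℂ-rawRing ℝ-isCommutative ℂ-isCommutative 𝕚 fromℝ ζ m n ≡ chebyshevProduct m n
chebyshev≡ m n = refl

productFormula-positive : ∀ m n .{{_ : NonZero m}} .{{_ : NonZero n}} → Pos (Formulas.productFormula ℝ-rawRing ℝ-isCommutative ζ m n)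
productFormula-positive = Formulas.productFormula-closed ℝ-rawRing ℝ-isCommutative ζ Pos Pos-1 (λ x y → Pos-* {x} {y}) (λ x y → Pos-+ {x} {y}) squares-positive

-- Over ℤ the determinant is the image of a natural number, the tiling count, which fixes its sign.
recurrents : (∀ m n .{{_ : NonZero m}} .{{_ : NonZero n}} → weightedDominoTilings m n ≢ 0) → ∀ m n .{{_ : NonZero m}} .{{_ : NonZero n}} → HasCardinality (SymmetricRecurrents (2 * m ∸ 1) (2 * n ∸ 1)) (weightedDominoTilings m n)
recurrents tilings≢0 (suc m) (suc n) = subst₂ (λ p q → HasCardinality (SymmetricRecurrents p q) N) (side m) (side n)
  (symmetric-recurrents {m} {n} N (tilings≢0 (suc m) (suc n)) (trans (sym (fromℕ-ℤ N)) (Tilings.tilings≈det ℤ.+-*-commutativeRing m n)))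
  where
  N = weightedDominoTilings (suc m) (suc n)
  side : ∀ m → suc (double m) ≡ 2 * suc m ∸ 1
  side m = cong (_∸ 1) (sym (2*≡double (suc m)))

theorem4p10 : ∀ (m n : ℕ) .{{_ : NonZero m}} .{{_ : NonZero n}} → ∃[ N ] (
    HasCardinality (SymmetricRecurrents (2 * m ∸ 1) (2 * n ∸ 1)) N
    × weightedDominoTilings m n ≡ N
    × chebyshevProduct m n ≈ᶜ fromℕᶜ N
    × cosineProduct m n ≈ʳ fromℕʳ N)
theorem4p10 = Conversions.conclusion weightedDominoTilings
  (Formulas.productFormula ℝ-rawRing ℝ-isCommutative ζ) cosineProduct cosine≡
  (Formulas.product≈tilings ℝ-rawRing ℝ-isCommutative ζ ζ-roots) productFormula-positive
  (chebyshevFormula ℝ-rawRing ℂ-rawRing ℝ-isCommutative ℂ-isCommutative 𝕚 fromℝ ζ) chebyshevProduct chebyshev≡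
  (chebyshev≈tilings ℝ-rawRing ℂ-rawRing ℝ-isCommutative ℂ-isCommutative 𝕚 fromℝ ζ 𝕚-square fromℝ-hom ζ-roots)
  (λ m n → HasCardinality (SymmetricRecurrents (2 * m ∸ 1) (2 * n ∸ 1))) recurrents
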